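{- Let $\{S_n\}_{n\ge 0}$ be the Tribonacci-Lucas sequence. The only solution of the Diophantine equation $$S_n = \overline{\underbrace{d_1\cdots d_1}_{\ell \text{ times}}\underbrace{d_2\cdots d_2}_{m \text{ times}}\underbrace{d_1\cdots d_1}_{\ell \text{ times}}}$$ in non-negative integers $(n,d_1,d_2,\ell,m)$ with $d_1,d_2\in\{0,1,\ldots,9\}$, $d_1\neq d_2$, $d_1>0$, and $\ell,m\ge 1$, is $S_8=131$ (i.e. $n=8$, $d_1=1$, $d_2=3$, $\ell=m=1$). In other words, the only Tribonacci-Lucas number that is a palindromic concatenation of two distinct repdigits is $S_8=131$.
   Context: The Tribonacci-Lucas sequence is defined by $S_0=3$, $S_1=1$, $S_2=3$ and $S_{n+3}=S_{n+2}+S_{n+1}+S_n$ for $n\ge 0$. The overline notation $\overline{a_1a_2\cdots a_k}$ denotes the natural number whose decimal digits are $a_1,a_2,\ldots,a_k$ (from most significant to least significant). A repdigit is a number all of whose decimal digits are equal. -}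

module Defs where

open import Data.Nat using (ℕ; zero; suc; _+_; _*_; _^_)

S : ℕ → ℕ
S zero = 3
S (suc zero) = 1
S (suc (suc zero)) = 3
S (suc (suc (suc n))) = S (suc (suc n)) + S (suc n) + S n

repdigit : ℕ → ℕ → ℕ
repdigit d zero = 0
repdigit d (suc k) = repdigit d k * 10 + d

-- the number  d1...d1 (l times) d2...d2 (m times) d1...d1 (l times)  in decimal
palRep : ℕ → ℕ → ℕ → ℕ → ℕ
palRep d₁ d₂ l m = (repdigit d₁ l * 10 ^ m + repdigit d₂ m) * 10 ^ l + repdigit d₁ l

-- Congruences modulo primes for which S and the powers of 10 have small periods exclude everything except d₁ = 9, d₂ = 8 and
-- l ≡ -1 modulo a large number. This residual case is the trace of S₋₁ = S₋₂ = S₋₅ = -1, the value of the pattern at l = -1, m = 1,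
-- so it is locally solvable everywhere. In it 2^l divides S n + 1, and 2-adically this forces n + 5 ≥ 2^l; on the other hand
-- 9 S n + 9 = 10^(l+m) B + 10^l with B = 9·10^l - 1, so 9 α^n and 10^(l+m) B are much closer than is possible for l = O(log n),
-- where α is the dominant root of x³ - x² - x - 1. The last claim is proved by Gel'fond's method. Dirichlet's theorem gives a and b
-- with w = α^a / 10^b close to 1, and Siegel's lemma gives small integers c_j,i, not all zero, such that the function
-- F(x) = ∑ c_j,i C(x,i) w^(jx) is tiny at all natural numbers x in a long range. At x = u + ⌊n/a⌋ v, the number α^n in w^(jx) may be
-- replaced by 10^(l+m) B / 9, after which F(x) is, up to a factor, the component along α of the integral Tribonacci sequence
-- G_t = ∑_j C_j X^(J-1-j) Z^j S_(t+jp). Its other components decay, so G vanishes from some index on. As 5 divides X to a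
-- known high power, the 5-adically dominant C_j is then divisible by a high power of 5 at more points than its degree in x, and
-- Lagrange interpolation makes its coefficients c_j,i divisible by a higher power of 5 than they are.

module Submission where

-- No real number occurs: a rational ω with tiny ω³ - ω² - ω - 1 replaces α, its precision chosen
-- after n, and identities for α become estimates. With n between 64^μ and 64^(μ+1) the 2-adic bound
-- leaves l ≤ 6μ + 6. This is used twice: α^n is compared with 10^k, k = l + m, only up to a factor
-- 10^(l+1), which is harmless for denominators a ≤ 4^μ; and the factors B^v, v < a, stay small
-- against the accuracy 2^(-80 μ I), where I = 32^μ bounds the degree in x. As w is within 128 ·
-- 4^(-μ) of 1, the Newton coefficients of F decay so fast that 89 I conditions from Siegel's lemma
-- make F tiny for all x ≤ 128 · 64^μ, without an analytic extrapolation step. The prime 5 separates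
-- the terms: X = 10^q 9^v has 5-adic exponent exactly q, while Z = B^v is prime to 5. Here q is
-- roughly b u. The Newton polygon of the C_j has fewer than J corners, so one of J widely spaced
-- blocks of u meets none, and there a single C_j dominates throughout. The number J = 4072 of terms
-- is what the count in Siegel's lemma demands.

-- Rational arithmetic, powers and finite sums

module Rationals where

  open import Data.Nat as ℕ using (ℕ; zero; suc)
  import Data.Nat.Properties as ℕ
  import Data.Nat.Coprimality as C
  open import Data.Integer as ℤ using (ℤ)
  import Data.Integer.Properties as ℤ
  import Data.Rational.Unnormalised as ℚᵘ
  import Data.Rational.Unnormalised.Properties as ℚᵘ
  open import Data.Rational
  open import Data.Rational.Properties
  open import Data.Rational.Solver
  open import Data.Sum using (inj₁; inj₂)
  open import Relation.Binary.PropositionalEquality hiding ([_])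
  open import Relation.Nullary.Decidable using (from-yes)

  -- Literals that evaluate, so that numerical inequalities can be decided by computation. The
  -- embedding `ι` below does not evaluate; `ι-lit` connects the two.
  lit : ℕ → ℚ
  lit n = mkℚ (ℤ.+ n) 0 (C.sym (C.1-coprimeTo n))

  0≤lit : ∀ n → 0ℚ ≤ lit n
  0≤lit n = *≤* (subst₂ ℤ._≤_ (sym (ℤ.*-identityʳ (ℤ.+ 0))) (sym (ℤ.*-identityʳ (ℤ.+ n))) (ℤ.+≤+ ℕ.z≤n))

  -- abstract, so that sums and products of embedded integers stay unevaluated
  abstract
    ι : ℤ → ℚ
    ι z = mkℚ z 0 (C.sym (C.1-coprimeTo ℤ.∣ z ∣))


    ι-+ : ∀ a b → ι (a ℤ.+ b) ≡ ι a + ι b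
    ι-+ a b = toℚᵘ-injective (ℚᵘ.≃-trans
      (ℚᵘ.*≡* (cong (ℤ._* ℤ.+ 1) (sym (cong₂ ℤ._+_ (ℤ.*-identityʳ a) (ℤ.*-identityʳ b)))))
      (ℚᵘ.≃-sym (toℚᵘ-homo-+ (ι a) (ι b))))

    ι-* : ∀ a b → ι (a ℤ.* b) ≡ ι a * ι b
    ι-* a b = toℚᵘ-injective (ℚᵘ.≃-trans (ℚᵘ.*≡* refl) (ℚᵘ.≃-sym (toℚᵘ-homo-* (ι a) (ι b))))

    ι-mono : ∀ {a b} → a ℤ.≤ b → ι a ≤ ι b
    ι-mono {a} {b} p = *≤* (subst₂ ℤ._≤_ (sym (ℤ.*-identityʳ a)) (sym (ℤ.*-identityʳ b)) p)

    toℚᵘ-ι : ∀ z → toℚᵘ (ι z) ≡ ℚᵘ.mkℚᵘ z 0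
    toℚᵘ-ι z = refl

    ι-lit : ∀ n → ι (ℤ.+ n) ≡ lit n
    ι-lit n = refl

    ι-cancel-≤ : ∀ {a b} → ι a ≤ ι b → a ℤ.≤ b
    ι-cancel-≤ {a} {b} (*≤* p) = subst₂ ℤ._≤_ (ℤ.*-identityʳ a) (ℤ.*-identityʳ b) p

    ∣ι∣ : ∀ a → ∣ ι a ∣ ≡ ι (ℤ.+ ℤ.∣ a ∣)
    ∣ι∣ (ℤ.+ n) = refl
    ∣ι∣ ℤ.-[1+ n ] = refl

  ν : ℕ → ℚ
  ν n = ι (ℤ.+ n)

  ν-+ : ∀ a b → ν (a ℕ.+ b) ≡ ν a + ν b
  ν-+ a b = ι-+ (ℤ.+ a) (ℤ.+ b)

  ν-* : ∀ a b → ν (a ℕ.* b) ≡ ν a * ν b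
  ν-* a b = trans (cong ι (ℤ.pos-* a b)) (ι-* (ℤ.+ a) (ℤ.+ b))

  ν-mono : ∀ {a b} → a ℕ.≤ b → ν a ≤ ν b
  ν-mono p = ι-mono (ℤ.+≤+ p)

  ν-cancel-≤ : ∀ {a b} → ν a ≤ ν b → a ℕ.≤ b
  ν-cancel-≤ p = ℤ.drop‿+≤+ (ι-cancel-≤ p)

  0≤ν : ∀ n → 0ℚ ≤ ν n
  0≤ν n = subst (_≤ ν n) (ι-lit 0) (ν-mono (ℕ.z≤n {n}))

  infixl 7 _*≤_
  _*≤_ : ∀ {a b c d} {p : 0ℚ ≤ a} {q : 0ℚ ≤ c} → a ≤ b → c ≤ d → a * c ≤ b * d
  _*≤_ {a} {b} {c} {d} {p} {q} r s = ≤-trans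
    (*-monoʳ-≤-nonNeg c {{nonNegative q}} r)
    (*-monoˡ-≤-nonNeg b {{nonNegative (≤-trans p r)}} s)

  *-mono : ∀ {a b c d} → 0ℚ ≤ a → 0ℚ ≤ c → a ≤ b → c ≤ d → a * c ≤ b * d
  *-mono p q r s = _*≤_ {p = p} {q = q} r s

  *-monoˡ : ∀ {a b} c → 0ℚ ≤ c → a ≤ b → c * a ≤ c * b
  *-monoˡ c p = *-monoˡ-≤-nonNeg c {{nonNegative p}}

  *-monoʳ : ∀ {a b} c → 0ℚ ≤ c → a ≤ b → a * c ≤ b * c
  *-monoʳ c p = *-monoʳ-≤-nonNeg c {{nonNegative p}}

  0≤* : ∀ {a b} → 0ℚ ≤ a → 0ℚ ≤ b → 0ℚ ≤ a * b
  0≤* {a} {b} p q = subst (_≤ a * b) (*-zeroˡ 0ℚ) (*-mono ≤-refl ≤-refl p q)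

  0≤+ : ∀ {a b} → 0ℚ ≤ a → 0ℚ ≤ b → 0ℚ ≤ a + b
  0≤+ p q = +-mono-≤ p q

  0≤sq : ∀ a → 0ℚ ≤ a * a
  0≤sq a with ≤-total 0ℚ a
  ... | inj₁ p = 0≤* p p
  ... | inj₂ p = subst (0ℚ ≤_) (solve 1 (λ a → (:- a) :* (:- a) := a :* a) refl a)
                   (0≤* (neg-antimono-≤ p) (neg-antimono-≤ p))
    where open +-*-Solver

  sub-≤ : ∀ {a b} → a ≤ b → 0ℚ ≤ b - a
  sub-≤ {a} {b} p = subst (_≤ b - a) (+-inverseʳ a) (+-monoˡ-≤ (- a) p)

  ≤-sub : ∀ {a b} → 0ℚ ≤ b - a → a ≤ b
  ≤-sub {a} {b} p = subst₂ _≤_ (+-identityˡ a)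
    (solve 2 (λ a b → (b :- a) :+ a := b) refl a b) (+-monoˡ-≤ a p)
    where open +-*-Solver

  p≤∣p∣ : ∀ p → p ≤ ∣ p ∣
  p≤∣p∣ p with ≤-total 0ℚ p
  ... | inj₁ q = ≤-reflexive (sym (0≤p⇒∣p∣≡p q))
  ... | inj₂ q = ≤-trans q (0≤∣p∣ p)

  ∣∣-bound : ∀ {p b} → p ≤ b → - p ≤ b → ∣ p ∣ ≤ b
  ∣∣-bound {p} {b} h k with ∣p∣≡p∨∣p∣≡-p p
  ... | inj₁ e = subst (_≤ b) (sym e) h
  ... | inj₂ e = subst (_≤ b) (sym e) k

  ∣*∣≤ : ∀ {p q a b} → ∣ p ∣ ≤ a → ∣ q ∣ ≤ b → ∣ p * q ∣ ≤ a * b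
  ∣*∣≤ {p} {q} h k = subst (_≤ _) (sym (∣p*q∣≡∣p∣*∣q∣ p q)) (*-mono (0≤∣p∣ p) (0≤∣p∣ q) h k)

  ∣+∣≤ : ∀ {p q a b} → ∣ p ∣ ≤ a → ∣ q ∣ ≤ b → ∣ p + q ∣ ≤ a + b
  ∣+∣≤ {p} {q} h k = ≤-trans (∣p+q∣≤∣p∣+∣q∣ p q) (+-mono-≤ h k)

  ∣-∣≤ : ∀ {p q a b} → ∣ p ∣ ≤ a → ∣ q ∣ ≤ b → ∣ p - q ∣ ≤ a + b
  ∣-∣≤ {p} {q} h k = ≤-trans (∣p-q∣≤∣p∣+∣q∣ p q) (+-mono-≤ h k)

  ∣0≤∣ : ∀ {p b} → 0ℚ ≤ p → p ≤ b → ∣ p ∣ ≤ b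
  ∣0≤∣ h k = subst (_≤ _) (sym (0≤p⇒∣p∣≡p h)) k

  pow : ℚ → ℕ → ℚ
  pow x zero    = 1ℚ
  pow x (suc n) = x * pow x n

  0≤1 : 0ℚ ≤ 1ℚ
  0≤1 = from-yes (0ℚ ≤? 1ℚ)

  pow-+ : ∀ x m n → pow x (m ℕ.+ n) ≡ pow x m * pow x n
  pow-+ x zero    n = sym (*-identityˡ _)
  pow-+ x (suc m) n = trans (cong (x *_) (pow-+ x m n)) (sym (*-assoc x (pow x m) (pow x n)))

  pow-1 : ∀ n → pow 1ℚ n ≡ 1ℚ
  pow-1 zero    = refl
  pow-1 (suc n) = trans (*-identityˡ _) (pow-1 n)

  pow-∙ : ∀ x y n → pow (x * y) n ≡ pow x n * pow y n
  pow-∙ x y zero    = refl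
  pow-∙ x y (suc n) = trans (cong ((x * y) *_) (pow-∙ x y n))
    (solve 4 (λ x y a b → (x :* y) :* (a :* b) := (x :* a) :* (y :* b)) refl x y (pow x n) (pow y n))
    where open +-*-Solver

  pow-* : ∀ x m n → pow x (m ℕ.* n) ≡ pow (pow x n) m
  pow-* x zero    n = refl
  pow-* x (suc m) n = trans (pow-+ x n (m ℕ.* n)) (cong (pow x n *_) (pow-* x m n))

  pow-*′ : ∀ x m n → pow x (m ℕ.* n) ≡ pow (pow x m) n
  pow-*′ x m n = trans (cong (pow x) (ℕ.*-comm m n)) (pow-* x n m)

  0≤pow : ∀ {x} n → 0ℚ ≤ x → 0ℚ ≤ pow x n
  0≤pow zero    p = 0≤1
  0≤pow (suc n) p = 0≤* p (0≤pow n p)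

  pow-mono : ∀ {x y} n → 0ℚ ≤ x → x ≤ y → pow x n ≤ pow y n
  pow-mono zero    p q = ≤-refl
  pow-mono (suc n) p q = *-mono p (0≤pow n p) q (pow-mono n p q)

  1≤pow : ∀ {x} n → 1ℚ ≤ x → 1ℚ ≤ pow x n
  1≤pow {x} n p = subst (_≤ pow x n) (pow-1 n) (pow-mono n 0≤1 p)

  pow≤1 : ∀ {x} n → 0ℚ ≤ x → x ≤ 1ℚ → pow x n ≤ 1ℚ
  pow≤1 {x} n p q = subst (pow x n ≤_) (pow-1 n) (pow-mono n p q)

  pow-monoʳ : ∀ {x m n} → 1ℚ ≤ x → m ℕ.≤ n → pow x m ≤ pow x n
  pow-monoʳ {x} {m} {n} p q = subst₂ _≤_ (*-identityʳ (pow x m))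
    (trans (sym (pow-+ x m (n ℕ.∸ m))) (cong (pow x) (ℕ.m+[n∸m]≡n q)))
    (*-monoˡ (pow x m) (0≤pow m (≤-trans 0≤1 p)) (1≤pow (n ℕ.∸ m) p))

  pow-antiʳ : ∀ {x m n} → 0ℚ ≤ x → x ≤ 1ℚ → m ℕ.≤ n → pow x n ≤ pow x m
  pow-antiʳ {x} {m} {n} p q r = subst₂ _≤_
    (trans (sym (pow-+ x m (n ℕ.∸ m))) (cong (pow x) (ℕ.m+[n∸m]≡n r))) (*-identityʳ (pow x m))
    (*-monoˡ (pow x m) (0≤pow m p) (pow≤1 (n ℕ.∸ m) p q))

  ∣pow∣ : ∀ x n → ∣ pow x n ∣ ≡ pow ∣ x ∣ n
  ∣pow∣ x zero    = refl
  ∣pow∣ x (suc n) = trans (∣p*q∣≡∣p∣*∣q∣ x (pow x n)) (cong (∣ x ∣ *_) (∣pow∣ x n))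

  ν-^ : ∀ a n → ν (a ℕ.^ n) ≡ pow (ν a) n
  ν-^ a zero    = ι-lit 1
  ν-^ a (suc n) = trans (ν-* a (a ℕ.^ n)) (cong (ν a *_) (ν-^ a n))

  ν-suc : ∀ n → ν (suc n) ≡ 1ℚ + ν n
  ν-suc n = trans (ν-+ 1 n) (cong (_+ ν n) (ι-lit 1))

  bernoulli : ∀ {t} n → 0ℚ ≤ t → 1ℚ + ν n * t ≤ pow (1ℚ + t) n
  bernoulli {t} zero p = ≤-reflexive (trans (cong (λ z → 1ℚ + z * t) (ι-lit 0)) (solve 1 (λ t → con 1ℚ :+ con 0ℚ :* t := con 1ℚ) refl t))
    where open +-*-Solver
  bernoulli {t} (suc n) p = ≤-trans
    (≤-sub (subst (0ℚ ≤_) (trans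
      (solve 2 (λ t m → m :* (t :* t) := (con 1ℚ :+ t) :* (con 1ℚ :+ m :* t) :- (con 1ℚ :+ (con 1ℚ :+ m) :* t)) refl t (ν n))
      (cong (λ z → (1ℚ + t) * (1ℚ + ν n * t) - (1ℚ + z * t)) (sym (ν-suc n))))
      (0≤* (0≤ν n) (0≤sq t))))
    (*-monoˡ (1ℚ + t) (0≤+ 0≤1 p) (bernoulli n p))
    where open +-*-Solver

  -- An upper bound for (1 + t)^n without exponentials, of use while n t < 1. Passing from m to m +
  -- 1 lowers the left side by (1 + t)^m (m + 1) t².
  bernoulli⁻ : ∀ {t} n → 0ℚ ≤ t → pow (1ℚ + t) n * (1ℚ - ν n * t) ≤ 1ℚ
  bernoulli⁻ {t} zero p = ≤-reflexive (trans (cong (λ z → 1ℚ * (1ℚ - z * t)) (ι-lit 0)) (solve 1 (λ t → con 1ℚ :* (con 1ℚ :- con 0ℚ :* t) := con 1ℚ) refl t))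
    where open +-*-Solver
  bernoulli⁻ {t} (suc n) p = ≤-trans
    (≤-sub (subst (0ℚ ≤_) (trans
      (solve 3 (λ t m x → x :* ((con 1ℚ :+ m) :* (t :* t)) := x :* (con 1ℚ :- m :* t) :- ((con 1ℚ :+ t) :* x) :* (con 1ℚ :- (con 1ℚ :+ m) :* t)) refl t (ν n) x)
      (cong (λ z → x * (1ℚ - ν n * t) - ((1ℚ + t) * x) * (1ℚ - z * t)) (sym (ν-suc n))))
      (0≤* (0≤pow n (0≤+ 0≤1 p)) (0≤* (0≤+ 0≤1 (0≤ν n)) (0≤sq t)))))
    (bernoulli⁻ n p)
    where open +-*-Solver
          x = pow (1ℚ + t) n

  2ℚ 4ℚ 8ℚ : ℚ
  2ℚ = lit 2
  4ℚ = lit 4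
  8ℚ = lit 8

  two : ℕ → ℚ
  two = pow 2ℚ

  half : ℕ → ℚ
  half = pow ½

  0≤2 : 0ℚ ≤ 2ℚ
  0≤2 = from-yes (0ℚ ≤? 2ℚ)

  1≤2 : 1ℚ ≤ 2ℚ
  1≤2 = from-yes (1ℚ ≤? 2ℚ)

  0≤½ : 0ℚ ≤ ½
  0≤½ = from-yes (0ℚ ≤? ½)

  ½≤1 : ½ ≤ 1ℚ
  ½≤1 = from-yes (½ ≤? 1ℚ)

  0≤two : ∀ n → 0ℚ ≤ two n
  0≤two n = 0≤pow n 0≤2

  0≤half : ∀ n → 0ℚ ≤ half n
  0≤half n = 0≤pow n 0≤½

  two-mono : ∀ {m n} → m ℕ.≤ n → two m ≤ two n
  two-mono = pow-monoʳ 1≤2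

  half-anti : ∀ {m n} → m ℕ.≤ n → half n ≤ half m
  half-anti = pow-antiʳ 0≤½ ½≤1

  two*half : ∀ n → two n * half n ≡ 1ℚ
  two*half n = trans (sym (pow-∙ 2ℚ ½ n)) (pow-1 n)

  two*half+ : ∀ a b → two a * half (a ℕ.+ b) ≡ half b
  two*half+ a b = trans (cong (two a *_) (pow-+ ½ a b))
    (trans (sym (*-assoc (two a) (half a) (half b))) (trans (cong (_* half b) (two*half a)) (*-identityˡ _)))

  two*half≤ : ∀ {a b c} → a ℕ.+ c ℕ.≤ b → two a * half b ≤ half c
  two*half≤ {a} {b} {c} p = ≤-trans (*-monoˡ (two a) (0≤two a) (half-anti p)) (≤-reflexive (two*half+ a c))

  ν-2^ : ∀ n → ν (2 ℕ.^ n) ≡ two n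
  ν-2^ n = trans (ν-^ 2 n) (cong (λ z → pow z n) (ι-lit 2))

  ∣half∣ : ∀ n → ∣ half n ∣ ≡ half n
  ∣half∣ n = 0≤p⇒∣p∣≡p (0≤half n)

  sum : ℕ → (ℕ → ℚ) → ℚ
  sum zero    f = 0ℚ
  sum (suc n) f = sum n f + f n

  sum-cong : ∀ n {f g} → (∀ i → i ℕ.< n → f i ≡ g i) → sum n f ≡ sum n g
  sum-cong zero    h = refl
  sum-cong (suc n) h = cong₂ _+_ (sum-cong n (λ i p → h i (ℕ.m<n⇒m<1+n p))) (h n ℕ.≤-refl)

  sum-+ : ∀ n f g → sum n (λ i → f i + g i) ≡ sum n f + sum n g
  sum-+ zero    f g = refl
  sum-+ (suc n) f g = trans (cong (_+ (f n + g n)) (sum-+ n f g))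
    (solve 4 (λ a b c d → (a :+ b) :+ (c :+ d) := (a :+ c) :+ (b :+ d)) refl (sum n f) (sum n g) (f n) (g n))
    where open +-*-Solver

  sum-* : ∀ n c f → sum n (λ i → c * f i) ≡ c * sum n f
  sum-* zero    c f = sym (*-zeroʳ c)
  sum-* (suc n) c f = trans (cong (_+ c * f n) (sum-* n c f)) (sym (*-distribˡ-+ c (sum n f) (f n)))

  sum-bound : ∀ n {f b} → (∀ i → i ℕ.< n → ∣ f i ∣ ≤ b) → ∣ sum n f ∣ ≤ ν n * b
  sum-bound zero    {f} {b} h = ≤-reflexive (sym (trans (cong (_* b) (ι-lit 0)) (*-zeroˡ b)))
  sum-bound (suc n) {f} {b} h = ≤-trans (∣+∣≤ (sum-bound n (λ i p → h i (ℕ.m<n⇒m<1+n p))) (h n ℕ.≤-refl))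
    (≤-reflexive (trans (solve 2 (λ m b → m :* b :+ b := (con 1ℚ :+ m) :* b) refl (ν n) b)
      (cong (_* b) (sym (ν-suc n)))))
    where open +-*-Solver

-- The dominant root, and decay of the conjugate components

module DominantRoot where

  open import Defs using (S)
  open Rationals
  open import Data.Nat as ℕ using (ℕ; zero; suc)
  import Data.Nat.Properties as ℕ
  import Data.Nat.Tactic.RingSolver as ℕR
  open import Data.Integer as ℤ using (ℤ)
  import Data.Integer.Properties as ℤ
  open import Data.Rational
  open import Data.Rational.Properties
  open import Data.Rational.Solver
  open import Data.Product using (_×_; _,_; ∃)
  open import Data.Sum using (inj₁; inj₂)
  open import Relation.Binary.PropositionalEquality hiding ([_])
  open import Relation.Nullary using (contradiction)
  open import Relation.Nullary.Decidable using (from-yes)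
  open +-*-Solver

  trib : ℚ → ℚ
  trib w = w * w * w - w * w - w - 1ℚ

  3ℚ 20ℚ lo₀ hi₀ 1/20 ¼ 3/5 17/20 : ℚ
  3ℚ = lit 3
  20ℚ = lit 20
  lo₀ = ℤ.+ 9 / 5
  hi₀ = ℤ.+ 37 / 20
  1/20 = ℤ.+ 1 / 20
  ¼ = ½ * ½
  3/5 = ℤ.+ 3 / 5
  17/20 = ℤ.+ 17 / 20

  -- A rational stand-in for α = 1.839... The interval from 9/5 to 37/20 supplies the crude
  -- inequalities, `tiny` the precision.
  record Root (ε : ℚ) : Set where
    field
      ω    : ℚ
      lo≤ω : lo₀ ≤ ω
      ω≤hi : ω ≤ hi₀
      tiny : ∣ trib ω ∣ ≤ ε

  private
    width : ℕ → ℚ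
    width m = half m * 1/20

    bracket : ∀ m → ∃ λ l → (lo₀ ≤ l × l + width m ≤ hi₀) × (trib l ≤ 0ℚ × 0ℚ ≤ trib (l + width m))
    bracket zero = lo₀ , (from-yes (lo₀ ≤? lo₀) , from-yes (lo₀ + width 0 ≤? hi₀)) ,
      (from-yes (trib lo₀ ≤? 0ℚ) , from-yes (0ℚ ≤? trib (lo₀ + width 0)))
    bracket (suc m) with bracket m
    ... | l , (p , q) , (r , s) with ≤-total (trib (l + width (suc m))) 0ℚ
    ... | inj₁ t = l + width (suc m) ,
          (≤-trans p (≤-trans (≤-reflexive (sym (+-identityʳ l))) (+-monoʳ-≤ l 0≤w)) , subst (_≤ hi₀) e q) ,
          (t , subst (λ z → 0ℚ ≤ trib z) e s)
      where
      0≤w : 0ℚ ≤ width (suc m)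
      0≤w = 0≤* (0≤half (suc m)) (from-yes (0ℚ ≤? 1/20))
      e : l + width m ≡ (l + width (suc m)) + width (suc m)
      e = solve 2 (λ l h → l :+ h :* con 1/20 := (l :+ (con ½ :* h) :* con 1/20) :+ (con ½ :* h) :* con 1/20) refl l (half m)
    ... | inj₂ t = l , (p , ≤-trans (+-monoʳ-≤ l (*-monoʳ 1/20 (from-yes (0ℚ ≤? 1/20)) (half-anti (ℕ.n≤1+n m)))) q) , (r , t)

  -- Bisection starting from length 1/20. Since trib (l + d) - trib l ≤ d (3l² + 3ld + d²) ≤ 20 d, a
  -- sign change on an interval of length 2^(-N) / 20 bounds trib at its left end by 2^(-N).
  root : ∀ N → Root (half N)
  root N with bracket N
  ... | l , (p , q) , (r , s) = record
    { ω = l ; lo≤ω = p ; ω≤hi = l≤hi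
    ; tiny = ∣∣-bound (≤-trans r (0≤half N)) (≤-trans -fl≤ d*20≤) }
    where
    d = width N
    0≤d : 0ℚ ≤ d
    0≤d = 0≤* (0≤half N) (from-yes (0ℚ ≤? 1/20))
    d≤1 : d ≤ 1ℚ
    d≤1 = ≤-trans (*-mono (0≤half N) (from-yes (0ℚ ≤? 1/20)) (half-anti {0} {N} ℕ.z≤n) ≤-refl) (from-yes (1ℚ * 1/20 ≤? 1ℚ))
    l≤hi : l ≤ hi₀
    l≤hi = ≤-trans (≤-trans (≤-reflexive (sym (+-identityʳ l))) (+-monoʳ-≤ l 0≤d)) q
    l≤2 : l ≤ 2ℚ
    l≤2 = ≤-trans l≤hi (from-yes (hi₀ ≤? 2ℚ))
    0≤l : 0ℚ ≤ l
    0≤l = ≤-trans (from-yes (0ℚ ≤? lo₀)) p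
    br : ℚ
    br = 3ℚ * (l * l) + 3ℚ * (l * d) + d * d
    br≤20 : br ≤ 20ℚ
    br≤20 = ≤-trans (+-mono-≤ (+-mono-≤
        (*-monoˡ 3ℚ (0≤lit 3) (*-mono 0≤l 0≤l l≤2 l≤2))
        (*-monoˡ 3ℚ (0≤lit 3) (*-mono 0≤l 0≤d l≤2 d≤1)))
        (*-mono 0≤d 0≤d d≤1 d≤1))
      (from-yes (3ℚ * (2ℚ * 2ℚ) + 3ℚ * (2ℚ * 1ℚ) + 1ℚ * 1ℚ ≤? 20ℚ))
    -fl≤ : - trib l ≤ d * 20ℚ
    -fl≤ = ≤-trans
      (≤-sub (subst (0ℚ ≤_)
        (solve 2 (λ l d → (((l :+ d) :* (l :+ d) :* (l :+ d) :- (l :+ d) :* (l :+ d) :- (l :+ d) :- con 1ℚ)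
           :+ d :* (con 2ℚ :* l :+ d :+ con 1ℚ)) :=
           d :* (con 3ℚ :* (l :* l) :+ con 3ℚ :* (l :* d) :+ d :* d) :- (:- (l :* l :* l :- l :* l :- l :- con 1ℚ))) refl l d)
        (0≤+ s (0≤* 0≤d (0≤+ (0≤+ (0≤* 0≤2 0≤l) 0≤d) 0≤1)))))
      (*-monoˡ d 0≤d br≤20)
    d*20≤ : d * 20ℚ ≤ half N
    d*20≤ = ≤-reflexive (trans (*-assoc (half N) 1/20 20ℚ) (*-identityʳ _))

  module Decay (ω : ℚ) (lo≤ω : lo₀ ≤ ω) (ω≤hi : ω ≤ hi₀) where

    0≤ω : 0ℚ ≤ ω
    0≤ω = ≤-trans (from-yes (0ℚ ≤? lo₀)) lo≤ω

    1≤ω : 1ℚ ≤ ω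
    1≤ω = ≤-trans (from-yes (1ℚ ≤? lo₀)) lo≤ω

    ω≤2 : ω ≤ 2ℚ
    ω≤2 = ≤-trans ω≤hi (from-yes (hi₀ ≤? 2ℚ))

    -- These are the coefficients of the cofactor: x³ - x² - x - 1 = (x - ω)(x² + ω̇ x + κ) + trib
    -- ω. So κ is nearly the squared modulus of the complex conjugates of α.
    ω̇ κ : ℚ
    ω̇ = ω - 1ℚ
    κ = ω * ω - ω - 1ℚ

    0≤ω̇ : 0ℚ ≤ ω̇
    0≤ω̇ = sub-≤ 1≤ω

    ω̇≤ : ω̇ ≤ 17/20
    ω̇≤ = ≤-trans (+-monoˡ-≤ (- 1ℚ) ω≤hi) (from-yes (hi₀ - 1ℚ ≤? 17/20))

    ω̇≤1 : ω̇ ≤ 1ℚ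
    ω̇≤1 = ≤-trans ω̇≤ (from-yes (17/20 ≤? 1ℚ))

    κ≡ : ω * ω̇ - 1ℚ ≡ κ
    κ≡ = solve 1 (λ w → w :* (w :- con 1ℚ) :- con 1ℚ := w :* w :- w :- con 1ℚ) refl ω

    κ≤ : κ ≤ 3/5
    κ≤ = ≤-trans (≤-reflexive (sym κ≡))
      (≤-trans (+-monoˡ-≤ (- 1ℚ) (*-mono 0≤ω 0≤ω̇ ω≤hi ω̇≤)) (from-yes (hi₀ * 17/20 - 1ℚ ≤? 3/5)))

    0≤κ : 0ℚ ≤ κ
    0≤κ = ≤-trans (from-yes (0ℚ ≤? lo₀ * (lo₀ - 1ℚ) - 1ℚ))
      (≤-trans (+-monoˡ-≤ (- 1ℚ) (*-mono (from-yes (0ℚ ≤? lo₀)) (from-yes (0ℚ ≤? lo₀ - 1ℚ)) lo≤ω (+-monoˡ-≤ (- 1ℚ) lo≤ω)))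
        (≤-reflexive κ≡))

    κ≤1 : κ ≤ 1ℚ
    κ≤1 = ≤-trans κ≤ (from-yes (3/5 ≤? 1ℚ))

    κ³≤ : pow κ 3 ≤ ¼
    κ³≤ = ≤-trans (pow-mono 3 0≤κ κ≤) (from-yes (pow 3/5 3 ≤? ¼))

    -- the norm form of the complex conjugates: it is multiplied by κ when a
    -- sequence with characteristic polynomial trib is shifted, up to its component along ω
    form : ℚ → ℚ → ℚ
    form x y = y * y + ω̇ * (y * x) + κ * (x * x)

    form-step : ∀ x y z → form y z ≡ κ * form x y + (z + ω̇ * y + κ * x) * (z - κ * x)
    form-step = solve 4 (λ w x y z → let v = w :- con 1ℚ ; k = w :* w :- w :- con 1ℚ in
      z :* z :+ v :* (z :* y) :+ k :* (y :* y) :=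
      k :* (y :* y :+ v :* (y :* x) :+ k :* (x :* x)) :+ (z :+ v :* y :+ k :* x) :* (z :- k :* x)) refl ω

    -- Completing the square in 8 · form - x² leaves (6ω² - 4ω - 11) x². Expanded at `lo₀`, this
    -- polynomial in ω has positive coefficients only.
    form-lower : ∀ x y → x * x ≤ 8ℚ * form x y
    form-lower x y = ≤-sub (subst (0ℚ ≤_) (eq ω x y)
      (0≤+ (0≤* 0≤2 (0≤sq (2ℚ * y + ω̇ * x))) (0≤* (0≤+ (0≤+ (0≤* (0≤lit 6) (0≤sq (ω - lo₀)))
         (0≤* (from-yes (0ℚ ≤? c₁)) (sub-≤ lo≤ω))) (from-yes (0ℚ ≤? c₀))) (0≤sq x))))
      where
      c₁ c₀ : ℚ
      c₁ = ℤ.+ 88 / 5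
      c₀ = ℤ.+ 31 / 25
      eq : ∀ ω x y → 2ℚ * ((2ℚ * y + (ω - 1ℚ) * x) * (2ℚ * y + (ω - 1ℚ) * x))
          + (lit 6 * ((ω - lo₀) * (ω - lo₀)) + c₁ * (ω - lo₀) + c₀) * (x * x)
          ≡ 8ℚ * (y * y + (ω - 1ℚ) * (y * x) + (ω * ω - ω - 1ℚ) * (x * x)) - x * x
      eq = solve 3 (λ w x y → con 2ℚ :* ((con 2ℚ :* y :+ (w :- con 1ℚ) :* x) :* (con 2ℚ :* y :+ (w :- con 1ℚ) :* x))
          :+ (con (lit 6) :* ((w :- con lo₀) :* (w :- con lo₀)) :+ con c₁ :* (w :- con lo₀) :+ con c₀) :* (x :* x)
          := con 8ℚ :* (y :* y :+ (w :- con 1ℚ) :* (y :* x) :+ (w :* w :- w :- con 1ℚ) :* (x :* x)) :- x :* x) refl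

    form-upper : ∀ {x y g} → ∣ x ∣ ≤ g → ∣ y ∣ ≤ g → form x y ≤ 3ℚ * (g * g)
    form-upper {x} {y} {g} p q = ≤-trans (p≤∣p∣ _) (≤-trans
      (∣+∣≤ (∣+∣≤ (∣*∣≤ q q) (∣*∣≤ (∣0≤∣ 0≤ω̇ ω̇≤1) (∣*∣≤ q p))) (∣*∣≤ (∣0≤∣ 0≤κ κ≤1) (∣*∣≤ p p)))
      (≤-reflexive (solve 1 (λ g → g :* g :+ con 1ℚ :* (g :* g) :+ con 1ℚ :* (g :* g) := con 3ℚ :* (g :* g)) refl g)))

    -- With E for the shift this is E² + ω̇ E + κ, which annihilates the conjugate components and so
    -- measures the component of G along ω.
    residual : (ℕ → ℚ) → ℕ → ℚ
    residual G τ = G (suc (suc τ)) + ω̇ * G (suc τ) + κ * G τ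

    -- By `form-step` the form contracts by κ in each step, and the residual enters multiplied by a
    -- combination of values of G. The error bound reproduces itself because 8 κ + 4 + 3/5 ≤ 16.
    form-decay : ∀ (G : ℕ → ℚ) g δ T → 0ℚ ≤ g → 0ℚ ≤ δ → (∀ τ → ∣ G τ ∣ ≤ g * two τ) →
      (∀ τ → τ ℕ.< T → ∣ residual G τ ∣ ≤ δ) →
      form (G T) (G (suc T)) ≤ pow κ T * form (G 0) (G 1) + δ * (g * two (3 ℕ.+ T))
    form-decay G g δ zero 0≤g 0≤δ hG hr = ≤-trans (≤-reflexive (sym (+-identityʳ (form (G 0) (G 1)))))
      (+-mono-≤ (≤-reflexive (sym (*-identityˡ (form (G 0) (G 1))))) (0≤* 0≤δ (0≤* 0≤g (0≤two 3))))
    form-decay G g δ (suc T) 0≤g 0≤δ hG hr = ≤-trans (≤-reflexive (form-step x y z)) (≤-trans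
      (+-mono-≤ (*-monoˡ κ 0≤κ (form-decay G g δ T 0≤g 0≤δ hG (λ τ p → hr τ (ℕ.m<n⇒m<1+n p))))
        (≤-trans (p≤∣p∣ _) (∣*∣≤ (hr T ℕ.≤-refl) (∣-∣≤ (hG (suc (suc T))) (∣*∣≤ (∣0≤∣ 0≤κ κ≤) (hG T))))))
      (≤-trans (≤-reflexive (e₁ κ (pow κ T) (form (G 0) (G 1)) δ g (two T)))
        (≤-trans (+-monoʳ-≤ (κ * pow κ T * form (G 0) (G 1)) (*-monoˡ (δ * (g * two T)) (0≤* 0≤δ (0≤* 0≤g (0≤two T)))
          (≤-trans (+-monoˡ-≤ (4ℚ + 3/5) (*-monoʳ 8ℚ (0≤lit 8) κ≤)) (from-yes (3/5 * 8ℚ + (4ℚ + 3/5) ≤? lit 16)))))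
          (≤-reflexive (e₂ (κ * pow κ T * form (G 0) (G 1)) δ g (two T))))))
      where
      x = G T
      y = G (suc T)
      z = G (suc (suc T))
      e₁ : ∀ k p f δ g t → k * (p * f + δ * (g * (2ℚ * (2ℚ * (2ℚ * t))))) + δ * (g * (2ℚ * (2ℚ * t)) + 3/5 * (g * t))
          ≡ k * p * f + (δ * (g * t)) * (k * 8ℚ + (4ℚ + 3/5))
      e₁ = solve 6 (λ k p f δ g t → k :* (p :* f :+ δ :* (g :* (con 2ℚ :* (con 2ℚ :* (con 2ℚ :* t))))) :+ δ :* (g :* (con 2ℚ :* (con 2ℚ :* t)) :+ con 3/5 :* (g :* t))
          := k :* p :* f :+ (δ :* (g :* t)) :* (k :* con 8ℚ :+ (con 4ℚ :+ con 3/5))) refl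
      e₂ : ∀ a δ g t → a + (δ * (g * t)) * lit 16 ≡ a + δ * (g * (2ℚ * (2ℚ * (2ℚ * (2ℚ * t)))))
      e₂ = solve 4 (λ a δ g t → a :+ (δ :* (g :* t)) :* con (lit 16) := a :+ δ :* (g :* (con 2ℚ :* (con 2ℚ :* (con 2ℚ :* (con 2ℚ :* t)))))) refl

    1≤ν : ∀ n → 1ℚ ≤ ν (suc n)
    1≤ν n = subst (_≤ ν (suc n)) (ι-lit 1) (ν-mono (ℕ.s≤s (ℕ.z≤n {n})))

    sq<1⇒0 : ∀ z → ι z * ι z < 1ℚ → z ≡ ℤ.+ 0
    sq<1⇒0 (ℤ.+ zero) h = refl
    sq<1⇒0 (ℤ.+ suc n) h = contradiction (<-≤-trans h (*-mono 0≤1 0≤1 (1≤ν n) (1≤ν n))) (<-irrefl refl)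
    sq<1⇒0 ℤ.-[1+ n ] h = contradiction (<-≤-trans (subst (_< 1ℚ) e h)
       (*-mono 0≤1 0≤1 (1≤ν n) (1≤ν n))) (<-irrefl refl)
      where
      e : ι ℤ.-[1+ n ] * ι ℤ.-[1+ n ] ≡ ν (suc n) * ν (suc n)
      e = trans (sym (ι-* ℤ.-[1+ n ] ℤ.-[1+ n ])) (ι-* (ℤ.+ suc n) (ℤ.+ suc n))

    -- An integer whose square is below 1 is 0. Three steps gain κ³ ≤ 1/4, so 3 (γ + 5) steps shrink
    -- the initial form, at most 3 · 4^(γ+1), to 3 / 2^8. The residuals add at most 2^(-6), and 8 (3
    -- / 2^8 + 2^(-6)) < 1.
    decay-zero : ∀ (G : ℕ → ℤ) γ → (∀ τ → ∣ ι (G τ) ∣ ≤ two γ * two τ) →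
      (∀ τ → τ ℕ.< (γ ℕ.+ 5) ℕ.* 3 → ∣ residual (λ i → ι (G i)) τ ∣ ≤ half (4 ℕ.* γ ℕ.+ 24)) →
      G ((γ ℕ.+ 5) ℕ.* 3) ≡ ℤ.+ 0
    decay-zero G γ hG hr = sq<1⇒0 (G T) (≤-<-trans (form-lower _ (ι (G (suc T)))) (≤-<-trans
       (*-monoˡ 8ℚ (0≤lit 8) (≤-trans (form-decay (λ i → ι (G i)) (two γ) (half (4 ℕ.* γ ℕ.+ 24)) T (0≤two γ) (0≤half (4 ℕ.* γ ℕ.+ 24)) hG hr)
         (+-mono-≤ first second)))
       (from-yes (8ℚ * (3ℚ * half 8 + half 6) <? 1ℚ))))
      where
      T = (γ ℕ.+ 5) ℕ.* 3
      g0 : ∀ τ → τ ℕ.≤ 1 → ∣ ι (G τ) ∣ ≤ two γ * 2ℚ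
      g0 τ p = ≤-trans (hG τ) (*-monoˡ (two γ) (0≤two γ) (two-mono p))
      powκ : pow κ T ≤ half ((γ ℕ.+ 5) ℕ.* 2)
      powκ = ≤-trans (≤-reflexive (pow-* κ (γ ℕ.+ 5) 3)) (≤-trans (pow-mono (γ ℕ.+ 5) (0≤pow 3 0≤κ) κ³≤)
        (≤-reflexive (sym (pow-* ½ (γ ℕ.+ 5) 2))))
      exp₁ : ∀ γ → (γ ℕ.+ 5) ℕ.* 2 ≡ γ ℕ.+ (γ ℕ.+ 10)
      exp₁ = ℕR.solve-∀
      first : pow κ T * form (ι (G 0)) (ι (G 1)) ≤ 3ℚ * half 8
      first = ≤-trans (*-monoˡ (pow κ T) (0≤pow T 0≤κ) (form-upper {g = two γ * 2ℚ} (g0 0 ℕ.z≤n) (g0 1 ℕ.≤-refl)))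
        (≤-trans (*-monoʳ _ (0≤* (0≤lit 3) (0≤sq (two γ * 2ℚ))) powκ)
          (≤-reflexive (trans (cong (λ e → half e * (3ℚ * (two γ * 2ℚ * (two γ * 2ℚ)))) (exp₁ γ))
            (trans (cong (_* (3ℚ * (two γ * 2ℚ * (two γ * 2ℚ)))) (trans (pow-+ ½ γ (γ ℕ.+ 10)) (cong (half γ *_) (pow-+ ½ γ 10))))
              (trans (solve 2 (λ h t → (h :* (h :* con (half 10))) :* (con 3ℚ :* (t :* con 2ℚ :* (t :* con 2ℚ))) := con (3ℚ * half 8) :* ((t :* h) :* (t :* h))) refl (half γ) (two γ))
                (trans (cong (λ z → 3ℚ * half 8 * (z * z)) (two*half γ)) (*-identityʳ (3ℚ * half 8))))))))
      exp₂ : ∀ γ → γ ℕ.+ (3 ℕ.+ (γ ℕ.+ 5) ℕ.* 3) ℕ.+ 6 ≡ 4 ℕ.* γ ℕ.+ 24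
      exp₂ = ℕR.solve-∀
      second : half (4 ℕ.* γ ℕ.+ 24) * (two γ * two (3 ℕ.+ T)) ≤ half 6
      second = ≤-trans (≤-reflexive (trans (*-comm (half (4 ℕ.* γ ℕ.+ 24)) (two γ * two (3 ℕ.+ T))) (cong (_* half (4 ℕ.* γ ℕ.+ 24)) (sym (pow-+ 2ℚ γ (3 ℕ.+ T))))))
        (two*half≤ {γ ℕ.+ (3 ℕ.+ T)} {4 ℕ.* γ ℕ.+ 24} {6} (ℕ.≤-reflexive (exp₂ γ)))

    ν-S : ∀ n → ν (S (3 ℕ.+ n)) ≡ ν (S (2 ℕ.+ n)) + ν (S (1 ℕ.+ n)) + ν (S n)
    ν-S n = trans (ν-+ (S (2 ℕ.+ n) ℕ.+ S (1 ℕ.+ n)) (S n)) (cong (_+ ν (S n)) (ν-+ (S (2 ℕ.+ n)) (S (1 ℕ.+ n))))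

    S≤two : ∀ n → ν (S n) ≤ 3ℚ * two n
    S≤two zero = ≤-trans (≤-reflexive (ι-lit 3)) (from-yes (lit 3 ≤? 3ℚ * 1ℚ))
    S≤two (suc zero) = ≤-trans (≤-reflexive (ι-lit 1)) (from-yes (lit 1 ≤? 3ℚ * two 1))
    S≤two (suc (suc zero)) = ≤-trans (≤-reflexive (ι-lit 3)) (from-yes (lit 3 ≤? 3ℚ * two 2))
    S≤two (suc (suc (suc n))) = ≤-trans (≤-reflexive (ν-S n)) (≤-trans
      (+-mono-≤ (+-mono-≤ (S≤two (suc (suc n))) (S≤two (suc n))) (S≤two n))
      (≤-trans (≤-reflexive (solve 1 (λ t → con 3ℚ :* (con 2ℚ :* (con 2ℚ :* t)) :+ con 3ℚ :* (con 2ℚ :* t) :+ con 3ℚ :* t := con (3ℚ * lit 7) :* t) refl (two n)))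
        (≤-trans (*-monoʳ (two n) (0≤two n) (from-yes (3ℚ * lit 7 ≤? 3ℚ * 8ℚ)))
          (≤-reflexive (solve 1 (λ t → con (3ℚ * 8ℚ) :* t := con 3ℚ :* (con 2ℚ :* (con 2ℚ :* (con 2ℚ :* t)))) refl (two n))))))

    ∣S∣≤ : ∀ n → ∣ ν (S n) ∣ ≤ 3ℚ * two n
    ∣S∣≤ n = ∣0≤∣ (0≤ν (S n)) (S≤two n)

    powω≤two : ∀ n → pow ω n ≤ two n
    powω≤two n = pow-mono n 0≤ω ω≤2

    ∣powω∣≤ : ∀ n → ∣ pow ω n ∣ ≤ two n
    ∣powω∣≤ n = ∣0≤∣ (0≤pow n 0≤ω) (powω≤two n)

    comp : ℕ → ℚ
    comp = residual (λ i → ν (S i))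

    -- The derivative 3ω² - 2ω - 1 of the characteristic polynomial. As α^n occurs in S n with
    -- coefficient 1, `comp n` is ω^n times this number up to the defect trib ω.
    comp₀ : ℚ
    comp₀ = ω * ω + ω̇ * ω + κ

    comp-0 : comp 0 ≡ comp₀
    comp-0 = trans (cong₂ (λ x y → x + ω̇ * y + κ * x) (ι-lit 3) (ι-lit 1))
      (solve 1 (λ w → con (lit 3) :+ (w :- con 1ℚ) :* con (lit 1) :+ (w :* w :- w :- con 1ℚ) :* con (lit 3)
         := w :* w :+ (w :- con 1ℚ) :* w :+ (w :* w :- w :- con 1ℚ)) refl ω)

    0≤comp₀ : 0ℚ ≤ comp₀
    0≤comp₀ = 0≤+ (0≤+ (0≤* 0≤ω 0≤ω) (0≤* 0≤ω̇ 0≤ω)) 0≤κ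

    comp₀≤8 : comp₀ ≤ 8ℚ
    comp₀≤8 = ≤-trans (+-mono-≤ (+-mono-≤ (*-mono 0≤ω 0≤ω ω≤2 ω≤2) (*-mono 0≤ω̇ 0≤ω ω̇≤1 ω≤2)) κ≤1)
      (from-yes (2ℚ * 2ℚ + 1ℚ * 2ℚ + 1ℚ ≤? 8ℚ))

    comp-step : ∀ n → comp (suc n) ≡ ω * comp n - trib ω * ν (S n)
    comp-step n = trans (cong (λ z → z + ω̇ * ν (S (suc (suc n))) + κ * ν (S (suc n))) (ν-S n))
      (solve 4 (λ w a b c → (a :+ b :+ c) :+ (w :- con 1ℚ) :* a :+ (w :* w :- w :- con 1ℚ) :* b
        := w :* (a :+ (w :- con 1ℚ) :* b :+ (w :* w :- w :- con 1ℚ) :* c) :- (w :* w :* w :- w :* w :- w :- con 1ℚ) :* c) refl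
        ω (ν (S (suc (suc n)))) (ν (S (suc n))) (ν (S n)))

    module Approx (ε : ℚ) (tiny : ∣ trib ω ∣ ≤ ε) where

      0≤ε : 0ℚ ≤ ε
      0≤ε = ≤-trans (0≤∣p∣ (trib ω)) tiny

      comp-error : ∀ n → ∣ comp n - pow ω n * comp₀ ∣ ≤ ε * (4ℚ * pow 4ℚ n)
      comp-error zero = ≤-trans (≤-reflexive (cong ∣_∣ (trans (cong (_- 1ℚ * comp₀) comp-0)
          (solve 1 (λ x → x :- con 1ℚ :* x := con 0ℚ) refl comp₀))))
        (0≤* 0≤ε (0≤* (0≤lit 4) 0≤1))
      comp-error (suc n) = ≤-trans (≤-reflexive (cong ∣_∣ (trans (cong (_- pow ω (suc n) * comp₀) (comp-step n))
          (solve 5 (λ w h p c s → (w :* h :- s) :- w :* p :* c := w :* (h :- p :* c) :- s) refl ω (comp n) (pow ω n) comp₀ (trib ω * ν (S n))))))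
        (≤-trans (∣-∣≤ (∣*∣≤ (∣0≤∣ 0≤ω ω≤2) (comp-error n)) (∣*∣≤ tiny (≤-trans (∣S∣≤ n) (*-monoˡ 3ℚ (0≤lit 3) (pow-mono n 0≤2 (from-yes (2ℚ ≤? 4ℚ)))))))
          (≤-trans (≤-reflexive (solve 2 (λ e t → con 2ℚ :* (e :* (con 4ℚ :* t)) :+ e :* (con 3ℚ :* t) := con (lit 11) :* (e :* t)) refl ε (pow 4ℚ n)))
            (≤-trans (*-monoʳ (ε * pow 4ℚ n) (0≤* 0≤ε (0≤pow n (0≤lit 4))) (from-yes (lit 11 ≤? lit 16)))
              (≤-reflexive (solve 2 (λ e t → con (lit 16) :* (e :* t) := e :* (con 4ℚ :* (con 4ℚ :* t))) refl ε (pow 4ℚ n))))))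

      private
        D : ℕ → ℚ
        D i = ν (S i) - pow ω i

        residual-D : ∀ τ → residual D τ ≡ comp τ - pow ω τ * comp₀
        residual-D τ = solve 5 (λ w p a b c →
          (a :- w :* (w :* p)) :+ (w :- con 1ℚ) :* (b :- w :* p) :+ (w :* w :- w :- con 1ℚ) :* (c :- p)
          := (a :+ (w :- con 1ℚ) :* b :+ (w :* w :- w :- con 1ℚ) :* c) :- p :* (w :* w :+ (w :- con 1ℚ) :* w :+ (w :* w :- w :- con 1ℚ))) refl
          ω (pow ω τ) (ν (S (suc (suc τ)))) (ν (S (suc τ))) (ν (S τ))

      -- S n is the sum of the n-th powers of the three roots, so up to the error of ω the
      -- difference is the bounded conjugate part. Its form starts at no more than 3 and gains at
      -- most 1, hence its square is at most 8 · 4 < 6².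
      S-approx : ∀ n → ε * (4ℚ * pow 4ℚ n) * (4ℚ * two (3 ℕ.+ n)) ≤ 1ℚ → ∣ ν (S n) - pow ω n ∣ ≤ lit 6
      S-approx n small with ≤-total ∣ D n ∣ (lit 6)
      ... | inj₁ p = p
      ... | inj₂ p = contradiction (≤-trans (*-mono (0≤lit 6) (0≤lit 6) p p)
            (≤-trans (≤-reflexive (trans (sym (∣p*q∣≡∣p∣*∣q∣ (D n) (D n))) (0≤p⇒∣p∣≡p (0≤sq (D n)))))
              (≤-trans (form-lower (D n) (D (suc n))) (*-monoˡ 8ℚ (0≤lit 8) bound))))
            (λ q → <-irrefl refl (<-≤-trans (from-yes (8ℚ * 4ℚ <? lit 6 * lit 6)) q))
        where
        D≤ : ∀ τ → ∣ D τ ∣ ≤ 4ℚ * two τ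
        D≤ τ = ≤-trans (∣-∣≤ (∣S∣≤ τ) (∣powω∣≤ τ))
          (≤-reflexive (solve 1 (λ t → con 3ℚ :* t :+ t := con 4ℚ :* t) refl (two τ)))
        res≤ : ∀ τ → τ ℕ.< n → ∣ residual D τ ∣ ≤ ε * (4ℚ * pow 4ℚ n)
        res≤ τ τ<n = ≤-trans (≤-reflexive (cong ∣_∣ (residual-D τ))) (≤-trans (comp-error τ)
          (*-monoˡ ε 0≤ε (*-monoˡ 4ℚ (0≤lit 4) (pow-monoʳ (from-yes (1ℚ ≤? 4ℚ)) (ℕ.<⇒≤ τ<n)))))
        form₀ : form (D 0) (D 1) ≤ 3ℚ
        form₀ = ≤-trans (≤-reflexive (trans (cong₂ (λ x y → form (x - 1ℚ) (y - pow ω 1)) (ι-lit 3) (ι-lit 1))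
           (solve 1 (λ w → let x = con (lit 3) :- con 1ℚ ; y = con (lit 1) :- w :* con 1ℚ ; v = w :- con 1ℚ ; k = w :* w :- w :- con 1ℚ in
             y :* y :+ v :* (y :* x) :+ k :* (x :* x) := con 4ℚ :* k :- v :* v) refl ω)))
           (≤-trans (+-mono-≤ (*-monoˡ 4ℚ (0≤lit 4) κ≤) (neg-antimono-≤ (0≤sq ω̇))) (from-yes (4ℚ * 3/5 + - 0ℚ ≤? 3ℚ)))
        bound : form (D n) (D (suc n)) ≤ 4ℚ
        bound = ≤-trans (form-decay D 4ℚ (ε * (4ℚ * pow 4ℚ n)) n (0≤lit 4) (0≤* 0≤ε (0≤* (0≤lit 4) (0≤pow n (0≤lit 4)))) D≤ res≤)
          (≤-trans (+-mono-≤ (≤-trans (*-monoˡ (pow κ n) (0≤pow n 0≤κ) form₀) (*-monoʳ 3ℚ (0≤lit 3) (pow≤1 n 0≤κ κ≤1))) small)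
            (from-yes (1ℚ * 3ℚ + 1ℚ ≤? 4ℚ)))

-- Newton series of binomials times exponentials

module NewtonSeries where

  open Rationals
  open import Data.Nat as ℕ using (ℕ; zero; suc)
  import Data.Nat.Properties as ℕ
  open import Data.Rational
  open import Data.Rational.Properties
  open import Data.Rational.Solver
  open import Function using (_∘_)
  open import Relation.Binary.PropositionalEquality hiding ([_])
  open import Relation.Nullary.Decidable using (from-yes)
  open +-*-Solver

  bin : ℕ → ℕ → ℕ
  bin x       zero    = 1
  bin zero    (suc i) = 0
  bin (suc x) (suc i) = bin x i ℕ.+ bin x (suc i)

  -- One term C(x,i) u^i of the expansion of (1 + u)^x, multiplied by t^i = u^(-i).
  bin-bound : ∀ {t u} x i → 0ℚ ≤ t → 0ℚ ≤ u → t * u ≡ 1ℚ → ν (bin x i) ≤ pow t i * pow (1ℚ + u) x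
  bin-bound {t} {u} x zero p q e = ≤-trans (≤-reflexive (ι-lit 1))
    (≤-trans (1≤pow x (≤-trans (≤-reflexive (sym (+-identityʳ 1ℚ))) (+-monoʳ-≤ 1ℚ q)))
      (≤-reflexive (sym (*-identityˡ (pow (1ℚ + u) x)))))
  bin-bound {t} {u} zero (suc i) p q e = ≤-trans (≤-reflexive (ι-lit 0)) (0≤* (0≤pow (suc i) p) 0≤1)
  bin-bound {t} {u} (suc x) (suc i) p q e = ≤-trans (≤-reflexive (ν-+ (bin x i) (bin x (suc i))))
    (≤-trans (+-mono-≤ (bin-bound x i p q e) (bin-bound x (suc i) p q e))
      (≤-reflexive (trans (cong (λ z → z + t * a * b) (sym (trans (cong (_* (a * b)) e) (*-identityˡ (a * b)))))
        (solve 4 (λ t u a b → (t :* u) :* (a :* b) :+ t :* a :* b := (t :* a) :* ((con 1ℚ :+ u) :* b)) refl t u a b))))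
    where
    a = pow t i
    b = pow (1ℚ + u) x

  -- This is ∑ d_s C(x,s), the function whose finite differences at 0 are d_s, with Pascal's rule as
  -- its definition.
  newton : (ℕ → ℚ) → ℕ → ℚ
  newton d zero    = d 0
  newton d (suc x) = newton d x + newton (d ∘ suc) x

  newton-cong : ∀ {d e} x → (∀ s → d s ≡ e s) → newton d x ≡ newton e x
  newton-cong zero    h = h 0
  newton-cong (suc x) h = cong₂ _+_ (newton-cong x h) (newton-cong x (h ∘ suc))

  newton-+ : ∀ d e x → newton (λ s → d s + e s) x ≡ newton d x + newton e x
  newton-+ d e zero    = refl
  newton-+ d e (suc x) = trans (cong₂ _+_ (newton-+ d e x) (newton-+ (d ∘ suc) (e ∘ suc) x))
    (solve 4 (λ a b c d → (a :+ b) :+ (c :+ d) := (a :+ c) :+ (b :+ d)) refl (newton d x) (newton e x) (newton (d ∘ suc) x) (newton (e ∘ suc) x))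

  newton-* : ∀ c d x → newton (λ s → c * d s) x ≡ c * newton d x
  newton-* c d zero    = refl
  newton-* c d (suc x) = trans (cong₂ _+_ (newton-* c d x) (newton-* c (d ∘ suc) x)) (sym (*-distribˡ-+ c (newton d x) (newton (d ∘ suc) x)))

  newton-0 : ∀ x → newton (λ _ → 0ℚ) x ≡ 0ℚ
  newton-0 zero    = refl
  newton-0 (suc x) = cong₂ _+_ (newton-0 x) (newton-0 x)

  newton-sum : ∀ n (d : ℕ → ℕ → ℚ) x → newton (λ s → sum n (λ i → d i s)) x ≡ sum n (λ i → newton (d i) x)
  newton-sum zero    d x = newton-0 x
  newton-sum (suc n) d x = trans (newton-+ _ (d n) x) (cong (_+ newton (d n) x) (newton-sum n d x))

  newton-bound : ∀ {d c θ} x → (∀ s → ∣ d s ∣ ≤ c * pow θ s) → ∣ newton d x ∣ ≤ c * pow (1ℚ + θ) x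
  newton-bound zero h = h 0
  newton-bound {d} {c} {θ} (suc x) h = ≤-trans (∣+∣≤ (newton-bound {d} {c} {θ} x h)
     (newton-bound {d ∘ suc} {c * θ} {θ} x (λ s → ≤-trans (h (suc s)) (≤-reflexive (sym (*-assoc c θ (pow θ s)))))))
    (≤-reflexive (solve 3 (λ c t p → c :* p :+ (c :* t) :* p := c :* ((con 1ℚ :+ t) :* p)) refl c θ (pow (1ℚ + θ) x)))

  -- the Newton coefficients (finite differences at 0) of x ↦ bin x i · W^x, where W = 1 + η
  coeff : ℚ → ℚ → ℕ → ℕ → ℚ
  coeff W η zero    s       = pow η s
  coeff W η (suc i) zero    = 0ℚ
  coeff W η (suc i) (suc s) = W * coeff W η i s + η * coeff W η (suc i) s

  -- The difference of C(x,i+1) W^x in x is W C(x,i) W^x + η C(x,i+1) W^x, which is the recursion of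
  -- `coeff`.
  newton-coeff : ∀ {W η} → W ≡ 1ℚ + η → ∀ i x → newton (coeff W η i) x ≡ ν (bin x i) * pow W x
  newton-coeff {W} {η} e zero zero = sym (trans (*-identityʳ (ν 1)) (ι-lit 1))
  newton-coeff {W} {η} e zero (suc x) = trans
    (cong (newton (pow η) x +_) (newton-* η (pow η) x))
    (trans (solve 2 (λ n h → n :+ h :* n := (con 1ℚ :+ h) :* n) refl (newton (pow η) x) η)
      (trans (cong₂ _*_ (sym e) (newton-coeff e zero x))
        (solve 3 (λ w b p → w :* (b :* p) := b :* (w :* p)) refl W (ν 1) (pow W x))))
  newton-coeff {W} {η} e (suc i) zero = sym (trans (cong (_* 1ℚ) (ι-lit 0)) (*-zeroˡ 1ℚ))
  newton-coeff {W} {η} e (suc i) (suc x) = trans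
    (cong (newton (coeff W η (suc i)) x +_) (trans (newton-+ _ _ x) (cong₂ _+_ (newton-* W _ x) (newton-* η _ x))))
    (trans (solve 4 (λ n m w h → n :+ (w :* m :+ h :* n) := (con 1ℚ :+ h) :* n :+ w :* m) refl
        (newton (coeff W η (suc i)) x) (newton (coeff W η i) x) W η)
      (trans (cong₂ (λ a b → a + W * b) (cong₂ _*_ (sym e) (newton-coeff e (suc i) x)) (newton-coeff e i x))
        (trans (solve 4 (λ w b c p → w :* (c :* p) :+ w :* (b :* p) := (b :+ c) :* (w :* p)) refl W (ν (bin x i)) (ν (bin x (suc i))) (pow W x))
          (cong (_* (W * pow W x)) (sym (ν-+ (bin x i) (bin x (suc i))))))))

  module _ {W η η̄ : ℚ} (∣W∣≤2 : ∣ W ∣ ≤ 2ℚ) (∣η∣≤ : ∣ η ∣ ≤ η̄) where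

    private
      0≤η̄ : 0ℚ ≤ η̄
      0≤η̄ = ≤-trans (0≤∣p∣ η) ∣η∣≤

    -- In closed form the coefficient is C(s,i) W^i η^(s-i), and C(s,i) ≤ 2^s. The factor η̄^i on
    -- the left replaces a division.
    coeff-bound : ∀ i s → ∣ coeff W η i s ∣ * pow η̄ i ≤ two i * pow (2ℚ * η̄) s
    coeff-bound zero s = ≤-trans (≤-reflexive (trans (*-identityʳ ∣ pow η s ∣) (∣pow∣ η s)))
      (≤-trans (pow-mono s (0≤∣p∣ η) (≤-trans ∣η∣≤ (≤-trans (≤-reflexive (sym (*-identityˡ η̄))) (*-monoʳ η̄ 0≤η̄ 1≤2))))
        (≤-reflexive (sym (*-identityˡ (pow (2ℚ * η̄) s)))))
    coeff-bound (suc i) zero = ≤-trans (≤-reflexive (*-zeroˡ (η̄ * pow η̄ i))) (0≤* (0≤two (suc i)) 0≤1)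
    coeff-bound (suc i) (suc s) = ≤-trans
      (*-monoʳ (η̄ * pow η̄ i) (0≤* 0≤η̄ (0≤pow i 0≤η̄)) (∣+∣≤ (∣*∣≤ ∣W∣≤2 ≤-refl) (∣*∣≤ ∣η∣≤ ≤-refl)))
      (≤-trans (≤-reflexive (solve 4 (λ h a b p → (con 2ℚ :* a :+ h :* b) :* (h :* p) := (con 2ℚ :* h) :* (a :* p) :+ h :* (b :* (h :* p))) refl
           η̄ ∣ coeff W η i s ∣ ∣ coeff W η (suc i) s ∣ (pow η̄ i)))
        (≤-trans (+-mono-≤ (*-monoˡ (2ℚ * η̄) (0≤* 0≤2 0≤η̄) (coeff-bound i s)) (*-monoˡ η̄ 0≤η̄ (coeff-bound (suc i) s)))
          (≤-reflexive (solve 3 (λ h t p → (con 2ℚ :* h) :* (t :* p) :+ h :* ((con 2ℚ :* t) :* p) := (con 2ℚ :* t) :* ((con 2ℚ :* h) :* p)) refl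
            η̄ (two i) (pow (2ℚ * η̄) s)))))

    coeff≤4^ : η̄ ≤ 2ℚ → ∀ i s → ∣ coeff W η i s ∣ ≤ pow 4ℚ s
    coeff≤4^ h zero s = ≤-trans (≤-reflexive (∣pow∣ η s))
      (pow-mono s (0≤∣p∣ η) (≤-trans ∣η∣≤ (≤-trans h (from-yes (2ℚ ≤? 4ℚ)))))
    coeff≤4^ h (suc i) zero = 0≤1
    coeff≤4^ h (suc i) (suc s) = ≤-trans
      (∣+∣≤ (∣*∣≤ ∣W∣≤2 (coeff≤4^ h i s)) (∣*∣≤ (≤-trans ∣η∣≤ h) (coeff≤4^ h (suc i) s)))
      (≤-reflexive (solve 1 (λ p → con 2ℚ :* p :+ con 2ℚ :* p := con 4ℚ :* p) refl (pow 4ℚ s)))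

-- Siegel's lemma and Dirichlet's approximation theorem

module Pigeonhole where

  open import Data.Nat as ℕ using (ℕ; zero; suc; NonZero)
  import Data.Nat.Properties as ℕ
  open import Data.Nat.DivMod using (_/_; _%_; m≡m%n+[m/n]*n; m%n<n; m<n*o⇒m/o<n; /-monoˡ-≤)
  open import Data.Nat.Tactic.RingSolver using (solve-∀)
  open import Data.Integer as ℤ using (ℤ; +_; -[1+_]; ∣_∣)
  import Data.Integer.Properties as ℤ
  import Data.Integer.Tactic.RingSolver as ℤR
  open import Data.Fin as Fin using (Fin; toℕ; fromℕ<; finToFun; funToFin)
  import Data.Fin.Properties as Fin
  open import Data.Product using (_×_; _,_; ∃; ∃₂; proj₁; proj₂)
  open import Function using (_∘_)
  open import Relation.Binary.PropositionalEquality hiding ([_])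
  open import Relation.Nullary using (¬_; contradiction; yes; no)

  sumℤ : ℕ → (ℕ → ℤ) → ℤ
  sumℤ zero    f = + 0
  sumℤ (suc n) f = sumℤ n f ℤ.+ f n

  sumℤ-cong : ∀ n {f g} → (∀ i → i ℕ.< n → f i ≡ g i) → sumℤ n f ≡ sumℤ n g
  sumℤ-cong zero    h = refl
  sumℤ-cong (suc n) h = cong₂ ℤ._+_ (sumℤ-cong n (λ i p → h i (ℕ.m<n⇒m<1+n p))) (h n ℕ.≤-refl)

  sumℤ-bound : ∀ n {f b} → (∀ i → i ℕ.< n → ∣ f i ∣ ℕ.≤ b) → ∣ sumℤ n f ∣ ℕ.≤ n ℕ.* b
  sumℤ-bound zero    h = ℕ.z≤n
  sumℤ-bound (suc n) {f} {b} h = ℕ.≤-trans (ℤ.∣i+j∣≤∣i∣+∣j∣ (sumℤ n f) (f n))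
    (ℕ.≤-trans (ℕ.+-mono-≤ (sumℤ-bound n (λ i p → h i (ℕ.m<n⇒m<1+n p))) (h n ℕ.≤-refl)) (ℕ.≤-reflexive (ℕ.+-comm (n ℕ.* b) b)))

  sumℤ-sub : ∀ n f g → sumℤ n (λ i → f i ℤ.- g i) ≡ sumℤ n f ℤ.- sumℤ n g
  sumℤ-sub zero    f g = refl
  sumℤ-sub (suc n) f g = trans (cong (ℤ._+ (f n ℤ.- g n)) (sumℤ-sub n f g)) (eq (sumℤ n f) (sumℤ n g) (f n) (g n))
    where
    eq : ∀ a b c d → (a ℤ.- b) ℤ.+ (c ℤ.- d) ≡ (a ℤ.+ c) ℤ.- (b ℤ.+ d)
    eq = ℤR.solve-∀

  sumℤ-++ : ∀ m n f → sumℤ (n ℕ.+ m) f ≡ sumℤ m f ℤ.+ sumℤ n (λ i → f (i ℕ.+ m))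
  sumℤ-++ m zero    f = sym (ℤ.+-identityʳ (sumℤ m f))
  sumℤ-++ m (suc n) f = trans (cong (ℤ._+ f (n ℕ.+ m)) (sumℤ-++ m n f)) (ℤ.+-assoc (sumℤ m f) _ _)

  sumℤ-flatten : ∀ m n f → sumℤ (m ℕ.* n) f ≡ sumℤ m (λ j → sumℤ n (λ i → f (i ℕ.+ j ℕ.* n)))
  sumℤ-flatten zero    n f = refl
  sumℤ-flatten (suc m) n f = trans (sumℤ-++ (m ℕ.* n) n f)
    (cong (ℤ._+ sumℤ n (λ i → f (i ℕ.+ m ℕ.* n))) (sumℤ-flatten m n f))

  private
    code : ℕ → ℤ → ℕ
    code K (+ n)    = K ℕ.+ n
    code K -[1+ n ] = K ℕ.∸ suc n

    code-eq : ∀ K z → ∣ z ∣ ℕ.≤ K → + code K z ≡ + K ℤ.+ z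
    code-eq K (+ n)    p = refl
    code-eq K -[1+ n ] p = sym (ℤ.⊖-≥ p)

    code< : ∀ K z → ∣ z ∣ ℕ.≤ K → code K z ℕ.< suc (K ℕ.+ K)
    code< K (+ n)    p = ℕ.s≤s (ℕ.+-monoʳ-≤ K p)
    code< K -[1+ n ] p = ℕ.s≤s (ℕ.≤-trans (ℕ.m∸n≤m K (suc n)) (ℕ.m≤m+n K K))

    code-inj : ∀ K z w → ∣ z ∣ ℕ.≤ K → ∣ w ∣ ℕ.≤ K → code K z ≡ code K w → z ≡ w
    code-inj K z w p q e = trans (eq z (+ K)) (trans (cong (ℤ._- + K)
        (trans (sym (code-eq K z p)) (trans (cong +_ e) (code-eq K w q)))) (sym (eq w (+ K))))
      where
      eq : ∀ a b → a ≡ (b ℤ.+ a) ℤ.- b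
      eq = ℤR.solve-∀

    digit : ∀ C N → Fin (suc C ℕ.^ N) → ℕ → ℤ
    digit C N k x with x ℕ.<? N
    ... | yes p = + toℕ (finToFun {suc C} {N} k (fromℕ< p))
    -- Digits outside the range are 0, which makes the bound C on the solution hold for every
    -- argument.
    ... | no  _ = + 0

    digit-toℕ : ∀ C N k (x : Fin N) → digit C N k (toℕ x) ≡ + toℕ (finToFun {suc C} {N} k x)
    digit-toℕ C N k x with toℕ x ℕ.<? N
    ... | yes p = cong (λ y → + toℕ (finToFun {suc C} {N} k y)) (Fin.fromℕ<-toℕ x p)
    ... | no ¬p = contradiction (Fin.toℕ<n x) ¬p

    digit-ℕ : ∀ C N k x → ∃ λ d → d ℕ.≤ C × digit C N k x ≡ + d
    digit-ℕ C N k x with x ℕ.<? N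
    ... | yes p = _ , ℕ.s≤s⁻¹ (Fin.toℕ<n (finToFun {suc C} {N} k (fromℕ< p))) , refl
    ... | no  _ = 0 , ℕ.z≤n , refl

    digit≤ : ∀ C N k x → ∣ digit C N k x ∣ ℕ.≤ C
    digit≤ C N k x with digit-ℕ C N k x
    ... | d , p , e = subst (λ z → ∣ z ∣ ℕ.≤ C) (sym e) p

    funToFin-cong : ∀ {m n} {f g : Fin m → Fin n} → (∀ x → f x ≡ g x) → funToFin f ≡ funToFin g
    funToFin-cong {zero}  h = refl
    funToFin-cong {suc m} h = cong₂ Fin.combine (h Fin.zero) (funToFin-cong (h ∘ Fin.suc))

  -- On the (C + 1)^N vectors with entries 0, ..., C each of the M forms takes at most 2 N A C + 1
  -- values. Two vectors therefore agree on all forms, and their difference has entries of absolute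
  -- value at most C.
  siegel : ∀ M N A C (θ : ℕ → ℕ → ℤ) → (∀ s x → s ℕ.< M → x ℕ.< N → ∣ θ s x ∣ ℕ.≤ A) →
    suc (N ℕ.* (A ℕ.* C) ℕ.+ N ℕ.* (A ℕ.* C)) ℕ.^ M ℕ.< suc C ℕ.^ N →
    ∃ λ (c : ℕ → ℤ) → (∃ λ x → x ℕ.< N × c x ≢ + 0) × (∀ x → ∣ c x ∣ ℕ.≤ C) ×
      (∀ s → s ℕ.< M → sumℤ N (λ x → θ s x ℤ.* c x) ≡ + 0)
  siegel M N A C θ hθ count = result
    where
    K = N ℕ.* (A ℕ.* C)
    value : Fin (suc C ℕ.^ N) → ℕ → ℤ
    value k s = sumℤ N (λ x → θ s x ℤ.* digit C N k x)
    value≤ : ∀ k s → s ℕ.< M → ∣ value k s ∣ ℕ.≤ K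
    value≤ k s p = sumℤ-bound N (λ x q → subst (ℕ._≤ A ℕ.* C) (sym (ℤ.abs-* (θ s x) (digit C N k x)))
      (ℕ.*-mono-≤ (hθ s x p q) (digit≤ C N k x)))
    values : Fin (suc C ℕ.^ N) → Fin M → Fin (suc (K ℕ.+ K))
    values k s = fromℕ< (code< K (value k (toℕ s)) (value≤ k (toℕ s) (Fin.toℕ<n s)))
    ph = Fin.pigeonhole count (λ k → funToFin (values k))
    k₁ = proj₁ ph
    k₂ = proj₁ (proj₂ ph)
    c : ℕ → ℤ
    c x = digit C N k₁ x ℤ.- digit C N k₂ x
    values-same : ∀ s → values k₁ s ≡ values k₂ s
    values-same s = trans (sym (Fin.finToFun-funToFin (values k₁) s))
      (trans (cong (λ k → finToFun k s) (proj₂ (proj₂ (proj₂ ph)))) (Fin.finToFun-funToFin (values k₂) s))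
    same : ∀ s → s ℕ.< M → value k₁ s ≡ value k₂ s
    same s p = code-inj K _ _ (value≤ k₁ s p) (value≤ k₂ s p)
      (trans (sym (Fin.toℕ-fromℕ< (code< K (value k₁ s) (value≤ k₁ s p))))
        (trans same-code (Fin.toℕ-fromℕ< (code< K (value k₂ s) (value≤ k₂ s p)))))
      where
      same-code : toℕ (fromℕ< (code< K (value k₁ s) (value≤ k₁ s p))) ≡ toℕ (fromℕ< (code< K (value k₂ s) (value≤ k₂ s p)))
      same-code = go (toℕ (fromℕ< p)) (Fin.toℕ-fromℕ< p) (Fin.toℕ<n (fromℕ< p)) (cong toℕ (values-same (fromℕ< p)))
        where
        go : ∀ t → t ≡ s → (q : t ℕ.< M) →
          toℕ (fromℕ< (code< K (value k₁ t) (value≤ k₁ t q))) ≡ toℕ (fromℕ< (code< K (value k₂ t) (value≤ k₂ t q))) →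
          toℕ (fromℕ< (code< K (value k₁ s) (value≤ k₁ s p))) ≡ toℕ (fromℕ< (code< K (value k₂ s) (value≤ k₂ s p)))
        go t refl q e = trans (Fin.toℕ-fromℕ< _) (trans (trans (sym (Fin.toℕ-fromℕ< _)) (trans e (Fin.toℕ-fromℕ< _))) (sym (Fin.toℕ-fromℕ< _)))
    kernel : ∀ s → s ℕ.< M → sumℤ N (λ x → θ s x ℤ.* c x) ≡ + 0
    kernel s p = trans (sumℤ-cong N (λ x _ → eq (θ s x) (digit C N k₁ x) (digit C N k₂ x)))
      (trans (sumℤ-sub N _ _) (ℤ.i≡j⇒i-j≡0 (same s p)))
      where
      eq : ∀ a b c → a ℤ.* (b ℤ.- c) ≡ a ℤ.* b ℤ.- a ℤ.* c
      eq = ℤR.solve-∀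
    c≤ : ∀ x → ∣ c x ∣ ℕ.≤ C
    c≤ x with digit-ℕ C N k₁ x | digit-ℕ C N k₂ x
    ... | d , p , e | d′ , p′ , e′ rewrite e | e′ | ℤ.[+m]-[+n]≡m⊖n d d′ =
      ℕ.≤-trans (ℤ.∣m⊝n∣≤m⊔n d d′) (ℕ.⊔-lub p p′)
    differ : ¬ (∀ x → finToFun {suc C} {N} k₁ x ≡ finToFun {suc C} {N} k₂ x)
    differ h = Fin.<⇒≢ (proj₁ (proj₂ (proj₂ ph))) (trans (sym (Fin.funToFin-finToFin {N} k₁))
      (trans (funToFin-cong h) (Fin.funToFin-finToFin {N} k₂)))
    nonzero : ∃ λ x → x ℕ.< N × c x ≢ + 0
    nonzero with Fin.¬∀⟶∃¬ N _ (λ x → finToFun {suc C} {N} k₁ x Fin.≟ finToFun {suc C} {N} k₂ x) differ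
    ... | x , ne = toℕ x , Fin.toℕ<n x , λ e → ne (Fin.toℕ-injective (ℤ.+-injective
      (trans (sym (digit-toℕ C N k₁ x)) (trans (ℤ.i-j≡0⇒i≡j _ _ e) (digit-toℕ C N k₂ x)))))
    result = c , nonzero , c≤ , kernel

  -- Two of the Q + 1 fractional parts of i k / n, 0 ≤ i ≤ Q, share an interval of length 1/Q. The
  -- result is |a k / n - b| ≤ 1/Q with denominators cleared.
  dirichlet : ∀ n k Q → .{{_ : NonZero n}} → .{{_ : NonZero Q}} →
    ∃₂ λ a b → (1 ℕ.≤ a × a ℕ.≤ Q) × (a ℕ.* k ℕ.* Q ℕ.≤ b ℕ.* n ℕ.* Q ℕ.+ n × b ℕ.* n ℕ.* Q ℕ.≤ a ℕ.* k ℕ.* Q ℕ.+ n)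
  dirichlet n k Q with Fin.pigeonhole (ℕ.n<1+n Q) box
    where
    box : Fin (suc Q) → Fin Q
    box i = fromℕ< (m<n*o⇒m/o<n (subst (((toℕ i ℕ.* k) % n) ℕ.* Q ℕ.<_) (ℕ.*-comm n Q) (ℕ.*-monoˡ-< Q (m%n<n (toℕ i ℕ.* k) n))))
  ... | i , j , i<j , same = a , b , (ℕ.m<n⇒0<n∸m i<j , ℕ.≤-trans (ℕ.m∸n≤m (toℕ j) (toℕ i)) (ℕ.s≤s⁻¹ (Fin.toℕ<n j))) ,
      (upper , lower)
    where
    q = toℕ i
    p = toℕ j
    a = p ℕ.∸ q
    b = (p ℕ.* k) / n ℕ.∸ (q ℕ.* k) / n
    X = (p ℕ.* k) % n
    Y = (q ℕ.* k) % n
    same′ : (Y ℕ.* Q) / n ≡ (X ℕ.* Q) / n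
    same′ = trans (sym (Fin.toℕ-fromℕ< _)) (trans (cong toℕ same) (Fin.toℕ-fromℕ< _))
    close : ∀ u v → u / n ≡ v / n → u ℕ.≤ v ℕ.+ n
    close u v e = subst (ℕ._≤ v ℕ.+ n) (sym (m≡m%n+[m/n]*n u n))
      (ℕ.≤-trans (ℕ.+-mono-≤ (ℕ.<⇒≤ (m%n<n u n)) (ℕ.≤-trans (ℕ.*-monoˡ-≤ n (ℕ.≤-reflexive e))
        (ℕ.≤-trans (ℕ.m≤n+m (v / n ℕ.* n) (v % n)) (ℕ.≤-reflexive (sym (m≡m%n+[m/n]*n v n))))))
        (ℕ.≤-reflexive (ℕ.+-comm n v)))
    main : a ℕ.* k ℕ.+ Y ≡ X ℕ.+ b ℕ.* n
    main = ℕ.+-cancelʳ-≡ ((q ℕ.* k) / n ℕ.* n) _ _ (begin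
      a ℕ.* k ℕ.+ Y ℕ.+ (q ℕ.* k) / n ℕ.* n   ≡⟨ ℕ.+-assoc (a ℕ.* k) Y _ ⟩
      a ℕ.* k ℕ.+ (Y ℕ.+ (q ℕ.* k) / n ℕ.* n) ≡⟨ cong (a ℕ.* k ℕ.+_) (m≡m%n+[m/n]*n (q ℕ.* k) n) ⟨
      a ℕ.* k ℕ.+ q ℕ.* k                     ≡⟨ ℕ.*-distribʳ-+ k a q ⟨
      (a ℕ.+ q) ℕ.* k                         ≡⟨ cong (ℕ._* k) (ℕ.m∸n+n≡m (ℕ.<⇒≤ i<j)) ⟩
      p ℕ.* k                                 ≡⟨ m≡m%n+[m/n]*n (p ℕ.* k) n ⟩
      X ℕ.+ (p ℕ.* k) / n ℕ.* n               ≡⟨ cong (λ z → X ℕ.+ z ℕ.* n) (ℕ.m∸n+n≡m (/-monoˡ-≤ n (ℕ.*-monoˡ-≤ k (ℕ.<⇒≤ i<j)))) ⟨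
      X ℕ.+ (b ℕ.+ (q ℕ.* k) / n) ℕ.* n       ≡⟨ cong (X ℕ.+_) (ℕ.*-distribʳ-+ n b _) ⟩
      X ℕ.+ (b ℕ.* n ℕ.+ (q ℕ.* k) / n ℕ.* n) ≡⟨ ℕ.+-assoc X (b ℕ.* n) _ ⟨
      X ℕ.+ b ℕ.* n ℕ.+ (q ℕ.* k) / n ℕ.* n   ∎)
      where open ≡-Reasoning
    mainQ : a ℕ.* k ℕ.* Q ℕ.+ Y ℕ.* Q ≡ X ℕ.* Q ℕ.+ b ℕ.* n ℕ.* Q
    mainQ = trans (sym (ℕ.*-distribʳ-+ Q (a ℕ.* k) Y)) (trans (cong (ℕ._* Q) main) (ℕ.*-distribʳ-+ Q X (b ℕ.* n)))
    upper : a ℕ.* k ℕ.* Q ℕ.≤ b ℕ.* n ℕ.* Q ℕ.+ n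
    upper = ℕ.+-cancelʳ-≤ (Y ℕ.* Q) _ _ (ℕ.≤-trans (ℕ.≤-reflexive mainQ)
      (ℕ.≤-trans (ℕ.+-monoˡ-≤ (b ℕ.* n ℕ.* Q) (close _ _ (sym same′))) (ℕ.≤-reflexive (eq (Y ℕ.* Q) n (b ℕ.* n ℕ.* Q)))))
      where
      eq : ∀ y n b → y ℕ.+ n ℕ.+ b ≡ b ℕ.+ n ℕ.+ y
      eq = solve-∀
    lower : b ℕ.* n ℕ.* Q ℕ.≤ a ℕ.* k ℕ.* Q ℕ.+ n
    lower = ℕ.+-cancelˡ-≤ (X ℕ.* Q) _ _ (ℕ.≤-trans (ℕ.≤-reflexive (sym mainQ))
      (ℕ.≤-trans (ℕ.+-monoʳ-≤ (a ℕ.* k ℕ.* Q) (close _ _ same′)) (ℕ.≤-reflexive (eq (a ℕ.* k ℕ.* Q) (X ℕ.* Q) n))))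
      where
      eq : ∀ a x n → a ℕ.+ (x ℕ.+ n) ≡ x ℕ.+ (a ℕ.+ n)
      eq = solve-∀

-- Integer polynomial functions and p-adic interpolation

module IntegerPolynomials where

  open import Data.Nat as ℕ using (ℕ; zero; suc)
  import Data.Nat.Properties as ℕ
  open import Data.Integer as ℤ using (ℤ; +_; _+_; _*_; _-_)
  import Data.Integer.Properties as ℤ
  open import Data.Integer.Divisibility.Signed using (_∣_; divides; ∣m∣n⇒∣m+n; ∣m⇒∣m*n; ∣n⇒∣m*n; *-monoˡ-∣; *-monoʳ-∣; ∣-refl; ∣-trans)
  open import Data.Integer.Tactic.RingSolver using (solve-∀)
  open import Data.List using (List; []; _∷_; length)
  open import Data.List.Relation.Unary.All as All using (All; []; _∷_)
  open import Data.List.Relation.Unary.Any using (here; there)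
  open import Data.List.Relation.Unary.AllPairs using (AllPairs; []; _∷_)
  open import Data.List.Membership.Propositional using (_∈_)
  open import Data.Product using (_×_; _,_; ∃; proj₁; proj₂)
  open import Relation.Binary.PropositionalEquality hiding ([_])

  -- integer polynomial functions of degree < d, characterised by divisibility of f y - f x by y - x
  Poly : ℕ → (ℕ → ℤ) → Set
  Poly zero    f = ∀ y → f y ≡ + 0
  Poly (suc d) f = ∀ x → ∃ λ g → Poly d g × (∀ y → f y ≡ f x + (+ y - + x) * g y)

  poly-cong : ∀ d {f g} → (∀ y → f y ≡ g y) → Poly d f → Poly d g
  poly-cong zero    h p y = trans (sym (h y)) (p y)
  poly-cong (suc d) h p x with p x
  ... | q , qp , e = q , qp , λ y → trans (sym (h y)) (trans (e y) (cong (_+ (+ y - + x) * q y) (h x)))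

  poly-0 : ∀ d → Poly d (λ _ → + 0)
  poly-0 zero    y = refl
  poly-0 (suc d) x = (λ _ → + 0) , poly-0 d , λ y → sym (trans (ℤ.+-identityˡ _) (ℤ.*-zeroʳ (+ y - + x)))

  poly-+ : ∀ d {f g} → Poly d f → Poly d g → Poly d (λ y → f y + g y)
  poly-+ zero    p q y = cong₂ _+_ (p y) (q y)
  poly-+ (suc d) {f} {g} p q x with p x | q x
  ... | a , ap , ae | b , bp , be = (λ y → a y + b y) , poly-+ d ap bp ,
    λ y → trans (cong₂ _+_ (ae y) (be y)) (eq (f x) (g x) (+ y - + x) (a y) (b y))
    where
    eq : ∀ f g t a b → (f + t * a) + (g + t * b) ≡ (f + g) + t * (a + b)
    eq = solve-∀

  poly-scale : ∀ d c {f} → Poly d f → Poly d (λ y → c * f y)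
  poly-scale zero    c p y = trans (cong (c *_) (p y)) (ℤ.*-zeroʳ c)
  poly-scale (suc d) c {f} p x with p x
  ... | a , ap , ae = (λ y → c * a y) , poly-scale d c ap ,
    λ y → trans (cong (c *_) (ae y)) (eq c (f x) (+ y - + x) (a y))
    where
    eq : ∀ c f t a → c * (f + t * a) ≡ c * f + t * (c * a)
    eq = solve-∀

  poly-suc : ∀ d {f} → Poly d f → Poly (suc d) f
  poly-suc zero    p x = (λ _ → + 0) , (λ _ → refl) , λ y → trans (p y)
    (sym (trans (cong₂ _+_ (p x) (ℤ.*-zeroʳ (+ y - + x))) refl))
  poly-suc (suc d) p x with p x
  ... | a , ap , ae = a , poly-suc d ap , ae

  poly-mono : ∀ k d {f} → Poly d f → Poly (k ℕ.+ d) f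
  poly-mono zero    d p = p
  poly-mono (suc k) d p = poly-suc (k ℕ.+ d) (poly-mono k d p)

  poly-lin : ∀ d c {f} → Poly d f → Poly (suc d) (λ y → (+ y - c) * f y)
  poly-lin zero c {f} p = poly-cong 1 (λ y → sym (trans (cong ((+ y - c) *_) (p y)) (ℤ.*-zeroʳ (+ y - c)))) (poly-0 1)
  poly-lin (suc d) c {f} p x with p x
  ... | a , ap , ae = (λ y → f y + (+ x - c) * a y) ,
    poly-+ (suc d) p (poly-scale (suc d) (+ x - c) (poly-suc d ap)) ,
    λ y → trans (eq (+ y) (+ x) c (f y)) (trans (cong (λ z → (+ x - c) * z + (+ y - + x) * f y) (ae y))
      (trans (eq₂ (+ x - c) (f x) (+ y - + x) (a y) (f y)) refl))
    where
    eq : ∀ y x c f → (y - c) * f ≡ (x - c) * f + (y - x) * f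
    eq = solve-∀
    eq₂ : ∀ u f t a g → u * (f + t * a) + t * g ≡ u * f + t * (g + u * a)
    eq₂ = solve-∀

  nodal : List ℕ → ℕ → ℤ
  nodal []       y = + 1
  nodal (x ∷ xs) y = (+ y - + x) * nodal xs y

  poly-1 : Poly 1 (λ _ → + 1)
  poly-1 x = (λ _ → + 0) , (λ _ → refl) , λ y → sym (trans (cong (λ z → + 1 + z) (ℤ.*-zeroʳ (+ y - + x))) refl)

  nodal-poly : ∀ xs → Poly (suc (length xs)) (nodal xs)
  nodal-poly []       = poly-1
  nodal-poly (x ∷ xs) = poly-lin (suc (length xs)) (+ x) (nodal-poly xs)

  nodal-zero : ∀ {x} xs → x ∈ xs → nodal xs x ≡ + 0
  nodal-zero {x} (x ∷ xs) (here refl) = trans (cong (_* nodal xs x) (ℤ.+-inverseʳ (+ x))) (ℤ.*-zeroˡ (nodal xs x))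
  nodal-zero {x} (z ∷ xs) (there p)   = trans (cong ((+ x - + z) *_) (nodal-zero xs p)) (ℤ.*-zeroʳ (+ x - + z))

  -- `v x y` plays the role of the p-adic exponent of x - y; summed in `total` it becomes the
  -- exponent of a Lagrange denominator.
  module Interpolation (p : ℕ) (v : ℕ → ℕ → ℕ) (v-refl : ∀ x → v x x ≡ 0)
    (v-divides : ∀ x y → x ≢ y → + (p ℕ.^ v x y) ∣ (+ x - + y))
    (v-cancel : ∀ x y → x ≢ y → ∀ s z → + (p ℕ.^ (s ℕ.+ v x y)) ∣ (+ x - + y) * z → + (p ℕ.^ s) ∣ z) where

    total : List ℕ → ℕ → ℕ
    total []       x = 0
    total (y ∷ ys) x = v x y ℕ.+ total ys x

    private
      p^+ : ∀ a b → + (p ℕ.^ (a ℕ.+ b)) ≡ + (p ℕ.^ a) * + (p ℕ.^ b)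
      p^+ a b = trans (cong +_ (ℕ.^-distribˡ-+-* p a b)) (ℤ.pos-* (p ℕ.^ a) (p ℕ.^ b))

      ∣-* : ∀ a b {x y} → + (p ℕ.^ a) ∣ x → + (p ℕ.^ b) ∣ y → + (p ℕ.^ (a ℕ.+ b)) ∣ x * y
      ∣-* a b {x} {y} h k = subst (_∣ x * y) (sym (p^+ a b)) (∣-trans (*-monoˡ-∣ (+ (p ℕ.^ b)) h) (*-monoʳ-∣ x k))

    nodal-divides : ∀ x ys → All (x ≢_) ys → + (p ℕ.^ total ys x) ∣ nodal ys x
    nodal-divides x []       []       = ∣-refl
    nodal-divides x (y ∷ ys) (h ∷ hs) = ∣-* (v x y) (total ys x) (v-divides x y h) (nodal-divides x ys hs)

    nodal-cancel : ∀ x ys → All (x ≢_) ys → ∀ s z → + (p ℕ.^ (s ℕ.+ total ys x)) ∣ nodal ys x * z → + (p ℕ.^ s) ∣ z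
    nodal-cancel x []       []       s z d = subst₂ (λ e w → + (p ℕ.^ e) ∣ w) (ℕ.+-identityʳ s) (ℤ.*-identityˡ z) d
    nodal-cancel x (y ∷ ys) (h ∷ hs) s z d = nodal-cancel x ys hs s z
      (v-cancel x y h (s ℕ.+ total ys x) (nodal ys x * z)
        (subst₂ (λ e w → + (p ℕ.^ e) ∣ w)
          (trans (cong (s ℕ.+_) (ℕ.+-comm (v x y) (total ys x))) (sym (ℕ.+-assoc s (total ys x) (v x y))))
          (ℤ.*-assoc (+ x - + y) (nodal ys x) z) d))

    -- Lagrange interpolation, one node at a time: after subtracting the contribution of
    -- the first node x, the rest is divisible by y - x with a quotient of smaller degree
    interpolate : ∀ xs f → AllPairs _≢_ xs → Poly (length xs) f → ∀ s →
      All (λ x → + (p ℕ.^ (s ℕ.+ total xs x)) ∣ f x) xs → ∀ y → + (p ℕ.^ s) ∣ f y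
    interpolate [] f [] P s [] y = subst (+ (p ℕ.^ s) ∣_) (sym (P y)) (divides (+ 0) refl)
    interpolate (x ∷ xs) f (ne ∷ nes) P s (h ∷ hs) y = nodal-cancel x xs ne s (f y)
      (subst (+ (p ℕ.^ (s ℕ.+ w)) ∣_) (sym (split y))
        (∣m∣n⇒∣m+n (∣m⇒∣m*n (nodal xs y) fx) (∣n⇒∣m*n (+ y - + x) (IH y))))
      where
      w = total xs x
      W = nodal xs x
      -- Instead of dividing the Lagrange basis polynomial by its denominator W, f is multiplied by
      -- W; then f₁ vanishes at x.
      f₁ : ℕ → ℤ
      f₁ y = W * f y + (ℤ.- f x) * nodal xs y
      f₁-poly : Poly (suc (length xs)) f₁
      f₁-poly = poly-+ (suc (length xs)) {λ y → W * f y} {λ y → (ℤ.- f x) * nodal xs y}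
        (poly-scale (suc (length xs)) W {f} P) (poly-scale (suc (length xs)) (ℤ.- f x) {nodal xs} (nodal-poly xs))
      g = proj₁ (f₁-poly x)
      f₁x≡0 : f₁ x ≡ + 0
      f₁x≡0 = eq W (f x)
        where
        eq : ∀ W a → W * a + (ℤ.- a) * W ≡ + 0
        eq = solve-∀
      split : ∀ y → W * f y ≡ f x * nodal xs y + (+ y - + x) * g y
      split y = trans (eq (W * f y) (f x) (nodal xs y)) (cong (λ z → f x * nodal xs y + z)
        (trans (proj₂ (proj₂ (f₁-poly x)) y) (trans (cong (_+ (+ y - + x) * g y) f₁x≡0) (ℤ.+-identityˡ _))))
        where
        eq : ∀ a b n → a ≡ b * n + (a + (ℤ.- b) * n)
        eq = solve-∀
      fx : + (p ℕ.^ (s ℕ.+ w)) ∣ f x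
      fx = subst (λ e → + (p ℕ.^ (s ℕ.+ (e ℕ.+ w))) ∣ f x) (v-refl x) h
      -- At another node x′ the nodal polynomial vanishes, so W f x′ = (x′ - x) g x′. The factor W
      -- contributes w, and cancelling x′ - x uses up the summand v x′ x in the total of x′.
      g-divides : ∀ {x′} → x ≢ x′ → x′ ∈ xs → + (p ℕ.^ (s ℕ.+ total (x ∷ xs) x′)) ∣ f x′ →
        + (p ℕ.^ ((s ℕ.+ w) ℕ.+ total xs x′)) ∣ g x′
      g-divides {x′} n m d = v-cancel x′ x (λ e → n (sym e)) (s ℕ.+ w ℕ.+ total xs x′) (g x′)
        (subst₂ (λ e z → + (p ℕ.^ e) ∣ z) (exp w s (v x′ x) (total xs x′))
          (trans (split x′) (trans (cong (λ z → f x * z + (+ x′ - + x) * g x′) (nodal-zero xs m))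
            (trans (cong (_+ (+ x′ - + x) * g x′) (ℤ.*-zeroʳ (f x))) (ℤ.+-identityˡ _))))
          (∣-* w (s ℕ.+ total (x ∷ xs) x′) (nodal-divides x xs ne) d))
        where
        open import Data.Nat.Tactic.RingSolver renaming (solve-∀ to solveℕ)
        exp : ∀ w s a t → w ℕ.+ (s ℕ.+ (a ℕ.+ t)) ≡ s ℕ.+ w ℕ.+ t ℕ.+ a
        exp = solveℕ
      IH : ∀ y → + (p ℕ.^ (s ℕ.+ w)) ∣ g y
      IH = interpolate xs g nes (proj₁ (proj₂ (f₁-poly x))) (s ℕ.+ w)
        (All.tabulate (λ {x′} m → g-divides (All.lookup ne m) m (All.lookup hs m)))

-- Exponents of 5 along arithmetic grids

module FiveAdicValuation where

  open IntegerPolynomials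
  open import Data.Nat as ℕ using (ℕ; zero; suc; NonZero)
  import Data.Nat.Properties as ℕ
  open import Data.Nat.Divisibility as ℕ∣ using (_∣?_) renaming (_∣_ to _∣ℕ_)
  open import Data.Nat.DivMod using (_/_; _%_; m≡m%n+[m/n]*n; m%n<n; m<n*o⇒m/o<n; /-monoˡ-≤; m/n/o≡m/[n*o]; m/n*n≤m; m*n/n≡m)
  open import Data.Nat.Primality using (Prime; prime?; euclidsLemma)
  open import Data.Nat.Induction using (<-rec)
  open import Data.Nat.Tactic.RingSolver using (solve-∀)
  open import Data.Integer as ℤ using (ℤ; +_; _+_; _*_; _-_)
  import Data.Integer.Properties as ℤ
  open import Data.Integer.Divisibility.Signed using (_∣_; divides; ∣m⇒∣m*n; ∣m∣n⇒∣m-n; ∣ᵤ⇒∣; ∣⇒∣ᵤ; ∣-trans)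
  import Data.Integer.Tactic.RingSolver as ℤR
  open import Data.List using (List; []; _∷_; length)
  open import Data.List.Relation.Unary.All as All using (All; []; _∷_)
  open import Data.List.Relation.Unary.AllPairs using (AllPairs; []; _∷_)
  open import Data.Product using (_×_; _,_; ∃₂; proj₁; proj₂)
  open import Data.Sum using (inj₁; inj₂)
  open import Relation.Binary.PropositionalEquality hiding ([_])
  open import Relation.Nullary using (¬_; yes; no; contradiction)
  open import Relation.Nullary.Decidable using (from-yes)

  prime5 : Prime 5
  prime5 = from-yes (prime? 5)

  indicator : ℕ → ℕ → ℕ
  indicator d x with d ∣? x
  ... | yes _ = 1
  ... | no  _ = 0

  -- the exponent of 5 in x, truncated at h
  val : ℕ → ℕ → ℕ
  val zero    x = 0
  val (suc h) x = val h x ℕ.+ indicator (5 ℕ.^ suc h) x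

  private
    5^≢0 : ∀ h → NonZero (5 ℕ.^ h)
    5^≢0 h = ℕ.m^n≢0 5 h

  split5 : ∀ x → 0 ℕ.< x → ∃₂ λ e m → x ≡ 5 ℕ.^ e ℕ.* m × ¬ (5 ∣ℕ m)
  split5 = <-rec _ go
    where
    go : ∀ x → (∀ {y} → y ℕ.< x → 0 ℕ.< y → ∃₂ λ e m → y ≡ 5 ℕ.^ e ℕ.* m × ¬ (5 ∣ℕ m)) →
      0 ℕ.< x → ∃₂ λ e m → x ≡ 5 ℕ.^ e ℕ.* m × ¬ (5 ∣ℕ m)
    go x rec 0<x with 5 ∣? x
    ... | no ¬d = 0 , x , sym (ℕ.*-identityˡ x) , ¬d
    ... | yes (ℕ∣.divides zero refl) = contradiction 0<x (λ ())
    ... | yes (ℕ∣.divides q@(suc q′) refl) with rec (ℕ.m<m*n q 5 (ℕ.s≤s (ℕ.s≤s ℕ.z≤n))) (ℕ.s≤s ℕ.z≤n)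
    ... | e , m , eq , ¬d = suc e , m , trans (ℕ.*-comm q 5) (trans (cong (5 ℕ.*_) eq) (sym (ℕ.*-assoc 5 (5 ℕ.^ e) m))) , ¬d

  pow5-coprime : ∀ s {m} → ¬ (5 ∣ℕ m) → ∀ z → 5 ℕ.^ s ∣ℕ m ℕ.* z → 5 ℕ.^ s ∣ℕ z
  pow5-coprime zero    ¬d z d = ℕ∣.1∣ z
  pow5-coprime (suc s) {m} ¬d z d with euclidsLemma m z prime5 (ℕ∣.∣-trans (ℕ∣.m∣m*n (5 ℕ.^ s)) d)
  ... | inj₁ k = contradiction k ¬d
  ... | inj₂ (ℕ∣.divides q refl) = subst (5 ℕ.^ suc s ∣ℕ_) (ℕ.*-comm 5 q)
    (ℕ∣.*-monoʳ-∣ 5 (pow5-coprime s ¬d q (ℕ∣.*-cancelˡ-∣ 5 (subst (5 ℕ.^ suc s ∣ℕ_) (eq m q) d))))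
    where
    eq : ∀ m q → m ℕ.* (q ℕ.* 5) ≡ 5 ℕ.* (m ℕ.* q)
    eq = solve-∀

  indicator-yes : ∀ {d x} → d ∣ℕ x → indicator d x ≡ 1
  indicator-yes {d} {x} p with d ∣? x
  ... | yes _ = refl
  ... | no ¬p = contradiction p ¬p

  indicator-no : ∀ {d x} → ¬ (d ∣ℕ x) → indicator d x ≡ 0
  indicator-no {d} {x} p with d ∣? x
  ... | yes q = contradiction q p
  ... | no _  = refl

  val-exact : ∀ h {e m} → ¬ (5 ∣ℕ m) → e ℕ.≤ h → val h (5 ℕ.^ e ℕ.* m) ≡ e
  val-exact h {e} {m} ¬d = go h
    where
    low : ∀ i → i ℕ.≤ e → 5 ℕ.^ i ∣ℕ 5 ℕ.^ e ℕ.* m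
    low i p = ℕ∣.∣m⇒∣m*n m (subst (5 ℕ.^ i ∣ℕ_) (trans (sym (ℕ.^-distribˡ-+-* 5 i (e ℕ.∸ i))) (cong (5 ℕ.^_) (ℕ.m+[n∸m]≡n p))) (ℕ∣.m∣m*n (5 ℕ.^ (e ℕ.∸ i))))
    high : ∀ i → e ℕ.< i → ¬ (5 ℕ.^ i ∣ℕ 5 ℕ.^ e ℕ.* m)
    high i p d = ¬d (ℕ∣.*-cancelˡ-∣ (5 ℕ.^ e) {{5^≢0 e}}
      (subst (_∣ℕ 5 ℕ.^ e ℕ.* m) (ℕ.*-comm 5 (5 ℕ.^ e)) (ℕ∣.∣-trans (pow-∣ p) d)))
      where
      pow-∣ : ∀ {a b} → a ℕ.≤ b → 5 ℕ.^ a ∣ℕ 5 ℕ.^ b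
      pow-∣ {a} {b} q = subst (5 ℕ.^ a ∣ℕ_) (trans (sym (ℕ.^-distribˡ-+-* 5 a (b ℕ.∸ a))) (cong (5 ℕ.^_) (ℕ.m+[n∸m]≡n q))) (ℕ∣.m∣m*n (5 ℕ.^ (b ℕ.∸ a)))
    full : ∀ h → h ℕ.≤ e → val h (5 ℕ.^ e ℕ.* m) ≡ h
    full zero    p = refl
    full (suc h) p = trans (cong₂ ℕ._+_ (full h (ℕ.<⇒≤ p)) (indicator-yes (low (suc h) p))) (ℕ.+-comm h 1)
    go : ∀ h → e ℕ.≤ h → val h (5 ℕ.^ e ℕ.* m) ≡ e
    go zero p = sym (ℕ.n≤0⇒n≡0 p)
    go (suc h) p with e ℕ.≟ suc h
    ... | yes q = trans (full (suc h) (ℕ.≤-reflexive (sym q))) (sym q)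
    ... | no  q = trans (cong₂ ℕ._+_ (go h (ℕ.s≤s⁻¹ e<)) (indicator-no (high (suc h) e<))) (ℕ.+-identityʳ e)
      where
      e< : e ℕ.< suc h
      e< = ℕ.≤∧≢⇒< p q

  module _ {h x : ℕ} (0<x : 0 ℕ.< x) (x< : x ℕ.< 5 ℕ.^ h) where
    private
      e = proj₁ (split5 x 0<x)
      m = proj₁ (proj₂ (split5 x 0<x))
      x≡ = proj₁ (proj₂ (proj₂ (split5 x 0<x)))
      ¬d = proj₂ (proj₂ (proj₂ (split5 x 0<x)))
      m≢0 : m ≢ 0
      m≢0 q = ¬d (subst (5 ∣ℕ_) (sym q) (5 ℕ∣.∣0))
      e≤h : e ℕ.≤ h
      e≤h with e ℕ.≤? h
      ... | yes p = p
      ... | no  p = contradiction (ℕ.<-≤-trans x< (ℕ.≤-trans (ℕ.^-monoʳ-≤ 5 (ℕ.<⇒≤ (ℕ.≰⇒> p)))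
              (ℕ.≤-trans (ℕ.m≤m*n (5 ℕ.^ e) m {{ℕ.≢-nonZero m≢0}}) (ℕ.≤-reflexive (sym x≡))))) (ℕ.<-irrefl refl)
      val≡ : val h x ≡ e
      val≡ = trans (cong (val h) x≡) (val-exact h ¬d e≤h)

    val-divides : 5 ℕ.^ val h x ∣ℕ x
    val-divides = subst₂ (λ a b → 5 ℕ.^ a ∣ℕ b) (sym val≡) (sym x≡) (ℕ∣.m∣m*n m)

    val-cancel : ∀ s z → 5 ℕ.^ (s ℕ.+ val h x) ∣ℕ x ℕ.* z → 5 ℕ.^ s ∣ℕ z
    val-cancel s z d = pow5-coprime s ¬d z (ℕ∣.*-cancelˡ-∣ (5 ℕ.^ e) {{5^≢0 e}}
      (subst₂ _∣ℕ_ (trans (cong (λ a → 5 ℕ.^ (s ℕ.+ a)) val≡) (trans (ℕ.^-distribˡ-+-* 5 s e) (ℕ.*-comm (5 ℕ.^ s) (5 ℕ.^ e))))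
        (trans (cong (ℕ._* z) x≡) (ℕ.*-assoc (5 ℕ.^ e) m z)) d))

  sumℕ : ℕ → (ℕ → ℕ) → ℕ
  sumℕ zero    f = 0
  sumℕ (suc n) f = sumℕ n f ℕ.+ f n

  sumℕ-mono : ∀ n {f g} → (∀ i → f i ℕ.≤ g i) → sumℕ n f ℕ.≤ sumℕ n g
  sumℕ-mono zero    h = ℕ.z≤n
  sumℕ-mono (suc n) h = ℕ.+-mono-≤ (sumℕ-mono n h) (h n)

  sumℕ-+ : ∀ n f g → sumℕ n (λ i → f i ℕ.+ g i) ≡ sumℕ n f ℕ.+ sumℕ n g
  sumℕ-+ zero    f g = refl
  sumℕ-+ (suc n) f g = trans (cong (ℕ._+ (f n ℕ.+ g n)) (sumℕ-+ n f g)) (eq (sumℕ n f) (sumℕ n g) (f n) (g n))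
    where
    eq : ∀ a b c d → a ℕ.+ b ℕ.+ (c ℕ.+ d) ≡ a ℕ.+ c ℕ.+ (b ℕ.+ d)
    eq = solve-∀

  -- Each multiple of d raises the quotient by d, so the count telescopes to at most ⌊(U + c) / d⌋ -
  -- ⌊c / d⌋.
  count-multiples : ∀ d .{{_ : NonZero d}} c U → sumℕ U (λ u → indicator d (suc (u ℕ.+ c))) ℕ.≤ suc (U / d)
  count-multiples d c U = ℕ.+-cancelʳ-≤ (c / d) _ _ (ℕ.≤-trans (telescope U) (ℕ.s≤s⁻¹ (m<n*o⇒m/o<n (begin-strict
    U ℕ.+ c                                                ≡⟨ cong₂ ℕ._+_ (m≡m%n+[m/n]*n U d) (m≡m%n+[m/n]*n c d) ⟩
    U % d ℕ.+ U / d ℕ.* d ℕ.+ (c % d ℕ.+ c / d ℕ.* d)      <⟨ ℕ.+-mono-< (ℕ.+-monoˡ-< (U / d ℕ.* d) (m%n<n U d)) (ℕ.+-monoˡ-< (c / d ℕ.* d) (m%n<n c d)) ⟩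
    d ℕ.+ U / d ℕ.* d ℕ.+ (d ℕ.+ c / d ℕ.* d)              ≡⟨ eq d (U / d) (c / d) ⟩
    suc (suc (U / d) ℕ.+ c / d) ℕ.* d                      ∎))))
    where
    open ℕ.≤-Reasoning
    eq : ∀ d a b → d ℕ.+ a ℕ.* d ℕ.+ (d ℕ.+ b ℕ.* d) ≡ suc (suc a ℕ.+ b) ℕ.* d
    eq = solve-∀
    step : ∀ w → indicator d (suc w) ℕ.+ w / d ℕ.≤ suc w / d
    step w with d ∣? suc w
    ... | yes (ℕ∣.divides q e) = subst (w / d ℕ.<_) (sym (trans (cong (_/ d) e) (m*n/n≡m q d)))
          (m<n*o⇒m/o<n (ℕ.≤-reflexive e))
    ... | no _ = /-monoˡ-≤ d (ℕ.n≤1+n w)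
    telescope : ∀ U → sumℕ U (λ u → indicator d (suc (u ℕ.+ c))) ℕ.+ c / d ℕ.≤ (U ℕ.+ c) / d
    telescope zero    = ℕ.≤-refl
    telescope (suc U) = ℕ.≤-trans (ℕ.≤-reflexive (eq₂ (sumℕ U _) (indicator d (suc (U ℕ.+ c))) (c / d)))
      (ℕ.≤-trans (ℕ.+-monoʳ-≤ (indicator d (suc (U ℕ.+ c))) (telescope U)) (step (U ℕ.+ c)))
      where
      eq₂ : ∀ a b c → a ℕ.+ b ℕ.+ c ≡ b ℕ.+ (a ℕ.+ c)
      eq₂ = solve-∀

  val-stable : ∀ {h h′ x} → 0 ℕ.< x → x ℕ.< 5 ℕ.^ h → x ℕ.< 5 ℕ.^ h′ → val h x ≡ val h′ x
  val-stable {h} {h′} {x} 0<x p q with split5 x 0<x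
  ... | e , m , refl , ¬d = trans (val-exact h ¬d (e≤ h p)) (sym (val-exact h′ ¬d (e≤ h′ q)))
    where
    m≢0 : m ≢ 0
    m≢0 r = ¬d (subst (5 ∣ℕ_) (sym r) (5 ℕ∣.∣0))
    e≤ : ∀ h → 5 ℕ.^ e ℕ.* m ℕ.< 5 ℕ.^ h → e ℕ.≤ h
    e≤ h x< with e ℕ.≤? h
    ... | yes p = p
    ... | no  p = contradiction (ℕ.<-≤-trans x< (ℕ.≤-trans (ℕ.^-monoʳ-≤ 5 (ℕ.<⇒≤ (ℕ.≰⇒> p)))
            (ℕ.m≤m*n (5 ℕ.^ e) m {{ℕ.≢-nonZero m≢0}}))) (ℕ.<-irrefl refl)

  dist : ℕ → ℕ → ℕ
  dist x y = ℤ.∣ + x - + y ∣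

  n<5^n : ∀ n → n ℕ.< 5 ℕ.^ n
  n<5^n zero    = ℕ.s≤s ℕ.z≤n
  n<5^n (suc n) = ℕ.≤-trans (ℕ.+-mono-≤ (ℕ.m^n>0 5 n) (n<5^n n)) (ℕ.+-monoʳ-≤ (5 ℕ.^ n) (ℕ.m≤m+n (5 ℕ.^ n) _))

  0<dist : ∀ {x y} → x ≢ y → 0 ℕ.< dist x y
  0<dist {x} {y} ne = ℕ.n≢0⇒n>0 (λ e → ne (ℤ.+-injective (ℤ.i-j≡0⇒i≡j (+ x) (+ y) (ℤ.∣i∣≡0⇒i≡0 e))))

  dist< : ∀ {x y b} → x ℕ.< b → y ℕ.< b → dist x y ℕ.< b
  dist< {x} {y} p q = ℕ.≤-<-trans (subst (λ z → ℤ.∣ z ∣ ℕ.≤ x ℕ.⊔ y) (sym (ℤ.[+m]-[+n]≡m⊖n x y)) (ℤ.∣m⊝n∣≤m⊔n x y)) (ℕ.⊔-lub p q)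

  -- Truncating at the distance itself loses nothing, as n < 5^n. By `val-stable` every sufficient
  -- truncation gives the same exponent, so that `vdist≤val` can pass to a common h.
  vdist : ℕ → ℕ → ℕ
  vdist x y with x ℕ.≟ y
  ... | yes _ = 0
  ... | no  _ = val (dist x y) (dist x y)

  vdist-refl : ∀ x → vdist x x ≡ 0
  vdist-refl x with x ℕ.≟ x
  ... | yes _ = refl
  ... | no ne = contradiction refl ne

  vdist-divides : ∀ x y → x ≢ y → + (5 ℕ.^ vdist x y) ∣ (+ x - + y)
  vdist-divides x y ne with x ℕ.≟ y
  ... | yes e = contradiction e ne
  ... | no  _ = ∣ᵤ⇒∣ (val-divides {dist x y} (0<dist ne) (n<5^n (dist x y)))

  vdist-cancel : ∀ x y → x ≢ y → ∀ s z → + (5 ℕ.^ (s ℕ.+ vdist x y)) ∣ (+ x - + y) * z → + (5 ℕ.^ s) ∣ z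
  vdist-cancel x y ne s z d with x ℕ.≟ y
  ... | yes e = contradiction e ne
  ... | no  _ = ∣ᵤ⇒∣ (val-cancel {dist x y} (0<dist ne) (n<5^n (dist x y)) s ℤ.∣ z ∣
    (subst (5 ℕ.^ (s ℕ.+ val (dist x y) (dist x y)) ∣ℕ_) (ℤ.abs-* (+ x - + y) z) (∣⇒∣ᵤ d)))

  vdist≤val : ∀ h {x y} → x ℕ.< 5 ℕ.^ h → y ℕ.< 5 ℕ.^ h → vdist x y ℕ.≤ val h (dist x y)
  vdist≤val h {x} {y} p q with x ℕ.≟ y
  ... | yes _ = ℕ.z≤n
  ... | no ne = ℕ.≤-reflexive (val-stable {dist x y} {h} (0<dist ne) (n<5^n (dist x y)) (dist< p q))

  open Interpolation 5 vdist vdist-refl vdist-divides vdist-cancel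

  -- Adding D (x + 1) to B + u - x gives a positive number with the same divisibility by D, in the
  -- shape that `count-multiples` expects.
  shifted-indicator : ∀ D .{{_ : NonZero D}} x B u →
    indicator D (dist x (B ℕ.+ u)) ℕ.≤ indicator D (suc (u ℕ.+ (B ℕ.+ ℕ.pred D ℕ.* x ℕ.+ ℕ.pred D)))
  shifted-indicator D@(suc D′) x B u with D ∣? dist x (B ℕ.+ u)
  ... | no  _ = ℕ.z≤n
  ... | yes d = ℕ.≤-reflexive (sym (indicator-yes {D} (∣⇒∣ᵤ (subst (+ D ∣_) eq
          (∣m∣n⇒∣m-n (∣m⇒∣m*n (+ suc x) (divides (+ 1) (sym (ℤ.*-identityˡ (+ D))))) (∣ᵤ⇒∣ {+ D} {+ x - + (B ℕ.+ u)} d))))))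
    where
    eqℤ : ∀ d x b u → (+ 1 + d) * (+ 1 + x) - (x - (b + u)) ≡ + 1 + (u + (b + d * x + d))
    eqℤ = ℤR.solve-∀
    eq : + D * + suc x - (+ x - + (B ℕ.+ u)) ≡ + suc (u ℕ.+ (B ℕ.+ D′ ℕ.* x ℕ.+ D′))
    eq = trans (eqℤ (+ D′) (+ x) (+ B) (+ u)) (cong (λ z → + 1 + (+ u + (+ B + z + + D′))) (sym (ℤ.pos-* D′ x)))

  -- Legendre's count: of U consecutive numbers at most U / 5^i + 1 are multiples of 5^i, and the
  -- powers 1 / 5^i, i ≥ 1, sum to 1/4.
  val-run : ∀ h x B U → 4 ℕ.* sumℕ U (λ u → val h (dist x (B ℕ.+ u))) ℕ.≤ U ℕ.+ 4 ℕ.* h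
  val-run h x B U = ℕ.≤-trans (ℕ.m≤m+n _ _) (go h)
    where
    -- The extra summand ⌊U / 5^h⌋ carries the geometric series: the next level adds 4 (1 + ⌊U /
    -- 5^(h+1)⌋), and 5 ⌊U / 5^(h+1)⌋ ≤ ⌊U / 5^h⌋.
    go : ∀ h → 4 ℕ.* sumℕ U (λ u → val h (dist x (B ℕ.+ u))) ℕ.+ _/_ U (5 ℕ.^ h) {{5^≢0 h}} ℕ.≤ U ℕ.+ 4 ℕ.* h
    go zero = ℕ.≤-reflexive (trans (cong₂ (λ a b → 4 ℕ.* a ℕ.+ b) (sum0 U) (Data.Nat.DivMod.n/1≡n U)) (sym (ℕ.+-identityʳ U)))
      where
      import Data.Nat.DivMod
      sum0 : ∀ U → sumℕ U (λ u → 0) ≡ 0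
      sum0 zero    = refl
      sum0 (suc U) = trans (ℕ.+-identityʳ _) (sum0 U)
    go (suc h) = begin
      4 ℕ.* sumℕ U (λ u → val h (dist x (B ℕ.+ u)) ℕ.+ indicator D (dist x (B ℕ.+ u))) ℕ.+ U/D
        ≡⟨ cong (λ z → 4 ℕ.* z ℕ.+ U/D) (sumℕ-+ U _ _) ⟩
      4 ℕ.* (A ℕ.+ sumℕ U (λ u → indicator D (dist x (B ℕ.+ u)))) ℕ.+ U/D
        ≤⟨ ℕ.+-monoˡ-≤ U/D (ℕ.*-monoʳ-≤ 4 (ℕ.+-monoʳ-≤ A (ℕ.≤-trans
             (sumℕ-mono U (λ u → shifted-indicator D {{5^≢0 (suc h)}} x B u))
             (count-multiples D {{5^≢0 (suc h)}} _ U)))) ⟩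
      4 ℕ.* (A ℕ.+ suc U/D) ℕ.+ U/D
        ≡⟨ eq A U/D ⟩
      4 ℕ.* A ℕ.+ U/D ℕ.* 5 ℕ.+ 4
        ≤⟨ ℕ.+-monoˡ-≤ 4 (ℕ.+-monoʳ-≤ (4 ℕ.* A) (subst (λ z → z ℕ.* 5 ℕ.≤ U/d) U/d/5 (m/n*n≤m U/d 5))) ⟩
      4 ℕ.* A ℕ.+ U/d ℕ.+ 4
        ≤⟨ ℕ.+-monoˡ-≤ 4 (go h) ⟩
      U ℕ.+ 4 ℕ.* h ℕ.+ 4
        ≡⟨ eq₂ U h ⟩
      U ℕ.+ 4 ℕ.* suc h ∎
      where
      open ℕ.≤-Reasoning
      D = 5 ℕ.^ suc h
      A = sumℕ U (λ u → val h (dist x (B ℕ.+ u)))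
      U/D = _/_ U D {{5^≢0 (suc h)}}
      U/d = _/_ U (5 ℕ.^ h) {{5^≢0 h}}
      U/d/5 : U/d / 5 ≡ U/D
      U/d/5 = trans (m/n/o≡m/[n*o] U (5 ℕ.^ h) 5 {{5^≢0 h}} {{_}} {{ℕ.m*n≢0 (5 ℕ.^ h) 5 {{5^≢0 h}}}})
        (Data.Nat.DivMod./-congʳ {{ℕ.m*n≢0 (5 ℕ.^ h) 5 {{5^≢0 h}}}} {{5^≢0 (suc h)}} (ℕ.*-comm (5 ℕ.^ h) 5))
        where import Data.Nat.DivMod
      eq : ∀ a b → 4 ℕ.* (a ℕ.+ suc b) ℕ.+ b ≡ 4 ℕ.* a ℕ.+ b ℕ.* 5 ℕ.+ 4
      eq = solve-∀
      eq₂ : ∀ u h → u ℕ.+ 4 ℕ.* h ℕ.+ 4 ≡ u ℕ.+ 4 ℕ.* suc h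
      eq₂ = solve-∀

  run : ℕ → ℕ → List ℕ → List ℕ
  run B zero    ys = ys
  run B (suc U) ys = (B ℕ.+ U) ∷ run B U ys

  grid : ℕ → ℕ → ℕ → ℕ → List ℕ
  grid U r B zero    = []
  grid U r B (suc V) = run (B ℕ.+ V ℕ.* r) U (grid U r B V)

  length-run : ∀ B U ys → length (run B U ys) ≡ U ℕ.+ length ys
  length-run B zero    ys = refl
  length-run B (suc U) ys = cong suc (length-run B U ys)

  length-grid : ∀ U r B V → length (grid U r B V) ≡ V ℕ.* U
  length-grid U r B zero    = refl
  length-grid U r B (suc V) = trans (length-run (B ℕ.+ V ℕ.* r) U (grid U r B V)) (cong (U ℕ.+_) (length-grid U r B V))

  All-run : ∀ {P : ℕ → Set} B U ys → (∀ u → u ℕ.< U → P (B ℕ.+ u)) → All P ys → All P (run B U ys)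
  All-run B zero    ys h k = k
  All-run B (suc U) ys h k = h U ℕ.≤-refl ∷ All-run B U ys (λ u p → h u (ℕ.m<n⇒m<1+n p)) k

  All-grid : ∀ {P : ℕ → Set} U r B V → (∀ v u → v ℕ.< V → u ℕ.< U → P (B ℕ.+ v ℕ.* r ℕ.+ u)) → All P (grid U r B V)
  All-grid U r B zero    h = []
  All-grid U r B (suc V) h = All-run (B ℕ.+ V ℕ.* r) U (grid U r B V) (λ u → h V u ℕ.≤-refl)
    (All-grid U r B V (λ v u p → h v u (ℕ.m<n⇒m<1+n p)))

  distinct-run : ∀ B U ys → All (ℕ._< B) ys → AllPairs _≢_ ys → AllPairs _≢_ (run B U ys)
  distinct-run B zero    ys h k = k
  distinct-run B (suc U) ys h k =
    All.map (λ p e → ℕ.<-irrefl (sym e) p) (All-run B U ys (λ u p → ℕ.+-monoʳ-< B p) (All.map (λ p → ℕ.<-≤-trans p (ℕ.m≤m+n B U)) h))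
    ∷ distinct-run B U ys h k

  distinct-grid : ∀ U r B V → U ℕ.≤ r → AllPairs _≢_ (grid U r B V)
  distinct-grid U r B zero    p = []
  distinct-grid U r B (suc V) p = distinct-run (B ℕ.+ V ℕ.* r) U (grid U r B V)
    (All-grid U r B V (λ v u v< u< → ℕ.≤-trans (ℕ.≤-reflexive (sym (ℕ.+-suc (B ℕ.+ v ℕ.* r) u)))
       (ℕ.≤-trans (ℕ.+-monoʳ-≤ (B ℕ.+ v ℕ.* r) (ℕ.≤-trans u< p))
         (ℕ.≤-trans (ℕ.≤-reflexive (eq B (v ℕ.* r) r)) (ℕ.+-monoʳ-≤ B (ℕ.*-monoˡ-≤ r v<))))))
    (distinct-grid U r B V p)
    where
    eq : ∀ b v r → b ℕ.+ v ℕ.+ r ≡ b ℕ.+ (r ℕ.+ v)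
    eq = solve-∀

  total-run : ∀ x B U ys → total (run B U ys) x ≡ sumℕ U (λ u → vdist x (B ℕ.+ u)) ℕ.+ total ys x
  total-run x B zero    ys = refl
  total-run x B (suc U) ys = trans (cong (vdist x (B ℕ.+ U) ℕ.+_) (total-run x B U ys))
    (eq (vdist x (B ℕ.+ U)) (sumℕ U (λ u → vdist x (B ℕ.+ u))) (total ys x))
    where
    eq : ∀ a b c → a ℕ.+ (b ℕ.+ c) ≡ b ℕ.+ a ℕ.+ c
    eq = solve-∀

-- Integer-valued polynomials in the binomial basis

module BinomialPolynomials where

  open NewtonSeries using (bin)
  open Pigeonhole using (sumℤ; sumℤ-cong)
  open IntegerPolynomials
  open FiveAdicValuation
  open import Data.Nat as ℕ using (ℕ; zero; suc; _!)
  import Data.Nat.Properties as ℕ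
  open import Data.Nat.Divisibility as ℕ∣ using (m≤n⇒m!∣n!) renaming (_∣_ to _∣ℕ_)
  open import Data.Nat.Tactic.RingSolver using (solve-∀)
  open import Data.Integer as ℤ using (ℤ; +_; _+_; _*_; _-_)
  import Data.Integer.Properties as ℤ
  open import Data.Integer.Divisibility.Signed using (_∣_; divides; ∣n⇒∣m*n; ∣m∣n⇒∣m-n; ∣ᵤ⇒∣; ∣⇒∣ᵤ; ∣-trans)
  import Data.Integer.Tactic.RingSolver as ℤR
  open import Data.List using (length)
  open import Function using (_∘_)
  open import Relation.Binary.PropositionalEquality hiding ([_])
  open Interpolation 5 vdist vdist-refl vdist-divides vdist-cancel

  sumℕ-mono< : ∀ n {f g} → (∀ i → i ℕ.< n → f i ℕ.≤ g i) → sumℕ n f ℕ.≤ sumℕ n g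
  sumℕ-mono< zero    h = ℕ.z≤n
  sumℕ-mono< (suc n) h = ℕ.+-mono-≤ (sumℕ-mono< n (λ i p → h i (ℕ.m<n⇒m<1+n p))) (h n ℕ.≤-refl)

  total-grid : ∀ h x U r B V → x ℕ.< 5 ℕ.^ h → (∀ v u → v ℕ.< V → u ℕ.< U → B ℕ.+ v ℕ.* r ℕ.+ u ℕ.< 5 ℕ.^ h) →
    4 ℕ.* total (grid U r B V) x ℕ.≤ V ℕ.* (U ℕ.+ 4 ℕ.* h)
  total-grid h x U r B zero    x< p< = ℕ.z≤n
  total-grid h x U r B (suc V) x< p< = begin
    4 ℕ.* total (run (B ℕ.+ V ℕ.* r) U (grid U r B V)) x
      ≡⟨ cong (4 ℕ.*_) (total-run x (B ℕ.+ V ℕ.* r) U (grid U r B V)) ⟩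
    4 ℕ.* (sumℕ U (λ u → vdist x (B ℕ.+ V ℕ.* r ℕ.+ u)) ℕ.+ total (grid U r B V) x)
      ≡⟨ ℕ.*-distribˡ-+ 4 (sumℕ U (λ u → vdist x (B ℕ.+ V ℕ.* r ℕ.+ u))) (total (grid U r B V) x) ⟩
    4 ℕ.* sumℕ U (λ u → vdist x (B ℕ.+ V ℕ.* r ℕ.+ u)) ℕ.+ 4 ℕ.* total (grid U r B V) x
      ≤⟨ ℕ.+-mono-≤ (ℕ.≤-trans (ℕ.*-monoʳ-≤ 4 (sumℕ-mono< U (λ u u< → vdist≤val h x< (p< V u ℕ.≤-refl u<))))
           (val-run h x (B ℕ.+ V ℕ.* r) U))
           (total-grid h x U r B V x< (λ v u p → p< v u (ℕ.m<n⇒m<1+n p))) ⟩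
    U ℕ.+ 4 ℕ.* h ℕ.+ V ℕ.* (U ℕ.+ 4 ℕ.* h) ∎
    where open ℕ.≤-Reasoning

  absorption : ∀ x i → suc i ℕ.* bin x (suc i) ℕ.+ i ℕ.* bin x i ≡ x ℕ.* bin x i
  absorption zero    zero    = refl
  absorption zero    (suc i) = cong₂ ℕ._+_ (ℕ.*-zeroʳ i) (ℕ.*-zeroʳ i)
  absorption (suc x) zero    = trans (eq (bin x 1)) (cong suc (absorption x zero))
    where
    eq : ∀ b → 1 ℕ.* (1 ℕ.+ b) ℕ.+ 0 ≡ suc (1 ℕ.* b ℕ.+ 0)
    eq = solve-∀
  absorption (suc x) (suc i) = begin
    suc (suc i) ℕ.* (b ℕ.+ c) ℕ.+ suc i ℕ.* (a ℕ.+ b)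
      ≡⟨ eq₁ i a b c ⟩
    suc (suc i) ℕ.* b ℕ.+ (suc (suc i) ℕ.* c ℕ.+ suc i ℕ.* b) ℕ.+ suc i ℕ.* a
      ≡⟨ cong (λ z → suc (suc i) ℕ.* b ℕ.+ z ℕ.+ suc i ℕ.* a) (absorption x (suc i)) ⟩
    suc (suc i) ℕ.* b ℕ.+ x ℕ.* b ℕ.+ suc i ℕ.* a
      ≡⟨ eq₂ i x a b ⟩
    (suc i ℕ.* b ℕ.+ i ℕ.* a) ℕ.+ (a ℕ.+ x ℕ.* b ℕ.+ b)
      ≡⟨ cong (ℕ._+ (a ℕ.+ x ℕ.* b ℕ.+ b)) (absorption x i) ⟩
    x ℕ.* a ℕ.+ (a ℕ.+ x ℕ.* b ℕ.+ b)
      ≡⟨ eq₃ x a b ⟩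
    suc x ℕ.* (a ℕ.+ b) ∎
    where
    open ≡-Reasoning
    a = bin x i
    b = bin x (suc i)
    c = bin x (suc (suc i))
    eq₁ : ∀ i a b c → suc (suc i) ℕ.* (b ℕ.+ c) ℕ.+ suc i ℕ.* (a ℕ.+ b) ≡
      suc (suc i) ℕ.* b ℕ.+ (suc (suc i) ℕ.* c ℕ.+ suc i ℕ.* b) ℕ.+ suc i ℕ.* a
    eq₁ = solve-∀
    eq₂ : ∀ i x a b → suc (suc i) ℕ.* b ℕ.+ x ℕ.* b ℕ.+ suc i ℕ.* a ≡ (suc i ℕ.* b ℕ.+ i ℕ.* a) ℕ.+ (a ℕ.+ x ℕ.* b ℕ.+ b)
    eq₂ = solve-∀
    eq₃ : ∀ x a b → x ℕ.* a ℕ.+ (a ℕ.+ x ℕ.* b ℕ.+ b) ≡ suc x ℕ.* (a ℕ.+ b)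
    eq₃ = solve-∀

  factorial-poly : ∀ i → Poly (suc i) (λ x → + (i ! ℕ.* bin x i))
  factorial-poly zero    = poly-1
  factorial-poly (suc i) = poly-cong (suc (suc i)) step (poly-lin (suc i) (+ i) (factorial-poly i))
    where
    step : ∀ x → (+ x - + i) * + (i ! ℕ.* bin x i) ≡ + (suc i ! ℕ.* bin x (suc i))
    step x = begin
      (+ x - + i) * + (i ! ℕ.* b)                ≡⟨ cong ((+ x - + i) *_) (ℤ.pos-* (i !) b) ⟩
      (+ x - + i) * (+ (i !) * + b)              ≡⟨ eq (+ x) (+ i) (+ (i !)) (+ b) ⟩
      + (i !) * (+ x * + b - + i * + b)          ≡⟨ cong (λ z → + (i !) * (z - + i * + b))
                                                      (trans (sym (ℤ.pos-* x b)) (trans (cong +_ (sym (absorption x i)))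
                                                        (cong₂ _+_ (ℤ.pos-* (suc i) (bin x (suc i))) (ℤ.pos-* i b)))) ⟩
      + (i !) * (+ suc i * + b′ + + i * + b - + i * + b) ≡⟨ eq₂ (+ (i !)) (+ suc i) (+ b′) (+ i * + b) ⟩
      (+ suc i * + (i !)) * + b′                 ≡⟨ cong (_* + b′) (ℤ.pos-* (suc i) (i !)) ⟨
      + (suc i !) * + b′                         ≡⟨ ℤ.pos-* (suc i !) b′ ⟨
      + (suc i ! ℕ.* b′) ∎
      where
      open ≡-Reasoning
      b = bin x i
      b′ = bin x (suc i)
      eq : ∀ x i f b → (x - i) * (f * b) ≡ f * (x * b - i * b)
      eq = ℤR.solve-∀
      eq₂ : ∀ f s b c → f * (s * b + c - c) ≡ (s * f) * b
      eq₂ = ℤR.solve-∀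

  value : ℕ → (ℕ → ℤ) → ℕ → ℤ
  value I c x = sumℤ I (λ i → c i * + bin x i)

  -- The denominators of C(x,0), ..., C(x,I-1) divide I!. The price of clearing them is the exponent
  -- of 5 in I!, paid in `factorial-cancel`.
  value-poly : ∀ I c → Poly I (λ x → + (I !) * value I c x)
  value-poly I c = go I ℕ.≤-refl
    where
    go : ∀ n → n ℕ.≤ I → Poly I (λ x → + (I !) * value n c x)
    go zero    p = poly-cong I (λ x → sym (ℤ.*-zeroʳ (+ (I !)))) (poly-0 I)
    go (suc n) p with m≤n⇒m!∣n! (ℕ.<⇒≤ p)
    ... | ℕ∣.divides k e = poly-cong I eq (poly-+ I {λ x → + (I !) * value n c x} {λ x → (+ k * c n) * + (n ! ℕ.* bin x n)}
        (go n (ℕ.<⇒≤ p)) (poly-scale I (+ k * c n) {λ x → + (n ! ℕ.* bin x n)}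
          (subst (λ d → Poly d (λ x → + (n ! ℕ.* bin x n))) (ℕ.m∸n+n≡m p) (poly-mono (I ℕ.∸ suc n) (suc n) (factorial-poly n)))))
      where
      eqℤ : ∀ F S k c f b → F ≡ k * f → F * S + (k * c) * (f * b) ≡ F * (S + c * b)
      eqℤ F S k c f b h = trans (e₁ F S k c f b) (trans (cong (λ z → F * S + z * (c * b)) (sym h)) (e₂ F S c b))
        where
        e₁ : ∀ F S k c f b → F * S + (k * c) * (f * b) ≡ F * S + (k * f) * (c * b)
        e₁ = ℤR.solve-∀
        e₂ : ∀ F S c b → F * S + F * (c * b) ≡ F * (S + c * b)
        e₂ = ℤR.solve-∀
      eq : ∀ x → + (I !) * value n c x + (+ k * c n) * + (n ! ℕ.* bin x n) ≡ + (I !) * value (suc n) c x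
      eq x = trans (cong (λ z → + (I !) * value n c x + (+ k * c n) * z) (ℤ.pos-* (n !) (bin x n)))
        (eqℤ (+ (I !)) (value n c x) (+ k) (c n) (+ (n !)) (+ bin x n) (trans (cong +_ e) (ℤ.pos-* k (n !))))

  factorial-cancel : ∀ h I → I ℕ.< 5 ℕ.^ h → ∀ s z → 5 ℕ.^ (s ℕ.+ sumℕ I (λ u → val h (suc u))) ∣ℕ I ! ℕ.* z → 5 ℕ.^ s ∣ℕ z
  factorial-cancel h zero    p s z d = subst₂ (λ a b → 5 ℕ.^ a ∣ℕ b) (ℕ.+-identityʳ s) (ℕ.*-identityˡ z) d
  factorial-cancel h (suc I) p s z d = factorial-cancel h I (ℕ.<-trans (ℕ.n<1+n I) p) s z
    (val-cancel {h} {suc I} (ℕ.s≤s ℕ.z≤n) p (s ℕ.+ w) (I ! ℕ.* z)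
      (subst₂ (λ a b → 5 ℕ.^ a ∣ℕ b) (sym (ℕ.+-assoc s w (val h (suc I)))) (ℕ.*-assoc (suc I) (I !) z) d))
    where
    w = sumℕ I (λ u → val h (suc u))

  sumℤ-head : ∀ n f → sumℤ (suc n) f ≡ f 0 + sumℤ n (f ∘ suc)
  sumℤ-head zero    f = ℤ.+-comm (+ 0) (f 0)
  sumℤ-head (suc n) f = trans (cong (_+ f (suc n)) (sumℤ-head n f)) (ℤ.+-assoc (f 0) _ _)

  sumℤ-+ : ∀ n f g → sumℤ n (λ i → f i + g i) ≡ sumℤ n f + sumℤ n g
  sumℤ-+ zero    f g = refl
  sumℤ-+ (suc n) f g = trans (cong (_+ (f n + g n)) (sumℤ-+ n f g)) (eq (sumℤ n f) (sumℤ n g) (f n) (g n))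
    where
    eq : ∀ a b c d → (a + b) + (c + d) ≡ (a + c) + (b + d)
    eq = ℤR.solve-∀

  value-step : ∀ I c x → value (suc I) c (suc x) ≡ value (suc I) c x + value I (c ∘ suc) x
  value-step I c x = trans (sumℤ-head I _) (trans (cong (λ z → c 0 * + 1 + z)
      (trans (sumℤ-cong I (λ i _ → ℤ.*-distribˡ-+ (c (suc i)) (+ bin x i) (+ bin x (suc i))))
        (trans (sumℤ-+ I _ _) (ℤ.+-comm (value I (c ∘ suc) x) _))))
    (trans (sym (ℤ.+-assoc (c 0 * + 1) _ _)) (cong (_+ value I (c ∘ suc) x) (sym (trans (sumℤ-head I _)
      (cong (λ z → c 0 * + z + sumℤ I (λ i → c (suc i) * + bin x (suc i))) (bin0 x)))))))
    where
    bin0 : ∀ x → bin x 0 ≡ 1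
    bin0 zero    = refl
    bin0 (suc x) = refl

  -- Coefficients in the binomial basis are iterated differences at 0: the value at 0 is c 0, and
  -- taking differences shifts c by one.
  values⇒coefficients : ∀ d I c → (∀ x → + d ∣ value I c x) → ∀ i → i ℕ.< I → + d ∣ c i
  values⇒coefficients d (suc I) c h zero p = subst (+ d ∣_) eq (h 0)
    where
    zeros : ∀ n → sumℤ n (λ i → c (suc i) * + 0) ≡ + 0
    zeros zero    = refl
    zeros (suc n) = cong₂ _+_ (zeros n) (ℤ.*-zeroʳ (c (suc n)))
    eq : value (suc I) c 0 ≡ c 0
    eq = trans (sumℤ-head I _) (trans (cong₂ _+_ (ℤ.*-identityʳ (c 0)) (zeros I)) (ℤ.+-identityʳ (c 0)))
  values⇒coefficients d (suc I) c h (suc i) p = values⇒coefficients d I (c ∘ suc)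
    (λ x → subst (+ d ∣_) (trans (cong (_- value (suc I) c x) (value-step I c x)) (eq (value (suc I) c x) _)) (∣m∣n⇒∣m-n (h (suc x)) (h x)))
    i (ℕ.s≤s⁻¹ p)
    where
    eq : ∀ a b → a + b - a ≡ b
    eq = ℤR.solve-∀

  pow5-∣ : ∀ {a b} → a ℕ.≤ b → + (5 ℕ.^ a) ∣ + (5 ℕ.^ b)
  pow5-∣ {a} {b} p = ∣ᵤ⇒∣ (ℕ∣.divides (5 ℕ.^ (b ℕ.∸ a)) (trans (cong (5 ℕ.^_) (sym (ℕ.m∸n+n≡m p))) (ℕ.^-distribˡ-+-* 5 (b ℕ.∸ a) a)))

  -- Interpolation on at least I nodes carries divisibility from the grid to all arguments. The
  -- losses are the exponents of 5 in I! and in the differences of nodes, about I / 4 and V U / 4,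
  -- so `loss` leaves one factor 5.
  content : ∀ I U V r B h G c → I ℕ.≤ V ℕ.* U → U ℕ.≤ r → I ℕ.< 5 ℕ.^ h →
    (∀ v u → v ℕ.< V → u ℕ.< U → B ℕ.+ v ℕ.* r ℕ.+ u ℕ.< 5 ℕ.^ h) →
    4 ℕ.+ (I ℕ.+ 4 ℕ.* h) ℕ.+ V ℕ.* (U ℕ.+ 4 ℕ.* h) ℕ.≤ 4 ℕ.* G →
    (∀ v u → v ℕ.< V → u ℕ.< U → + (5 ℕ.^ G) ∣ value I c (B ℕ.+ v ℕ.* r ℕ.+ u)) →
    ∀ i → i ℕ.< I → + 5 ∣ c i
  content I U V r B h G c I≤ U≤r I< pts loss div = values⇒coefficients 5 I c (λ y → ∣ᵤ⇒∣ (factorial-cancel h I I< 1 ℤ.∣ value I c y ∣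
      (subst (5 ℕ.^ s ∣ℕ_) (ℤ.abs-* (+ (I !)) (value I c y)) (∣⇒∣ᵤ (all y)))))
    where
    w = sumℕ I (λ u → val h (suc u))
    s = 1 ℕ.+ w
    4w≤ : 4 ℕ.* w ℕ.≤ I ℕ.+ 4 ℕ.* h
    4w≤ = val-run h 0 1 I
    Q : ℕ → ℤ
    Q x = + (I !) * value I c x
    Q-poly : Poly (length (grid U r B V)) Q
    Q-poly = subst (λ d → Poly d Q) (trans (ℕ.m∸n+n≡m I≤) (sym (length-grid U r B V)))
      (poly-mono (V ℕ.* U ℕ.∸ I) I (value-poly I c))
    exp≤ : ∀ x → x ℕ.< 5 ℕ.^ h → s ℕ.+ total (grid U r B V) x ℕ.≤ G
    exp≤ x x< = ℕ.*-cancelˡ-≤ 4 (ℕ.≤-trans (ℕ.≤-reflexive (eq w (total (grid U r B V) x)))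
      (ℕ.≤-trans (ℕ.+-mono-≤ (ℕ.+-monoʳ-≤ 4 4w≤) (total-grid h x U r B V x< pts)) loss))
      where
      eq : ∀ w t → 4 ℕ.* (1 ℕ.+ w ℕ.+ t) ≡ 4 ℕ.+ 4 ℕ.* w ℕ.+ 4 ℕ.* t
      eq = solve-∀
    all : ∀ y → + (5 ℕ.^ s) ∣ Q y
    all = interpolate (grid U r B V) Q (distinct-grid U r B V U≤r) Q-poly s
      (All-grid U r B V (λ v u v< u< → ∣-trans (pow5-∣ (exp≤ _ (pts v u v< u<))) (∣n⇒∣m*n (+ (I !)) (div v u v< u<))))

-- The 5-adic zero estimate

module Zeros where

  open NewtonSeries using (bin)
  open BinomialPolynomials
  open import Data.Nat as ℕ using (ℕ; zero; suc)
  import Data.Nat.Properties as ℕ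
  import Data.Nat.Divisibility as ℕ∣
  open import Data.Nat.Tactic.RingSolver using (solve-∀)
  open import Data.Integer as ℤ using (ℤ; +_; _+_; _*_)
  import Data.Integer.Properties as ℤ
  open import Data.Integer.Divisibility.Signed using (_∣_; _∣?_; divides; ∣m∣n⇒∣m+n; ∣m⇒∣m*n; ∣⇒∣ᵤ; ∣-trans; *-monoˡ-∣; *-cancelˡ-∣)
  import Data.Integer.Tactic.RingSolver as ℤR
  open import Data.Product using (_×_; _,_; ∃; ∃₂; proj₁; proj₂)
  open import Data.Sum using (_⊎_; inj₁; inj₂)
  open import Data.Empty using (⊥)
  open import Relation.Binary.PropositionalEquality hiding ([_])
  open import Relation.Binary.Definitions using (tri<; tri≈; tri>)
  open import Relation.Nullary using (¬_; Dec; yes; no; contradiction)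
  open import Relation.Nullary.Decidable using (map′)

  argmin : ∀ (f : ℕ → ℕ) J → ∃ λ j → j ℕ.< suc J × (∀ j′ → j′ ℕ.< suc J → f j ℕ.≤ f j′)
  argmin f zero = 0 , ℕ.s≤s ℕ.z≤n , λ { zero _ → ℕ.≤-refl ; (suc _) (ℕ.s≤s ()) }
  argmin f (suc J) with argmin f J
  ... | j , j< , min with f j ℕ.≤? f (suc J)
  ... | yes p = j , ℕ.m<n⇒m<1+n j< , λ j′ j′< → go j′ j′<
    where
    go : ∀ j′ → j′ ℕ.< suc (suc J) → f j ℕ.≤ f j′
    go j′ j′< with j′ ℕ.≟ suc J
    ... | yes refl = p
    ... | no ne = min j′ (ℕ.≤∧≢⇒< (ℕ.s≤s⁻¹ j′<) ne)
  ... | no p = suc J , ℕ.≤-refl , λ j′ j′< → go j′ j′<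
    where
    go : ∀ j′ → j′ ℕ.< suc (suc J) → f (suc J) ℕ.≤ f j′
    go j′ j′< with j′ ℕ.≟ suc J
    ... | yes refl = ℕ.≤-refl
    ... | no ne = ℕ.≤-trans (ℕ.<⇒≤ (ℕ.≰⇒> p)) (min j′ (ℕ.≤∧≢⇒< (ℕ.s≤s⁻¹ j′<) ne))

  stationary : ∀ (f : ℕ → ℕ) T → (∀ t → t ℕ.< T → f t ℕ.≤ f (suc t)) → (∃ λ t → t ℕ.< T × f t ≡ f (suc t)) ⊎ T ℕ.≤ f T
  stationary f zero    h = inj₂ ℕ.z≤n
  stationary f (suc T) h with stationary f T (λ t p → h t (ℕ.m<n⇒m<1+n p))
  ... | inj₁ (t , p , e) = inj₁ (t , ℕ.m<n⇒m<1+n p , e)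
  ... | inj₂ p with f T ℕ.≟ f (suc T)
  ... | yes e = inj₁ (T , ℕ.≤-refl , e)
  ... | no ne = inj₂ (ℕ.≤-<-trans p (ℕ.≤∧≢⇒< (h T ℕ.≤-refl) ne))

  maximal-exponent : ∀ (P : ℕ → Set) → (∀ e → Dec (P e)) → P 0 → ∀ E → ∃ λ e → P e × (E ℕ.≤ e ⊎ ¬ P (suc e))
  maximal-exponent P P? p₀ zero = 0 , p₀ , inj₁ ℕ.z≤n
  maximal-exponent P P? p₀ (suc E) with maximal-exponent P P? p₀ E
  ... | e , p , inj₂ n = e , p , inj₂ n
  ... | e , p , inj₁ q with P? (suc e)
  ... | yes p′ = suc e , p′ , inj₁ (ℕ.s≤s q)
  ... | no  n  = e , p , inj₂ n

  all<? : ∀ {P : ℕ → Set} → (∀ i → Dec (P i)) → ∀ n → Dec (∀ i → i ℕ.< n → P i)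
  all<? P? n = map′ (λ h i p → h p) (λ h {i} p → h i p) (ℕ.allUpTo? P? n)

  module ZeroEstimate (I J : ℕ) (c : ℕ → ℕ → ℤ) where

    weight : ℕ → ℕ
    weight j = J ℕ.∸ suc j

    weight-< : ∀ {i j} → i ℕ.< j → j ℕ.< J → suc (weight j) ℕ.≤ weight i
    weight-< p q = ℕ.∸-monoʳ-< (ℕ.s≤s p) q

    -- what the vanishing of ∑ c_j(x) Y^j at a point with 5-adic exponent -q of Y amounts to 5-adically
    Vanishes : ℕ → ℕ → Set
    Vanishes x q = ∀ j → j ℕ.< J → ∀ K →
      (∀ j′ → j′ ℕ.< J → j′ ≢ j → + (5 ℕ.^ (K ℕ.+ weight j ℕ.* q)) ∣ value I (c j′) x * + (5 ℕ.^ (weight j′ ℕ.* q))) →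
      + (5 ℕ.^ K) ∣ value I (c j) x

    private
      ∣-pow : ∀ e x → (∀ i → i ℕ.< I → + (5 ℕ.^ e) ∣ x i) → ∀ y → + (5 ℕ.^ e) ∣ value I x y
      ∣-pow e x h y = go I h
        where
        go : ∀ n → (∀ i → i ℕ.< n → + (5 ℕ.^ e) ∣ x i) → + (5 ℕ.^ e) ∣ value n x y
        go zero    h = divides (+ 0) refl
        go (suc n) h = ∣m∣n⇒∣m+n (go n (λ i p → h i (ℕ.m<n⇒m<1+n p))) (∣m⇒∣m*n (+ bin y n) (h n ℕ.≤-refl))

      pow-∣-value : ∀ {a b} → a ℕ.≤ b → ∀ {z} → + (5 ℕ.^ b) ∣ z → + (5 ℕ.^ a) ∣ z
      pow-∣-value p d = ∣-trans (pow5-∣ p) d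

      5^+ : ∀ a b → + (5 ℕ.^ (a ℕ.+ b)) ≡ + (5 ℕ.^ a) * + (5 ℕ.^ b)
      5^+ a b = trans (cong +_ (ℕ.^-distribˡ-+-* 5 a b)) (ℤ.pos-* (5 ℕ.^ a) (5 ℕ.^ b))

    module _ {U V r h G E₀ : ℕ} (B Pos : ℕ → ℕ) (q : ℕ → ℕ → ℕ → ℕ)
      (nonzero : ∃₂ λ j i → j ℕ.< J × i ℕ.< I × c j i ≢ + 0)
      (small : ∀ j i → ℤ.∣ c j i ∣ ℕ.< 5 ℕ.^ E₀)
      (0<G : 0 ℕ.< G) (I≤ : I ℕ.≤ V ℕ.* U) (U≤r : U ℕ.≤ r) (I< : I ℕ.< 5 ℕ.^ h) (0<V : 0 ℕ.< V) (0<U : 0 ℕ.< U)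
      (pts : ∀ t → t ℕ.< J → ∀ v u → v ℕ.< V → u ℕ.< U → B t ℕ.+ v ℕ.* r ℕ.+ u ℕ.< 5 ℕ.^ h)
      (loss : 4 ℕ.+ (I ℕ.+ 4 ℕ.* h) ℕ.+ V ℕ.* (U ℕ.+ 4 ℕ.* h) ℕ.≤ 4 ℕ.* G)
      (above : ∀ t → t ℕ.< J → ∀ v u → v ℕ.< V → u ℕ.< U → Pos t ℕ.+ G ℕ.≤ q t v u)
      (below : ∀ t → t ℕ.< J → ∀ v u → v ℕ.< V → u ℕ.< U → q t v u ℕ.+ G ℕ.≤ Pos (suc t))
      (vanish : ∀ t → t ℕ.< J → ∀ v u → v ℕ.< V → u ℕ.< U → Vanishes (B t ℕ.+ v ℕ.* r ℕ.+ u) (q t v u)) where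

      private
        Pos-step : ∀ t → t ℕ.< J → Pos t ℕ.< Pos (suc t)
        Pos-step t p = ℕ.<-≤-trans (ℕ.m<m+n (Pos t) 0<G) (ℕ.≤-trans (above t p 0 0 0<V 0<U)
          (ℕ.≤-trans (ℕ.m≤m+n _ G) (below t p 0 0 0<V 0<U)))

        Pos-max : ∀ t k → t ℕ.+ k ≡ J → Pos t ℕ.≤ Pos J
        Pos-max t zero    e = ℕ.≤-reflexive (cong Pos (trans (sym (ℕ.+-identityʳ t)) e))
        Pos-max t (suc k) e = ℕ.≤-trans (ℕ.<⇒≤ (Pos-step t (ℕ.≤-trans (ℕ.m≤m+n (suc t) k) (ℕ.≤-reflexive e′)))) (Pos-max (suc t) k e′)
          where
          e′ : suc t ℕ.+ k ≡ J
          e′ = trans (sym (ℕ.+-suc t k)) e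

        -- A column c_j that is identically zero is divisible by all powers of 5, so the search for
        -- its exponent must stop somewhere. The bound lies above the exponent of any dominant
        -- column, see `not-capped`.
        cap = suc (E₀ ℕ.+ J ℕ.* Pos J)

        abstract
          exponent : ∀ j → ∃ λ e → (∀ i → i ℕ.< I → + (5 ℕ.^ e) ∣ c j i) × (cap ℕ.≤ e ⊎ ¬ (∀ i → i ℕ.< I → + (5 ℕ.^ suc e) ∣ c j i))
          exponent j = maximal-exponent (λ e → ∀ i → i ℕ.< I → + (5 ℕ.^ e) ∣ c j i)
            (λ e → all<? (λ i → + (5 ℕ.^ e) ∣? c j i) I) (λ i _ → divides (c j i) (sym (ℤ.*-identityʳ (c j i)))) cap

        e : ℕ → ℕ
        e j = proj₁ (exponent j)

        J-pos : ∃ λ J′ → J ≡ suc J′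
        J-pos = go J (proj₁ (proj₂ (proj₂ nonzero)))
          where
          go : ∀ K → proj₁ nonzero ℕ.< K → ∃ λ J′ → K ≡ suc J′
          go (suc K) _ = K , refl

        -- The guaranteed exponent of 5 in the term C_j X^(J-1-j) when X has exponent Pos t. For
        -- fixed j it is linear in the position, and the lower envelope of these lines is a Newton
        -- polygon.
        φ : ℕ → ℕ → ℕ
        φ t j = e j ℕ.+ weight j ℕ.* Pos t

        abstract
          best : ∀ t → ∃ λ j → j ℕ.< J × (∀ j′ → j′ ℕ.< J → φ t j ℕ.≤ φ t j′)
          best t = subst (λ K → ∃ λ j → j ℕ.< K × (∀ j′ → j′ ℕ.< K → φ t j ℕ.≤ φ t j′)) (sym (proj₂ J-pos)) (argmin (φ t) (proj₁ J-pos))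

        top : ℕ → ℕ
        top t = proj₁ (best t)

        -- A larger exponent of X favours smaller weights, that is, larger j. If the dominant index
        -- dropped, the sum of the two minimality inequalities would contradict the strict decrease
        -- of `weight`.
        top-mono : ∀ t → t ℕ.< J → top t ℕ.≤ top (suc t)
        top-mono t t< with top t ℕ.≤? top (suc t)
        ... | yes p = p
        ... | no  p = contradiction (ℕ.+-mono-≤ (proj₂ (proj₂ (best t)) b (proj₁ (proj₂ (best (suc t)))))
                                                 (proj₂ (proj₂ (best (suc t))) a (proj₁ (proj₂ (best t)))))
                (ℕ.<⇒≱ (begin-strict
                  e b ℕ.+ wb ℕ.* P ℕ.+ (e a ℕ.+ wa ℕ.* P′)
                    ≡⟨ cong (λ z → e b ℕ.+ wb ℕ.* P ℕ.+ (e a ℕ.+ wa ℕ.* z)) (sym (ℕ.m+[n∸m]≡n (ℕ.<⇒≤ P<P′))) ⟩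
                  e b ℕ.+ wb ℕ.* P ℕ.+ (e a ℕ.+ wa ℕ.* (P ℕ.+ d))
                    ≡⟨ eq₁ (e a) (e b) wa wb P d ⟩
                  (e a ℕ.+ wa ℕ.* P ℕ.+ (e b ℕ.+ wb ℕ.* P)) ℕ.+ wa ℕ.* d
                    <⟨ ℕ.+-monoʳ-< _ (ℕ.*-monoˡ-< d {{ℕ.>-nonZero (ℕ.m<n⇒0<n∸m P<P′)}} (weight-< (ℕ.≰⇒> p) (proj₁ (proj₂ (best t))))) ⟩
                  (e a ℕ.+ wa ℕ.* P ℕ.+ (e b ℕ.+ wb ℕ.* P)) ℕ.+ wb ℕ.* d
                    ≡⟨ eq₂ (e a) (e b) wa wb P d ⟩
                  e a ℕ.+ wa ℕ.* P ℕ.+ (e b ℕ.+ wb ℕ.* (P ℕ.+ d))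
                    ≡⟨ cong (λ z → e a ℕ.+ wa ℕ.* P ℕ.+ (e b ℕ.+ wb ℕ.* z)) (ℕ.m+[n∸m]≡n (ℕ.<⇒≤ P<P′)) ⟩
                  e a ℕ.+ wa ℕ.* P ℕ.+ (e b ℕ.+ wb ℕ.* P′) ∎))
          where
          open ℕ.≤-Reasoning
          a = top t
          b = top (suc t)
          wa = weight a
          wb = weight b
          P = Pos t
          P′ = Pos (suc t)
          P<P′ = Pos-step t t<
          d = P′ ℕ.∸ P
          eq₁ : ∀ ea eb wa wb P d → eb ℕ.+ wb ℕ.* P ℕ.+ (ea ℕ.+ wa ℕ.* (P ℕ.+ d)) ≡ (ea ℕ.+ wa ℕ.* P ℕ.+ (eb ℕ.+ wb ℕ.* P)) ℕ.+ wa ℕ.* d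
          eq₁ = solve-∀
          eq₂ : ∀ ea eb wa wb P d → (ea ℕ.+ wa ℕ.* P ℕ.+ (eb ℕ.+ wb ℕ.* P)) ℕ.+ wb ℕ.* d ≡ ea ℕ.+ wa ℕ.* P ℕ.+ (eb ℕ.+ wb ℕ.* (P ℕ.+ d))
          eq₂ = solve-∀

        abstract
          -- The dominant index is monotone on the J + 1 positions 0, ..., J but has only J possible
          -- values.
          repeated : ∃ λ t → t ℕ.< J × top t ≡ top (suc t)
          repeated with stationary top J top-mono
          ... | inj₁ r = r
          ... | inj₂ p = contradiction p (ℕ.<⇒≱ (proj₁ (proj₂ (best J))))

        t* = proj₁ repeated
        t*< = proj₁ (proj₂ repeated)
        j* = top t*
        j*< = proj₁ (proj₂ (best t*))

        -- The lines e j + weight j · Q have distinct integral slopes. One that is lowest at both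
        -- ends of an interval is lower by at least G at every point at distance G from both ends.
        dominates : ∀ Q j → j ℕ.< J → j ≢ j* → Pos t* ℕ.+ G ℕ.≤ Q → Q ℕ.+ G ℕ.≤ Pos (suc t*) →
          e j* ℕ.+ G ℕ.+ weight j* ℕ.* Q ℕ.≤ e j ℕ.+ weight j ℕ.* Q
        dominates Q j j< ne lo hi with ℕ.<-cmp j j*
        ... | tri≈ _ q _ = contradiction q ne
        ... | tri< j<j* _ _ = subst (λ z → e j* ℕ.+ G ℕ.+ w* ℕ.* z ℕ.≤ e j ℕ.+ w ℕ.* z) (ℕ.m+[n∸m]≡n (ℕ.m+n≤o⇒m≤o P lo)) (begin
                e j* ℕ.+ G ℕ.+ w* ℕ.* (P ℕ.+ d)        ≤⟨ ℕ.+-monoˡ-≤ (w* ℕ.* (P ℕ.+ d)) (ℕ.+-monoʳ-≤ (e j*) (ℕ.m+n≤o⇒m≤o∸n G (subst (ℕ._≤ Q) (ℕ.+-comm P G) lo))) ⟩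
                e j* ℕ.+ d ℕ.+ w* ℕ.* (P ℕ.+ d)        ≡⟨ eq (e j*) w* P d ⟩
                (e j* ℕ.+ w* ℕ.* P) ℕ.+ suc w* ℕ.* d   ≤⟨ ℕ.+-mono-≤ (proj₂ (proj₂ (best t*)) j j<) (ℕ.*-monoˡ-≤ d (weight-< j<j* j*<)) ⟩
                (e j ℕ.+ w ℕ.* P) ℕ.+ w ℕ.* d          ≡⟨ eq₂ (e j) w P d ⟩
                e j ℕ.+ w ℕ.* (P ℕ.+ d) ∎)
          where
          open ℕ.≤-Reasoning
          P = Pos t*
          d = Q ℕ.∸ P
          w = weight j
          w* = weight j*
          eq : ∀ e w P d → e ℕ.+ d ℕ.+ w ℕ.* (P ℕ.+ d) ≡ (e ℕ.+ w ℕ.* P) ℕ.+ suc w ℕ.* d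
          eq = solve-∀
          eq₂ : ∀ e w P d → (e ℕ.+ w ℕ.* P) ℕ.+ w ℕ.* d ≡ e ℕ.+ w ℕ.* (P ℕ.+ d)
          eq₂ = solve-∀
        ... | tri> _ _ j*<j = ℕ.+-cancelʳ-≤ (w ℕ.* d) _ _ (begin
                e j* ℕ.+ G ℕ.+ w* ℕ.* Q ℕ.+ w ℕ.* d    ≤⟨ ℕ.+-monoˡ-≤ (w ℕ.* d) (ℕ.+-monoˡ-≤ (w* ℕ.* Q) (ℕ.+-monoʳ-≤ (e j*) (ℕ.m+n≤o⇒m≤o∸n G (subst (ℕ._≤ P′) (ℕ.+-comm Q G) hi)))) ⟩
                e j* ℕ.+ d ℕ.+ w* ℕ.* Q ℕ.+ w ℕ.* d    ≡⟨ eq (e j*) w w* Q d ⟩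
                (e j* ℕ.+ w* ℕ.* Q) ℕ.+ suc w ℕ.* d    ≤⟨ ℕ.+-monoʳ-≤ _ (ℕ.*-monoˡ-≤ d (weight-< j*<j j<)) ⟩
                (e j* ℕ.+ w* ℕ.* Q) ℕ.+ w* ℕ.* d       ≡⟨ eq₂ (e j*) w* Q d ⟩
                e j* ℕ.+ w* ℕ.* (Q ℕ.+ d)              ≡⟨ cong (λ z → e j* ℕ.+ w* ℕ.* z) Q+d ⟩
                e j* ℕ.+ w* ℕ.* P′                     ≤⟨ subst (λ k → φ (suc t*) k ℕ.≤ φ (suc t*) j) (sym (proj₂ (proj₂ repeated))) (proj₂ (proj₂ (best (suc t*))) j j<) ⟩
                e j ℕ.+ w ℕ.* P′                       ≡⟨ cong (λ z → e j ℕ.+ w ℕ.* z) Q+d ⟨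
                e j ℕ.+ w ℕ.* (Q ℕ.+ d)                ≡⟨ eq₂ (e j) w Q d ⟨
                e j ℕ.+ w ℕ.* Q ℕ.+ w ℕ.* d ∎)
          where
          open ℕ.≤-Reasoning
          P′ = Pos (suc t*)
          d = P′ ℕ.∸ Q
          w = weight j
          w* = weight j*
          Q+d : Q ℕ.+ d ≡ P′
          Q+d = ℕ.m+[n∸m]≡n (ℕ.m+n≤o⇒m≤o Q hi)
          eq : ∀ e w v Q d → e ℕ.+ d ℕ.+ v ℕ.* Q ℕ.+ w ℕ.* d ≡ (e ℕ.+ v ℕ.* Q) ℕ.+ suc w ℕ.* d
          eq = solve-∀
          eq₂ : ∀ e w Q d → (e ℕ.+ w ℕ.* Q) ℕ.+ w ℕ.* d ≡ e ℕ.+ w ℕ.* (Q ℕ.+ d)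
          eq₂ = solve-∀

        divisible : ∀ v u → v ℕ.< V → u ℕ.< U → + (5 ℕ.^ (e j* ℕ.+ G)) ∣ value I (c j*) (B t* ℕ.+ v ℕ.* r ℕ.+ u)
        divisible v u v< u< = vanish t* t*< v u v< u< j* j*< (e j* ℕ.+ G) (λ j j< ne →
          pow-∣-value (dominates Q j j< ne (above t* t*< v u v< u<) (below t* t*< v u v< u<))
            (subst (_∣ value I (c j) x * + (5 ℕ.^ (weight j ℕ.* Q))) (sym (5^+ (e j) (weight j ℕ.* Q)))
              (*-monoˡ-∣ (+ (5 ℕ.^ (weight j ℕ.* Q))) (∣-pow (e j) (c j) (proj₁ (proj₂ (exponent j))) x))))
          where
          Q = q t* v u
          x = B t* ℕ.+ v ℕ.* r ℕ.+ u

        -- The dominant column is compared with a column j₀ that has a nonzero coefficient; as this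
        -- coefficient is below 5^E₀, the exponent e j₀ is at most E₀.
        not-capped : ¬ (cap ℕ.≤ e j*)
        not-capped p = ℕ.<⇒≱ (begin-strict
            e j*                                  ≤⟨ ℕ.m≤m+n (e j*) _ ⟩
            φ t* j*                               ≤⟨ proj₂ (proj₂ (best t*)) j₀ j₀< ⟩
            e j₀ ℕ.+ weight j₀ ℕ.* Pos t*         ≤⟨ ℕ.+-mono-≤ e₀≤ (ℕ.*-mono-≤ (ℕ.m∸n≤m J (suc j₀)) (Pos-max t* (J ℕ.∸ t*) (ℕ.m+[n∸m]≡n (ℕ.<⇒≤ t*<)))) ⟩
            E₀ ℕ.+ J ℕ.* Pos J                    <⟨ ℕ.n<1+n _ ⟩
            cap ∎) p
          where
          open ℕ.≤-Reasoning
          j₀ = proj₁ nonzero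
          i₀ = proj₁ (proj₂ nonzero)
          j₀< = proj₁ (proj₂ (proj₂ nonzero))
          i₀< = proj₁ (proj₂ (proj₂ (proj₂ nonzero)))
          ne = proj₂ (proj₂ (proj₂ (proj₂ nonzero)))
          abs≢0 : ℤ.∣ c j₀ i₀ ∣ ≢ 0
          abs≢0 z = ne (ℤ.∣i∣≡0⇒i≡0 z)
          e₀≤ : e j₀ ℕ.≤ E₀
          e₀≤ with e j₀ ℕ.≤? E₀
          ... | yes p = p
          ... | no  p = contradiction (ℕ.<-≤-trans (small j₀ i₀) (ℕ.≤-trans (ℕ.^-monoʳ-≤ 5 (ℕ.<⇒≤ (ℕ.≰⇒> p)))
                  (ℕ∣.∣⇒≤ {{ℕ.≢-nonZero abs≢0}} (∣⇒∣ᵤ (proj₁ (proj₂ (exponent j₀)) i₀ i₀<))))) (ℕ.<-irrefl refl)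

        c′ : ℕ → ℤ
        c′ i with i ℕ.<? I
        ... | yes p = _∣_.quotient (proj₁ (proj₂ (exponent j*)) i p)
        ... | no  _ = + 0

        c′-eq : ∀ i → i ℕ.< I → c j* i ≡ c′ i * + (5 ℕ.^ e j*)
        c′-eq i p with i ℕ.<? I
        ... | yes p′ = _∣_.equality (proj₁ (proj₂ (exponent j*)) i p′)
        ... | no ¬p  = contradiction p ¬p

        value-eq : ∀ x → value I (c j*) x ≡ + (5 ℕ.^ e j*) * value I c′ x
        value-eq x = go I (λ i p → c′-eq i p)
          where
          F = + (5 ℕ.^ e j*)
          eq : ∀ F s c b → F * s + (c * F) * b ≡ F * (s + c * b)
          eq = ℤR.solve-∀
          go : ∀ n → (∀ i → i ℕ.< n → c j* i ≡ c′ i * F) → value n (c j*) x ≡ F * value n c′ x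
          go zero    h = sym (ℤ.*-zeroʳ F)
          go (suc n) h = trans (cong₂ _+_ (go n (λ i p → h i (ℕ.m<n⇒m<1+n p))) (cong (_* + bin x n) (h n ℕ.≤-refl)))
            (eq F (value n c′ x) (c′ n) (+ bin x n))

        divisible′ : ∀ v u → v ℕ.< V → u ℕ.< U → + (5 ℕ.^ G) ∣ value I c′ (B t* ℕ.+ v ℕ.* r ℕ.+ u)
        divisible′ v u v< u< = *-cancelˡ-∣ (+ (5 ℕ.^ e j*)) {{ℕ.m^n≢0 5 (e j*)}}
          (subst₂ _∣_ (5^+ (e j*) G) (value-eq _) (divisible v u v< u<))

      -- After division by 5^(e j*) the dominant column still has values divisible by 5^G on a whole
      -- grid. By `content` its coefficients admit another factor 5, against the maximality of e j*.
      contradiction-from-vanishing : ⊥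
      contradiction-from-vanishing with proj₂ (proj₂ (exponent j*))
      ... | inj₁ p = not-capped p
      ... | inj₂ n = n (λ i p → subst₂ _∣_ (sym (5^+ 1 (e j*))) (sym (c′-eq i p))
        (*-monoˡ-∣ (+ (5 ℕ.^ e j*)) (content I U V r (B t*) h G c′ I≤ U≤r I< (pts t* t*<) loss divisible′ i p)))

-- Construction of the auxiliary function

module AuxiliaryFunction where

  open Rationals
  open NewtonSeries
  open Pigeonhole
  open BinomialPolynomials using (value)
  open import Data.Nat as ℕ using (ℕ; zero; suc)
  import Data.Nat.Properties as ℕ
  open import Data.Nat.DivMod using (_%_; m%n<n; m≡m%n+[m/n]*n; m<n*o⇒m/o<n; [m+kn]%n≡m%n; m<n⇒m%n≡m; +-distrib-/-∣ʳ; m<n⇒m/n≡0; m*n/n≡m) renaming (_/_ to _/ℕ_)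
  open import Data.Nat.Divisibility using (n∣m*n)
  open import Data.Integer as ℤ using (ℤ)
  import Data.Integer.Properties as ℤ
  import Data.Integer.DivMod as ℤ
  import Data.Rational.Unnormalised as ℚᵘ
  import Data.Rational.Unnormalised.Properties as ℚᵘ
  open import Data.Rational hiding (round)
  open import Data.Rational.Properties
  open import Data.Rational.Solver
  open import Data.Product using (_×_; _,_; ∃; ∃₂; proj₁; proj₂)
  open import Relation.Binary.PropositionalEquality hiding ([_]; J)
  open import Relation.Nullary using (yes; no)
  open import Relation.Nullary.Decidable using (from-yes)
  open +-*-Solver

  ι-sum : ∀ n f → ι (sumℤ n f) ≡ sum n (λ i → ι (f i))
  ι-sum zero    f = ι-lit 0
  ι-sum (suc n) f = trans (ι-+ (sumℤ n f) (f n)) (cong (_+ ι (f n)) (ι-sum n f))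

  ∣ι∣≤ : ∀ {z A} → ℤ.∣ z ∣ ℕ.≤ A → ∣ ι z ∣ ≤ ν A
  ∣ι∣≤ {z} p = ≤-trans (≤-reflexive (∣ι∣ z)) (ν-mono p)

  abstract
    round : ℚ → ℤ
    round q = ↥ q ℤ./ ↧ q

    private
      clear-denominator : ∀ q → q * ν (↧ₙ q) ≡ ι (↥ q)
      clear-denominator q@record{} = toℚᵘ-injective (ℚᵘ.≃-trans (toℚᵘ-homo-* q (ν (↧ₙ q)))
        (ℚᵘ.≃-trans (ℚᵘ.*-congˡ {toℚᵘ q} (ℚᵘ.≃-reflexive (toℚᵘ-ι (ℤ.+ ↧ₙ q))))
          (ℚᵘ.≃-trans (ℚᵘ.*≡* (trans (ℤ.*-identityʳ _) (cong (↥ q ℤ.*_) (sym (ℤ.*-identityʳ (ℤ.+ ↧ₙ q))))))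
            (ℚᵘ.≃-reflexive (sym (toℚᵘ-ι (↥ q)))))))

    round-error : ∀ q → ∣ q - ι (round q) ∣ ≤ 1ℚ
    round-error q = ∣0≤∣ lower upper
      where
      d r : ℕ
      d = ↧ₙ q
      r = ↥ q ℤ.% ↧ q
      0<d : 0ℚ < ν d
      0<d = <-≤-trans (from-yes (0ℚ <? 1ℚ)) (subst (_≤ ν d) (ι-lit 1) (ν-mono (ℕ.s≤s ℕ.z≤n)))
      instance
        pd : Positive (ν d)
        pd = positive 0<d
      eq : (q - ι (round q)) * ν d ≡ ν r
      eq = trans (solve 3 (λ q t d → (q :- t) :* d := q :* d :- t :* d) refl q (ι (round q)) (ν d))
        (trans (cong₂ _-_ (trans (clear-denominator q) (trans (cong ι (ℤ.a≡a%n+[a/n]*n (↥ q) (↧ q))) (ι-+ (ℤ.+ r) (round q ℤ.* ↧ q)))) (sym (ι-* (round q) (↧ q))))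
          (solve 2 (λ r t → (r :+ t) :- t := r) refl (ν r) (ι (round q ℤ.* ↧ q))))
      lower : 0ℚ ≤ q - ι (round q)
      lower = *-cancelʳ-≤-pos (ν d) (≤-trans (≤-reflexive (*-zeroˡ (ν d))) (≤-trans (0≤ν r) (≤-reflexive (sym eq))))
      upper : q - ι (round q) ≤ 1ℚ
      upper = *-cancelʳ-≤-pos (ν d) (≤-trans (≤-reflexive eq) (≤-trans (ν-mono (ℕ.<⇒≤ (ℤ.n%d<d (↥ q) (↧ q)))) (≤-reflexive (sym (*-identityˡ (ν d))))))

  round-bound : ∀ q A → ∣ q ∣ + 1ℚ ≤ ν A → ℤ.∣ round q ∣ ℕ.≤ A
  round-bound q A h = ν-cancel-≤ (≤-trans (≤-reflexive (sym (∣ι∣ (round q)))) (≤-trans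
    (≤-trans (≤-reflexive (cong ∣_∣ (eq q (ι (round q)))))
      (∣-∣≤ {q} {q - ι (round q)} ≤-refl (round-error q))) h))
    where
    eq : ∀ q t → t ≡ q - (q - t)
    eq = solve 2 (λ q t → t := q :- (q :- t)) refl

  -- There are N = J I unknowns bounded by C, and M conditions whose coefficients, scaled by 2^E,
  -- are bounded by A. The goal is Newton coefficients of size 2^(-Z - t s): `head` obtains it from
  -- Siegel's lemma for s < M, `tail` from the natural decay 2^(-e s) for s ≥ M.
  record Parameters : Set where
    field
      I J M C A E Z t e a : ℕ
      {{I≢0}} : ℕ.NonZero I
    N : ℕ
    N = J ℕ.* I
    field
      count   : suc (N ℕ.* (A ℕ.* C) ℕ.+ N ℕ.* (A ℕ.* C)) ℕ.^ M ℕ.< suc C ℕ.^ N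
      A-large : pow 4ℚ M * two E + 1ℚ ≤ ν A
      NC≤     : ν (N ℕ.* C) ≤ two a
      head    : a ℕ.+ (Z ℕ.+ t ℕ.* M) ℕ.≤ E
      tail    : ∀ s → M ℕ.≤ s → a ℕ.+ (I ℕ.+ suc e ℕ.* I) ℕ.+ (Z ℕ.+ t ℕ.* s) ℕ.≤ e ℕ.* s

  module Auxiliary (P : Parameters) (w : ℚ)
    (W≤2 : ∀ j → j ℕ.< Parameters.J P → ∣ pow w j ∣ ≤ 2ℚ) (η≤ : ∀ j → j ℕ.< Parameters.J P → ∣ pow w j - 1ℚ ∣ ≤ half (suc (Parameters.e P))) where

    open Parameters P

    private
      D : ℕ → ℕ → ℕ → ℚ
      D j i s = coeff (pow w j) (pow w j - 1ℚ) i s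

      -- The true coefficients are rational. Siegel's lemma is applied to rounded multiples, so its
      -- solution makes the first Newton coefficients small rather than zero.
      θ : ℕ → ℕ → ℕ → ℤ
      θ s j i = round (D j i s * two E)

      η̄≤2 : half (suc e) ≤ 2ℚ
      η̄≤2 = ≤-trans (pow≤1 (suc e) 0≤½ ½≤1) 1≤2

      D≤4^ : ∀ j i s → j ℕ.< J → ∣ D j i s ∣ ≤ pow 4ℚ s
      D≤4^ j i s j< = coeff≤4^ {pow w j} {pow w j - 1ℚ} {half (suc e)} (W≤2 j j<) (η≤ j j<) η̄≤2 i s

      θ≤ : ∀ s x → s ℕ.< M → x ℕ.< N → ℤ.∣ θ s (x /ℕ I) (x % I) ∣ ℕ.≤ A
      θ≤ s x s< x< = round-bound _ A (≤-trans (+-monoˡ-≤ 1ℚ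
        (∣*∣≤ (≤-trans (D≤4^ (x /ℕ I) (x % I) s (m<n*o⇒m/o<n x<)) (pow-monoʳ (from-yes (1ℚ ≤? 4ℚ)) (ℕ.<⇒≤ s<)))
          (∣0≤∣ (0≤two E) ≤-refl))) A-large)

      abstract
        solution : ∃ λ (c : ℕ → ℤ) → (∃ λ x → x ℕ.< N × c x ≢ ℤ.+ 0) × (∀ x → ℤ.∣ c x ∣ ℕ.≤ C) ×
          (∀ s → s ℕ.< M → sumℤ N (λ x → θ s (x /ℕ I) (x % I) ℤ.* c x) ≡ ℤ.+ 0)
        solution = siegel M N A C (λ s x → θ s (x /ℕ I) (x % I)) θ≤ count

      flat : ℕ → ℤ
      flat = proj₁ solution

    c : ℕ → ℕ → ℤ
    c j i = flat (i ℕ.+ j ℕ.* I)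

    c-nonzero : ∃₂ λ j i → j ℕ.< J × i ℕ.< I × c j i ≢ ℤ.+ 0
    c-nonzero = x /ℕ I , x % I , m<n*o⇒m/o<n x< , m%n<n x I , λ z → ne (trans (cong flat (m≡m%n+[m/n]*n x I)) z)
      where
      x = proj₁ (proj₁ (proj₂ solution))
      x< = proj₁ (proj₂ (proj₁ (proj₂ solution)))
      ne = proj₂ (proj₂ (proj₁ (proj₂ solution)))

    c≤ : ∀ j i → ℤ.∣ c j i ∣ ℕ.≤ C
    c≤ j i = proj₁ (proj₂ (proj₂ solution)) (i ℕ.+ j ℕ.* I)

    private
      kernel : ∀ s → s ℕ.< M → sumℤ J (λ j → sumℤ I (λ i → θ s j i ℤ.* c j i)) ≡ ℤ.+ 0
      kernel s s< = trans (sumℤ-cong J (λ j _ → sumℤ-cong I (λ i i< → cong (ℤ._* c j i)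
          (cong₂ (θ s) (sym (quot i j i<)) (sym (rem i j i<))))))
        (trans (sym (sumℤ-flatten J I (λ x → θ s (x /ℕ I) (x % I) ℤ.* flat x))) (proj₂ (proj₂ (proj₂ solution)) s s<))
        where
        rem : ∀ i j → i ℕ.< I → (i ℕ.+ j ℕ.* I) % I ≡ i
        rem i j p = trans ([m+kn]%n≡m%n i j I) (m<n⇒m%n≡m p)
        quot : ∀ i j → i ℕ.< I → (i ℕ.+ j ℕ.* I) /ℕ I ≡ j
        quot i j p = trans (+-distrib-/-∣ʳ i (n∣m*n j)) (cong₂ ℕ._+_ (m<n⇒m/n≡0 p) (m*n/n≡m j I))

      Φ : ℕ → ℚ
      Φ s = sum J (λ j → sum I (λ i → ι (c j i) * D j i s))

      double-bound : ∀ {f : ℕ → ℕ → ℚ} {b} → (∀ j i → j ℕ.< J → i ℕ.< I → ∣ f j i ∣ ≤ b) → ∣ sum J (λ j → sum I (f j)) ∣ ≤ ν N * b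
      double-bound {f} {b} h = ≤-trans (sum-bound J (λ j j< → sum-bound I (λ i i< → h j i j< i<)))
        (≤-reflexive (trans (sym (*-assoc (ν J) (ν I) b)) (cong (_* b) (sym (ν-* J I)))))

      -- The rounded parts cancel. What remains of 2^E Φ s is a combination of rounding errors, at
      -- most N C ≤ 2^a.
      Φ-head : ∀ s → s ℕ.< M → ∣ Φ s ∣ ≤ two a * half E
      Φ-head s s< = ≤-trans (≤-reflexive (cong ∣_∣ scaled)) (∣*∣≤ error≤ (≤-reflexive (∣half∣ E)))
        where
        δ : ℕ → ℕ → ℚ
        δ j i = D j i s * two E - ι (θ s j i)
        R : ℚ
        R = sum J (λ j → sum I (λ i → ι (c j i) * δ j i))
        error≤ : ∣ R ∣ ≤ two a
        error≤ = ≤-trans (double-bound {λ j i → ι (c j i) * δ j i} (λ j i _ _ → ∣*∣≤ {ι (c j i)} {δ j i} (∣ι∣≤ {c j i} (c≤ j i)) (round-error (D j i s * two E))))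
          (≤-trans (≤-reflexive (trans (cong (ν N *_) (*-identityʳ (ν C))) (sym (ν-* N C)))) NC≤)
        zero-sum : sum J (λ j → sum I (λ i → ι (θ s j i) * ι (c j i))) ≡ 0ℚ
        zero-sum = trans (sym (trans (ι-sum J _) (sum-cong J (λ j _ → trans (ι-sum I _) (sum-cong I (λ i _ → ι-* (θ s j i) (c j i)))))))
          (trans (cong ι (kernel s s<)) (ι-lit 0))
        expand : Φ s * two E ≡ R
        expand = trans (*-comm (Φ s) (two E)) (trans (sym (sum-* J (two E) _)) (trans (sum-cong J (λ j _ →
            trans (sym (sum-* I (two E) _)) (trans (sum-cong I (λ i _ →
              solve 4 (λ T c D t → T :* (c :* D) := c :* (D :* T :- t) :+ t :* c) refl (two E) (ι (c j i)) (D j i s) (ι (θ s j i))))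
              (sum-+ I _ _)))) (trans (sum-+ J _ _) (trans (cong (R +_) zero-sum) (+-identityʳ R)))))
        scaled : Φ s ≡ R * half E
        scaled = trans (sym (*-identityʳ (Φ s))) (trans (cong (Φ s *_) (sym (two*half E)))
          (trans (sym (*-assoc (Φ s) (two E) (half E))) (cong (_* half E) expand)))

      -- `coeff-bound` is used with η̄ = 2^(-e-1). The cost 2^i 2^((e+1) i) of the binomial factor
      -- is bounded once and for all by i < I, while the decay 2^(-e s) is kept.
      Φ-tail : ∀ s → ∣ Φ s ∣ ≤ two a * (two (I ℕ.+ suc e ℕ.* I) * pow (half e) s)
      Φ-tail s = ≤-trans (double-bound {λ j i → ι (c j i) * D j i s} (λ j i j< i< → ∣*∣≤ {ι (c j i)} {D j i s} (∣ι∣≤ {c j i} (c≤ j i)) (D≤ j i j< i<)))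
        (≤-trans (≤-reflexive (trans (sym (*-assoc (ν N) (ν C) X)) (cong (_* X) (sym (ν-* N C)))))
          (*-monoʳ X (0≤* (0≤two (I ℕ.+ suc e ℕ.* I)) (0≤pow s (0≤half e))) NC≤))
        where
        X = two (I ℕ.+ suc e ℕ.* I) * pow (half e) s
        D≤ : ∀ j i → j ℕ.< J → i ℕ.< I → ∣ D j i s ∣ ≤ X
        D≤ j i j< i< = begin
          ∣ D j i s ∣ ≡⟨ trans (sym (*-identityʳ ∣ D j i s ∣)) (cong (∣ D j i s ∣ *_) (sym (trans (*-comm (half (suc e ℕ.* i)) (two (suc e ℕ.* i))) (two*half (suc e ℕ.* i))))) ⟩
          ∣ D j i s ∣ * (half (suc e ℕ.* i) * two (suc e ℕ.* i)) ≡⟨ trans (sym (*-assoc ∣ D j i s ∣ (half (suc e ℕ.* i)) (two (suc e ℕ.* i)))) (cong (λ z → ∣ D j i s ∣ * z * two (suc e ℕ.* i)) (pow-*′ ½ (suc e) i)) ⟩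
          ∣ D j i s ∣ * pow (half (suc e)) i * two (suc e ℕ.* i)
            ≤⟨ *-monoʳ (two (suc e ℕ.* i)) (0≤two (suc e ℕ.* i)) (coeff-bound {pow w j} {pow w j - 1ℚ} {half (suc e)} (W≤2 j j<) (η≤ j j<) i s) ⟩
          two i * pow (2ℚ * half (suc e)) s * two (suc e ℕ.* i)
            ≡⟨ cong (λ z → two i * pow z s * two (suc e ℕ.* i)) (solve 1 (λ h → con 2ℚ :* (con ½ :* h) := h) refl (half e)) ⟩
          two i * pow (half e) s * two (suc e ℕ.* i)
            ≡⟨ solve 3 (λ a b c → a :* b :* c := (a :* c) :* b) refl (two i) (pow (half e) s) (two (suc e ℕ.* i)) ⟩
          (two i * two (suc e ℕ.* i)) * pow (half e) s
            ≡⟨ cong (_* pow (half e) s) (sym (pow-+ 2ℚ i (suc e ℕ.* i))) ⟩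
          two (i ℕ.+ suc e ℕ.* i) * pow (half e) s
            ≤⟨ *-monoʳ (pow (half e) s) (0≤pow s (0≤half e)) (two-mono (ℕ.+-mono-≤ (ℕ.<⇒≤ i<) (ℕ.*-monoʳ-≤ (suc e) (ℕ.<⇒≤ i<)))) ⟩
          X ∎
          where open ≤-Reasoning

      Φ-bound : ∀ s → ∣ Φ s ∣ ≤ half Z * pow (half t) s
      Φ-bound s with s ℕ.<? M
      ... | yes s< = ≤-trans (Φ-head s s<) (≤-trans (two*half≤ {a} {E} {Z ℕ.+ t ℕ.* s}
          (ℕ.≤-trans (ℕ.+-monoʳ-≤ a (ℕ.+-monoʳ-≤ Z (ℕ.*-monoʳ-≤ t (ℕ.<⇒≤ s<)))) head))
          (≤-reflexive (trans (pow-+ ½ Z (t ℕ.* s)) (cong (half Z *_) (pow-*′ ½ t s)))))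
      ... | no s≮ = ≤-trans (Φ-tail s) (≤-trans (≤-reflexive (trans (sym (*-assoc (two a) (two b) _))
          (cong₂ _*_ (sym (pow-+ 2ℚ a b)) (sym (pow-*′ ½ e s)))))
          (≤-trans (two*half≤ {a ℕ.+ b} {e ℕ.* s} {Z ℕ.+ t ℕ.* s} (tail s (ℕ.≮⇒≥ s≮)))
          (≤-reflexive (trans (pow-+ ½ Z (t ℕ.* s)) (cong (half Z *_) (pow-*′ ½ t s))))))
        where
        b = I ℕ.+ suc e ℕ.* I

    f : ℕ → ℚ
    f x = sum J (λ j → ι (value I (c j) x) * pow (pow w j) x)

    private
      f-newton : ∀ x → newton Φ x ≡ f x
      f-newton x = trans (newton-sum J _ x) (sum-cong J (λ j _ → trans (newton-sum I _ x)
        (trans (sum-cong I (λ i _ → trans (newton-* (ι (c j i)) _ x)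
           (trans (cong (ι (c j i) *_) (newton-coeff (W≡ (pow w j)) i x))
             (solve 3 (λ c b p → c :* (b :* p) := p :* (c :* b)) refl (ι (c j i)) (ν (bin x i)) (pow (pow w j) x)))))
        (trans (sum-* I (pow (pow w j) x) _) (trans (*-comm (pow (pow w j) x) _)
          (cong (_* pow (pow w j) x) (sym (trans (ι-sum I _) (sum-cong I (λ i _ → ι-* (c j i) (ℤ.+ bin x i)))))))))))
        where
        W≡ : ∀ W → W ≡ 1ℚ + (W - 1ℚ)
        W≡ = solve 1 (λ W → W := con 1ℚ :+ (W :- con 1ℚ)) refl

    f-small : ∀ x → ∣ f x ∣ ≤ half Z * pow (1ℚ + half t) x
    f-small x = ≤-trans (≤-reflexive (cong ∣_∣ (sym (f-newton x)))) (newton-bound {Φ} {half Z} {half t} x Φ-bound)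

-- From small values of the auxiliary function to 5-adic relations

module VanishingPoints where

  open import Defs using (S)
  open Rationals
  open DominantRoot
  open Pigeonhole
  open FiveAdicValuation using (pow5-coprime; prime5)
  open BinomialPolynomials using (value)
  open Zeros
  open AuxiliaryFunction using (ι-sum)
  open import Data.Nat as ℕ using (ℕ; zero; suc)
  import Data.Nat.Properties as ℕ
  import Data.Nat.Divisibility as ℕ∣
  open import Data.Nat.Primality using (euclidsLemma)
  import Data.Nat.Tactic.RingSolver as ℕR
  open import Data.Integer as ℤ using (ℤ)
  import Data.Integer.Properties as ℤ
  open import Data.Integer.Divisibility.Signed using (_∣_; divides; ∣m∣n⇒∣m+n; ∣m∣n⇒∣m-n; ∣m⇒∣m*n; ∣ᵤ⇒∣; ∣⇒∣ᵤ; *-cancelˡ-∣)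
  import Data.Integer.Tactic.RingSolver as ℤR
  open import Data.Rational
  open import Data.Rational.Properties
  open import Data.Rational.Solver
  open import Data.Sum using (inj₁; inj₂)
  open import Relation.Binary.PropositionalEquality hiding ([_]; J)
  open import Relation.Nullary using (¬_; yes; no; contradiction)
  open import Relation.Nullary.Decidable using (from-yes)
  open +-*-Solver

  other-terms : ∀ {d} n f j → j ℕ.< n → (∀ i → i ℕ.< n → i ≢ j → d ∣ f i) → d ∣ sumℤ n f → d ∣ f j
  other-terms {d} (suc n) f j j< h s with j ℕ.≟ n
  ... | yes refl = subst (d ∣_) (eq (sumℤ n f) (f n)) (∣m∣n⇒∣m-n s (all n (λ i i< → h i (ℕ.m<n⇒m<1+n i<) (λ e → ℕ.<⇒≢ i< e))))
    where
    eq : ∀ a b → a ℤ.+ b ℤ.- a ≡ b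
    eq = ℤR.solve-∀
    all : ∀ m → (∀ i → i ℕ.< m → d ∣ f i) → d ∣ sumℤ m f
    all zero    h = divides (ℤ.+ 0) refl
    all (suc m) h = ∣m∣n⇒∣m+n (all m (λ i p → h i (ℕ.m<n⇒m<1+n p))) (h m ℕ.≤-refl)
  ... | no ne = other-terms n f j (ℕ.≤∧≢⇒< (ℕ.s≤s⁻¹ j<) ne) (λ i p → h i (ℕ.m<n⇒m<1+n p))
    (subst (d ∣_) (eq (sumℤ n f) (f n)) (∣m∣n⇒∣m-n s (h n ℕ.≤-refl (λ e → ne (sym e)))))
    where
    eq : ∀ a b → a ℤ.+ b ℤ.- b ≡ a
    eq = ℤR.solve-∀

  -- the Tribonacci-Lucas recurrence can be run backwards, down to S 1 = 1
  consecutive : ∀ d C t → d ∣ C ℤ.* ℤ.+ S t → d ∣ C ℤ.* ℤ.+ S (suc t) → d ∣ C ℤ.* ℤ.+ S (suc (suc t)) → d ∣ C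
  consecutive d C zero    a b c = subst (d ∣_) (ℤ.*-identityʳ C) b
  consecutive d C (suc t) a b c = consecutive d C t (subst (d ∣_) (eq C (ℤ.+ S (suc (suc t))) (ℤ.+ S (suc t)) (ℤ.+ S t)) (∣m∣n⇒∣m-n (∣m∣n⇒∣m-n c b) a)) a b
    where
    eq : ∀ C x y z → C ℤ.* (x ℤ.+ y ℤ.+ z) ℤ.- C ℤ.* x ℤ.- C ℤ.* y ≡ C ℤ.* z
    eq = ℤR.solve-∀

  not5-* : ∀ {a b} → ¬ (5 ℕ∣.∣ a) → ¬ (5 ℕ∣.∣ b) → ¬ (5 ℕ∣.∣ a ℕ.* b)
  not5-* {a} {b} p q d with euclidsLemma a b prime5 d
  ... | inj₁ r = p r
  ... | inj₂ r = q r

  not5-^ : ∀ {a} n → ¬ (5 ℕ∣.∣ a) → ¬ (5 ℕ∣.∣ a ℕ.^ n)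
  not5-^ zero    p d = contradiction (ℕ∣.∣⇒≤ d) (λ { (ℕ.s≤s ()) })
  not5-^ {a} (suc n) p = not5-* {a} {a ℕ.^ n} p (not5-^ n p)

  ^-∙ : ∀ a b n → (a ℕ.* b) ℕ.^ n ≡ a ℕ.^ n ℕ.* b ℕ.^ n
  ^-∙ a b zero    = refl
  ^-∙ a b (suc n) = trans (cong (a ℕ.* b ℕ.*_) (^-∙ a b n)) (eq a b (a ℕ.^ n) (b ℕ.^ n))
    where
    eq : ∀ a b x y → a ℕ.* b ℕ.* (x ℕ.* y) ≡ a ℕ.* x ℕ.* (b ℕ.* y)
    eq = ℕR.solve-∀

  -- Sizes are given as binary logarithms: λ′ for J, α for the values of the C_j, β for the
  -- monomials, Ω for the smallness of all errors. Then γ bounds the sequence G, and T is an index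
  -- at which it vanishes.
  module Vanishing (I J : ℕ) (c : ℕ → ℕ → ℤ) {ε ω : ℚ} (lo≤ω : lo₀ ≤ ω) (ω≤hi : ω ≤ hi₀) (tiny : ∣ trib ω ∣ ≤ ε)
    (λ′ α β : ℕ) (Ω : ℕ) (J≤ : ν J ≤ two λ′) (ε≤ : ε ≤ half Ω) where

    open Decay ω lo≤ω ω≤hi
    open Approx ε tiny
    open ZeroEstimate I J c

    γ T : ℕ
    γ = λ′ ℕ.+ α ℕ.+ β ℕ.+ 4
    T = (γ ℕ.+ 5) ℕ.* 3

    -- `W` stands for w^x and `y` for the v-th power of 9 ω^n / (10^k B), which is almost 1. The
    -- equation `point` trades w^x for integers and a power of ω.
    module Point (budget : 2 ℕ.* T ℕ.+ 4 ℕ.* γ ℕ.+ λ′ ℕ.+ α ℕ.+ 3 ℕ.* β ℕ.+ 40 ℕ.≤ Ω)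
      (x q p X′ Z : ℕ) (W y : ℚ)
      (C≤ : ∀ j → j ℕ.< J → ν ℤ.∣ value I (c j) x ∣ ≤ two α)
      (terms≤ : ∀ j → j ℕ.< J → pow (ν (5 ℕ.^ q ℕ.* X′)) (weight j) * pow (ν Z) j * two (j ℕ.* p) ≤ two β)
      (jp≤ : ∀ j → j ℕ.< J → j ℕ.* p ℕ.≤ β)
      (X≤ : pow (ν (5 ℕ.^ q ℕ.* X′)) (J ℕ.∸ 1) ≤ two β)
      (point : ν (5 ℕ.^ q ℕ.* X′) * W ≡ ν Z * pow ω p * y)
      (y≤ : ∀ j → j ℕ.< J → ∣ 1ℚ - pow y j ∣ ≤ half Ω)
      (f≤ : ∣ sum J (λ j → ι (value I (c j) x) * pow W j) ∣ ≤ half Ω)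
      (5∤X′ : ¬ (5 ℕ∣.∣ X′)) (5∤Z : ¬ (5 ℕ∣.∣ Z)) where

      private
        X : ℕ
        X = 5 ℕ.^ q ℕ.* X′
        C : ℕ → ℤ
        C j = value I (c j) x
        m : ℕ → ℕ
        m j = X ℕ.^ weight j ℕ.* Z ℕ.^ j
        G : ℕ → ℤ
        G τ = sumℤ J (λ j → C j ℤ.* ℤ.+ m j ℤ.* ℤ.+ S (j ℕ.* p ℕ.+ τ))

        a : ℕ → ℚ
        a j = ι (C j) * ν (m j)

        ν-m : ∀ j → ν (m j) ≡ pow (ν X) (weight j) * pow (ν Z) j
        ν-m j = trans (ν-* (X ℕ.^ weight j) (Z ℕ.^ j)) (cong₂ _*_ (ν-^ X (weight j)) (ν-^ Z j))

        ∣a∣≤ : ∀ j → j ℕ.< J → ∣ a j ∣ * two (j ℕ.* p) ≤ two (α ℕ.+ β)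
        ∣a∣≤ j j< = ≤-trans (≤-reflexive (trans (cong (_* two (j ℕ.* p)) (trans (∣p*q∣≡∣p∣*∣q∣ (ι (C j)) (ν (m j)))
            (cong₂ _*_ (∣ι∣ (C j)) (0≤p⇒∣p∣≡p (0≤ν (m j)))))) (*-assoc (ν ℤ.∣ C j ∣) (ν (m j)) (two (j ℕ.* p)))))
          (≤-trans (*-mono (0≤ν ℤ.∣ C j ∣) (0≤* (0≤ν (m j)) (0≤two (j ℕ.* p))) (C≤ j j<)
            (≤-trans (≤-reflexive (cong (_* two (j ℕ.* p)) (ν-m j))) (terms≤ j j<)))
            (≤-reflexive (sym (pow-+ 2ℚ α β))))

        ι-G : ∀ τ → ι (G τ) ≡ sum J (λ j → a j * ν (S (j ℕ.* p ℕ.+ τ)))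
        ι-G τ = trans (ι-sum J _) (sum-cong J (λ j _ → trans (ι-* (C j ℤ.* ℤ.+ m j) (ℤ.+ S (j ℕ.* p ℕ.+ τ)))
          (cong (_* ν (S (j ℕ.* p ℕ.+ τ))) (ι-* (C j) (ℤ.+ m j)))))

        J-bound : ∀ {g : ℕ → ℚ} {b} → 0ℚ ≤ b → (∀ j → j ℕ.< J → ∣ g j ∣ ≤ b) → ∣ sum J g ∣ ≤ two λ′ * b
        J-bound {g} {b} 0≤b h = ≤-trans (sum-bound J h) (*-monoʳ b 0≤b J≤)

        G≤ : ∀ τ → ∣ ι (G τ) ∣ ≤ two (λ′ ℕ.+ α ℕ.+ β ℕ.+ 2) * two τ
        G≤ τ = ≤-trans (≤-reflexive (cong ∣_∣ (ι-G τ))) (≤-trans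
          (J-bound {λ j → a j * ν (S (j ℕ.* p ℕ.+ τ))} {two (α ℕ.+ β) * (4ℚ * two τ)} (0≤* (0≤two (α ℕ.+ β)) (0≤* (0≤lit 4) (0≤two τ)))
            (λ j j< → ≤-trans (∣*∣≤ {a j} ≤-refl (∣S∣≤ (j ℕ.* p ℕ.+ τ)))
              (≤-trans (≤-reflexive (trans (cong (λ z → ∣ a j ∣ * (3ℚ * z)) (pow-+ 2ℚ (j ℕ.* p) τ))
                  (solve 3 (λ a t s → a :* (con 3ℚ :* (t :* s)) := (a :* t) :* (con 3ℚ :* s)) refl ∣ a j ∣ (two (j ℕ.* p)) (two τ))))
                (*-mono (0≤* (0≤∣p∣ (a j)) (0≤two (j ℕ.* p))) (0≤* (0≤lit 3) (0≤two τ)) (∣a∣≤ j j<)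
                  (*-monoʳ (two τ) (0≤two τ) (from-yes (3ℚ ≤? 4ℚ)))))))
          (≤-reflexive (trans (solve 3 (λ l u s → l :* (u :* (con 4ℚ :* s)) := (l :* u) :* con (two 2) :* s) refl (two λ′) (two (α ℕ.+ β)) (two τ))
            (cong (_* two τ) (trans (cong (_* two 2) (sym (pow-+ 2ℚ λ′ (α ℕ.+ β)))) (trans (sym (pow-+ 2ℚ (λ′ ℕ.+ (α ℕ.+ β)) 2))
              (cong (λ e → two (e ℕ.+ 2)) (sym (ℕ.+-assoc λ′ α β)))))))))

        -- Up to the factor ω^τ `comp₀` and the defect of ω this is the component of G along ω,
        -- since S (j p + τ) contributes ω^(j p + τ).
        U : ℚ
        U = sum J (λ j → a j * pow (pow ω p) j)

        expand-residual : ∀ τ → residual (λ i → ι (G i)) τ ≡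
          pow ω τ * comp₀ * U + sum J (λ j → a j * (comp (j ℕ.* p ℕ.+ τ) - pow ω (j ℕ.* p ℕ.+ τ) * comp₀))
        expand-residual τ = trans (cong₂ _+_ (cong₂ _+_ (ι-G _) (cong (ω̇ *_) (ι-G _))) (cong (κ *_) (ι-G _)))
          (trans (cong₂ (λ u v → sum J (λ j → a j * s j (suc (suc τ))) + u + v) (sym (sum-* J ω̇ _)) (sym (sum-* J κ _)))
          (trans (cong (_+ sum J (λ j → κ * (a j * s j τ))) (sym (sum-+ J _ _)))
          (trans (sym (sum-+ J _ _))
          (trans (sum-cong J (λ j _ → trans (cong₂ (λ u v → a j * ν (S u) + ω̇ * (a j * ν (S v)) + κ * (a j * s j τ)) (trans (ℕ.+-suc (j ℕ.* p) (suc τ)) (cong suc (ℕ.+-suc (j ℕ.* p) τ))) (ℕ.+-suc (j ℕ.* p) τ))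
              (trans (regroup j) (cong (λ z → pow ω τ * comp₀ * (a j * z) + a j * (comp (j ℕ.* p ℕ.+ τ) - pow ω (j ℕ.* p ℕ.+ τ) * comp₀)) (pow-* ω j p)))))
          (trans (sum-+ J _ _) (cong (_+ sum J (λ j → a j * (comp (j ℕ.* p ℕ.+ τ) - pow ω (j ℕ.* p ℕ.+ τ) * comp₀))) (sum-* J (pow ω τ * comp₀) _)))))))
          where
          s : ℕ → ℕ → ℚ
          s j t = ν (S (j ℕ.* p ℕ.+ t))
          regroup : ∀ j → let e = j ℕ.* p ℕ.+ τ in a j * ν (S (suc (suc e))) + ω̇ * (a j * ν (S (suc e))) + κ * (a j * ν (S e))
            ≡ pow ω τ * comp₀ * (a j * pow ω (j ℕ.* p)) + a j * (comp e - pow ω e * comp₀)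
          regroup j = trans (solve 9 (λ a x y z v k c w u → a :* x :+ v :* (a :* y) :+ k :* (a :* z)
              := w :* c :* (a :* u) :+ a :* ((x :+ v :* y :+ k :* z) :- (u :* w) :* c)) refl
              (a j) (ν (S (suc (suc (j ℕ.* p ℕ.+ τ))))) (ν (S (suc (j ℕ.* p ℕ.+ τ)))) (ν (S (j ℕ.* p ℕ.+ τ))) ω̇ κ comp₀ (pow ω τ) (pow ω (j ℕ.* p)))
            (cong (λ z → pow ω τ * comp₀ * (a j * pow ω (j ℕ.* p)) + a j * (comp (j ℕ.* p ℕ.+ τ) - z * comp₀)) (sym (pow-+ ω (j ℕ.* p) τ)))

        Yterm : ℕ → ℚ
        Yterm j = a j * pow (pow ω p) j

        Yterm≤ : ∀ j → j ℕ.< J → ∣ Yterm j ∣ ≤ two (α ℕ.+ β)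
        Yterm≤ j j< = ≤-trans (∣*∣≤ {a j} ≤-refl (≤-trans (≤-reflexive (cong ∣_∣ (sym (pow-* ω j p)))) (∣powω∣≤ (j ℕ.* p)))) (∣a∣≤ j j<)

        weight+ : ∀ j → j ℕ.< J → weight j ℕ.+ j ≡ J ℕ.∸ 1
        weight+ j j< = go J j<
          where
          go : ∀ J → j ℕ.< J → J ℕ.∸ suc j ℕ.+ j ≡ J ℕ.∸ 1
          go (suc J) (ℕ.s≤s p) = ℕ.m∸n+n≡m p

        -- By `point`, X^(J-1) W^j = X^(J-1-j) Z^j ω^(p j) y^j. So U is X^(J-1) times the auxiliary
        -- function at x, up to replacing powers of y by 1; both parts are tiny.
        U-split : U ≡ sum J (λ j → Yterm j * (1ℚ - pow y j)) + pow (ν X) (J ℕ.∸ 1) * sum J (λ j → ι (C j) * pow W j)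
        U-split = trans (sum-cong J (λ j j< → trans (solve 2 (λ t u → t := t :* (con 1ℚ :- u) :+ t :* u) refl (Yterm j) (pow y j))
            (cong (λ z → Yterm j * (1ℚ - pow y j) + z) (step j j<))))
          (trans (sum-+ J _ _) (cong (sum J (λ j → Yterm j * (1ℚ - pow y j)) +_) (sum-* J (pow (ν X) (J ℕ.∸ 1)) _)))
          where
          step : ∀ j → j ℕ.< J → Yterm j * pow y j ≡ pow (ν X) (J ℕ.∸ 1) * (ι (C j) * pow W j)
          step j j< = begin
            ι (C j) * ν (m j) * pow (pow ω p) j * pow y j
              ≡⟨ cong (λ z → ι (C j) * z * pow (pow ω p) j * pow y j) (ν-m j) ⟩
            ι (C j) * (pow (ν X) (weight j) * pow (ν Z) j) * pow (pow ω p) j * pow y j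
              ≡⟨ solve 5 (λ C X Z w y → C :* (X :* Z) :* w :* y := C :* X :* ((Z :* w) :* y)) refl (ι (C j)) (pow (ν X) (weight j)) (pow (ν Z) j) (pow (pow ω p) j) (pow y j) ⟩
            ι (C j) * pow (ν X) (weight j) * (pow (ν Z) j * pow (pow ω p) j * pow y j)
              ≡⟨ cong (ι (C j) * pow (ν X) (weight j) *_) (trans (cong (_* pow y j) (sym (pow-∙ (ν Z) (pow ω p) j))) (trans (sym (pow-∙ (ν Z * pow ω p) y j))
                   (trans (cong (λ z → pow z j) (sym point)) (pow-∙ (ν X) W j)))) ⟩
            ι (C j) * pow (ν X) (weight j) * (pow (ν X) j * pow W j)
              ≡⟨ solve 4 (λ C A B w → C :* A :* (B :* w) := (A :* B) :* (C :* w)) refl (ι (C j)) (pow (ν X) (weight j)) (pow (ν X) j) (pow W j) ⟩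
            (pow (ν X) (weight j) * pow (ν X) j) * (ι (C j) * pow W j)
              ≡⟨ cong (_* (ι (C j) * pow W j)) (trans (sym (pow-+ (ν X) (weight j) j)) (cong (pow (ν X)) (weight+ j j<))) ⟩
            pow (ν X) (J ℕ.∸ 1) * (ι (C j) * pow W j) ∎
            where open ≡-Reasoning

        U≤ : ∣ U ∣ ≤ two (λ′ ℕ.+ (α ℕ.+ β)) * half Ω + two β * half Ω
        U≤ = ≤-trans (≤-reflexive (cong ∣_∣ U-split)) (∣+∣≤
          (≤-trans (J-bound {λ j → Yterm j * (1ℚ - pow y j)} {two (α ℕ.+ β) * half Ω} (0≤* (0≤two (α ℕ.+ β)) (0≤half Ω))
              (λ j j< → ∣*∣≤ {Yterm j} (Yterm≤ j j<) (y≤ j j<)))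
            (≤-reflexive (trans (sym (*-assoc (two λ′) (two (α ℕ.+ β)) (half Ω))) (cong (_* half Ω) (sym (pow-+ 2ℚ λ′ (α ℕ.+ β)))))))
          (∣*∣≤ {pow (ν X) (J ℕ.∸ 1)} (∣0≤∣ (0≤pow (J ℕ.∸ 1) (0≤ν X)) X≤) f≤))

        err≤ : ∀ τ → ∣ sum J (λ j → a j * (comp (j ℕ.* p ℕ.+ τ) - pow ω (j ℕ.* p ℕ.+ τ) * comp₀)) ∣ ≤
          two (λ′ ℕ.+ (α ℕ.+ β)) * (half Ω * (two 2 * two (2 ℕ.* (β ℕ.+ τ))))
        err≤ τ = ≤-trans (J-bound {λ j → a j * (comp (j ℕ.* p ℕ.+ τ) - pow ω (j ℕ.* p ℕ.+ τ) * comp₀)} {two (α ℕ.+ β) * Y} (0≤* (0≤two (α ℕ.+ β)) 0≤Y)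
            (λ j j< → ∣*∣≤ {a j} (≤-trans (≤-trans (≤-reflexive (sym (*-identityʳ ∣ a j ∣))) (*-monoˡ ∣ a j ∣ (0≤∣p∣ (a j)) (1≤pow (j ℕ.* p) 1≤2))) (∣a∣≤ j j<))
              (≤-trans (comp-error (j ℕ.* p ℕ.+ τ)) (*-mono 0≤ε (0≤* (0≤lit 4) (0≤pow (j ℕ.* p ℕ.+ τ) (0≤lit 4))) ε≤
                (*-monoˡ 4ℚ (0≤lit 4) (≤-trans (≤-reflexive (sym (pow-*′ 2ℚ 2 (j ℕ.* p ℕ.+ τ)))) (two-mono (ℕ.*-monoʳ-≤ 2 (ℕ.+-monoˡ-≤ τ (jp≤ j j<))))))))))
          (≤-reflexive (trans (sym (*-assoc (two λ′) (two (α ℕ.+ β)) Y)) (cong (_* Y) (sym (pow-+ 2ℚ λ′ (α ℕ.+ β))))))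
          where
          Y = half Ω * (two 2 * two (2 ℕ.* (β ℕ.+ τ)))
          0≤Y : 0ℚ ≤ Y
          0≤Y = 0≤* (0≤half Ω) (0≤* (0≤two 2) (0≤two (2 ℕ.* (β ℕ.+ τ))))

        -- The range extends to 1 + T because the decay is also applied to G shifted by 1 and by 2.
        residual≤ : ∀ τ → τ ℕ.≤ 1 ℕ.+ T → ∣ residual (λ i → ι (G i)) τ ∣ ≤ half (4 ℕ.* γ ℕ.+ 24)
        residual≤ τ τ≤ = ≤-trans (≤-reflexive (cong ∣_∣ (expand-residual τ))) (≤-trans
          (∣+∣≤ (∣*∣≤ {pow ω τ * comp₀} (∣*∣≤ {pow ω τ} (∣powω∣≤ τ) (∣0≤∣ 0≤comp₀ comp₀≤8)) U≤) (err≤ τ))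
          (≤-trans (≤-reflexive rearrange) (≤-trans (+-mono-≤ (+-mono-≤
              (two*half≤ {τ ℕ.+ 3 ℕ.+ u} {Ω} {Δ} (ℕ.≤-trans (b₁ τ≤) budget))
              (two*half≤ {τ ℕ.+ 3 ℕ.+ β} {Ω} {Δ} (ℕ.≤-trans (b₂ τ≤) budget)))
              (two*half≤ {u ℕ.+ 2 ℕ.+ 2 ℕ.* (β ℕ.+ τ)} {Ω} {Δ} (ℕ.≤-trans (b₃ τ≤) budget)))
            three)))
          where
          u = λ′ ℕ.+ (α ℕ.+ β)
          Δ = 4 ℕ.* γ ℕ.+ 26
          rearrange : two τ * 8ℚ * (two u * half Ω + two β * half Ω) + two u * (half Ω * (two 2 * two (2 ℕ.* (β ℕ.+ τ))))
            ≡ two (τ ℕ.+ 3 ℕ.+ u) * half Ω + two (τ ℕ.+ 3 ℕ.+ β) * half Ω + two (u ℕ.+ 2 ℕ.+ 2 ℕ.* (β ℕ.+ τ)) * half Ω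
          rearrange = trans (solve 5 (λ t u h b v → t :* con 8ℚ :* (u :* h :+ b :* h) :+ u :* (h :* (con (two 2) :* v))
              := (t :* con (two 3) :* u) :* h :+ (t :* con (two 3) :* b) :* h :+ (u :* con (two 2) :* v) :* h) refl (two τ) (two u) (half Ω) (two β) (two (2 ℕ.* (β ℕ.+ τ))))
            (cong₂ _+_ (cong₂ _+_ (cong (_* half Ω) (three-pow τ 3 u)) (cong (_* half Ω) (three-pow τ 3 β))) (cong (_* half Ω) (three-pow u 2 (2 ℕ.* (β ℕ.+ τ)))))
            where
            three-pow : ∀ a b c → two a * two b * two c ≡ two (a ℕ.+ b ℕ.+ c)
            three-pow a b c = trans (cong (_* two c) (sym (pow-+ 2ℚ a b))) (sym (pow-+ 2ℚ (a ℕ.+ b) c))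
          three : half Δ + half Δ + half Δ ≤ half (4 ℕ.* γ ℕ.+ 24)
          three = ≤-trans (≤-reflexive (trans (cong (λ e → half e + half e + half e) (sym (ℕ.+-assoc (4 ℕ.* γ) 24 2)))
              (trans (cong (λ h → h + h + h) (pow-+ ½ (4 ℕ.* γ ℕ.+ 24) 2))
                (solve 1 (λ h → h :* con (half 2) :+ h :* con (half 2) :+ h :* con (half 2) := con (½ + half 2) :* h) refl (half (4 ℕ.* γ ℕ.+ 24))))))
            (≤-trans (*-monoʳ (half (4 ℕ.* γ ℕ.+ 24)) (0≤half (4 ℕ.* γ ℕ.+ 24)) (from-yes (½ + half 2 ≤? 1ℚ))) (≤-reflexive (*-identityˡ (half (4 ℕ.* γ ℕ.+ 24)))))
          open ℕ.≤-Reasoning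
          B = 2 ℕ.* T ℕ.+ 4 ℕ.* γ ℕ.+ λ′ ℕ.+ α ℕ.+ 3 ℕ.* β ℕ.+ 40
          b₁ : τ ℕ.≤ 1 ℕ.+ T → τ ℕ.+ 3 ℕ.+ u ℕ.+ Δ ℕ.≤ B
          b₁ h = begin
            τ ℕ.+ 3 ℕ.+ u ℕ.+ Δ                 ≤⟨ ℕ.+-monoˡ-≤ Δ (ℕ.+-monoˡ-≤ u (ℕ.+-monoˡ-≤ 3 h)) ⟩
            1 ℕ.+ T ℕ.+ 3 ℕ.+ u ℕ.+ Δ           ≤⟨ ℕ.m≤m+n _ (T ℕ.+ 2 ℕ.* β ℕ.+ 10) ⟩
            1 ℕ.+ T ℕ.+ 3 ℕ.+ u ℕ.+ Δ ℕ.+ (T ℕ.+ 2 ℕ.* β ℕ.+ 10) ≡⟨ eq T γ λ′ α β ⟩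
            B ∎
            where
            eq : ∀ T γ l α β → 1 ℕ.+ T ℕ.+ 3 ℕ.+ (l ℕ.+ (α ℕ.+ β)) ℕ.+ (4 ℕ.* γ ℕ.+ 26) ℕ.+ (T ℕ.+ 2 ℕ.* β ℕ.+ 10) ≡ 2 ℕ.* T ℕ.+ 4 ℕ.* γ ℕ.+ l ℕ.+ α ℕ.+ 3 ℕ.* β ℕ.+ 40
            eq = ℕR.solve-∀
          b₂ : τ ℕ.≤ 1 ℕ.+ T → τ ℕ.+ 3 ℕ.+ β ℕ.+ Δ ℕ.≤ B
          b₂ h = ℕ.≤-trans (ℕ.+-monoˡ-≤ Δ (ℕ.+-monoʳ-≤ (τ ℕ.+ 3) (ℕ.≤-trans (ℕ.m≤n+m β α) (ℕ.m≤n+m (α ℕ.+ β) λ′)))) (b₁ h)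
          b₃ : τ ℕ.≤ 1 ℕ.+ T → u ℕ.+ 2 ℕ.+ 2 ℕ.* (β ℕ.+ τ) ℕ.+ Δ ℕ.≤ B
          b₃ h = begin
            u ℕ.+ 2 ℕ.+ 2 ℕ.* (β ℕ.+ τ) ℕ.+ Δ   ≤⟨ ℕ.+-monoˡ-≤ Δ (ℕ.+-monoʳ-≤ (u ℕ.+ 2) (ℕ.*-monoʳ-≤ 2 (ℕ.+-monoʳ-≤ β h))) ⟩
            u ℕ.+ 2 ℕ.+ 2 ℕ.* (β ℕ.+ (1 ℕ.+ T)) ℕ.+ Δ ≤⟨ ℕ.m≤m+n _ 10 ⟩
            u ℕ.+ 2 ℕ.+ 2 ℕ.* (β ℕ.+ (1 ℕ.+ T)) ℕ.+ Δ ℕ.+ 10 ≡⟨ eq T γ λ′ α β ⟩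
            B ∎
            where
            eq : ∀ T γ l α β → l ℕ.+ (α ℕ.+ β) ℕ.+ 2 ℕ.+ 2 ℕ.* (β ℕ.+ (1 ℕ.+ T)) ℕ.+ (4 ℕ.* γ ℕ.+ 26) ℕ.+ 10 ≡ 2 ℕ.* T ℕ.+ 4 ℕ.* γ ℕ.+ l ℕ.+ α ℕ.+ 3 ℕ.* β ℕ.+ 40
            eq = ℕR.solve-∀

        G≤shift : ∀ i → i ℕ.≤ 2 → ∀ τ → ∣ ι (G (i ℕ.+ τ)) ∣ ≤ two γ * two τ
        G≤shift i i≤ τ = ≤-trans (G≤ (i ℕ.+ τ)) (≤-trans (*-monoˡ (two g) (0≤two g) (two-mono (ℕ.+-monoˡ-≤ τ i≤)))
          (≤-reflexive (trans (cong (two g *_) (pow-+ 2ℚ 2 τ)) (trans (sym (*-assoc (two g) (two 2) (two τ)))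
            (cong (_* two τ) (trans (sym (pow-+ 2ℚ g 2)) (cong two (ℕ.+-assoc (λ′ ℕ.+ α ℕ.+ β) 2 2))))))))
          where
          g = λ′ ℕ.+ α ℕ.+ β ℕ.+ 2

        G-zero : ∀ i → i ℕ.≤ 2 → G (i ℕ.+ T) ≡ ℤ.+ 0
        G-zero 0 i≤ = decay-zero G γ (G≤shift 0 i≤) (λ τ p → residual≤ τ (ℕ.≤-trans (ℕ.<⇒≤ p) (ℕ.m≤n+m T 1)))
        G-zero 1 i≤ = decay-zero (λ τ → G (1 ℕ.+ τ)) γ (G≤shift 1 i≤) (λ τ p → residual≤ (1 ℕ.+ τ) (ℕ.≤-trans p (ℕ.m≤n+m T 1)))
        G-zero 2 i≤ = decay-zero (λ τ → G (2 ℕ.+ τ)) γ (G≤shift 2 i≤) (λ τ p → residual≤ (2 ℕ.+ τ) (ℕ.s≤s p))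
        G-zero (suc (suc (suc i))) (ℕ.s≤s (ℕ.s≤s ()))

        m≡ : ∀ j → m j ≡ 5 ℕ.^ (weight j ℕ.* q) ℕ.* (X′ ℕ.^ weight j ℕ.* Z ℕ.^ j)
        m≡ j = trans (cong (ℕ._* Z ℕ.^ j) (trans (^-∙ (5 ℕ.^ q) X′ (weight j))
          (cong (ℕ._* X′ ℕ.^ weight j) (trans (ℕ.^-*-assoc 5 q (weight j)) (cong (5 ℕ.^_) (ℕ.*-comm q (weight j)))))))
          (ℕ.*-assoc (5 ℕ.^ (weight j ℕ.* q)) (X′ ℕ.^ weight j) (Z ℕ.^ j))

      -- At T, T + 1 and T + 2 the terms of G sum to 0, so the j-th is divisible by 5^(K + weight j
      -- · q) if the others are. Its factor m j accounts for exactly weight j · q of this, and three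
      -- consecutive indices remove the factor S.
      vanishes : Vanishes x q
      vanishes j j< K others = consecutive (ℤ.+ (5 ℕ.^ K)) (C j) (j ℕ.* p ℕ.+ T) (at 0 ℕ.z≤n)
        (subst (λ e → ℤ.+ (5 ℕ.^ K) ∣ C j ℤ.* ℤ.+ S e) (ℕ.+-suc (j ℕ.* p) T) (at 1 (ℕ.s≤s ℕ.z≤n)))
        (subst (λ e → ℤ.+ (5 ℕ.^ K) ∣ C j ℤ.* ℤ.+ S e) (trans (ℕ.+-suc (j ℕ.* p) (suc T)) (cong suc (ℕ.+-suc (j ℕ.* p) T))) (at 2 (ℕ.s≤s (ℕ.s≤s ℕ.z≤n))))
        where
        F = 5 ℕ.^ (weight j ℕ.* q)
        n = X′ ℕ.^ weight j ℕ.* Z ℕ.^ j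
        term : ℕ → ℕ → ℤ
        term τ j′ = C j′ ℤ.* ℤ.+ m j′ ℤ.* ℤ.+ S (j′ ℕ.* p ℕ.+ τ)
        F*K : ℤ.+ (5 ℕ.^ (K ℕ.+ weight j ℕ.* q)) ≡ ℤ.+ F ℤ.* ℤ.+ (5 ℕ.^ K)
        F*K = trans (cong ℤ.+_ (trans (ℕ.^-distribˡ-+-* 5 K (weight j ℕ.* q)) (ℕ.*-comm (5 ℕ.^ K) F))) (ℤ.pos-* F (5 ℕ.^ K))
        at : ∀ i → i ℕ.≤ 2 → ℤ.+ (5 ℕ.^ K) ∣ C j ℤ.* ℤ.+ S (j ℕ.* p ℕ.+ (i ℕ.+ T))
        at i i≤ = ∣ᵤ⇒∣ (pow5-coprime K {n} (not5-* (not5-^ (weight j) 5∤X′) (not5-^ j 5∤Z)) ℤ.∣ C j ℤ.* s ∣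
          (subst (5 ℕ.^ K ℕ∣.∣_) (ℤ.abs-* (ℤ.+ n) (C j ℤ.* s)) (∣⇒∣ᵤ (*-cancelˡ-∣ (ℤ.+ F) {{ℕ.m^n≢0 5 (weight j ℕ.* q)}}
            (subst₂ _∣_ F*K (trans (cong (λ z → C j ℤ.* z ℤ.* s) (trans (cong ℤ.+_ (m≡ j)) (ℤ.pos-* F n))) (eq (C j) (ℤ.+ F) (ℤ.+ n) s))
              (other-terms J (term τ) j j< (λ j′ j′< ne → subst (ℤ.+ (5 ℕ.^ (K ℕ.+ weight j ℕ.* q)) ∣_) (sym (split j′))
                  (∣m⇒∣m*n _ (others j′ j′< ne)))
                (subst (ℤ.+ (5 ℕ.^ (K ℕ.+ weight j ℕ.* q)) ∣_) (sym (G-zero i i≤)) (divides (ℤ.+ 0) refl))))))))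
          where
          τ = i ℕ.+ T
          s = ℤ.+ S (j ℕ.* p ℕ.+ τ)
          eq : ∀ C F n s → C ℤ.* (F ℤ.* n) ℤ.* s ≡ F ℤ.* (n ℤ.* (C ℤ.* s))
          eq = ℤR.solve-∀
          split : ∀ j′ → term τ j′ ≡ C j′ ℤ.* ℤ.+ (5 ℕ.^ (weight j′ ℕ.* q)) ℤ.* (ℤ.+ (X′ ℕ.^ weight j′ ℕ.* Z ℕ.^ j′) ℤ.* ℤ.+ S (j′ ℕ.* p ℕ.+ τ))
          split j′ = trans (cong (λ z → C j′ ℤ.* z ℤ.* ℤ.+ S (j′ ℕ.* p ℕ.+ τ)) (trans (cong ℤ.+_ (m≡ j′)) (ℤ.pos-* (5 ℕ.^ (weight j′ ℕ.* q)) _)))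
            (eq₂ (C j′) _ _ _)
            where
            eq₂ : ∀ C F n s → C ℤ.* (F ℤ.* n) ℤ.* s ≡ C ℤ.* F ℤ.* (n ℤ.* s)
            eq₂ = ℤR.solve-∀

-- Closeness of 9 α^n and 10^k B

module RatioEstimate where

  open import Defs using (S)
  open Rationals
  open DominantRoot
  open import Data.Nat as ℕ using (ℕ; zero; suc)
  import Data.Nat.Properties as ℕ
  import Data.Nat.Tactic.RingSolver as ℕR
  open import Data.Integer as ℤ using (ℤ)
  open import Data.Rational
  open import Data.Rational.Properties
  open import Data.Rational.Solver
  open import Data.Sum using (inj₁; inj₂)
  open import Relation.Binary.PropositionalEquality hiding ([_]; J)
  open import Relation.Nullary using (yes; no; contradiction)
  open import Relation.Nullary.Decidable using (from-yes)
  open +-*-Solver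

  1/10 10ℚ 9ℚ : ℚ
  1/10 = ℤ.+ 1 / 10
  10ℚ = lit 10
  9ℚ = lit 9

  ten : ℕ → ℚ
  ten = pow 10ℚ

  tenth : ℕ → ℚ
  tenth = pow 1/10

  0≤ten : ∀ n → 0ℚ ≤ ten n
  0≤ten n = 0≤pow n (0≤lit 10)

  0≤1/10 : 0ℚ ≤ 1/10
  0≤1/10 = from-yes (0ℚ ≤? 1/10)

  0≤tenth : ∀ n → 0ℚ ≤ tenth n
  0≤tenth n = 0≤pow n 0≤1/10

  ten*tenth : ∀ n → ten n * tenth n ≡ 1ℚ
  ten*tenth n = trans (sym (pow-∙ 10ℚ 1/10 n)) (pow-1 n)

  ν-10^ : ∀ n → ν (10 ℕ.^ n) ≡ ten n
  ν-10^ n = trans (ν-^ 10 n) (cong (λ z → pow z n) (ι-lit 10))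

  pow-cancel : ∀ {x y} n → 0ℚ ≤ y → pow x (suc n) ≤ pow y (suc n) → x ≤ y
  pow-cancel {x} {y} n 0≤y h with ≤-total x y
  ... | inj₁ p = p
  ... | inj₂ p with x ≤? y
  ... | yes q = q
  ... | no ¬q = contradiction (<-≤-trans (pow-< n) h) (<-irrefl refl)
    where
    y<x : y < x
    y<x = ≰⇒> ¬q
    pow-< : ∀ n → pow y (suc n) < pow x (suc n)
    pow-< zero    = subst₂ _<_ (sym (*-identityʳ y)) (sym (*-identityʳ x)) y<x
    pow-< (suc n) = ≤-<-trans (*-monoˡ y 0≤y (<⇒≤ (pow-< n)))
      (*-monoˡ-<-pos (pow x (suc n)) {{positive (≤-<-trans (0≤pow (suc n) 0≤y) (pow-< n))}} y<x)

  pow-1-error : ∀ {x} n → ∣ x ∣ ≤ 2ℚ → ∣ pow x n - 1ℚ ∣ ≤ pow 4ℚ n * ∣ x - 1ℚ ∣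
  pow-1-error {x} zero h = ≤-trans (0≤∣p∣ (x - 1ℚ)) (≤-reflexive (sym (*-identityˡ ∣ x - 1ℚ ∣)))
  pow-1-error {x} (suc n) h = ≤-trans (≤-reflexive (cong ∣_∣ (eq x (pow x n))))
    (≤-trans (∣+∣≤ {x * (pow x n - 1ℚ)} (∣*∣≤ {x} h (pow-1-error n h)) ≤-refl)
    (≤-trans (≤-reflexive (solve 2 (λ p d → con 2ℚ :* (p :* d) :+ d := (con 2ℚ :* p :+ con 1ℚ) :* d) refl (pow 4ℚ n) ∣ x - 1ℚ ∣))
      (*-monoʳ ∣ x - 1ℚ ∣ (0≤∣p∣ (x - 1ℚ)) (≤-trans (+-monoʳ-≤ (2ℚ * pow 4ℚ n) (≤-trans (1≤pow n (from-yes (1ℚ ≤? 4ℚ)))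
        (≤-trans (≤-reflexive (sym (*-identityˡ (pow 4ℚ n)))) (*-monoʳ (pow 4ℚ n) (0≤pow n (0≤lit 4)) 1≤2))))
        (≤-reflexive (solve 1 (λ p → con 2ℚ :* p :+ con 2ℚ :* p := con 4ℚ :* p) refl (pow 4ℚ n)))))))
    where
    eq : ∀ x p → x * p - 1ℚ ≡ x * (p - 1ℚ) + (x - 1ℚ)
    eq = solve 2 (λ x p → x :* p :- con 1ℚ := x :* (p :- con 1ℚ) :+ (x :- con 1ℚ)) refl

  module Ratio {n k l B : ℕ} (equation : 9 ℕ.* S n ℕ.+ 9 ≡ 10 ℕ.^ k ℕ.* B ℕ.+ 10 ℕ.^ l) (B+1 : suc B ≡ 9 ℕ.* 10 ℕ.^ l)
    {ω : ℚ} (0≤ω : 0ℚ ≤ ω) (approx : ∣ ν (S n) - pow ω n ∣ ≤ lit 6) where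

    B≥ : 10 ℕ.^ l ℕ.≤ B
    B≥ = ℕ.s≤s⁻¹ (subst (suc (10 ℕ.^ l) ℕ.≤_) (sym B+1) (ℕ.≤-trans (ℕ.+-monoˡ-≤ (10 ℕ.^ l) (ℕ.m^n>0 10 l))
      (ℕ.≤-trans (ℕ.m≤m+n (10 ℕ.^ l ℕ.+ 10 ℕ.^ l) (7 ℕ.* 10 ℕ.^ l)) (ℕ.≤-reflexive (eq (10 ℕ.^ l))))))
      where
      eq : ∀ x → x ℕ.+ x ℕ.+ 7 ℕ.* x ≡ 9 ℕ.* x
      eq = ℕR.solve-∀

    P : ℚ
    P = ten k * ν B

    ten≤B : ten l ≤ ν B
    ten≤B = ≤-trans (≤-reflexive (sym (ν-10^ l))) (ν-mono B≥)

    1≤ten : ∀ n → 1ℚ ≤ ten n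
    1≤ten n = 1≤pow n (from-yes (1ℚ ≤? 10ℚ))

    1≤B : 1ℚ ≤ ν B
    1≤B = ≤-trans (1≤ten l) ten≤B

    instance
      B-pos : Positive (ν B)
      B-pos = positive (<-≤-trans (from-yes (0ℚ <? 1ℚ)) 1≤B)
      B-nz : NonZero (ν B)
      B-nz = pos⇒nonZero (ν B)

    invB : ℚ
    invB = 1/ ν B

    B*invB : ν B * invB ≡ 1ℚ
    B*invB = *-inverseʳ (ν B)

    ν-equation : 9ℚ * ν (S n) + 9ℚ ≡ P + ten l
    ν-equation = trans (sym (trans (ν-+ (9 ℕ.* S n) 9) (cong₂ _+_ (trans (ν-* 9 (S n)) (cong (_* ν (S n)) (ι-lit 9))) (ι-lit 9))))
      (trans (cong ν equation) (trans (ν-+ (10 ℕ.^ k ℕ.* B) (10 ℕ.^ l)) (cong₂ _+_ (trans (ν-* (10 ℕ.^ k) B) (cong (_* ν B) (ν-10^ k))) (ν-10^ l))))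

    -- 9 ω^n - P = 10^l - 9 - 9 (S n - ω^n), and 64 = 1 + 9 + 9 · 6.
    difference : ∣ 9ℚ * pow ω n - P ∣ ≤ lit 64 * ten l
    difference = ≤-trans (≤-reflexive (cong ∣_∣ (trans (eq (pow ω n) (ν (S n)) P (ten l)) (cong (λ z → z - 9ℚ * (ν (S n) - pow ω n)) (trans (cong (λ z → z - 9ℚ - P) ν-equation) (eq₂ P (ten l)))))))
      (≤-trans (∣-∣≤ {ten l - 9ℚ} (∣-∣≤ {ten l} {9ℚ} (∣0≤∣ (0≤ten l) ≤-refl) (≤-refl {9ℚ})) (∣*∣≤ {9ℚ} (≤-refl {9ℚ}) approx))
      (≤-trans (+-mono-≤ (+-mono-≤ (≤-reflexive (sym (*-identityˡ (ten l)))) (*-monoˡ 9ℚ (0≤lit 9) (1≤ten l))) (*-monoˡ (9ℚ * lit 6) (0≤lit 54) (1≤ten l)))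
        (≤-reflexive (solve 1 (λ t → con 1ℚ :* t :+ con 9ℚ :* t :+ con (9ℚ * lit 6) :* t := con (lit 64) :* t) refl (ten l)))))
      where
      eq : ∀ w s P t → 9ℚ * w - P ≡ (9ℚ * s + 9ℚ - 9ℚ - P) - 9ℚ * (s - w)
      eq = solve 4 (λ w s P t → con 9ℚ :* w :- P := (con 9ℚ :* s :+ con 9ℚ :- con 9ℚ :- P) :- con 9ℚ :* (s :- w)) refl
      eq₂ : ∀ P t → P + t - 9ℚ - P ≡ t - 9ℚ
      eq₂ = solve 2 (λ P t → P :+ t :- con 9ℚ :- P := t :- con 9ℚ) refl

    -- The ratio 9 ω^n / (10^k B). It differs from 1 by O(10^(-k)), as B ≥ 10^l absorbs the factor
    -- 10^l of `difference`.
    y : ℚ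
    y = 9ℚ * pow ω n * (tenth k * invB)

    P*inv : P * (tenth k * invB) ≡ 1ℚ
    P*inv = trans (solve 4 (λ a b c d → (a :* b) :* (c :* d) := (a :* c) :* (b :* d)) refl (ten k) (ν B) (tenth k) invB)
      (trans (cong₂ _*_ (ten*tenth k) B*invB) (*-identityˡ 1ℚ))

    0≤invB : 0ℚ ≤ invB
    0≤invB = <⇒≤ (positive⁻¹ invB {{1/pos⇒pos (ν B)}})

    y-close : ∣ y - 1ℚ ∣ ≤ lit 64 * tenth k
    y-close = ≤-trans (≤-reflexive (cong ∣_∣ (trans (cong (λ z → y - z) (sym P*inv)) (eq (9ℚ * pow ω n) P (tenth k * invB)))))
      (≤-trans (∣*∣≤ {9ℚ * pow ω n - P} {tenth k * invB} difference (∣0≤∣ (0≤* (0≤tenth k) 0≤invB) ≤-refl))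
        (≤-trans (≤-reflexive (solve 4 (λ c t k i → (c :* t) :* (k :* i) := (c :* k) :* (t :* i)) refl (lit 64) (ten l) (tenth k) invB))
          (≤-trans (*-monoˡ (lit 64 * tenth k) (0≤* (0≤lit 64) (0≤tenth k)) (≤-trans (*-monoʳ invB 0≤invB ten≤B) (≤-reflexive B*invB)))
            (≤-reflexive (*-identityʳ (lit 64 * tenth k))))))
      where
      eq : ∀ a P i → a * i - P * i ≡ (a - P) * i
      eq = solve 3 (λ a P i → a :* i :- P :* i := (a :- P) :* i) refl

    power-upper : lit 64 * tenth k ≤ 1ℚ → pow ω n ≤ ten (k ℕ.+ suc l)
    power-upper h = *-cancelˡ-≤-pos 9ℚ (begin
      9ℚ * pow ω n                    ≡⟨ eq (9ℚ * pow ω n) P ⟩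
      P + (9ℚ * pow ω n - P)          ≤⟨ +-monoʳ-≤ P (≤-trans (p≤∣p∣ _) difference) ⟩
      P + lit 64 * ten l              ≤⟨ +-mono-≤ (*-monoˡ (ten k) (0≤ten k) B≤) 64≤ ⟩
      ten k * (9ℚ * ten l) + ten k * ten l ≡⟨ solve 2 (λ k l → k :* (con 9ℚ :* l) :+ k :* l := con 10ℚ :* (k :* l)) refl (ten k) (ten l) ⟩
      10ℚ * (ten k * ten l)           ≤⟨ *-monoʳ (ten k * ten l) (0≤* (0≤ten k) (0≤ten l)) (from-yes (10ℚ ≤? lit 90)) ⟩
      lit 90 * (ten k * ten l)        ≡⟨ solve 2 (λ k l → con (lit 90) :* (k :* l) := con 9ℚ :* (k :* (con 10ℚ :* l))) refl (ten k) (ten l) ⟩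
      9ℚ * (ten k * ten (suc l))      ≡⟨ cong (9ℚ *_) (sym (pow-+ 10ℚ k (suc l))) ⟩
      9ℚ * ten (k ℕ.+ suc l) ∎)
      where
      open ≤-Reasoning
      eq : ∀ a P → a ≡ P + (a - P)
      eq = solve 2 (λ a P → a := P :+ (a :- P)) refl
      B≤ : ν B ≤ 9ℚ * ten l
      B≤ = ≤-trans (ν-mono (ℕ.≤-trans (ℕ.n≤1+n B) (ℕ.≤-reflexive B+1))) (≤-reflexive (trans (ν-* 9 (10 ℕ.^ l)) (cong₂ _*_ (ι-lit 9) (ν-10^ l))))
      64≤ : lit 64 * ten l ≤ ten k * ten l
      64≤ = *-monoʳ (ten l) (0≤ten l) (≤-trans (≤-reflexive (trans (sym (*-identityʳ (lit 64))) (trans (cong (lit 64 *_) (trans (sym (ten*tenth k)) (*-comm (ten k) (tenth k)))) (sym (*-assoc (lit 64) (tenth k) (ten k))))))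
        (≤-trans (*-monoʳ (ten k) (0≤ten k) h) (≤-reflexive (*-identityˡ (ten k)))))

    power-lower : 1 ℕ.≤ l → lit 64 * tenth k ≤ ½ → ten k ≤ pow ω n
    power-lower 1≤l h = *-cancelˡ-≤-pos 9ℚ (≤-trans (*-monoʳ (ten k) (0≤ten k) 9≤) (≤-trans
        (≤-reflexive (solve 2 (λ k b → con ½ :* b :* k := (k :* b) :- con ½ :* (k :* b)) refl (ten k) (ν B)))
        (≤-trans (+-monoʳ-≤ P (neg-antimono-≤ 64≤)) (≤-trans (+-monoʳ-≤ P (≤-trans (neg-antimono-≤ difference) (neg-abs (9ℚ * pow ω n - P)))) (≤-reflexive (sym (eq (9ℚ * pow ω n) P)))))))
      where
      eq : ∀ a P → a ≡ P + (a - P)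
      eq = solve 2 (λ a P → a := P :+ (a :- P)) refl
      neg-abs : ∀ p → - ∣ p ∣ ≤ p
      neg-abs p = ≤-trans (neg-antimono-≤ (≤-trans (p≤∣p∣ (- p)) (≤-reflexive (∣-p∣≡∣p∣ p)))) (≤-reflexive (neg-involutive p))
        where
        neg-involutive : ∀ p → - (- p) ≡ p
        neg-involutive = solve 1 (λ p → :- (:- p) := p) refl
      89≤B : 89 ℕ.≤ B
      89≤B = ℕ.s≤s⁻¹ (subst (90 ℕ.≤_) (sym B+1) (ℕ.*-monoʳ-≤ 9 (ℕ.^-monoʳ-≤ 10 1≤l)))
      9≤ : 9ℚ ≤ ½ * ν B
      9≤ = ≤-trans (from-yes (9ℚ ≤? ½ * lit 89)) (*-monoˡ ½ 0≤½ (≤-trans (≤-reflexive (sym (ι-lit 89))) (ν-mono 89≤B)))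
      64≤ : lit 64 * ten l ≤ ½ * P
      64≤ = ≤-trans (≤-reflexive (trans (sym (*-identityʳ (lit 64 * ten l))) (trans (cong (lit 64 * ten l *_) (sym (ten*tenth k)))
          (solve 4 (λ c l k t → c :* l :* (k :* t) := (c :* t) :* (k :* l)) refl (lit 64) (ten l) (ten k) (tenth k)))))
        (*-mono (0≤* (0≤lit 64) (0≤tenth k)) (0≤* (0≤ten k) (0≤ten l)) h (*-monoˡ (ten k) (0≤ten k) ten≤B))

-- Exponents of α and 10, and the lattice of evaluation points

module Exponents where

  open Rationals
  open DominantRoot using (lo₀)
  open RatioEstimate
  open import Data.Nat as ℕ using (ℕ; suc)
  import Data.Nat.Properties as ℕ
  open import Data.Nat.DivMod using (_%_; m%n<n; m≡m%n+[m/n]*n) renaming (_/_ to _/ℕ_)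
  import Data.Nat.Tactic.RingSolver as ℕR
  open import Data.Rational
  open import Data.Rational.Properties
  open import Data.Rational.Solver
  open import Data.Sum using (inj₁; inj₂)
  open import Relation.Binary.PropositionalEquality hiding ([_]; J)
  open import Relation.Nullary using (yes; no; contradiction)
  open import Relation.Nullary.Decidable using (from-yes)
  open +-*-Solver

  tenth-anti : ∀ {m n} → m ℕ.≤ n → tenth n ≤ tenth m
  tenth-anti = pow-antiʳ 0≤1/10 (from-yes (1/10 ≤? 1ℚ))

  ten-mono : ∀ {m n} → m ℕ.≤ n → ten m ≤ ten n
  ten-mono = pow-monoʳ (from-yes (1ℚ ≤? 10ℚ))

  ten-tenth+ : ∀ a b → ten (a ℕ.+ b) * tenth a ≡ ten b
  ten-tenth+ a b = trans (cong (_* tenth a) (pow-+ 10ℚ a b)) (trans (solve 3 (λ x y z → (x :* y) :* z := (x :* z) :* y) refl (ten a) (ten b) (tenth a))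
    (trans (cong (_* ten b) (ten*tenth a)) (*-identityˡ (ten b))))

  tenth-ten+ : ∀ a b → ten a * tenth (a ℕ.+ b) ≡ tenth b
  tenth-ten+ a b = trans (cong (ten a *_) (pow-+ 1/10 a b)) (trans (sym (*-assoc (ten a) (tenth a) (tenth b)))
    (trans (cong (_* tenth b) (ten*tenth a)) (*-identityˡ (tenth b))))

  module NearOne {ω : ℚ} (0≤ω : 0ℚ ≤ ω) {n k l a b Q e : ℕ}
    (lower : ten k ≤ pow ω (suc n)) (upper : pow ω (suc n) ≤ ten (k ℕ.+ suc l))
    (up : a ℕ.* k ℕ.* Q ℕ.≤ b ℕ.* suc n ℕ.* Q ℕ.+ suc n) (lo : b ℕ.* suc n ℕ.* Q ℕ.≤ a ℕ.* k ℕ.* Q ℕ.+ suc n)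
    (small : suc l ℕ.* (a ℕ.* Q) ℕ.≤ suc n) (Q≡ : ν Q ≡ two (7 ℕ.+ e)) where

    private
      n₁ : ℕ
      n₁ = suc n

    w : ℚ
    w = pow ω a * tenth b

    0≤w : 0ℚ ≤ w
    0≤w = 0≤* (0≤pow a 0≤ω) (0≤tenth b)

    private
      w^ : pow (pow w Q) n₁ ≡ pow (pow ω n₁) (a ℕ.* Q) * tenth (b ℕ.* n₁ ℕ.* Q)
      w^ = trans (sym (pow-* w n₁ Q)) (trans (pow-∙ (pow ω a) (tenth b) (n₁ ℕ.* Q)) (cong₂ _*_
        (trans (sym (pow-* ω (n₁ ℕ.* Q) a)) (trans (cong (pow ω) (eq₁ n₁ Q a)) (pow-* ω (a ℕ.* Q) n₁)))
        (trans (sym (pow-* 1/10 (n₁ ℕ.* Q) b)) (cong tenth (eq₂ n₁ Q b)))))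
        where
        eq₁ : ∀ n Q a → n ℕ.* Q ℕ.* a ≡ a ℕ.* Q ℕ.* n
        eq₁ = ℕR.solve-∀
        eq₂ : ∀ n Q b → n ℕ.* Q ℕ.* b ≡ b ℕ.* n ℕ.* Q
        eq₂ = ℕR.solve-∀

      wQ≤100 : pow w Q ≤ lit 100
      wQ≤100 = pow-cancel n (0≤lit 100) (begin
        pow (pow w Q) n₁
          ≡⟨ w^ ⟩
        pow (pow ω n₁) (a ℕ.* Q) * tenth (b ℕ.* n₁ ℕ.* Q)
          ≤⟨ *-monoʳ (tenth (b ℕ.* n₁ ℕ.* Q)) (0≤tenth (b ℕ.* n₁ ℕ.* Q)) (≤-trans (pow-mono (a ℕ.* Q) (0≤pow n₁ 0≤ω) upper)
               (≤-trans (≤-reflexive (sym (pow-* 10ℚ (a ℕ.* Q) (k ℕ.+ suc l)))) (ten-mono exp≤))) ⟩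
        ten (b ℕ.* n₁ ℕ.* Q ℕ.+ n₁ ℕ.* 2) * tenth (b ℕ.* n₁ ℕ.* Q)
          ≡⟨ ten-tenth+ (b ℕ.* n₁ ℕ.* Q) (n₁ ℕ.* 2) ⟩
        ten (n₁ ℕ.* 2)
          ≡⟨ pow-* 10ℚ n₁ 2 ⟩
        pow (lit 100) n₁ ∎)
        where
        open ≤-Reasoning
        eq : ∀ a Q k l → a ℕ.* Q ℕ.* (k ℕ.+ l) ≡ a ℕ.* k ℕ.* Q ℕ.+ l ℕ.* (a ℕ.* Q)
        eq = ℕR.solve-∀
        eq₂ : ∀ x n → x ℕ.+ n ℕ.+ n ≡ x ℕ.+ n ℕ.* 2
        eq₂ = ℕR.solve-∀
        exp≤ : a ℕ.* Q ℕ.* (k ℕ.+ suc l) ℕ.≤ b ℕ.* n₁ ℕ.* Q ℕ.+ n₁ ℕ.* 2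
        exp≤ = ℕ.≤-trans (ℕ.≤-reflexive (eq a Q k (suc l))) (ℕ.≤-trans (ℕ.+-mono-≤ up small) (ℕ.≤-reflexive (eq₂ (b ℕ.* n₁ ℕ.* Q) n₁)))

      1/10≤wQ : 1/10 ≤ pow w Q
      1/10≤wQ = pow-cancel n (0≤pow Q 0≤w) (begin
        tenth n₁                                      ≡⟨ tenth-ten+ (a ℕ.* k ℕ.* Q) n₁ ⟨
        ten (a ℕ.* k ℕ.* Q) * tenth (a ℕ.* k ℕ.* Q ℕ.+ n₁)
          ≤⟨ *-mono (0≤ten (a ℕ.* k ℕ.* Q)) (0≤tenth (a ℕ.* k ℕ.* Q ℕ.+ n₁))
               (≤-trans (≤-reflexive (trans (cong ten (eq a k Q)) (pow-* 10ℚ (a ℕ.* Q) k))) (pow-mono (a ℕ.* Q) (0≤ten k) lower)) (tenth-anti lo) ⟩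
        pow (pow ω n₁) (a ℕ.* Q) * tenth (b ℕ.* n₁ ℕ.* Q) ≡⟨ w^ ⟨
        pow (pow w Q) n₁ ∎)
        where
        open ≤-Reasoning
        eq : ∀ a k Q → a ℕ.* k ℕ.* Q ≡ a ℕ.* Q ℕ.* k
        eq = ℕR.solve-∀

      τ : ℚ
      τ = half e

      0≤τ : 0ℚ ≤ τ
      0≤τ = 0≤half e

      129≤ : 1ℚ + two 7 ≤ pow (1ℚ + τ) Q
      129≤ = ≤-trans (≤-reflexive (cong (1ℚ +_) (sym (trans (cong (_* τ) (trans Q≡ (pow-+ 2ℚ 7 e)))
        (trans (*-assoc (two 7) (two e) τ) (trans (cong (two 7 *_) (two*half e)) (*-identityʳ (two 7)))))))) (bernoulli Q 0≤τ)

    -- Logarithms are avoided: the n₁-th power of w^Q lies between 10^(-n₁) and 100^n₁, so w^Q lies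
    -- between 1/10 and 100. By Bernoulli (1 + τ)^Q ≥ 129. Hence w > 1 + τ is impossible, and so is
    -- w < 1 - τ ≤ 1 / (1 + τ), which would give w^Q ≤ 1/129.
    near-one : ∣ w - 1ℚ ∣ ≤ half e
    near-one = ∣∣-bound above below
      where
      above : w - 1ℚ ≤ τ
      above with ≤-total w (1ℚ + τ)
      ... | inj₁ p = ≤-trans (+-monoˡ-≤ (- 1ℚ) p) (≤-reflexive (solve 1 (λ t → con 1ℚ :+ t :- con 1ℚ := t) refl τ))
      ... | inj₂ p = contradiction (≤-trans 129≤ (≤-trans (pow-mono Q (0≤+ 0≤1 0≤τ) p) wQ≤100)) (λ h → <-irrefl refl (<-≤-trans (from-yes (lit 100 <? 1ℚ + two 7)) h))
      below : - (w - 1ℚ) ≤ τ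
      below with ≤-total (1ℚ - τ) w
      ... | inj₁ p = ≤-trans (≤-reflexive (solve 1 (λ w → :- (w :- con 1ℚ) := con 1ℚ :- w) refl w))
                       (≤-trans (+-monoʳ-≤ 1ℚ (neg-antimono-≤ p)) (≤-reflexive (solve 1 (λ t → con 1ℚ :- (con 1ℚ :- t) := t) refl τ)))
      ... | inj₂ p = contradiction (≤-trans (*-mono 0≤1/10 (from-yes (0ℚ ≤? 1ℚ + two 7)) 1/10≤wQ 129≤)
                       (≤-trans (≤-reflexive (sym (pow-∙ w (1ℚ + τ) Q))) (pow≤1 Q (0≤* 0≤w (0≤+ 0≤1 0≤τ)) product≤1)))
                       (λ h → <-irrefl refl (<-≤-trans (from-yes (1ℚ <? 1/10 * (1ℚ + two 7))) h))
        where
        product≤1 : w * (1ℚ + τ) ≤ 1ℚ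
        product≤1 = ≤-trans (*-monoʳ (1ℚ + τ) (0≤+ 0≤1 0≤τ) p) (≤-trans (≤-reflexive (solve 1 (λ t → (con 1ℚ :- t) :* (con 1ℚ :+ t) := con 1ℚ :- t :* t) refl τ))
          (≤-trans (+-monoʳ-≤ 1ℚ (neg-antimono-≤ (0≤sq τ))) (from-yes (1ℚ + - 0ℚ ≤? 1ℚ))))

  -- The reason for the factor 4 is (9/5)^4 > 10.
  exponent-lower : ∀ {ω n K} → lo₀ ≤ ω → pow ω n ≤ ten (suc K) → n ℕ.< 4 ℕ.* suc K
  exponent-lower {ω} {n} {K} lo≤ω h with n ℕ.<? 4 ℕ.* suc K
  ... | yes p = p
  ... | no ¬p = contradiction (pow-cancel K (0≤lit 10) (≤-trans (≤-reflexive (sym (pow-* lo₀ (suc K) 4)))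
      (≤-trans (pow-monoʳ (from-yes (1ℚ ≤? lo₀)) (ℕ.≤-trans (ℕ.≤-reflexive (ℕ.*-comm (suc K) 4)) (ℕ.≮⇒≥ ¬p)))
        (≤-trans (pow-mono n (from-yes (0ℚ ≤? lo₀)) lo≤ω) h)))) (λ q → <-irrefl refl (<-≤-trans (from-yes (10ℚ <? pow lo₀ 4)) q))

  exponent-upper : ∀ {ω n k} → ω ≤ 2ℚ → 0ℚ ≤ ω → ten k ≤ pow ω n → k ℕ.≤ n
  exponent-upper {ω} {n} {k} ω≤2 0≤ω h with k ℕ.≤? n
  ... | yes p = p
  ... | no ¬p = contradiction (≤-trans (two-mono (ℕ.≰⇒> ¬p)) (≤-trans (pow-mono k 0≤2 (from-yes (2ℚ ≤? 10ℚ))) (≤-trans h (pow-mono n 0≤ω ω≤2))))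
      (λ q → <-irrefl refl (<-≤-trans (subst (_< 2ℚ * two n) (*-identityˡ (two n)) (*-monoˡ-<-pos (two n) {{positive 0<two}} (from-yes (1ℚ <? 2ℚ)))) q))
    where
    0<two : 0ℚ < two n
    0<two = <-≤-trans (from-yes (0ℚ <? 1ℚ)) (1≤pow n 1≤2)

  -- At these points α^n splits off: w^x = ω^p 10^(-q) (ω^n / 10^k)^v. As a ⌊n/a⌋ is nearly n and b
  -- n nearly a k, the exponents p and q have the size of a u and b u, although x may be as large as
  -- n. D bounds the deviation of q from b u.
  module Lattice {n k a b Q D : ℕ} {{_ : ℕ.NonZero a}} {{_ : ℕ.NonZero Q}}
    (up : a ℕ.* k ℕ.* Q ℕ.≤ b ℕ.* n ℕ.* Q ℕ.+ n) (lo : b ℕ.* n ℕ.* Q ℕ.≤ a ℕ.* k ℕ.* Q ℕ.+ n)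
    (hD : a ℕ.* b ℕ.* Q ℕ.+ n ℕ.≤ Q ℕ.* D) {u v : ℕ} (v< : v ℕ.< a) (a≤u : a ℕ.≤ u) (D≤ : D ℕ.≤ b ℕ.* u) where

    r x : ℕ
    r = n /ℕ a
    x = u ℕ.+ v ℕ.* r

    private
      a′ = n % a
      n≡ : n ≡ a′ ℕ.+ r ℕ.* a
      n≡ = m≡m%n+[m/n]*n n a
      a′≤ : a′ ℕ.≤ a
      a′≤ = ℕ.<⇒≤ (m%n<n n a)

    p q : ℕ
    p = a ℕ.* x ℕ.∸ n ℕ.* v
    q = b ℕ.* x ℕ.∸ k ℕ.* v

    private
      ax : a ℕ.* x ℕ.+ v ℕ.* a′ ≡ a ℕ.* u ℕ.+ n ℕ.* v
      ax = trans (eq a u v r a′) (cong (λ z → a ℕ.* u ℕ.+ z ℕ.* v) (sym n≡))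
        where
        eq : ∀ a u v r a′ → a ℕ.* (u ℕ.+ v ℕ.* r) ℕ.+ v ℕ.* a′ ≡ a ℕ.* u ℕ.+ (a′ ℕ.+ r ℕ.* a) ℕ.* v
        eq = ℕR.solve-∀

      nv≤ax : n ℕ.* v ℕ.≤ a ℕ.* x
      nv≤ax = ℕ.+-cancelˡ-≤ (a ℕ.* u) _ _ (subst (ℕ._≤ a ℕ.* u ℕ.+ a ℕ.* x) ax
        (ℕ.≤-trans (ℕ.≤-reflexive (ℕ.+-comm (a ℕ.* x) (v ℕ.* a′))) (ℕ.+-monoˡ-≤ (a ℕ.* x) (ℕ.≤-trans (ℕ.*-mono-≤ (ℕ.<⇒≤ v<) a′≤) (ℕ.*-monoʳ-≤ a a≤u)))))

      v*n≤ : v ℕ.* n ℕ.≤ a ℕ.* n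
      v*n≤ = ℕ.*-monoˡ-≤ n (ℕ.<⇒≤ v<)

      kv≤ : k ℕ.* v ℕ.≤ b ℕ.* (v ℕ.* r) ℕ.+ D
      kv≤ = ℕ.*-cancelˡ-≤ (a ℕ.* Q) {{ℕ.m*n≢0 a Q}} (begin
        a ℕ.* Q ℕ.* (k ℕ.* v)                                ≡⟨ eq₁ a Q k v ⟩
        v ℕ.* (a ℕ.* k ℕ.* Q)                                ≤⟨ ℕ.*-monoʳ-≤ v up ⟩
        v ℕ.* (b ℕ.* n ℕ.* Q ℕ.+ n)                          ≡⟨ cong (λ z → v ℕ.* (b ℕ.* z ℕ.* Q ℕ.+ n)) n≡ ⟩
        v ℕ.* (b ℕ.* (a′ ℕ.+ r ℕ.* a) ℕ.* Q ℕ.+ n)           ≡⟨ eq₂ v b a′ r a Q n ⟩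
        a ℕ.* Q ℕ.* (b ℕ.* (v ℕ.* r)) ℕ.+ (v ℕ.* (b ℕ.* a′ ℕ.* Q) ℕ.+ v ℕ.* n)
          ≤⟨ ℕ.+-monoʳ-≤ (a ℕ.* Q ℕ.* (b ℕ.* (v ℕ.* r))) (ℕ.+-mono-≤ (ℕ.*-mono-≤ (ℕ.<⇒≤ v<) (ℕ.*-monoˡ-≤ Q (ℕ.*-monoʳ-≤ b a′≤))) v*n≤) ⟩
        a ℕ.* Q ℕ.* (b ℕ.* (v ℕ.* r)) ℕ.+ (a ℕ.* (b ℕ.* a ℕ.* Q) ℕ.+ a ℕ.* n) ≡⟨ cong (a ℕ.* Q ℕ.* (b ℕ.* (v ℕ.* r)) ℕ.+_) (eq₃ a b Q n) ⟩
        a ℕ.* Q ℕ.* (b ℕ.* (v ℕ.* r)) ℕ.+ a ℕ.* (a ℕ.* b ℕ.* Q ℕ.+ n) ≤⟨ ℕ.+-monoʳ-≤ (a ℕ.* Q ℕ.* (b ℕ.* (v ℕ.* r))) (ℕ.*-monoʳ-≤ a hD) ⟩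
        a ℕ.* Q ℕ.* (b ℕ.* (v ℕ.* r)) ℕ.+ a ℕ.* (Q ℕ.* D)    ≡⟨ eq₄ a Q (b ℕ.* (v ℕ.* r)) D ⟩
        a ℕ.* Q ℕ.* (b ℕ.* (v ℕ.* r) ℕ.+ D) ∎)
        where
        open ℕ.≤-Reasoning
        eq₁ : ∀ a Q k v → a ℕ.* Q ℕ.* (k ℕ.* v) ≡ v ℕ.* (a ℕ.* k ℕ.* Q)
        eq₁ = ℕR.solve-∀
        eq₂ : ∀ v b a′ r a Q n → v ℕ.* (b ℕ.* (a′ ℕ.+ r ℕ.* a) ℕ.* Q ℕ.+ n) ≡ a ℕ.* Q ℕ.* (b ℕ.* (v ℕ.* r)) ℕ.+ (v ℕ.* (b ℕ.* a′ ℕ.* Q) ℕ.+ v ℕ.* n)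
        eq₂ = ℕR.solve-∀
        eq₃ : ∀ a b Q n → a ℕ.* (b ℕ.* a ℕ.* Q) ℕ.+ a ℕ.* n ≡ a ℕ.* (a ℕ.* b ℕ.* Q ℕ.+ n)
        eq₃ = ℕR.solve-∀
        eq₄ : ∀ a Q y D → a ℕ.* Q ℕ.* y ℕ.+ a ℕ.* (Q ℕ.* D) ≡ a ℕ.* Q ℕ.* (y ℕ.+ D)
        eq₄ = ℕR.solve-∀

      bvr≤ : b ℕ.* (v ℕ.* r) ℕ.≤ k ℕ.* v ℕ.+ D
      bvr≤ = ℕ.*-cancelˡ-≤ (a ℕ.* Q) {{ℕ.m*n≢0 a Q}} (begin
        a ℕ.* Q ℕ.* (b ℕ.* (v ℕ.* r))                        ≤⟨ ℕ.m≤m+n _ (v ℕ.* b ℕ.* a′ ℕ.* Q) ⟩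
        a ℕ.* Q ℕ.* (b ℕ.* (v ℕ.* r)) ℕ.+ v ℕ.* b ℕ.* a′ ℕ.* Q ≡⟨ eq₁ v b a′ r a Q ⟩
        v ℕ.* (b ℕ.* (a′ ℕ.+ r ℕ.* a) ℕ.* Q)                 ≡⟨ cong (λ z → v ℕ.* (b ℕ.* z ℕ.* Q)) n≡ ⟨
        v ℕ.* (b ℕ.* n ℕ.* Q)                                ≤⟨ ℕ.*-monoʳ-≤ v lo ⟩
        v ℕ.* (a ℕ.* k ℕ.* Q ℕ.+ n)                          ≡⟨ eq₂ v a k Q n ⟩
        a ℕ.* Q ℕ.* (k ℕ.* v) ℕ.+ v ℕ.* n                    ≤⟨ ℕ.+-monoʳ-≤ (a ℕ.* Q ℕ.* (k ℕ.* v)) v*n≤ ⟩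
        a ℕ.* Q ℕ.* (k ℕ.* v) ℕ.+ a ℕ.* n                    ≤⟨ ℕ.+-monoʳ-≤ (a ℕ.* Q ℕ.* (k ℕ.* v)) (ℕ.*-monoʳ-≤ a (ℕ.≤-trans (ℕ.m≤n+m n (a ℕ.* b ℕ.* Q)) hD)) ⟩
        a ℕ.* Q ℕ.* (k ℕ.* v) ℕ.+ a ℕ.* (Q ℕ.* D)            ≡⟨ eq₄ a Q (k ℕ.* v) D ⟩
        a ℕ.* Q ℕ.* (k ℕ.* v ℕ.+ D) ∎)
        where
        open ℕ.≤-Reasoning
        eq₁ : ∀ v b a′ r a Q → a ℕ.* Q ℕ.* (b ℕ.* (v ℕ.* r)) ℕ.+ v ℕ.* b ℕ.* a′ ℕ.* Q ≡ v ℕ.* (b ℕ.* (a′ ℕ.+ r ℕ.* a) ℕ.* Q)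
        eq₁ = ℕR.solve-∀
        eq₂ : ∀ v a k Q n → v ℕ.* (a ℕ.* k ℕ.* Q ℕ.+ n) ≡ a ℕ.* Q ℕ.* (k ℕ.* v) ℕ.+ v ℕ.* n
        eq₂ = ℕR.solve-∀
        eq₄ : ∀ a Q y D → a ℕ.* Q ℕ.* y ℕ.+ a ℕ.* (Q ℕ.* D) ≡ a ℕ.* Q ℕ.* (y ℕ.+ D)
        eq₄ = ℕR.solve-∀

      bx : b ℕ.* x ≡ b ℕ.* u ℕ.+ b ℕ.* (v ℕ.* r)
      bx = ℕ.*-distribˡ-+ b u (v ℕ.* r)

      kv≤bx : k ℕ.* v ℕ.≤ b ℕ.* x
      kv≤bx = ℕ.≤-trans kv≤ (ℕ.≤-trans (ℕ.+-monoʳ-≤ (b ℕ.* (v ℕ.* r)) D≤) (ℕ.≤-reflexive (trans (ℕ.+-comm (b ℕ.* (v ℕ.* r)) (b ℕ.* u)) (sym bx))))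

    p-eq : p ℕ.+ n ℕ.* v ≡ a ℕ.* x
    p-eq = ℕ.m∸n+n≡m nv≤ax

    q-eq : q ℕ.+ k ℕ.* v ≡ b ℕ.* x
    q-eq = ℕ.m∸n+n≡m kv≤bx

    p≤ : p ℕ.≤ a ℕ.* u
    p≤ = ℕ.+-cancelʳ-≤ (n ℕ.* v) _ _ (subst₂ ℕ._≤_ (sym p-eq) ax (ℕ.m≤m+n (a ℕ.* x) (v ℕ.* a′)))

    q≤ : q ℕ.≤ b ℕ.* u ℕ.+ D
    q≤ = ℕ.+-cancelʳ-≤ (k ℕ.* v) _ _ (begin
      q ℕ.+ k ℕ.* v                     ≡⟨ trans q-eq bx ⟩
      b ℕ.* u ℕ.+ b ℕ.* (v ℕ.* r)       ≤⟨ ℕ.+-monoʳ-≤ (b ℕ.* u) bvr≤ ⟩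
      b ℕ.* u ℕ.+ (k ℕ.* v ℕ.+ D)       ≡⟨ eq (b ℕ.* u) (k ℕ.* v) D ⟩
      b ℕ.* u ℕ.+ D ℕ.+ k ℕ.* v ∎)
      where
      open ℕ.≤-Reasoning
      eq : ∀ x y D → x ℕ.+ (y ℕ.+ D) ≡ x ℕ.+ D ℕ.+ y
      eq = ℕR.solve-∀

    ≤q : b ℕ.* u ℕ.≤ q ℕ.+ D
    ≤q = ℕ.+-cancelʳ-≤ (k ℕ.* v) _ _ (begin
      b ℕ.* u ℕ.+ k ℕ.* v               ≤⟨ ℕ.+-monoʳ-≤ (b ℕ.* u) kv≤ ⟩
      b ℕ.* u ℕ.+ (b ℕ.* (v ℕ.* r) ℕ.+ D) ≡⟨ ℕ.+-assoc (b ℕ.* u) _ D ⟨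
      b ℕ.* u ℕ.+ b ℕ.* (v ℕ.* r) ℕ.+ D ≡⟨ cong (ℕ._+ D) (trans (sym bx) (sym q-eq)) ⟩
      q ℕ.+ k ℕ.* v ℕ.+ D               ≡⟨ eq q (k ℕ.* v) D ⟩
      q ℕ.+ D ℕ.+ k ℕ.* v ∎)
      where
      open ℕ.≤-Reasoning
      eq : ∀ x y D → x ℕ.+ y ℕ.+ D ≡ x ℕ.+ D ℕ.+ y
      eq = ℕR.solve-∀

-- Inequalities between the parameters

module SizeBounds where

  open import Data.Nat
  open import Data.Nat.Properties
  open import Data.Nat.DivMod using (_/_; m/n*n≤m; /-monoˡ-≤; m*n/n≡m; m≡m%n+[m/n]*n; m%n<n; +-distrib-/-∣ʳ; n/n≡1)
  open import Data.Nat.Divisibility using (∣-refl)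
  open import Data.Nat.Tactic.RingSolver using (solve-∀)
  open import Relation.Binary.PropositionalEquality
  open import Relation.Nullary using (yes; no; contradiction)
  open ≤-Reasoning

  -- Here n has the order of magnitude 2^(6μ): the height bounds a, and J and the degree bound the two degrees of the auxiliary function.
  height degree : ℕ → ℕ
  height μ = 2 ^ μ * 2 ^ μ
  degree μ = 2 ^ μ * (height μ * height μ)

  module Sizes (μ J n k l a b : ℕ) .{{_ : NonZero a}} (1≤J : 1 ≤ J) (1≤μ : 1 ≤ μ)
    (hμ : J * (170 * J + 200) ≤ μ) (hm : 1000 * μ ≤ 2 ^ μ)
    (n≥ : 2 ^ μ * degree μ ≤ n) (n≤ : n ≤ 64 * (2 ^ μ * degree μ)) (l≤ : l ≤ 6 * μ + 6) (a≤Q : a ≤ height μ)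
    (up : a * k * height μ ≤ b * n * height μ + n) (lo : b * n * height μ ≤ a * k * height μ + n) (k≤n : k ≤ n) (n<k : n < 4 * suc (k + l)) where

    m Q m⁴ I D L U r h : ℕ
    m = 2 ^ μ
    Q = height μ
    m⁴ = Q * Q
    I = degree μ
    D = 65 * m⁴
    L = μ * I
    U = suc (I / a)
    r = n / a
    h = 6 * μ + 7

    1000≤m : 1000 ≤ m
    1000≤m = ≤-trans (*-monoʳ-≤ 1000 1≤μ) hm

    c≤m : ∀ {c} → c ≤ 1000 → c ≤ m
    c≤m p = ≤-trans p 1000≤m

    instance
      m≢0 : NonZero m
      m≢0 = m^n≢0 2 μ
      Q≢0 : NonZero Q
      Q≢0 = m*n≢0 m m
      m⁴≢0 : NonZero m⁴
      m⁴≢0 = m*n≢0 Q Q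
      I≢0 : NonZero I
      I≢0 = m*n≢0 m m⁴

    linear≤m : ∀ c d → c + d ≤ 1000 → c * μ + d ≤ m
    linear≤m c d p = begin
      c * μ + d        ≤⟨ +-monoʳ-≤ (c * μ) (≤-trans (≤-reflexive (sym (*-identityʳ d))) (*-monoʳ-≤ d 1≤μ)) ⟩
      c * μ + d * μ    ≡⟨ *-distribʳ-+ μ c d ⟨
      (c + d) * μ      ≤⟨ *-monoˡ-≤ μ p ⟩
      1000 * μ         ≤⟨ hm ⟩
      m ∎

    suc-l≤m : suc l ≤ m
    suc-l≤m = ≤-trans (s≤s l≤) (≤-trans (≤-reflexive (eq μ)) (linear≤m 6 7 (≤ᵇ⇒≤ 13 1000 _)))
      where
      eq : ∀ μ → suc (6 * μ + 6) ≡ 6 * μ + 7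
      eq = solve-∀

    small : suc l * (a * Q) ≤ n
    small = begin
      suc l * (a * Q)  ≤⟨ *-mono-≤ suc-l≤m (*-monoˡ-≤ Q a≤Q) ⟩
      I                ≤⟨ m≤n*m I m ⟩
      m * I            ≤⟨ n≥ ⟩
      n ∎

    0<n : 0 < n
    0<n = <-≤-trans (>-nonZero⁻¹ (m * I) {{m*n≢0 m I}}) n≥

    instance
      n≢0 : NonZero n
      n≢0 = >-nonZero 0<n

    m≤Q : m ≤ Q
    m≤Q = m≤m*n m m

    b≤a : b ≤ a
    b≤a with b ≤? a
    ... | yes p = p
    ... | no ¬p = contradiction (begin
        a * n * Q + n * Q     ≡⟨ eq a n Q ⟩
        suc a * n * Q         ≤⟨ *-monoˡ-≤ Q (*-monoˡ-≤ n (≰⇒> ¬p)) ⟩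
        b * n * Q             ≤⟨ lo ⟩
        a * k * Q + n         ≤⟨ +-monoˡ-≤ n (*-monoˡ-≤ Q (*-monoʳ-≤ a k≤n)) ⟩
        a * n * Q + n ∎)
        (<⇒≱ (+-monoʳ-< (a * n * Q) (subst (_< n * Q) (*-identityʳ n) (*-monoʳ-< n (<-≤-trans (≤-trans (s≤s (s≤s z≤n)) 1000≤m) m≤Q)))))
      where
      eq : ∀ a n Q → a * n * Q + n * Q ≡ suc a * n * Q
      eq = solve-∀

    -- The hypothesis n < 4 (k + l + 1) keeps k / n from falling much below 1/4, and b / a is very
    -- close to k / n.
    a≤4b : a ≤ 4 * b
    a≤4b with a ≤? 4 * b
    ... | yes p = p
    ... | no ¬p = contradiction (begin
        suc (4 * b) * n * Q                        ≤⟨ *-monoˡ-≤ Q (*-monoˡ-≤ n (≰⇒> ¬p)) ⟩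
        a * n * Q                                  ≤⟨ *-monoˡ-≤ Q (*-monoʳ-≤ a (<⇒≤ n<k)) ⟩
        a * (4 * suc (k + l)) * Q                  ≡⟨ eq₁ a k l Q ⟩
        4 * (a * k * Q) + 4 * (suc l * (a * Q))    ≤⟨ +-mono-≤ (*-monoʳ-≤ 4 up) (*-monoʳ-≤ 4 (*-mono-≤ suc-l≤m (*-monoˡ-≤ Q a≤Q))) ⟩
        4 * (b * n * Q + n) + 4 * I                ≡⟨ eq₂ b n Q I ⟩
        4 * b * n * Q + (4 * n + 4 * I) ∎)
        (<⇒≱ (begin-strict
        4 * b * n * Q + (4 * n + 4 * I)            ≤⟨ +-monoʳ-≤ (4 * b * n * Q) (+-monoʳ-≤ (4 * n) (*-monoʳ-≤ 4 (≤-trans (m≤n*m I m) n≥))) ⟩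
        4 * b * n * Q + (4 * n + 4 * n)            ≡⟨ cong (4 * b * n * Q +_) (*-distribʳ-+ n 4 4) ⟨
        4 * b * n * Q + 8 * n                      <⟨ +-monoʳ-< (4 * b * n * Q) (subst (8 * n <_) (*-comm Q n) (*-monoˡ-< n (<-≤-trans (c≤m (≤ᵇ⇒≤ 9 1000 _)) m≤Q))) ⟩
        4 * b * n * Q + n * Q                      ≡⟨ eq₃ b n Q ⟩
        suc (4 * b) * n * Q ∎))
      where
      eq₁ : ∀ a k l Q → a * (4 * suc (k + l)) * Q ≡ 4 * (a * k * Q) + 4 * (suc l * (a * Q))
      eq₁ = solve-∀
      eq₂ : ∀ b n Q I → 4 * (b * n * Q + n) + 4 * I ≡ 4 * b * n * Q + (4 * n + 4 * I)
      eq₂ = solve-∀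
      eq₃ : ∀ b n Q → 4 * b * n * Q + n * Q ≡ suc (4 * b) * n * Q
      eq₃ = solve-∀

    -- The two summands are at most m⁶ and 64 m⁶, which is the origin of the 65 in `D`.
    hD : a * b * Q + n ≤ Q * D
    hD = begin
      a * b * Q + n                   ≤⟨ +-mono-≤ (*-monoˡ-≤ Q (*-mono-≤ a≤Q (≤-trans b≤a a≤Q))) n≤ ⟩
      m⁴ * Q + 64 * (m * I)           ≡⟨ eq m ⟩
      Q * D ∎
      where
      eq : ∀ m → (m * m) * (m * m) * (m * m) + 64 * (m * (m * ((m * m) * (m * m)))) ≡ (m * m) * (65 * ((m * m) * (m * m)))
      eq = solve-∀

    I≤aU : I ≤ a * U
    I≤aU = begin
      I                       ≡⟨ m≡m%n+[m/n]*n I a ⟩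
      I Data.Nat.DivMod.% a + I / a * a ≤⟨ +-monoˡ-≤ (I / a * a) (<⇒≤ (m%n<n I a)) ⟩
      a + I / a * a           ≡⟨ *-comm U a ⟩
      a * U ∎
      where import Data.Nat.DivMod

    aU≤ : a * U ≤ I + a
    aU≤ = begin
      a * U           ≡⟨ *-comm a U ⟩
      a + I / a * a   ≤⟨ +-monoʳ-≤ a (m/n*n≤m I a) ⟩
      a + I           ≡⟨ +-comm a I ⟩
      I + a ∎

    a≤I : a ≤ I
    a≤I = ≤-trans a≤Q (≤-trans (m≤m*n Q Q) (m≤n*m m⁴ m))

    aU≤2I : a * U ≤ 2 * I
    aU≤2I = ≤-trans aU≤ (≤-trans (+-monoʳ-≤ I a≤I) (≤-reflexive (cong (I +_) (sym (+-identityʳ I)))))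

    U≤r : U ≤ r
    U≤r = subst (_≤ r) (trans (+-distrib-/-∣ʳ I ∣-refl) (trans (cong (I / a +_) (n/n≡1 a)) (+-comm (I / a) 1)))
      (/-monoˡ-≤ a (≤-trans (+-monoʳ-≤ I a≤I) (≤-trans (≤-trans (≤-reflexive (cong (I +_) (sym (+-identityʳ I)))) (*-monoˡ-≤ I (c≤m (≤ᵇ⇒≤ 2 1000 _)))) n≥)))

    D≤I : D ≤ I
    D≤I = *-monoˡ-≤ m⁴ (c≤m (≤ᵇ⇒≤ 65 1000 _))

    gap : I + D ≤ b * (8 * U)
    gap = begin
      I + D             ≤⟨ +-monoʳ-≤ I D≤I ⟩
      I + I             ≤⟨ +-mono-≤ I≤aU I≤aU ⟩
      a * U + a * U     ≤⟨ +-mono-≤ (*-monoˡ-≤ U a≤4b) (*-monoˡ-≤ U a≤4b) ⟩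
      4 * b * U + 4 * b * U ≡⟨ eq b U ⟩
      b * (8 * U) ∎
      where
      eq : ∀ b U → 4 * b * U + 4 * b * U ≡ b * (8 * U)
      eq = solve-∀

    -- The main terms I and a U ≤ I + a use up half of 4 I; the terms with h are logarithmic. The
    -- choice h = 6 μ + 7 puts all points at most 2^h < 5^h.
    loss : 4 + (I + 4 * h) + a * (U + 4 * h) ≤ 4 * I
    loss = begin
      4 + (I + 4 * h) + a * (U + 4 * h)         ≡⟨ eq I h a U ⟩
      I + a * U + (4 + 4 * h + a * (4 * h))     ≤⟨ +-mono-≤ (+-monoʳ-≤ I aU≤) (+-mono-≤ 4+4h≤ (*-monoˡ-≤ (4 * h) a≤Q)) ⟩
      I + (I + a) + (m + Q * (4 * h))           ≤⟨ +-mono-≤ (+-monoʳ-≤ I (+-monoʳ-≤ I a≤Q)) (+-monoʳ-≤ m (*-monoʳ-≤ Q 4h≤)) ⟩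
      I + (I + Q) + (m + Q * m)                 ≤⟨ +-mono-≤ (+-monoʳ-≤ I (+-monoʳ-≤ I Q≤I)) (+-mono-≤ (≤-trans m≤Q (m≤n*m Q m)) (≤-reflexive (*-comm Q m))) ⟩
      I + (I + I) + (m * Q + m * Q)             ≤⟨ +-monoʳ-≤ (I + (I + I)) mQ+mQ≤ ⟩
      I + (I + I) + I                           ≡⟨ eq₂ I ⟩
      4 * I ∎
      where
      eq : ∀ I h a U → 4 + (I + 4 * h) + a * (U + 4 * h) ≡ I + a * U + (4 + 4 * h + a * (4 * h))
      eq = solve-∀
      eq₂ : ∀ I → I + (I + I) + I ≡ 4 * I
      eq₂ = solve-∀
      4+4h≤ : 4 + 4 * h ≤ m
      4+4h≤ = ≤-trans (≤-reflexive (e μ)) (linear≤m 24 32 (≤ᵇ⇒≤ 56 1000 _))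
        where
        e : ∀ μ → 4 + 4 * (6 * μ + 7) ≡ 24 * μ + 32
        e = solve-∀
      4h≤ : 4 * h ≤ m
      4h≤ = ≤-trans (m≤n+m (4 * h) 4) 4+4h≤
      Q≤I : Q ≤ I
      Q≤I = ≤-trans (m≤m*n Q Q) (m≤n*m m⁴ m)
      mQ+mQ≤ : m * Q + m * Q ≤ I
      mQ+mQ≤ = ≤-trans (≤-reflexive (e m Q)) (*-monoʳ-≤ m (*-monoˡ-≤ Q (≤-trans (c≤m (≤ᵇ⇒≤ 2 1000 _)) m≤Q)))
        where
        e : ∀ m Q → m * Q + m * Q ≡ m * (2 * Q)
        e = solve-∀

    -- A block of length 17 U has U points in the middle and 8 U free places on either side. Since 8
    -- b U ≥ 2 a U ≥ 2 I and q deviates from b times the offset by at most D ≤ I, every q keeps the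
    -- distance I from both ends of its interval from Pos t to Pos (t + 1).
    base : ℕ → ℕ
    base t = 17 * U * t + 8 * U

    Pos : ℕ → ℕ
    Pos t = b * (17 * U * t)

    module _ {t u : ℕ} (t< : t < J) (u< : u < U) where

      base+u≤ : base t + u ≤ 17 * U * J
      base+u≤ = begin
        17 * U * t + 8 * U + u        ≤⟨ +-monoʳ-≤ (17 * U * t + 8 * U) (<⇒≤ u<) ⟩
        17 * U * t + 8 * U + U        ≤⟨ m≤m+n _ (8 * U) ⟩
        17 * U * t + 8 * U + U + 8 * U ≡⟨ eq U t ⟩
        17 * U * suc t                ≤⟨ *-monoʳ-≤ (17 * U) t< ⟩
        17 * U * J ∎
        where
        eq : ∀ U t → 17 * U * t + 8 * U + U + 8 * U ≡ 17 * U * suc t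
        eq = solve-∀

      a*≤ : a * (base t + u) ≤ 34 * J * I
      a*≤ = begin
        a * (base t + u)      ≤⟨ *-monoʳ-≤ a base+u≤ ⟩
        a * (17 * U * J)      ≡⟨ eq a U J ⟩
        17 * J * (a * U)      ≤⟨ *-monoʳ-≤ (17 * J) aU≤2I ⟩
        17 * J * (2 * I)      ≡⟨ eq₂ J I ⟩
        34 * J * I ∎
        where
        eq : ∀ a U J → a * (17 * U * J) ≡ 17 * J * (a * U)
        eq = solve-∀
        eq₂ : ∀ J I → 17 * J * (2 * I) ≡ 34 * J * I
        eq₂ = solve-∀

      b*≤ : b * (base t + u) ≤ 34 * J * I
      b*≤ = ≤-trans (*-monoˡ-≤ (base t + u) b≤a) a*≤

      a≤base : a ≤ base t + u
      a≤base = begin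
        a             ≤⟨ subst (_≤ I / a) (m*n/n≡m a a) (/-monoˡ-≤ a (≤-trans (*-mono-≤ a≤Q a≤Q) (m≤n*m m⁴ m))) ⟩
        I / a         ≤⟨ n≤1+n (I / a) ⟩
        U             ≤⟨ m≤n*m U 8 ⟩
        8 * U         ≤⟨ m≤n+m (8 * U) (17 * U * t) ⟩
        base t        ≤⟨ m≤m+n (base t) u ⟩
        base t + u ∎

      D≤base : D ≤ b * (base t + u)
      D≤base = begin
        D                 ≤⟨ m≤n+m D I ⟩
        I + D             ≤⟨ gap ⟩
        b * (8 * U)       ≤⟨ *-monoʳ-≤ b (≤-trans (m≤n+m (8 * U) (17 * U * t)) (m≤m+n (base t) u)) ⟩
        b * (base t + u) ∎

      above : ∀ {q} → b * (base t + u) ≤ q + D → Pos t + I ≤ q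
      above {q} p = +-cancelʳ-≤ D _ _ (begin
        Pos t + I + D                 ≡⟨ +-assoc (Pos t) I D ⟩
        Pos t + (I + D)               ≤⟨ +-monoʳ-≤ (Pos t) gap ⟩
        Pos t + b * (8 * U)           ≡⟨ *-distribˡ-+ b (17 * U * t) (8 * U) ⟨
        b * base t                    ≤⟨ *-monoʳ-≤ b (m≤m+n (base t) u) ⟩
        b * (base t + u)              ≤⟨ p ⟩
        q + D ∎)

      below : ∀ {q} → q ≤ b * (base t + u) + D → q + I ≤ Pos (suc t)
      below {q} p = begin
        q + I                                 ≤⟨ +-monoˡ-≤ I p ⟩
        b * (base t + u) + D + I              ≤⟨ +-monoˡ-≤ I (+-monoˡ-≤ D (*-monoʳ-≤ b (+-monoʳ-≤ (base t) (<⇒≤ u<)))) ⟩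
        b * (base t + U) + D + I              ≡⟨ eq (b * (base t + U)) D I ⟩
        b * (base t + U) + (I + D)            ≤⟨ +-monoʳ-≤ (b * (base t + U)) gap ⟩
        b * (base t + U) + b * (8 * U)        ≡⟨ eq₂ b U t ⟩
        Pos (suc t) ∎
        where
        eq : ∀ x D I → x + D + I ≡ x + (I + D)
        eq = solve-∀
        eq₂ : ∀ b U t → b * (17 * U * t + 8 * U + U) + b * (8 * U) ≡ b * (17 * U * suc t)
        eq₂ = solve-∀

      x≤ : ∀ {v} → v < a → base t + u + v * r ≤ 128 * (m * I)
      x≤ {v} v< = begin
        base t + u + v * r        ≤⟨ +-mono-≤ base+u≤ (*-monoˡ-≤ r (<⇒≤ v<)) ⟩
        17 * U * J + a * r        ≤⟨ +-mono-≤ (≤-trans (m≤n*m (17 * U * J) a) a*17) (≤-trans (≤-reflexive (*-comm a r)) (m/n*n≤m n a)) ⟩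
        34 * J * I + n            ≤⟨ +-mono-≤ (*-monoˡ-≤ I 34J≤m) n≤ ⟩
        m * I + 64 * (m * I)      ≤⟨ *-monoˡ-≤ (m * I) (≤ᵇ⇒≤ 65 128 _) ⟩
        128 * (m * I) ∎
        where
        a*17 : a * (17 * U * J) ≤ 34 * J * I
        a*17 = ≤-trans (≤-reflexive (eq a U J)) (≤-trans (*-monoʳ-≤ (17 * J) aU≤2I) (≤-reflexive (eq₂ J I)))
          where
          eq : ∀ a U J → a * (17 * U * J) ≡ 17 * J * (a * U)
          eq = solve-∀
          eq₂ : ∀ J I → 17 * J * (2 * I) ≡ 34 * J * I
          eq₂ = solve-∀
        34J≤m : 34 * J ≤ m
        34J≤m = ≤-trans (*-monoʳ-≤ 34 J≤μ) (≤-trans (*-monoˡ-≤ μ (≤ᵇ⇒≤ 34 1000 _)) hm)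
          where
          J≤μ : J ≤ μ
          J≤μ = ≤-trans (m≤m*n J (170 * J + 200) {{>-nonZero (≤-trans (s≤s z≤n) (m≤n+m 200 (170 * J)))}}) hμ

    small-l : a * (4 * l + 8) ≤ I
    small-l = begin
      a * (4 * l + 8)   ≤⟨ *-mono-≤ a≤Q (≤-trans (+-monoˡ-≤ 8 (*-monoʳ-≤ 4 l≤)) (≤-trans (≤-reflexive (eq μ)) (linear≤m 24 32 (≤ᵇ⇒≤ 56 1000 _)))) ⟩
      Q * m             ≡⟨ *-comm Q m ⟩
      m * Q             ≤⟨ *-monoʳ-≤ m (m≤m*n Q Q) ⟩
      I ∎
      where
      eq : ∀ μ → 4 * (6 * μ + 6) + 8 ≡ 24 * μ + 32
      eq = solve-∀

    -- A bound for the binary logarithm of X^(J-1-j) Z^j ω^(j p), where 16 replaces 9 and 10. With p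
    -- and q about 34 J I the leading constant is 4 · 34 + 34 = 170, whence the hypothesis J (170 J
    -- + 200) ≤ μ.
    budget : ∀ {p q} → p ≤ 34 * J * I → q ≤ 34 * J * I + D → J * (4 * q + a * (4 * l + 8) + p) ≤ L
    budget {p} {q} p≤ q≤ = begin
      J * (4 * q + a * (4 * l + 8) + p)                         ≤⟨ *-monoʳ-≤ J (+-mono-≤ (+-mono-≤ (*-monoʳ-≤ 4 (≤-trans q≤ (+-monoʳ-≤ (34 * J * I) D≤I))) small-l) p≤) ⟩
      J * (4 * (34 * J * I + I) + I + 34 * J * I)               ≤⟨ m≤m+n _ (195 * J * I) ⟩
      J * (4 * (34 * J * I + I) + I + 34 * J * I) + 195 * J * I ≡⟨ eq J I ⟩
      J * (170 * J + 200) * I                                   ≤⟨ *-monoˡ-≤ I hμ ⟩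
      L ∎
      where
      eq : ∀ J I → J * (4 * (34 * J * I + I) + I + 34 * J * I) + 195 * J * I ≡ J * (170 * J + 200) * I
      eq = solve-∀

    J≤μ : J ≤ μ
    J≤μ = ≤-trans (m≤m*n J (170 * J + 200) {{>-nonZero (≤-trans (s≤s z≤n) (m≤n+m 200 (170 * J)))}}) hμ

    -- The ratio y is within 64 · 10^(-k) ≤ 2^(6 - 3k) of 1, and powers with exponents below a J
    -- cost a factor 4^(a J). As k has the order of n, this still leaves the accuracy 2^(-80 L).
    far : 6 + 80 * L + 2 * (a * J) ≤ 3 * k
    far = *-cancelˡ-≤ 4 (+-cancelʳ-≤ (12 * suc l) _ _ (begin
      4 * (6 + 80 * L + 2 * (a * J)) + 12 * suc l   ≤⟨ +-mono-≤ (*-monoʳ-≤ 4 (+-mono-≤ (+-monoˡ-≤ (80 * L) 6≤L) (*-monoʳ-≤ 2 aJ≤))) (*-monoʳ-≤ 12 (≤-trans suc-l≤m m≤L)) ⟩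
      4 * (L + 80 * L + 2 * L) + 12 * L             ≡⟨ eq L ⟩
      344 * L                                       ≤⟨ *-monoˡ-≤ L (≤ᵇ⇒≤ 344 1000 _) ⟩
      1000 * L                                      ≡⟨ *-assoc 1000 μ I ⟨
      1000 * μ * I                                  ≤⟨ *-monoˡ-≤ I hm ⟩
      m * I                                         ≤⟨ n≥ ⟩
      n                                             ≤⟨ m≤n*m n 3 ⟩
      3 * n                                         ≤⟨ *-monoʳ-≤ 3 (<⇒≤ n<k) ⟩
      3 * (4 * suc (k + l))                         ≡⟨ eq₂ k l ⟩
      4 * (3 * k) + 12 * suc l ∎))
      where
      eq : ∀ L → 4 * (L + 80 * L + 2 * L) + 12 * L ≡ 344 * L
      eq = solve-∀
      eq₂ : ∀ k l → 3 * (4 * suc (k + l)) ≡ 4 * (3 * k) + 12 * suc l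
      eq₂ = solve-∀
      m≤L : m ≤ L
      m≤L = ≤-trans (m≤m*n m m⁴) (≤-trans (≤-reflexive (sym (*-identityˡ I))) (*-monoˡ-≤ I 1≤μ))
      6≤L : 6 ≤ L
      6≤L = ≤-trans (c≤m (≤ᵇ⇒≤ 6 1000 _)) m≤L
      aJ≤ : a * J ≤ L
      aJ≤ = ≤-trans (*-mono-≤ a≤I J≤μ) (≤-reflexive (*-comm I μ))

-- Gel'fond's method with explicit parameters

module LinearForms where

  open import Defs using (S)
  open Rationals
  open DominantRoot
  open NewtonSeries
  open Pigeonhole using (dirichlet)
  open BinomialPolynomials using (value)
  open Zeros
  open AuxiliaryFunction
  open VanishingPoints
  open RatioEstimate
  open Exponents
  open SizeBounds
  open import Data.Nat as ℕ using (ℕ; zero; suc)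
  import Data.Nat.Properties as ℕ
  import Data.Nat.Divisibility as ℕ∣
  import Data.Nat.Tactic.RingSolver as ℕR
  open import Data.Integer as ℤ using (ℤ)
  open import Data.Rational hiding (round; NonZero)
  open import Data.Rational.Properties
  open import Data.Rational.Solver
  open import Data.Empty using (⊥)
  open import Data.Product using (_×_; proj₁; proj₂; ∃₂)
  open import Relation.Binary.PropositionalEquality hiding ([_]; J)
  open import Relation.Nullary using (¬_; contradiction)
  open import Relation.Nullary.Decidable using (from-yes; from-no)
  open +-*-Solver

  n<2^n : ∀ n → n ℕ.< 2 ℕ.^ n
  n<2^n zero    = ℕ.s≤s ℕ.z≤n
  n<2^n (suc n) = ℕ.≤-trans (ℕ.+-mono-≤ (ℕ.m^n>0 2 n) (n<2^n n)) (ℕ.+-monoʳ-≤ (2 ℕ.^ n) (ℕ.m≤m+n (2 ℕ.^ n) 0))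

  tenth≤half : ∀ k → tenth k ≤ half (3 ℕ.* k)
  tenth≤half k = ≤-trans (pow-mono k 0≤1/10 (from-yes (1/10 ≤? half 3))) (≤-reflexive (sym (pow-*′ ½ 3 k)))

  lit64*tenth : ∀ {k e} → 6 ℕ.+ e ℕ.≤ 3 ℕ.* k → lit 64 * tenth k ≤ half e
  lit64*tenth {k} {e} p = ≤-trans (*-monoˡ (lit 64) (0≤lit 64) (tenth≤half k)) (two*half≤ {6} {3 ℕ.* k} {e} p)

  module LinearForm (μ J n′ k l B : ℕ)
    (J≥ : 4072 ℕ.≤ J) (J≤ : J ℕ.≤ 4096) (hμ : J ℕ.* (170 ℕ.* J ℕ.+ 200) ℕ.≤ μ) (hm : 1000 ℕ.* μ ℕ.≤ 2 ℕ.^ μ)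
    (n≥ : 2 ℕ.^ μ ℕ.* degree μ ℕ.≤ suc n′) (n≤ : suc n′ ℕ.≤ 64 ℕ.* (2 ℕ.^ μ ℕ.* degree μ)) (1≤l : 1 ℕ.≤ l) (l≤ : l ℕ.≤ 6 ℕ.* μ ℕ.+ 6) (3≤k : 3 ℕ.≤ k)
    (equation : 9 ℕ.* S (suc n′) ℕ.+ 9 ≡ 10 ℕ.^ k ℕ.* B ℕ.+ 10 ℕ.^ l) (B+1 : suc B ≡ 9 ℕ.* 10 ℕ.^ l) where

    n m Q I : ℕ
    n = suc n′
    m = 2 ℕ.^ μ
    Q = height μ
    I = degree μ

    1≤J : 1 ℕ.≤ J
    1≤J = ℕ.≤-trans (ℕ.s≤s ℕ.z≤n) J≥

    μ≥ : ∀ {c} → c ℕ.≤ 814400 → c ℕ.≤ μ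
    μ≥ p = ℕ.≤-trans p (ℕ.≤-trans (ℕ.*-mono-≤ J≥ (ℕ.m≤n+m 200 (170 ℕ.* J))) hμ)

    1≤μ : 1 ℕ.≤ μ
    1≤μ = μ≥ (ℕ.≤ᵇ⇒≤ 1 814400 _)

    L Ω : ℕ
    L = μ ℕ.* I
    Ω = 80 ℕ.* L

    -- The precision of ω: `S-approx` requires 3 n + 7 bits, from 4 · 4^n · 4 · 2^(n+3), and the
    -- vanishing argument Ω bits.
    Nω : ℕ
    Nω = 3 ℕ.* n ℕ.+ 7 ℕ.+ Ω

    abstract
      rt : Root (half Nω)
      rt = root Nω

    open Root rt
    open Decay ω lo≤ω ω≤hi using (0≤ω; ω≤2; powω≤two; module Approx)

    approx : ∣ ν (S n) - pow ω n ∣ ≤ lit 6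
    approx = Approx.S-approx (half Nω) tiny n (≤-trans (≤-reflexive e) (two*half≤ {3 ℕ.* n ℕ.+ 7} {Nω} {0} (ℕ.≤-trans (ℕ.≤-reflexive (ℕ.+-identityʳ (3 ℕ.* n ℕ.+ 7))) (ℕ.m≤m+n (3 ℕ.* n ℕ.+ 7) Ω))))
      where
      e : half Nω * (4ℚ * pow 4ℚ n) * (4ℚ * two (3 ℕ.+ n)) ≡ two (3 ℕ.* n ℕ.+ 7) * half Nω
      e = trans (cong (λ z → half Nω * (4ℚ * z) * (4ℚ * two (3 ℕ.+ n))) (sym (pow-*′ 2ℚ 2 n)))
        (trans (solve 3 (λ h x y → h :* (con 4ℚ :* x) :* (con 4ℚ :* y) := (x :* y :* con (two 4)) :* h) refl (half Nω) (two (2 ℕ.* n)) (two (3 ℕ.+ n)))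
          (cong (_* half Nω) (trans (cong (_* two 4) (sym (pow-+ 2ℚ (2 ℕ.* n) (3 ℕ.+ n)))) (trans (sym (pow-+ 2ℚ (2 ℕ.* n ℕ.+ (3 ℕ.+ n)) 4)) (cong two (eq n))))))
        where
        eq : ∀ n → 2 ℕ.* n ℕ.+ (3 ℕ.+ n) ℕ.+ 4 ≡ 3 ℕ.* n ℕ.+ 7
        eq = ℕR.solve-∀

    open Ratio {n} {k} {l} {B} equation B+1 0≤ω approx

    64tenth≤½ : lit 64 * tenth k ≤ half 1
    64tenth≤½ = lit64*tenth {k} {1} (ℕ.≤-trans (ℕ.≤ᵇ⇒≤ 7 9 _) (ℕ.*-monoʳ-≤ 3 3≤k))

    lowerω : ten k ≤ pow ω n
    lowerω = power-lower 1≤l 64tenth≤½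

    upperω : pow ω n ≤ ten (k ℕ.+ suc l)
    upperω = power-upper (≤-trans 64tenth≤½ (from-yes (half 1 ≤? 1ℚ)))

    k≤n : k ℕ.≤ n
    k≤n = exponent-upper ω≤2 0≤ω lowerω

    n<k : n ℕ.< 4 ℕ.* suc (k ℕ.+ l)
    n<k = exponent-lower {ω} {n} {k ℕ.+ l} lo≤ω (≤-trans upperω (≤-reflexive (cong ten (ℕ.+-suc k l))))

    Q≢0 : ℕ.NonZero Q
    Q≢0 = ℕ.m*n≢0 m m {{ℕ.m^n≢0 2 μ}} {{ℕ.m^n≢0 2 μ}}

    abstract
      diri : ∃₂ λ a b → (1 ℕ.≤ a × a ℕ.≤ Q) × (a ℕ.* k ℕ.* Q ℕ.≤ b ℕ.* n ℕ.* Q ℕ.+ n × b ℕ.* n ℕ.* Q ℕ.≤ a ℕ.* k ℕ.* Q ℕ.+ n)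
      diri = dirichlet n k Q {{_}} {{Q≢0}}

    a b : ℕ
    a = proj₁ diri
    b = proj₁ (proj₂ diri)

    1≤a : 1 ℕ.≤ a
    1≤a = proj₁ (proj₁ (proj₂ (proj₂ diri)))
    a≤Q : a ℕ.≤ Q
    a≤Q = proj₂ (proj₁ (proj₂ (proj₂ diri)))
    up : a ℕ.* k ℕ.* Q ℕ.≤ b ℕ.* n ℕ.* Q ℕ.+ n
    up = proj₁ (proj₂ (proj₂ (proj₂ diri)))
    lo : b ℕ.* n ℕ.* Q ℕ.≤ a ℕ.* k ℕ.* Q ℕ.+ n
    lo = proj₂ (proj₂ (proj₂ (proj₂ diri)))

    instance
      a≢0 : ℕ.NonZero a
      a≢0 = ℕ.>-nonZero 1≤a

    module Z = Sizes μ J n k l a b 1≤J 1≤μ hμ hm n≥ n≤ l≤ a≤Q up lo k≤n n<k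

    instance
      I≢0 : ℕ.NonZero I
      I≢0 = Z.I≢0

    D : ℕ
    D = 65 ℕ.* (Q ℕ.* Q)

    I≤L : I ℕ.≤ L
    I≤L = ℕ.m≤n*m I μ {{ℕ.>-nonZero 1≤μ}}

    cI≤L : ∀ c → c ℕ.≤ 814400 → c ℕ.* I ℕ.≤ L
    cI≤L c p = ℕ.*-monoˡ-≤ I (μ≥ p)

    c≤L : ∀ c → c ℕ.≤ 814400 → c ℕ.≤ L
    c≤L c p = ℕ.≤-trans (ℕ.m≤m*n c I) (cI≤L c p)

    -- Of the 2 μ bits of Q, 7 go into the constant 1 + 2^7 of `near-one`, 2 J into the passage from
    -- w to w^j for j < J, and one into `suc e₁`.
    e₁ : ℕ
    e₁ = 2 ℕ.* μ ℕ.∸ (8 ℕ.+ 2 ℕ.* J)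

    J≤μ : 20 ℕ.* J ℕ.≤ μ
    J≤μ = ℕ.≤-trans (ℕ.≤-trans (ℕ.≤-reflexive (ℕ.*-comm 20 J)) (ℕ.*-monoʳ-≤ J (ℕ.≤-trans (ℕ.≤ᵇ⇒≤ 20 200 _) (ℕ.m≤n+m 200 (170 ℕ.* J))))) hμ

    e₁-eq : (8 ℕ.+ 2 ℕ.* J) ℕ.+ e₁ ≡ 2 ℕ.* μ
    e₁-eq = ℕ.m+[n∸m]≡n (ℕ.≤-trans (ℕ.+-mono-≤ (μ≥ (ℕ.≤ᵇ⇒≤ 8 814400 _)) (ℕ.≤-trans (ℕ.*-monoˡ-≤ J (ℕ.≤ᵇ⇒≤ 2 20 _)) J≤μ)) (ℕ.≤-reflexive (cong (μ ℕ.+_) (sym (ℕ.+-identityʳ μ)))))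

    Q≡two : ν Q ≡ two (7 ℕ.+ (2 ℕ.* J ℕ.+ suc e₁))
    Q≡two = trans (cong ν (trans (sym (ℕ.^-distribˡ-+-* 2 μ μ)) (cong (2 ℕ.^_) (cong (μ ℕ.+_) (sym (ℕ.+-identityʳ μ))))))
      (trans (ν-2^ (2 ℕ.* μ)) (cong two (trans (sym e₁-eq) (eq J e₁))))
      where
      eq : ∀ J e → (8 ℕ.+ 2 ℕ.* J) ℕ.+ e ≡ 7 ℕ.+ (2 ℕ.* J ℕ.+ suc e)
      eq = ℕR.solve-∀

    open NearOne 0≤ω {n′} {k} {l} {a} {b} {Q} {2 ℕ.* J ℕ.+ suc e₁} lowerω upperω up lo Z.small Q≡two using (w; 0≤w; near-one)

    ∣∣≤2 : ∀ {x} → ∣ x - 1ℚ ∣ ≤ 1ℚ → ∣ x ∣ ≤ 2ℚ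
    ∣∣≤2 {x} h = ≤-trans (≤-reflexive (cong ∣_∣ (eq x))) (≤-trans (∣+∣≤ {x - 1ℚ} {1ℚ} h (≤-refl {1ℚ})) (from-yes (1ℚ + 1ℚ ≤? 2ℚ)))
      where
      eq : ∀ x → x ≡ (x - 1ℚ) + 1ℚ
      eq = solve 1 (λ x → x := (x :- con 1ℚ) :+ con 1ℚ) refl

    η≤ : ∀ j → j ℕ.< J → ∣ pow w j - 1ℚ ∣ ≤ half (suc e₁)
    η≤ j j< = ≤-trans (pow-1-error j (∣∣≤2 (≤-trans near-one (pow≤1 (2 ℕ.* J ℕ.+ suc e₁) 0≤½ ½≤1))))
      (≤-trans (*-mono (0≤pow j (0≤lit 4)) (0≤∣p∣ (w - 1ℚ)) (≤-trans (≤-reflexive (sym (pow-*′ 2ℚ 2 j))) (two-mono (ℕ.*-monoʳ-≤ 2 (ℕ.<⇒≤ j<)))) near-one)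
        (≤-reflexive (two*half+ (2 ℕ.* J) (suc e₁))))

    W≤2 : ∀ j → j ℕ.< J → ∣ pow w j ∣ ≤ 2ℚ
    W≤2 j j< = ∣∣≤2 (≤-trans (η≤ j j<) (pow≤1 (suc e₁) 0≤½ ½≤1))

    N≤ : J ℕ.* I ℕ.≤ 2 ℕ.^ L
    N≤ = ℕ.≤-trans (ℕ.*-monoˡ-≤ I Z.J≤μ) (ℕ.<⇒≤ (n<2^n L))

    -- The constants form a chain. Vanishing needs 79 L + 242 ≤ 80 L bits and the growth of the
    -- Newton series at most L more, so Z = 81 L. In `tail` the demands add up to 81 + 5 + 2 = 88
    -- times L, slightly exceeded; the surplus decay, about μ per index, covers them from s = 89 I
    -- on. Then `head` needs 81 + 5 + 89 = 175 times L and a little more, so E = 176 L. This gives A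
    -- = 2^(177 L), at most 2^(183 L) values per condition, and 183 · 89 = 16287 < 4 · 4072 ≤ 4 J.
    params : Parameters
    params = record
      { I = I ; J = J ; M = 89 ℕ.* I ; C = 2 ℕ.^ (4 ℕ.* L) ; A = 2 ℕ.^ (177 ℕ.* L) ; E = 176 ℕ.* L ; Z = 81 ℕ.* L
      ; t = μ ℕ.+ 8 ; e = e₁ ; a = 5 ℕ.* L
      ; count = count ; A-large = A-large ; NC≤ = NC≤ ; head = head ; tail = tail }
      where
      open ℕ.≤-Reasoning
      A = 2 ℕ.^ (177 ℕ.* L)
      C = 2 ℕ.^ (4 ℕ.* L)
      N = J ℕ.* I
      N*AC≤ : N ℕ.* (A ℕ.* C) ℕ.≤ 2 ℕ.^ (182 ℕ.* L)
      N*AC≤ = ℕ.≤-trans (ℕ.*-monoˡ-≤ (A ℕ.* C) N≤) (ℕ.≤-reflexive (trans (cong (2 ℕ.^ L ℕ.*_) (sym (ℕ.^-distribˡ-+-* 2 (177 ℕ.* L) (4 ℕ.* L))))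
        (trans (sym (ℕ.^-distribˡ-+-* 2 L (177 ℕ.* L ℕ.+ 4 ℕ.* L))) (cong (2 ℕ.^_) (eq L)))))
        where
        eq : ∀ L → L ℕ.+ (177 ℕ.* L ℕ.+ 4 ℕ.* L) ≡ 182 ℕ.* L
        eq = ℕR.solve-∀
      K≤ : suc (N ℕ.* (A ℕ.* C) ℕ.+ N ℕ.* (A ℕ.* C)) ℕ.≤ 2 ℕ.^ (183 ℕ.* L)
      K≤ = begin
        1 ℕ.+ (N ℕ.* (A ℕ.* C) ℕ.+ N ℕ.* (A ℕ.* C))   ≤⟨ ℕ.+-mono-≤ (ℕ.m^n>0 2 (182 ℕ.* L)) (ℕ.+-mono-≤ N*AC≤ N*AC≤) ⟩
        X ℕ.+ (X ℕ.+ X)                               ≤⟨ ℕ.m≤n+m (X ℕ.+ (X ℕ.+ X)) X ⟩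
        X ℕ.+ (X ℕ.+ (X ℕ.+ X))                       ≡⟨ eq X ⟩
        2 ℕ.^ 2 ℕ.* X                                 ≤⟨ ℕ.*-monoˡ-≤ X (ℕ.^-monoʳ-≤ 2 (c≤L 2 (ℕ.≤ᵇ⇒≤ 2 814400 _))) ⟩
        2 ℕ.^ L ℕ.* X                                 ≡⟨ ℕ.^-distribˡ-+-* 2 L (182 ℕ.* L) ⟨
        2 ℕ.^ (183 ℕ.* L) ∎
        where
        X = 2 ℕ.^ (182 ℕ.* L)
        eq : ∀ x → x ℕ.+ (x ℕ.+ (x ℕ.+ x)) ≡ 4 ℕ.* x
        eq = ℕR.solve-∀
      count : suc (N ℕ.* (A ℕ.* C) ℕ.+ N ℕ.* (A ℕ.* C)) ℕ.^ (89 ℕ.* I) ℕ.< suc C ℕ.^ N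
      count = begin-strict
        suc (N ℕ.* (A ℕ.* C) ℕ.+ N ℕ.* (A ℕ.* C)) ℕ.^ (89 ℕ.* I) ≤⟨ ℕ.^-monoˡ-≤ (89 ℕ.* I) K≤ ⟩
        (2 ℕ.^ (183 ℕ.* L)) ℕ.^ (89 ℕ.* I)     ≡⟨ ℕ.^-*-assoc 2 (183 ℕ.* L) (89 ℕ.* I) ⟩
        2 ℕ.^ (183 ℕ.* L ℕ.* (89 ℕ.* I))       ≤⟨ ℕ.^-monoʳ-≤ 2 exp≤ ⟩
        2 ℕ.^ (4 ℕ.* L ℕ.* N)                  ≡⟨ ℕ.^-*-assoc 2 (4 ℕ.* L) N ⟨
        C ℕ.^ N                                <⟨ ℕ.^-monoˡ-< N {{ℕ.m*n≢0 J I {{ℕ.>-nonZero 1≤J}}}} (ℕ.n<1+n C) ⟩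
        suc C ℕ.^ N ∎
        where
        eq : ∀ L I → 183 ℕ.* L ℕ.* (89 ℕ.* I) ≡ 16287 ℕ.* (L ℕ.* I)
        eq = ℕR.solve-∀
        eq₂ : ∀ L I J → 4 ℕ.* J ℕ.* (L ℕ.* I) ≡ 4 ℕ.* L ℕ.* (J ℕ.* I)
        eq₂ = ℕR.solve-∀
        exp≤ : 183 ℕ.* L ℕ.* (89 ℕ.* I) ℕ.≤ 4 ℕ.* L ℕ.* N
        exp≤ = ℕ.≤-trans (ℕ.≤-reflexive (eq L I)) (ℕ.≤-trans (ℕ.*-monoˡ-≤ (L ℕ.* I) (ℕ.≤-trans (ℕ.≤ᵇ⇒≤ 16287 16288 _) (ℕ.*-monoʳ-≤ 4 J≥))) (ℕ.≤-reflexive (eq₂ L I J)))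
      A-large : pow 4ℚ (89 ℕ.* I) * two (176 ℕ.* L) + 1ℚ ≤ ν A
      A-large = ≤-trans (+-mono-≤ (≤-reflexive (trans (cong (_* two (176 ℕ.* L)) (sym (pow-*′ 2ℚ 2 (89 ℕ.* I)))) (sym (pow-+ 2ℚ (2 ℕ.* (89 ℕ.* I)) (176 ℕ.* L))))) (1≤pow X 1≤2))
        (≤-trans (≤-reflexive (solve 1 (λ x → x :+ x := con 2ℚ :* x) refl (two X))) (≤-trans (two-mono X≤) (≤-reflexive (sym (ν-2^ (177 ℕ.* L))))))
        where
        X = 2 ℕ.* (89 ℕ.* I) ℕ.+ 176 ℕ.* L
        eq : ∀ I L → suc (2 ℕ.* (89 ℕ.* I) ℕ.+ 176 ℕ.* L) ≡ 1 ℕ.+ 178 ℕ.* I ℕ.+ 176 ℕ.* L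
        eq = ℕR.solve-∀
        X≤ : suc X ℕ.≤ 177 ℕ.* L
        X≤ = ℕ.≤-trans (ℕ.≤-reflexive (eq I L)) (ℕ.+-monoˡ-≤ (176 ℕ.* L) (ℕ.≤-trans (ℕ.+-monoˡ-≤ (178 ℕ.* I) (ℕ.>-nonZero⁻¹ I)) (cI≤L 179 (ℕ.≤ᵇ⇒≤ 179 814400 _))))
      NC≤ : ν (N ℕ.* C) ≤ two (5 ℕ.* L)
      NC≤ = ≤-trans (ν-mono (ℕ.≤-trans (ℕ.*-monoˡ-≤ C N≤) (ℕ.≤-reflexive (sym (ℕ.^-distribˡ-+-* 2 L (4 ℕ.* L)))))) (≤-reflexive (ν-2^ (5 ℕ.* L)))
      head : 5 ℕ.* L ℕ.+ (81 ℕ.* L ℕ.+ (μ ℕ.+ 8) ℕ.* (89 ℕ.* I)) ℕ.≤ 176 ℕ.* L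
      head = begin
        5 ℕ.* L ℕ.+ (81 ℕ.* L ℕ.+ (μ ℕ.+ 8) ℕ.* (89 ℕ.* I)) ≡⟨ eq μ I ⟩
        175 ℕ.* L ℕ.+ 712 ℕ.* I                              ≤⟨ ℕ.+-monoʳ-≤ (175 ℕ.* L) (cI≤L 712 (ℕ.≤ᵇ⇒≤ 712 814400 _)) ⟩
        175 ℕ.* L ℕ.+ L                                      ≡⟨ ℕ.+-comm (175 ℕ.* L) L ⟩
        176 ℕ.* L ∎
        where
        eq : ∀ μ I → 5 ℕ.* (μ ℕ.* I) ℕ.+ (81 ℕ.* (μ ℕ.* I) ℕ.+ (μ ℕ.+ 8) ℕ.* (89 ℕ.* I)) ≡ 175 ℕ.* (μ ℕ.* I) ℕ.+ 712 ℕ.* I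
        eq = ℕR.solve-∀
      tail : ∀ s → 89 ℕ.* I ℕ.≤ s → 5 ℕ.* L ℕ.+ (I ℕ.+ suc e₁ ℕ.* I) ℕ.+ (81 ℕ.* L ℕ.+ (μ ℕ.+ 8) ℕ.* s) ℕ.≤ e₁ ℕ.* s
      tail s s≥ = begin
        5 ℕ.* L ℕ.+ (I ℕ.+ suc e₁ ℕ.* I) ℕ.+ (81 ℕ.* L ℕ.+ (μ ℕ.+ 8) ℕ.* s)
          ≤⟨ ℕ.+-monoˡ-≤ _ (ℕ.+-monoʳ-≤ (5 ℕ.* L) (ℕ.+-monoʳ-≤ I (ℕ.*-monoˡ-≤ I e₁≤))) ⟩
        5 ℕ.* L ℕ.+ (I ℕ.+ 2 ℕ.* μ ℕ.* I) ℕ.+ (81 ℕ.* L ℕ.+ (μ ℕ.+ 8) ℕ.* s)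
          ≡⟨ eq μ I s ⟩
        (88 ℕ.* μ ℕ.+ 1) ℕ.* I ℕ.+ (μ ℕ.+ 8) ℕ.* s
          ≤⟨ ℕ.+-monoˡ-≤ ((μ ℕ.+ 8) ℕ.* s) (ℕ.*-monoˡ-≤ I δ≥) ⟩
        89 ℕ.* δ ℕ.* I ℕ.+ (μ ℕ.+ 8) ℕ.* s
          ≡⟨ cong (ℕ._+ (μ ℕ.+ 8) ℕ.* s) (eq₂ δ I) ⟩
        δ ℕ.* (89 ℕ.* I) ℕ.+ (μ ℕ.+ 8) ℕ.* s
          ≤⟨ ℕ.+-monoˡ-≤ ((μ ℕ.+ 8) ℕ.* s) (ℕ.*-monoʳ-≤ δ s≥) ⟩
        δ ℕ.* s ℕ.+ (μ ℕ.+ 8) ℕ.* s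
          ≡⟨ trans (sym (ℕ.*-distribʳ-+ s δ (μ ℕ.+ 8))) (cong (ℕ._* s) δ+) ⟩
        e₁ ℕ.* s ∎
        where
        δ = μ ℕ.∸ (16 ℕ.+ 2 ℕ.* J)
        16+2J≤ : 16 ℕ.+ 2 ℕ.* J ℕ.≤ 3 ℕ.* J
        16+2J≤ = ℕ.≤-trans (ℕ.+-monoˡ-≤ (2 ℕ.* J) (ℕ.≤-trans (ℕ.≤ᵇ⇒≤ 16 4072 _) J≥)) (ℕ.≤-reflexive (eq₀ J))
          where
          eq₀ : ∀ J → J ℕ.+ 2 ℕ.* J ≡ 3 ℕ.* J
          eq₀ = ℕR.solve-∀
        δ-eq : δ ℕ.+ (16 ℕ.+ 2 ℕ.* J) ≡ μ
        δ-eq = ℕ.m∸n+n≡m (ℕ.≤-trans 16+2J≤ (ℕ.≤-trans (ℕ.*-monoˡ-≤ J (ℕ.≤ᵇ⇒≤ 3 20 _)) J≤μ))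
        δ+ : δ ℕ.+ (μ ℕ.+ 8) ≡ e₁
        δ+ = ℕ.+-cancelˡ-≡ (8 ℕ.+ 2 ℕ.* J) _ _ (trans (eq₃ δ J μ) (trans (cong (ℕ._+ μ) δ-eq) (trans (cong (μ ℕ.+_) (sym (ℕ.+-identityʳ μ))) (sym e₁-eq))))
          where
          eq₃ : ∀ δ J μ → 8 ℕ.+ 2 ℕ.* J ℕ.+ (δ ℕ.+ (μ ℕ.+ 8)) ≡ δ ℕ.+ (16 ℕ.+ 2 ℕ.* J) ℕ.+ μ
          eq₃ = ℕR.solve-∀
        e₁≤ : suc e₁ ℕ.≤ 2 ℕ.* μ
        e₁≤ = ℕ.≤-trans (ℕ.s≤s (ℕ.m≤n+m e₁ (7 ℕ.+ 2 ℕ.* J))) (ℕ.≤-reflexive e₁-eq)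
        eq : ∀ μ I s → 5 ℕ.* (μ ℕ.* I) ℕ.+ (I ℕ.+ 2 ℕ.* μ ℕ.* I) ℕ.+ (81 ℕ.* (μ ℕ.* I) ℕ.+ (μ ℕ.+ 8) ℕ.* s) ≡ (88 ℕ.* μ ℕ.+ 1) ℕ.* I ℕ.+ (μ ℕ.+ 8) ℕ.* s
        eq = ℕR.solve-∀
        eq₂ : ∀ δ I → 89 ℕ.* δ ℕ.* I ≡ δ ℕ.* (89 ℕ.* I)
        eq₂ = ℕR.solve-∀
        δ≥ : 88 ℕ.* μ ℕ.+ 1 ℕ.≤ 89 ℕ.* δ
        δ≥ = ℕ.+-cancelʳ-≤ (89 ℕ.* (16 ℕ.+ 2 ℕ.* J)) _ _ (begin
          88 ℕ.* μ ℕ.+ 1 ℕ.+ 89 ℕ.* (16 ℕ.+ 2 ℕ.* J)  ≤⟨ ℕ.+-monoʳ-≤ (88 ℕ.* μ ℕ.+ 1) (ℕ.*-monoʳ-≤ 89 16+2J≤) ⟩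
          88 ℕ.* μ ℕ.+ 1 ℕ.+ 89 ℕ.* (3 ℕ.* J)         ≡⟨ ℕ.+-assoc (88 ℕ.* μ) 1 _ ⟩
          88 ℕ.* μ ℕ.+ (1 ℕ.+ 89 ℕ.* (3 ℕ.* J))       ≤⟨ ℕ.+-monoʳ-≤ (88 ℕ.* μ) (ℕ.+-monoˡ-≤ _ 1≤J) ⟩
          88 ℕ.* μ ℕ.+ (J ℕ.+ 89 ℕ.* (3 ℕ.* J))       ≤⟨ ℕ.+-monoʳ-≤ (88 ℕ.* μ) J-lin ⟩
          88 ℕ.* μ ℕ.+ μ                              ≡⟨ ℕ.+-comm (88 ℕ.* μ) μ ⟩
          89 ℕ.* μ                                    ≡⟨ cong (89 ℕ.*_) (sym δ-eq) ⟩
          89 ℕ.* (δ ℕ.+ (16 ℕ.+ 2 ℕ.* J))             ≡⟨ ℕ.*-distribˡ-+ 89 δ (16 ℕ.+ 2 ℕ.* J) ⟩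
          89 ℕ.* δ ℕ.+ 89 ℕ.* (16 ℕ.+ 2 ℕ.* J) ∎)
          where
          J-lin : J ℕ.+ 89 ℕ.* (3 ℕ.* J) ℕ.≤ μ
          J-lin = ℕ.≤-trans (ℕ.≤-reflexive (eq₄ J)) (ℕ.≤-trans (ℕ.*-monoʳ-≤ J (ℕ.≤-trans (ℕ.≤ᵇ⇒≤ 268 (170 ℕ.* 4072) _) (ℕ.≤-trans (ℕ.*-monoʳ-≤ 170 J≥) (ℕ.m≤m+n (170 ℕ.* J) 200)))) hμ)
            where
            eq₄ : ∀ J → J ℕ.+ 89 ℕ.* (3 ℕ.* J) ≡ J ℕ.* 268
            eq₄ = ℕR.solve-∀

    module FromCoefficients (c : ℕ → ℕ → ℤ) (c-nonzero : ∃₂ λ j i → j ℕ.< J × i ℕ.< I × c j i ≢ ℤ.+ 0)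
      (c≤ : ∀ j i → ℤ.∣ c j i ∣ ℕ.≤ 2 ℕ.^ (4 ℕ.* L))
      (f-small : ∀ x → ∣ sum J (λ j → ι (value I (c j) x) * pow (pow w j) x) ∣ ≤ half (81 ℕ.* L) * pow (1ℚ + half (μ ℕ.+ 8)) x) where

      open ZeroEstimate I J c using (weight; Vanishes; contradiction-from-vanishing)

      m*I≡ : m ℕ.* I ≡ 2 ℕ.^ (6 ℕ.* μ)
      m*I≡ = trans (eq m) (trans (ℕ.^-*-assoc 2 μ 6) (cong (2 ℕ.^_) (ℕ.*-comm μ 6)))
        where
        eq : ∀ m → m ℕ.* (m ℕ.* ((m ℕ.* m) ℕ.* (m ℕ.* m))) ≡ m ℕ.* (m ℕ.* (m ℕ.* (m ℕ.* (m ℕ.* (m ℕ.* 1)))))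
        eq = ℕR.solve-∀

      128mI≡ : 128 ℕ.* (m ℕ.* I) ≡ 2 ℕ.^ Z.h
      128mI≡ = trans (cong (128 ℕ.*_) m*I≡) (trans (sym (ℕ.^-distribˡ-+-* 2 7 (6 ℕ.* μ))) (cong (2 ℕ.^_) (ℕ.+-comm 7 (6 ℕ.* μ))))

      <5^h : ∀ {x} → x ℕ.≤ 128 ℕ.* (m ℕ.* I) → x ℕ.< 5 ℕ.^ Z.h
      <5^h p = ℕ.≤-<-trans p (subst (ℕ._< 5 ℕ.^ Z.h) (sym 128mI≡) (ℕ.^-monoˡ-< Z.h {{ℕ.>-nonZero (ℕ.≤-trans (ℕ.s≤s ℕ.z≤n) (ℕ.m≤n+m 7 (6 ℕ.* μ)))}} (ℕ.≤ᵇ⇒≤ 3 5 _)))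

      -- By `bernoulli⁻` with N u = 1/2, a product of 2^(μ+7) factors 1 + 2^(-μ-8) is at most 2; and
      -- 128 m I = I · 2^(μ+7).
      growth≤ : ∀ x → x ℕ.≤ 128 ℕ.* (m ℕ.* I) → pow (1ℚ + half (μ ℕ.+ 8)) x ≤ two I
      growth≤ x x≤ = ≤-trans (pow-monoʳ 1≤base (ℕ.≤-trans x≤ (ℕ.≤-reflexive exp))) (≤-trans (≤-reflexive (pow-* (1ℚ + u) I N)) (pow-mono I (0≤pow N 0≤base) ≤2))
        where
        u = half (μ ℕ.+ 8)
        N = 2 ℕ.^ (μ ℕ.+ 7)
        1≤base : 1ℚ ≤ 1ℚ + u
        1≤base = ≤-trans (≤-reflexive (sym (+-identityʳ 1ℚ))) (+-monoʳ-≤ 1ℚ (0≤half (μ ℕ.+ 8)))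
        0≤base : 0ℚ ≤ 1ℚ + u
        0≤base = ≤-trans 0≤1 1≤base
        exp : 128 ℕ.* (m ℕ.* I) ≡ I ℕ.* N
        exp = trans (eq m I) (cong (I ℕ.*_) (sym (ℕ.^-distribˡ-+-* 2 μ 7)))
          where
          eq : ∀ m I → 128 ℕ.* (m ℕ.* I) ≡ I ℕ.* (m ℕ.* 128)
          eq = ℕR.solve-∀
        Nu : ν N * u ≡ ½
        Nu = trans (cong₂ _*_ (ν-2^ (μ ℕ.+ 7)) (cong half (sym (ℕ.+-assoc μ 7 1)))) (two*half+ (μ ℕ.+ 7) 1)
        ≤2 : pow (1ℚ + u) N ≤ 2ℚ
        ≤2 = *-cancelʳ-≤-pos ½ (≤-trans (≤-reflexive (cong (pow (1ℚ + u) N *_) (trans (from-yes (½ ≟ 1ℚ - ½)) (cong (λ z → 1ℚ - z) (sym Nu))))) (≤-trans (bernoulli⁻ {u} N (0≤half (μ ℕ.+ 8))) (from-yes (1ℚ ≤? 2ℚ * ½))))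

      -- B + 1 = 9 · 10^l is a multiple of 5, because l ≥ 1.
      5∤B : ¬ (5 ℕ∣.∣ B)
      5∤B d = contradiction (ℕ∣.∣m+n∣m⇒∣n (subst (5 ℕ∣.∣_) (ℕ.+-comm 1 B) (subst (5 ℕ∣.∣_) (sym B+1) (ℕ∣.∣n⇒∣m*n 9 5∣10^l))) d) (λ q → contradiction (ℕ∣.∣⇒≤ q) (λ { (ℕ.s≤s ()) }))
        where
        5∣10^l : 5 ℕ∣.∣ 10 ℕ.^ l
        5∣10^l = subst (λ z → 5 ℕ∣.∣ 10 ℕ.^ z) (ℕ.m+[n∸m]≡n 1≤l) (ℕ∣.∣m⇒∣m*n (10 ℕ.^ (l ℕ.∸ 1)) (ℕ∣.divides 2 refl))

      value≤ : ∀ j x → x ℕ.≤ 128 ℕ.* (m ℕ.* I) → ν ℤ.∣ value I (c j) x ∣ ≤ two (6 ℕ.* L)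
      value≤ j x x≤ = ≤-trans (≤-reflexive (trans (sym (∣ι∣ (value I (c j) x))) (cong ∣_∣ (ι-sum I _))))
        (≤-trans (sum-bound I (λ i i< → term i i<)) (≤-trans (*-monoʳ (two (4 ℕ.* L) * two (L ℕ.+ 9 ℕ.* I)) (0≤* (0≤two (4 ℕ.* L)) (0≤two (L ℕ.+ 9 ℕ.* I)))
          (≤-trans (ν-mono (ℕ.<⇒≤ (n<2^n I))) (≤-reflexive (ν-2^ I))))
          (≤-trans (≤-reflexive (trans (cong (two I *_) (sym (pow-+ 2ℚ (4 ℕ.* L) (L ℕ.+ 9 ℕ.* I)))) (sym (pow-+ 2ℚ I (4 ℕ.* L ℕ.+ (L ℕ.+ 9 ℕ.* I)))))) (two-mono exp≤))))
        where
        exp≤ : I ℕ.+ (4 ℕ.* L ℕ.+ (L ℕ.+ 9 ℕ.* I)) ℕ.≤ 6 ℕ.* L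
        exp≤ = ℕ.≤-trans (ℕ.≤-reflexive (eq I L)) (ℕ.≤-trans (ℕ.+-monoʳ-≤ (5 ℕ.* L) (cI≤L 10 (ℕ.≤ᵇ⇒≤ 10 814400 _))) (ℕ.≤-reflexive (ℕ.+-comm (5 ℕ.* L) L)))
          where
          eq : ∀ I L → I ℕ.+ (4 ℕ.* L ℕ.+ (L ℕ.+ 9 ℕ.* I)) ≡ 5 ℕ.* L ℕ.+ 10 ℕ.* I
          eq = ℕR.solve-∀
        term : ∀ i → i ℕ.< I → ∣ ι (c j i ℤ.* ℤ.+ bin x i) ∣ ≤ two (4 ℕ.* L) * two (L ℕ.+ 9 ℕ.* I)
        term i i< = ≤-trans (≤-reflexive (cong ∣_∣ (ι-* (c j i) (ℤ.+ bin x i)))) (∣*∣≤ {ι (c j i)} {ν (bin x i)}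
          (≤-trans (∣ι∣≤ {c j i} (c≤ j i)) (≤-reflexive (ν-2^ (4 ℕ.* L))))
          (∣0≤∣ (0≤ν (bin x i)) (≤-trans (bin-bound x i (0≤two (μ ℕ.+ 8)) (0≤half (μ ℕ.+ 8)) (two*half (μ ℕ.+ 8)))
            (≤-trans (*-mono (0≤pow i (0≤two (μ ℕ.+ 8))) (0≤pow x (0≤+ 0≤1 (0≤half (μ ℕ.+ 8))))
                (≤-trans (≤-reflexive (sym (pow-*′ 2ℚ (μ ℕ.+ 8) i))) (two-mono (ℕ.*-monoʳ-≤ (μ ℕ.+ 8) (ℕ.<⇒≤ i<)))) (growth≤ x x≤))
              (≤-reflexive (trans (sym (pow-+ 2ℚ ((μ ℕ.+ 8) ℕ.* I) I)) (cong two (eq μ I))))))))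
          where
          eq : ∀ μ I → (μ ℕ.+ 8) ℕ.* I ℕ.+ I ≡ μ ℕ.* I ℕ.+ 9 ℕ.* I
          eq = ℕR.solve-∀

      y≤2 : ∣ y ∣ ≤ 2ℚ
      y≤2 = ∣∣≤2 (≤-trans y-close (≤-trans 64tenth≤½ (from-yes (half 1 ≤? 1ℚ))))

      ν5≤16 : ∀ q v → ν (5 ℕ.^ q ℕ.* (2 ℕ.^ q ℕ.* 9 ℕ.^ v)) ≡ ten q * pow 9ℚ v
      ν5≤16 q v = trans (ν-* (5 ℕ.^ q) (2 ℕ.^ q ℕ.* 9 ℕ.^ v)) (trans (cong₂ _*_ (trans (ν-^ 5 q) (cong (λ z → pow z q) (ι-lit 5)))
          (trans (ν-* (2 ℕ.^ q) (9 ℕ.^ v)) (cong₂ _*_ (trans (ν-^ 2 q) (cong (λ z → pow z q) (ι-lit 2))) (trans (ν-^ 9 v) (cong (λ z → pow z v) (ι-lit 9))))))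
        (trans (sym (*-assoc (pow (lit 5) q) (two q) (pow 9ℚ v))) (cong (_* pow 9ℚ v) (sym (pow-∙ (lit 5) 2ℚ q)))))

      module AtPoint {t u v : ℕ} (t< : t ℕ.< J) (u< : u ℕ.< Z.U) (v< : v ℕ.< a) where

        private
          module G = Lattice {n} {k} {a} {b} {Q} {D} {{a≢0}} {{Q≢0}} up lo Z.hD {Z.base t ℕ.+ u} {v} v< (Z.a≤base t< u<) (Z.D≤base t< u<)

        x p q : ℕ
        x = G.x
        p = G.p
        q = G.q

        above : Z.Pos t ℕ.+ I ℕ.≤ q
        above = Z.above t< u< G.≤q

        below : q ℕ.+ I ℕ.≤ Z.Pos (suc t)
        below = Z.below t< u< G.q≤

        x≤ : x ℕ.≤ 128 ℕ.* (m ℕ.* I)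
        x≤ = Z.x≤ t< u< v<

        private
          p≤ : p ℕ.≤ 34 ℕ.* J ℕ.* I
          p≤ = ℕ.≤-trans G.p≤ (Z.a*≤ t< u<)

          q≤ : q ℕ.≤ 34 ℕ.* J ℕ.* I ℕ.+ D
          q≤ = ℕ.≤-trans G.q≤ (ℕ.+-monoˡ-≤ D (Z.b*≤ t< u<))

          X′ Zv : ℕ
          X′ = 2 ℕ.^ q ℕ.* 9 ℕ.^ v
          Zv = B ℕ.^ v

          xe ze : ℕ
          xe = 4 ℕ.* q ℕ.+ 4 ℕ.* a
          ze = a ℕ.* (4 ℕ.* l ℕ.+ 4)

          budget : J ℕ.* xe ℕ.+ J ℕ.* ze ℕ.+ J ℕ.* p ℕ.≤ L
          budget = ℕ.≤-trans (ℕ.≤-reflexive (eq J q a l p)) (Z.budget {p} {q} p≤ q≤)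
            where
            eq : ∀ J q a l p → J ℕ.* (4 ℕ.* q ℕ.+ 4 ℕ.* a) ℕ.+ J ℕ.* (a ℕ.* (4 ℕ.* l ℕ.+ 4)) ℕ.+ J ℕ.* p ≡ J ℕ.* (4 ℕ.* q ℕ.+ a ℕ.* (4 ℕ.* l ℕ.+ 8) ℕ.+ p)
            eq = ℕR.solve-∀

          νX≤ : ν (5 ℕ.^ q ℕ.* X′) ≤ two xe
          νX≤ = ≤-trans (≤-reflexive (ν5≤16 q v)) (≤-trans (*-mono (0≤ten q) (0≤pow v (0≤lit 9))
              (≤-trans (pow-mono q (0≤lit 10) (from-yes (10ℚ ≤? two 4))) (≤-reflexive (sym (pow-*′ 2ℚ 4 q))))
              (≤-trans (pow-mono v (0≤lit 9) (from-yes (9ℚ ≤? two 4))) (≤-trans (≤-reflexive (sym (pow-*′ 2ℚ 4 v))) (two-mono (ℕ.*-monoʳ-≤ 4 (ℕ.<⇒≤ v<))))))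
            (≤-reflexive (sym (pow-+ 2ℚ (4 ℕ.* q) (4 ℕ.* a)))))

          νB≤ : ν B ≤ two (4 ℕ.* l ℕ.+ 4)
          νB≤ = ≤-trans (ν-mono (ℕ.≤-trans (ℕ.n≤1+n B) (ℕ.≤-reflexive B+1))) (≤-trans (≤-reflexive (trans (ν-* 9 (10 ℕ.^ l)) (cong₂ _*_ (ι-lit 9) (ν-10^ l))))
            (≤-trans (*-mono (0≤lit 9) (0≤ten l) (from-yes (9ℚ ≤? two 4)) (≤-trans (pow-mono l (0≤lit 10) (from-yes (10ℚ ≤? two 4))) (≤-reflexive (sym (pow-*′ 2ℚ 4 l)))))
              (≤-reflexive (trans (sym (pow-+ 2ℚ 4 (4 ℕ.* l))) (cong two (ℕ.+-comm 4 (4 ℕ.* l)))))))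

          νZ≤ : ν Zv ≤ two ze
          νZ≤ = ≤-trans (≤-reflexive (ν-^ B v)) (≤-trans (pow-mono v (0≤ν B) νB≤) (≤-trans (≤-reflexive (sym (pow-* 2ℚ v (4 ℕ.* l ℕ.+ 4))))
            (two-mono (ℕ.*-monoˡ-≤ (4 ℕ.* l ℕ.+ 4) (ℕ.<⇒≤ v<)))))

          pow-two : ∀ {z e i} → 0ℚ ≤ z → z ≤ two e → i ℕ.≤ J → pow z i ≤ two (J ℕ.* e)
          pow-two {z} {e} {i} 0≤z h p = ≤-trans (pow-mono i 0≤z h) (≤-trans (≤-reflexive (sym (pow-* 2ℚ i e))) (two-mono (ℕ.*-monoˡ-≤ e p)))

          terms≤ : ∀ j → j ℕ.< J → pow (ν (5 ℕ.^ q ℕ.* X′)) (weight j) * pow (ν Zv) j * two (j ℕ.* p) ≤ two L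
          terms≤ j j< = ≤-trans (*-mono (0≤* (0≤pow (weight j) (0≤ν (5 ℕ.^ q ℕ.* X′))) (0≤pow j (0≤ν Zv))) (0≤two (j ℕ.* p))
              (*-mono (0≤pow (weight j) (0≤ν (5 ℕ.^ q ℕ.* X′))) (0≤pow j (0≤ν Zv))
                (pow-two {e = xe} (0≤ν (5 ℕ.^ q ℕ.* X′)) νX≤ (ℕ.m∸n≤m J (suc j))) (pow-two {e = ze} (0≤ν Zv) νZ≤ (ℕ.<⇒≤ j<)))
              (two-mono (ℕ.*-monoˡ-≤ p (ℕ.<⇒≤ j<))))
            (≤-trans (≤-reflexive (trans (cong (_* two (J ℕ.* p)) (sym (pow-+ 2ℚ (J ℕ.* xe) (J ℕ.* ze)))) (sym (pow-+ 2ℚ (J ℕ.* xe ℕ.+ J ℕ.* ze) (J ℕ.* p))))) (two-mono budget))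

          jp≤ : ∀ j → j ℕ.< J → j ℕ.* p ℕ.≤ L
          jp≤ j j< = ℕ.≤-trans (ℕ.*-monoˡ-≤ p (ℕ.<⇒≤ j<)) (ℕ.≤-trans (ℕ.m≤n+m (J ℕ.* p) (J ℕ.* xe ℕ.+ J ℕ.* ze)) budget)

          X≤ : pow (ν (5 ℕ.^ q ℕ.* X′)) (J ℕ.∸ 1) ≤ two L
          X≤ = ≤-trans (pow-two {e = xe} (0≤ν (5 ℕ.^ q ℕ.* X′)) νX≤ (ℕ.m∸n≤m J 1))
            (two-mono (ℕ.≤-trans (ℕ.≤-trans (ℕ.m≤m+n (J ℕ.* xe) (J ℕ.* ze)) (ℕ.m≤m+n (J ℕ.* xe ℕ.+ J ℕ.* ze) (J ℕ.* p))) budget))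

          -- Here X = 10^q 9^v cancels the denominator 10^q of w^x and supplies v factors 9; then 9
          -- ω^n / 10^k = B y turns the remaining v-th power into B^v y^v.
          point : ν (5 ℕ.^ q ℕ.* X′) * pow w x ≡ ν Zv * pow ω p * pow y v
          point = begin
            ν (5 ℕ.^ q ℕ.* X′) * pow w x
              ≡⟨ cong₂ _*_ (ν5≤16 q v) (trans (pow-∙ (pow ω a) (tenth b) x) (cong₂ _*_
                   (trans (sym (pow-*′ ω a x)) (trans (cong (pow ω) (sym G.p-eq)) (pow-+ ω p (n ℕ.* v))))
                   (trans (sym (pow-*′ 1/10 b x)) (trans (cong tenth (sym G.q-eq)) (pow-+ 1/10 q (k ℕ.* v)))))) ⟩
            ten q * pow 9ℚ v * (pow ω p * pow ω (n ℕ.* v) * (tenth q * tenth (k ℕ.* v)))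
              ≡⟨ solve 6 (λ t n o z s r → t :* n :* (o :* z :* (s :* r)) := (t :* s) :* (n :* o :* z :* r)) refl (ten q) (pow 9ℚ v) (pow ω p) (pow ω (n ℕ.* v)) (tenth q) (tenth (k ℕ.* v)) ⟩
            (ten q * tenth q) * (pow 9ℚ v * pow ω p * pow ω (n ℕ.* v) * tenth (k ℕ.* v))
              ≡⟨ cong₂ _*_ (ten*tenth q) (cong₂ (λ a b → pow 9ℚ v * pow ω p * a * b) (pow-*′ ω n v) (pow-*′ 1/10 k v)) ⟩
            1ℚ * (pow 9ℚ v * pow ω p * pow (pow ω n) v * pow (tenth k) v)
              ≡⟨ cong (_* (pow 9ℚ v * pow ω p * pow (pow ω n) v * pow (tenth k) v)) (sym (trans (sym (pow-∙ (ν B) invB v)) (trans (cong (λ z → pow z v) B*invB) (pow-1 v)))) ⟩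
            pow (ν B) v * pow invB v * (pow 9ℚ v * pow ω p * pow (pow ω n) v * pow (tenth k) v)
              ≡⟨ solve 6 (λ b i n o z r → b :* i :* (n :* o :* z :* r) := b :* o :* ((n :* z) :* (r :* i))) refl (pow (ν B) v) (pow invB v) (pow 9ℚ v) (pow ω p) (pow (pow ω n) v) (pow (tenth k) v) ⟩
            pow (ν B) v * pow ω p * ((pow 9ℚ v * pow (pow ω n) v) * (pow (tenth k) v * pow invB v))
              ≡⟨ cong₂ (λ a b → a * pow ω p * b) (sym (ν-^ B v)) (sym (trans (pow-∙ (9ℚ * pow ω n) (tenth k * invB) v) (cong₂ _*_ (pow-∙ 9ℚ (pow ω n) v) (pow-∙ (tenth k) invB v)))) ⟩
            ν Zv * pow ω p * pow y v ∎
            where open ≡-Reasoning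

          y≤ : ∀ j → j ℕ.< J → ∣ 1ℚ - pow (pow y v) j ∣ ≤ half Ω
          y≤ j j< = ≤-trans (≤-reflexive (trans (cong ∣_∣ (trans (eq (pow (pow y v) j)) (cong (λ z → - (z - 1ℚ)) (sym (pow-* y j v))))) (∣-p∣≡∣p∣ (pow y (j ℕ.* v) - 1ℚ))))
            (≤-trans (pow-1-error {y} (j ℕ.* v) y≤2) (≤-trans (*-mono (0≤pow (j ℕ.* v) (0≤lit 4)) (0≤∣p∣ (y - 1ℚ))
                (≤-trans (≤-reflexive (sym (pow-*′ 2ℚ 2 (j ℕ.* v)))) (two-mono (ℕ.*-monoʳ-≤ 2 (ℕ.≤-trans (ℕ.*-mono-≤ (ℕ.<⇒≤ j<) (ℕ.<⇒≤ v<)) (ℕ.≤-reflexive (ℕ.*-comm J a))))))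
                (≤-trans y-close (lit64*tenth {k} {2 ℕ.* (a ℕ.* J) ℕ.+ Ω} (ℕ.≤-trans (ℕ.≤-reflexive (eq₂ (2 ℕ.* (a ℕ.* J)) Ω)) Z.far))))
              (≤-reflexive (two*half+ (2 ℕ.* (a ℕ.* J)) Ω))))
            where
            eq : ∀ z → 1ℚ - z ≡ - (z - 1ℚ)
            eq = solve 1 (λ z → con 1ℚ :- z := :- (z :- con 1ℚ)) refl
            eq₂ : ∀ x Ω → 6 ℕ.+ (x ℕ.+ Ω) ≡ 6 ℕ.+ Ω ℕ.+ x
            eq₂ = ℕR.solve-∀

          f≤ : ∣ sum J (λ j → ι (value I (c j) x) * pow (pow w x) j) ∣ ≤ half Ω
          f≤ = ≤-trans (≤-reflexive (cong ∣_∣ (sum-cong J (λ j _ → cong (ι (value I (c j) x) *_) (trans (sym (pow-* w j x)) (pow-*′ w j x))))))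
            (≤-trans (f-small x) (≤-trans (*-monoˡ (half (81 ℕ.* L)) (0≤half (81 ℕ.* L)) (growth≤ x x≤))
              (≤-trans (≤-reflexive (*-comm (half (81 ℕ.* L)) (two I))) (two*half≤ {I} {81 ℕ.* L} {Ω} (ℕ.+-monoˡ-≤ Ω I≤L)))))

        open Vanishing I J c {half Nω} {ω} lo≤ω ω≤hi tiny 12 (6 ℕ.* L) L Ω
          (≤-trans (ν-mono J≤) (≤-trans (≤-reflexive (ι-lit 4096)) (from-yes (lit 4096 ≤? two 12)))) (half-anti (ℕ.m≤n+m Ω (3 ℕ.* n ℕ.+ 7)))

        private
          budget′ : 2 ℕ.* T ℕ.+ 4 ℕ.* γ ℕ.+ 12 ℕ.+ 6 ℕ.* L ℕ.+ 3 ℕ.* L ℕ.+ 40 ℕ.≤ Ω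
          budget′ = ℕ.≤-trans (ℕ.≤-reflexive (eq L)) (ℕ.≤-trans (ℕ.+-monoʳ-≤ (79 ℕ.* L) (c≤L 242 (ℕ.≤ᵇ⇒≤ 242 814400 _))) (ℕ.≤-reflexive (ℕ.+-comm (79 ℕ.* L) L)))
            where
            eq : ∀ L → 2 ℕ.* ((12 ℕ.+ 6 ℕ.* L ℕ.+ L ℕ.+ 4 ℕ.+ 5) ℕ.* 3) ℕ.+ 4 ℕ.* (12 ℕ.+ 6 ℕ.* L ℕ.+ L ℕ.+ 4) ℕ.+ 12 ℕ.+ 6 ℕ.* L ℕ.+ 3 ℕ.* L ℕ.+ 40 ≡ 79 ℕ.* L ℕ.+ 242
            eq = ℕR.solve-∀

        vanish : Vanishes x q
        vanish = Point.vanishes budget′ x q p X′ Zv (pow w x) (pow y v) (λ j _ → value≤ j x x≤) terms≤ jp≤ X≤ point y≤ f≤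
          (not5-* (not5-^ q (from-no (5 ℕ∣.∣? 2))) (not5-^ v (from-no (5 ℕ∣.∣? 9)))) (not5-^ v 5∤B)

      private
        q : ℕ → ℕ → ℕ → ℕ
        q t v u = b ℕ.* (Z.base t ℕ.+ u ℕ.+ v ℕ.* Z.r) ℕ.∸ k ℕ.* v

        swap : ∀ t v u → Z.base t ℕ.+ u ℕ.+ v ℕ.* Z.r ≡ Z.base t ℕ.+ v ℕ.* Z.r ℕ.+ u
        swap t v u = eq (Z.base t) u (v ℕ.* Z.r)
          where
          eq : ∀ a b c → a ℕ.+ b ℕ.+ c ≡ a ℕ.+ c ℕ.+ b
          eq = ℕR.solve-∀

        c-small : ∀ j i → ℤ.∣ c j i ∣ ℕ.< 5 ℕ.^ suc (4 ℕ.* L)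
        c-small j i = ℕ.≤-<-trans (c≤ j i) (ℕ.≤-<-trans (ℕ.^-monoˡ-≤ (4 ℕ.* L) (ℕ.≤ᵇ⇒≤ 2 5 _))
          (ℕ.^-monoʳ-< 5 (ℕ.≤ᵇ⇒≤ 2 5 _) (ℕ.n<1+n (4 ℕ.* L))))

      -- One run of U = ⌊I/a⌋ + 1 points for each v < a gives the I nodes that the degree requires,
      -- and the gain G is I.
      impossible : ⊥
      impossible = contradiction-from-vanishing {Z.U} {a} {Z.r} {Z.h} {I} {suc (4 ℕ.* L)} Z.base Z.Pos q
        c-nonzero c-small (ℕ.>-nonZero⁻¹ I) Z.I≤aU Z.U≤r (<5^h (ℕ.≤-trans (ℕ.m≤n*m I m {{ℕ.m^n≢0 2 μ}}) (ℕ.m≤n*m (m ℕ.* I) 128))) 1≤a (ℕ.s≤s ℕ.z≤n)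
        (λ t t< v u v< u< → <5^h (subst (ℕ._≤ 128 ℕ.* (m ℕ.* I)) (swap t v u) (AtPoint.x≤ t< u< v<)))
        Z.loss
        (λ t t< v u v< u< → AtPoint.above t< u< v<)
        (λ t t< v u v< u< → AtPoint.below t< u< v<)
        (λ t t< v u v< u< → subst (λ x → Vanishes x (q t v u)) (swap t v u) (AtPoint.vanish t< u< v<))

    impossible : ⊥
    impossible = FromCoefficients.impossible A.c A.c-nonzero A.c≤ A.f-small
      where module A = Auxiliary params w W≤2 η≤

-- The 2-adic lower bound for n

module TwoAdic where

  open import Defs using (S)
  open import Data.Nat as ℕ using (ℕ; zero; suc)
  import Data.Nat.Properties as ℕ
  import Data.Nat.Tactic.RingSolver as ℕR
  open import Data.Integer using (ℤ; +_; _+_; _*_; -_; _-_; ∣_∣; _≟_)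
  open import Data.Integer.Properties
  open import Data.Integer.Divisibility.Signed using (_∣_; _∣?_; divides)
  open import Data.Integer.Tactic.RingSolver using (solve-∀)
  open import Data.Empty using (⊥-elim)
  open import Data.Product using (∃; _×_; _,_; proj₁; proj₂)
  open import Data.Sum using (_⊎_; inj₁; inj₂)
  open import Relation.Binary.PropositionalEquality
  open import Relation.Nullary using (¬_; yes; no; _→-dec_; _⊎-dec_)
  open import Relation.Nullary.Decidable using (toWitness)

  Tribonacci : (ℕ → ℤ) → Set
  Tribonacci G = ∀ t → G (3 ℕ.+ t) ≡ G (2 ℕ.+ t) + G (1 ℕ.+ t) + G t

  Power : Set
  Power = ℤ × ℤ × ℤ

  apply : (ℕ → ℤ) → Power → ℕ → ℤ
  apply G (a , b , c) t = a * G t + b * G (1 ℕ.+ t) + c * G (2 ℕ.+ t)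

  times-α : Power → Power
  times-α (a , b , c) = c , a + c , b + c

  power : ℕ → Power
  power zero    = + 1 , + 0 , + 0
  power (suc n) = times-α (power n)

  apply-power : ∀ {G} → Tribonacci G → ∀ n t → G (n ℕ.+ t) ≡ apply G (power n) t
  apply-power {G} g zero t = eq (G t) (G (1 ℕ.+ t)) (G (2 ℕ.+ t))
    where
    eq : ∀ x y z → x ≡ + 1 * x + + 0 * y + + 0 * z
    eq = solve-∀
  apply-power {G} g (suc n) t = trans (cong G (sym (ℕ.+-suc n t))) (trans (apply-power {G} g n (suc t)) (trans
      (cong (λ w → a * G (1 ℕ.+ t) + b * G (2 ℕ.+ t) + c * w) (g t)) (eq a b c (G t) (G (1 ℕ.+ t)) (G (2 ℕ.+ t)))))
    where
    a = proj₁ (power n)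
    b = proj₁ (proj₂ (power n))
    c = proj₂ (proj₂ (power n))
    eq : ∀ a b c x y z → a * y + b * z + c * (z + y + x) ≡ c * x + (a + c) * y + (b + c) * z
    eq = solve-∀

  Tribonacci-apply : ∀ {G} → Tribonacci G → ∀ v → Tribonacci (apply G v)
  Tribonacci-apply {G} g (a , b , c) t = trans (cong₂ _+_ (cong₂ (λ x y → a * x + b * y) (g t) (g (1 ℕ.+ t))) (cong (c *_) (g (2 ℕ.+ t))))
    (eq a b c (G t) (G (1 ℕ.+ t)) (G (2 ℕ.+ t)) (G (3 ℕ.+ t)) (G (4 ℕ.+ t)))
    where
    eq : ∀ a b c x y z u v → a * (z + y + x) + b * (u + z + y) + c * (v + u + z) ≡ (a * z + b * u + c * v) + (a * y + b * z + c * u) + (a * x + b * y + c * z)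
    eq = solve-∀

  Tribonacci-+ : ∀ {G H} → Tribonacci G → Tribonacci H → ∀ c → Tribonacci (λ t → G t + c * H t)
  Tribonacci-+ {G} {H} g h c t = trans (cong₂ (λ x y → x + c * y) (g t) (h t)) (eq c (G t) (G (1 ℕ.+ t)) (G (2 ℕ.+ t)) (H t) (H (1 ℕ.+ t)) (H (2 ℕ.+ t)))
    where
    eq : ∀ c x y z u v w → z + y + x + c * (w + v + u) ≡ (z + c * w) + (y + c * v) + (x + c * u)
    eq = solve-∀

  increment : (ℕ → ℤ) → (ℕ → ℤ) → ℕ → ℤ
  increment G H t = G t + G (1 ℕ.+ t) + + 4 * H t

  Tribonacci-increment : ∀ {G H} → Tribonacci G → Tribonacci H → Tribonacci (increment G H)
  Tribonacci-increment {G} {H} g h t = trans (cong₂ _+_ (cong₂ _+_ (g t) (g (1 ℕ.+ t))) (cong (+ 4 *_) (h t)))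
    (eq (G t) (G (1 ℕ.+ t)) (G (2 ℕ.+ t)) (G (3 ℕ.+ t)) (H t) (H (1 ℕ.+ t)) (H (2 ℕ.+ t)))
    where
    eq : ∀ x y z s u v w → z + y + x + (s + z + y) + + 4 * (w + v + u) ≡ (z + s + + 4 * w) + (y + z + + 4 * v) + (x + y + + 4 * u)
    eq = solve-∀

  +2^suc : ∀ k → + (2 ℕ.^ suc k) ≡ + 2 * + (2 ℕ.^ k)
  +2^suc k = pos-* 2 (2 ℕ.^ k)

  -- 2-adically, α^(2^K) = 1 + 2^(K-1) (1 + α + 4 η) for an algebraic integer η: this starts with α^16 = 1 + 8 (213 + 329 α + 392 α²) and is preserved by squaring.
  shift : ∀ k {G} → Tribonacci G → ∃ λ H → Tribonacci H × (∀ t → G (2 ℕ.^ (4 ℕ.+ k) ℕ.+ t) ≡ G t + + (2 ℕ.^ (3 ℕ.+ k)) * increment G H t)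
  shift zero {G} g = apply G (+ 53 , + 82 , + 98) , Tribonacci-apply {G} g (+ 53 , + 82 , + 98)
    , λ t → trans (apply-power {G} g 16 t) (eq (G t) (G (1 ℕ.+ t)) (G (2 ℕ.+ t)))
    where
    eq : ∀ x y z → + 1705 * x + + 2632 * y + + 3136 * z ≡ x + + 8 * (x + y + + 4 * (+ 53 * x + + 82 * y + + 98 * z))
    eq = solve-∀
  shift (suc k) {G} g with shift k {G} g
  ... | H , h , G-shift with shift k {increment G H} (Tribonacci-increment {G} {H} g h)
  ...   | H′ , h′ , M-shift = (λ t → H t + + (2 ℕ.^ k) * N t) , Tribonacci-+ {H} {N} h (Tribonacci-increment {M} {H′} (Tribonacci-increment {G} {H} g h) h′) (+ (2 ℕ.^ k)) , next
    where
    M = increment G H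
    N = increment M H′
    K = 2 ℕ.^ (4 ℕ.+ k)
    u = + (2 ℕ.^ (3 ℕ.+ k))
    v = + (2 ℕ.^ k)
    u≡ : u ≡ + 8 * v
    u≡ = trans (cong +_ (ℕ.^-distribˡ-+-* 2 3 k)) (pos-* 8 (2 ℕ.^ k))
    next : ∀ t → G (2 ℕ.^ (5 ℕ.+ k) ℕ.+ t) ≡ G t + + (2 ℕ.^ (4 ℕ.+ k)) * increment G (λ t → H t + v * N t) t
    next t = begin
      G (2 ℕ.^ (5 ℕ.+ k) ℕ.+ t)              ≡⟨ cong G (eqℕ K t) ⟩
      G (K ℕ.+ (K ℕ.+ t))                    ≡⟨ G-shift (K ℕ.+ t) ⟩
      G (K ℕ.+ t) + u * M (K ℕ.+ t)          ≡⟨ cong₂ (λ x y → x + u * y) (G-shift t) (M-shift t) ⟩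
      G t + u * M t + u * (M t + u * N t)    ≡⟨ cong (λ w → G t + u * M t + u * (M t + w * N t)) u≡ ⟩
      G t + u * M t + u * (M t + + 8 * v * N t) ≡⟨ eq (G t) u v (G (1 ℕ.+ t)) (H t) (N t) ⟩
      G t + + 2 * u * increment G (λ t → H t + v * N t) t ≡⟨ cong (λ w → G t + w * increment G (λ t → H t + v * N t) t) (sym (+2^suc (3 ℕ.+ k))) ⟩
      G t + + (2 ℕ.^ (4 ℕ.+ k)) * increment G (λ t → H t + v * N t) t ∎
      where
      open ≡-Reasoning
      eqℕ : ∀ K t → 2 ℕ.* K ℕ.+ t ≡ K ℕ.+ (K ℕ.+ t)
      eqℕ = ℕR.solve-∀
      eq : ∀ g u v g′ h n → g + u * (g + g′ + + 4 * h) + u * (g + g′ + + 4 * h + + 8 * v * n) ≡ g + + 2 * u * (g + g′ + + 4 * (h + v * n))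
      eq = solve-∀

  -- Z t is S_{t-5}, the sequence S continued to negative indices.
  Z : ℕ → ℤ
  Z 0 = - + 1
  Z 1 = - + 5
  Z 2 = + 5
  Z (suc (suc (suc t))) = Z (suc (suc t)) + Z (suc t) + Z t

  Z≡S : ∀ n → Z (5 ℕ.+ n) ≡ + S n
  Z≡S 0 = refl
  Z≡S 1 = refl
  Z≡S 2 = refl
  Z≡S (suc (suc (suc n))) = cong₂ _+_ (cong₂ _+_ (Z≡S (suc (suc n))) (Z≡S (suc n))) (Z≡S n)

  Z-odd : ∀ t → ∃ λ w → Z t ≡ + 1 + + 2 * w
  Z-odd 0 = - + 1 , refl
  Z-odd 1 = - + 3 , refl
  Z-odd 2 = + 2 , refl
  Z-odd (suc (suc (suc t))) with Z-odd (2 ℕ.+ t) | Z-odd (1 ℕ.+ t) | Z-odd t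
  ... | a , p | b , q | c , r = a + b + c + + 1 , trans (cong₂ _+_ (cong₂ _+_ p q) r) (eq a b c)
    where
    eq : ∀ a b c → + 1 + + 2 * a + (+ 1 + + 2 * b) + (+ 1 + + 2 * c) ≡ + 1 + + 2 * (a + b + c + + 1)
    eq = solve-∀

  1≢2* : ∀ x → + 1 ≢ + 2 * x
  1≢2* x e = odd ∣ x ∣ (trans (cong ∣_∣ e) (abs-* (+ 2) x))
    where
    odd : ∀ n → 1 ≢ 2 ℕ.* n
    odd zero ()
    odd (suc n) e = ℕ.1+n≢0 (sym (ℕ.suc-injective (trans e (cong suc (ℕ.+-suc n (n ℕ.+ 0))))))

  Exceptional : ℕ → Set
  Exceptional t = t ≡ 0 ⊎ t ≡ 3 ⊎ t ≡ 4

  exceptional-next : ∀ {t} → Exceptional t → Z t ≡ - + 1 × ∃ λ h → Z t + Z (1 ℕ.+ t) ≡ + 2 + + 4 * h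
  exceptional-next (inj₁ refl)        = refl , - + 2 , refl
  exceptional-next (inj₂ (inj₁ refl)) = refl , - + 1 , refl
  exceptional-next (inj₂ (inj₂ refl)) = refl , + 0 , refl

  module Descent (u q h H z z′ : ℤ) (e : z + u * (z + z′ + + 4 * H) + + 1 ≡ q * (+ 2 * (+ 2 * u))) where

    -- As z and z′ are odd, the increment z + z′ + 4 H is even, so u times it disappears modulo 2 u:
    -- the congruence descends to the earlier index with half the modulus.
    previous : ∀ a b → z ≡ + 1 + + 2 * a → z′ ≡ + 1 + + 2 * b → z + + 1 ≡ (+ 2 * q - (+ 1 + a + b + + 2 * H)) * (+ 2 * u)
    previous a b refl refl = trans (eq₁ u H a b) (trans (cong (_- u * (+ 2 * (+ 1 + a + b + + 2 * H))) e) (eq₂ u q (+ 1 + a + b + + 2 * H)))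
      where
      eq₁ : ∀ u H a b → + 1 + + 2 * a + + 1 ≡ (+ 1 + + 2 * a + u * (+ 1 + + 2 * a + (+ 1 + + 2 * b) + + 4 * H) + + 1) - u * (+ 2 * (+ 1 + a + b + + 2 * H))
      eq₁ = solve-∀
      eq₂ : ∀ u q c → q * (+ 2 * (+ 2 * u)) - u * (+ 2 * c) ≡ (+ 2 * q - c) * (+ 2 * u)
      eq₂ = solve-∀

    -- The left side of `e` is 2 u times an odd number, which cannot be a multiple of 4 u. The
    -- conclusion is this contradiction in the form 1 = 2 (...), still multiplied by 2 u.
    parity : z ≡ - + 1 → z + z′ ≡ + 2 + + 4 * h → (+ 2 * u) * + 1 ≡ (+ 2 * u) * (+ 2 * (q - h - H))
    parity z≡ z+z′ = trans (eq₁ u h H) (trans (cong (λ x → x - + 4 * u * (h + H)) (trans (cong₂ (λ x y → x + u * (y + + 4 * H) + + 1) (sym z≡) (sym z+z′)) e)) (eq₂ u q h H))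
      where
      eq₁ : ∀ u h H → (+ 2 * u) * + 1 ≡ (- + 1 + u * (+ 2 + + 4 * h + + 4 * H) + + 1) - + 4 * u * (h + H)
      eq₁ = solve-∀
      eq₂ : ∀ u q h H → q * (+ 2 * (+ 2 * u)) - + 4 * u * (h + H) ≡ (+ 2 * u) * (+ 2 * (q - h - H))
      eq₂ = solve-∀

  -- Doubling the modulus creates no new solution: an index t ≥ 2^(4+k) descends to s = t - 2^(4+k),
  -- which is exceptional by induction, and then `parity` excludes t. Below 16 there are only the
  -- three indices where Z is exactly -1.
  exceptional : ∀ k t → t ℕ.< 2 ℕ.^ (4 ℕ.+ k) → + (2 ℕ.^ (4 ℕ.+ k)) ∣ Z t + + 1 → Exceptional t
  exceptional zero t t< d = toWitness {a? = ℕ.allUpTo? (λ t → (+ 16 ∣? Z t + + 1) →-dec (t ℕ.≟ 0 ⊎-dec t ℕ.≟ 3 ⊎-dec t ℕ.≟ 4)) 16} _ t< d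
  exceptional (suc k) t t< (divides q e) with t ℕ.<? 2 ℕ.^ (4 ℕ.+ k)
  ... | yes t<′ = exceptional k t t<′ (divides (q * + 2) (trans e (trans (cong (q *_) (+2^suc (4 ℕ.+ k))) (sym (*-assoc q (+ 2) _)))))
  ... | no  t≮ with ℕ.m≤n⇒∃[o]m+o≡n (ℕ.≮⇒≥ t≮)
  ...   | s , refl = ⊥-elim (1≢2* (q - h - H s) (*-cancelˡ-≡ (+ 2 * u) (+ 1) (+ 2 * (q - h - H s)) {{2u≢0}} (D.parity h (proj₁ next) (proj₂ (proj₂ next)))))
    where
    u = + (2 ℕ.^ (3 ℕ.+ k))
    2u≡ : + (2 ℕ.^ (4 ℕ.+ k)) ≡ + 2 * u
    2u≡ = +2^suc (3 ℕ.+ k)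
    2u≢0 = subst (λ x → ℕ.NonZero ∣ x ∣) 2u≡ (ℕ.m^n≢0 2 (4 ℕ.+ k))
    H = proj₁ (shift k {Z} (λ _ → refl))
    module D h = Descent u q h (H s) (Z s) (Z (1 ℕ.+ s)) (trans (cong (_+ + 1) (sym (proj₂ (proj₂ (shift k {Z} (λ _ → refl))) s)))
      (trans e (cong (q *_) (trans (+2^suc (4 ℕ.+ k)) (cong (+ 2 *_) 2u≡)))))
    odd₀ = Z-odd s
    odd₁ = Z-odd (1 ℕ.+ s)
    s< : s ℕ.< 2 ℕ.^ (4 ℕ.+ k)
    s< = ℕ.+-cancelˡ-< (2 ℕ.^ (4 ℕ.+ k)) s _ (subst (2 ℕ.^ (4 ℕ.+ k) ℕ.+ s ℕ.<_) (cong (2 ℕ.^ (4 ℕ.+ k) ℕ.+_) (ℕ.+-identityʳ (2 ℕ.^ (4 ℕ.+ k)))) t<)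
    r = + 2 * q - (+ 1 + proj₁ odd₀ + proj₁ odd₁ + + 2 * H s)
    next = exceptional-next (exceptional k s s< (divides r (trans (D.previous (+ 0) (proj₁ odd₀) (proj₁ odd₁) (proj₂ odd₀) (proj₂ odd₁)) (cong (r *_) (sym 2u≡)))))
    h = proj₁ (proj₂ next)

  -- In Z the value S n has index 5 + n, while the exceptional indices 0, 3 and 4 belong to S at -5,
  -- -2 and -1.
  large-index : ∀ n l c → 4 ℕ.≤ l → 1 ℕ.+ S n ≡ c ℕ.* 2 ℕ.^ l → 2 ℕ.^ l ℕ.≤ 5 ℕ.+ n
  large-index n l c 4≤l e with ℕ.m≤n⇒∃[o]m+o≡n 4≤l
  ... | k , refl = ℕ.≮⇒≥ λ lt → late (exceptional k (5 ℕ.+ n) lt (divides (+ c) (trans (cong (_+ + 1) (Z≡S n)) (trans (cong +_ (trans (ℕ.+-comm (S n) 1) e)) (pos-* c (2 ℕ.^ (4 ℕ.+ k)))))))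
    where
    late : ¬ Exceptional (5 ℕ.+ n)
    late (inj₁ ())
    late (inj₂ (inj₁ ()))
    late (inj₂ (inj₂ ()))

-- A verified congruence sieve

module Sieving where

  open import Defs using (S; repdigit; palRep)
  open import Data.Nat
  open import Data.Nat.Properties
  open import Data.Nat.DivMod
  open import Data.Nat.Divisibility using (_∣_; divides; m%n≡0⇒n∣m)
  open import Data.Nat.Tactic.RingSolver using (solve-∀)
  open import Data.Bool using (Bool; true; false; if_then_else_; _∧_; not; T)
  open import Data.Bool.ListAction using (all)
  open import Data.List using (List; []; _∷_; map; concatMap; upTo)
  open import Data.List.Membership.Propositional using (_∈_; lose)
  open import Data.List.Membership.Propositional.Properties using (∈-concatMap⁺; ∈-map⁺; ∈-upTo⁺)
  open import Data.List.Relation.Unary.Any using (here; there)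
  open import Data.Product using (_×_; _,_; proj₁; proj₂)
  open import Data.Unit using (tt)
  open import Function using (it)
  open import Function using (it)
  open import Function using (it)
  open import Relation.Binary.PropositionalEquality hiding ([_])
  open import Relation.Nullary using (contradiction)

  infix 4 _≈_[_]
  _≈_[_] : ℕ → ℕ → (p : ℕ) → .{{NonZero p}} → Set
  x ≈ y [ p ] = x % p ≡ y % p

  module _ {p : ℕ} .{{_ : NonZero p}} where

    ≈-+ : ∀ {a b c d} → a ≈ b [ p ] → c ≈ d [ p ] → a + c ≈ b + d [ p ]
    ≈-+ {a} {b} {c} {d} h k = trans (%-distribˡ-+ a c p) (trans (cong₂ (λ x y → (x + y) % p) h k) (sym (%-distribˡ-+ b d p)))

    ≈-* : ∀ {a b c d} → a ≈ b [ p ] → c ≈ d [ p ] → a * c ≈ b * d [ p ]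
    ≈-* {a} {b} {c} {d} h k = trans (%-distribˡ-* a c p) (trans (cong₂ (λ x y → (x * y) % p) h k) (sym (%-distribˡ-* b d p)))

    %-≈ : ∀ a → a % p ≈ a [ p ]
    %-≈ a = m%n%n≡m%n a p

  Triple : Set
  Triple = ℕ × ℕ × ℕ

  comb : Triple → ℕ → ℕ
  comb (a , b , c) t = a * S t + b * S (1 + t) + c * S (2 + t)

  -- Arithmetic of a + b α + c α², using α³ = 1 + α + α² and α⁴ = 1 + 2 α + 2 α².
  square times-α : Triple → Triple
  square (a , b , c) = a * a + (2 * (b * c) + c * c) , 2 * (a * b) + (2 * (b * c) + 2 * (c * c)) , 2 * (a * c) + b * b + (2 * (b * c) + 2 * (c * c))
  times-α (a , b , c) = c , a + c , b + c

  reduce : (p : ℕ) → .{{NonZero p}} → Triple → Triple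
  reduce p (a , b , c) = a % p , b % p , c % p

  -- The coordinates of α^n modulo p in the basis 1, α, α²; correct for n < 2^f, as is power-10.
  power-α : (p : ℕ) → .{{NonZero p}} → ℕ → ℕ → Triple
  power-α p zero    n = 1 , 0 , 0
  power-α p (suc f) n = if n % 2 ≡ᵇ 0 then reduce p (square (power-α p f (n / 2))) else reduce p (times-α (reduce p (square (power-α p f (n / 2)))))

  power-10 : (p : ℕ) → .{{NonZero p}} → ℕ → ℕ → ℕ
  power-10 p zero    n = 1
  power-10 p (suc f) n = if n % 2 ≡ᵇ 0 then (power-10 p f (n / 2) ^ 2) % p else (10 * power-10 p f (n / 2) ^ 2) % p

  half< : ∀ f n → n < 2 ^ suc f → n / 2 < 2 ^ f
  half< f n h = m<n*o⇒m/o<n (subst (n <_) (*-comm 2 (2 ^ f)) h)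

  halves : ∀ n → n ≡ n % 2 + (n / 2 + n / 2)
  halves n = trans (m≡m%n+[m/n]*n n 2) (cong (n % 2 +_) (trans (*-comm (n / 2) 2) (cong (n / 2 +_) (+-identityʳ (n / 2)))))

  bit : ∀ n → n % 2 ≢ 0 → n % 2 ≡ 1
  bit n h with n % 2 | m%n<n n 2
  ... | zero        | _ = contradiction refl h
  ... | suc zero    | _ = refl
  ... | suc (suc _) | s≤s (s≤s ())

  module _ (p : ℕ) .{{_ : NonZero p}} where

    Represents : ℕ → Triple → Set
    Represents n v = ∀ t → S (n + t) ≈ comb v t [ p ]

    represents-reduce : ∀ n v → Represents n v → Represents n (reduce p v)
    represents-reduce n (a , b , c) h t = trans (h t) (≈-+ (≈-+ (≈-* (sym (%-≈ a)) refl) (≈-* (sym (%-≈ b)) refl)) (≈-* (sym (%-≈ c)) refl))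

    represents-α : ∀ n v → Represents n v → Represents (suc n) (times-α v)
    represents-α n v@(a , b , c) h t = trans (cong (λ e → S e % p) (sym (+-suc n t))) (trans (h (suc t)) (cong (_% p) (eq a b c (S t) (S (1 + t)) (S (2 + t)))))
      where
      eq : ∀ a b c x y z → a * y + b * z + c * (z + y + x) ≡ c * x + (a + c) * y + (b + c) * z
      eq = solve-∀

    represents-square : ∀ n v → Represents n v → Represents (n + n) (square v)
    represents-square n v@(a , b , c) h t = trans (cong (λ e → S e % p) (+-assoc n n t)) (trans (h (n + t))
      (trans (≈-+ (≈-+ (≈-* {a = a} refl (h t)) (≈-* {a = b} refl (trans (cong (λ e → S e % p) (sym (+-suc n t))) (h (suc t)))))
          (≈-* {a = c} refl (trans (cong (λ e → S e % p) (trans (cong suc (sym (+-suc n t))) (sym (+-suc n (suc t))))) (h (suc (suc t))))))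
        (cong (_% p) (eq a b c (S t) (S (1 + t)) (S (2 + t))))))
      where
      eq : ∀ a b c x y z → a * (a * x + b * y + c * z) + b * (a * y + b * z + c * (z + y + x)) + c * (a * z + b * (z + y + x) + c * ((z + y + x) + z + y))
        ≡ (a * a + (2 * (b * c) + c * c)) * x + (2 * (a * b) + (2 * (b * c) + 2 * (c * c))) * y + (2 * (a * c) + b * b + (2 * (b * c) + 2 * (c * c))) * z
      eq = solve-∀

    power-α-correct : ∀ f n → n < 2 ^ f → Represents n (power-α p f n)
    power-α-correct zero zero h t = cong (_% p) (eq (S t) (S (1 + t)) (S (2 + t)))
      where
      eq : ∀ x y z → x ≡ 1 * x + 0 * y + 0 * z
      eq = solve-∀
    power-α-correct zero (suc n) (s≤s ()) t
    power-α-correct (suc f) n h with n % 2 ≡ᵇ 0 in e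
    ... | true = subst (λ k → Represents k R) (sym (trans (halves n) (cong (_+ (n / 2 + n / 2)) (≡ᵇ⇒≡ (n % 2) 0 (subst T (sym e) tt))))) r
      where
      R = reduce p (square (power-α p f (n / 2)))
      r : Represents (n / 2 + n / 2) R
      r = represents-reduce (n / 2 + n / 2) (square (power-α p f (n / 2))) (represents-square (n / 2) (power-α p f (n / 2)) (power-α-correct f (n / 2) (half< f n h)))
    ... | false = subst (λ k → Represents k (reduce p (times-α R))) (sym (trans (halves n) (cong (_+ (n / 2 + n / 2)) (bit n (λ z → subst T e (≡⇒≡ᵇ (n % 2) 0 z))))))
        (represents-reduce (suc (n / 2 + n / 2)) (times-α R) (represents-α (n / 2 + n / 2) R r))
      where
      R = reduce p (square (power-α p f (n / 2)))
      r : Represents (n / 2 + n / 2) R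
      r = represents-reduce (n / 2 + n / 2) (square (power-α p f (n / 2))) (represents-square (n / 2) (power-α p f (n / 2)) (power-α-correct f (n / 2) (half< f n h)))

    power-10-correct : ∀ f n → n < 2 ^ f → power-10 p f n ≈ 10 ^ n [ p ]
    power-10-correct zero zero h = refl
    power-10-correct zero (suc n) (s≤s ())
    power-10-correct (suc f) n h with n % 2 ≡ᵇ 0 in e
    ... | true = trans (%-≈ (x ^ 2)) (trans x²≈ (cong (λ k → 10 ^ k % p) (sym (trans (halves n) (cong (_+ (n / 2 + n / 2)) (≡ᵇ⇒≡ (n % 2) 0 (subst T (sym e) tt)))))))
      where
      x = power-10 p f (n / 2)
      x²≈ : x ^ 2 ≈ 10 ^ (n / 2 + n / 2) [ p ]
      x²≈ = trans (cong (_% p) (cong (x *_) (*-identityʳ x))) (trans (≈-* ih ih) (cong (_% p) (sym (^-distribˡ-+-* 10 (n / 2) (n / 2)))))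
        where ih = power-10-correct f (n / 2) (half< f n h)
    ... | false = trans (%-≈ (10 * x ^ 2)) (trans (≈-* {a = 10} refl x²≈) (cong (λ k → 10 ^ k % p) (sym (trans (halves n) (cong (_+ (n / 2 + n / 2)) (bit n (λ z → subst T e (≡⇒≡ᵇ (n % 2) 0 z))))))))
      where
      x = power-10 p f (n / 2)
      x²≈ : x ^ 2 ≈ 10 ^ (n / 2 + n / 2) [ p ]
      x²≈ = trans (cong (_% p) (cong (x *_) (*-identityʳ x))) (trans (≈-* ih ih) (cong (_% p) (sym (^-distribˡ-+-* 10 (n / 2) (n / 2)))))
        where ih = power-10-correct f (n / 2) (half< f n h)

    module _ (π : ℕ) (p₀ : S π ≈ 3 [ p ]) (p₁ : S (suc π) ≈ 1 [ p ]) (p₂ : S (suc (suc π)) ≈ 3 [ p ]) where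

      S-period : ∀ t → S (π + t) ≈ S t [ p ]
      S-period 0 = trans (cong (λ e → S e % p) (+-identityʳ π)) p₀
      S-period 1 = trans (cong (λ e → S e % p) (+-comm π 1)) p₁
      S-period 2 = trans (cong (λ e → S e % p) (+-comm π 2)) p₂
      S-period (suc (suc (suc t))) = trans (cong (λ e → S e % p) (trans (+-suc π _) (cong suc (trans (+-suc π _) (cong suc (+-suc π t))))))
        (≈-+ (≈-+ (trans (cong (λ e → S e % p) (sym (trans (+-suc π _) (cong suc (+-suc π t))))) (S-period (suc (suc t))))
          (trans (cong (λ e → S e % p) (sym (+-suc π t))) (S-period (suc t)))) (S-period t))

      S-periods : ∀ c t → S (c * π + t) ≈ S t [ p ]
      S-periods zero    t = refl
      S-periods (suc c) t = trans (cong (λ e → S e % p) (+-assoc π (c * π) t)) (trans (S-period (c * π + t)) (S-periods c t))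

      S-mod : ∀ N .{{_ : NonZero N}} → π ∣ N → ∀ n → S n ≈ S (n % N) [ p ]
      S-mod N (divides c refl) n = trans (cong (λ e → S e % p) (trans (m≡m%n+[m/n]*n n N) (trans (+-comm (n % N) _) (cong (_+ n % N) (sym (*-assoc (n / N) c π))))))
        (S-periods (n / N * c) (n % N))

    module _ (t : ℕ) (h : 10 ^ t ≈ 1 [ p ]) where

      10^-periods : ∀ c → 10 ^ (c * t) ≈ 1 [ p ]
      10^-periods zero    = refl
      10^-periods (suc c) = trans (cong (_% p) (^-distribˡ-+-* 10 t (c * t))) (≈-* h (10^-periods c))

      10^-mod : ∀ L .{{_ : NonZero L}} → t ∣ L → ∀ l → 10 ^ l ≈ 10 ^ (l % L) [ p ]
      10^-mod L (divides c refl) l = trans (cong (λ e → 10 ^ e % p) (trans (m≡m%n+[m/n]*n l L) (cong (l % L +_) (sym (*-assoc (l / L) c t)))))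
        (trans (cong (_% p) (^-distribˡ-+-* 10 (l % L) (l / L * c * t))) (trans (≈-* {a = 10 ^ (l % L)} refl (10^-periods (l / L * c)))
          (cong (_% p) (*-identityʳ (10 ^ (l % L))))))

  repdigit-closed : ∀ d k → 9 * repdigit d k + d ≡ d * 10 ^ k
  repdigit-closed d zero    = sym (*-identityʳ d)
  repdigit-closed d (suc k) = trans (eq (repdigit d k) d) (trans (cong (10 *_) (repdigit-closed d k)) (eq₂ d (10 ^ k)))
    where
    eq : ∀ r d → 9 * (r * 10 + d) + d ≡ 10 * (9 * r + d)
    eq = solve-∀
    eq₂ : ∀ d x → 10 * (d * x) ≡ d * (10 * x)
    eq₂ = solve-∀

  -- Closed forms of the repdigits make nine times the pattern a polynomial in 10^l and 10^m; its
  -- negative terms stand on the left.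
  palRep-equation : ∀ d₁ d₂ l m → let A = 10 ^ l ; X = 10 ^ m in
    9 * palRep d₁ d₂ l m + d₁ * (A * X) + d₂ * A + d₁ ≡ d₁ * (A * (A * X)) + d₂ * (A * X) + d₁ * A
  palRep-equation d₁ d₂ l m = trans (eq r₁ r₂ A X d₁ d₂) (trans (cong₂ (λ u v → (u * X + v) * A + u) (repdigit-closed d₁ l) (repdigit-closed d₂ m)) (eq₂ A X d₁ d₂))
    where
    A = 10 ^ l
    X = 10 ^ m
    r₁ = repdigit d₁ l
    r₂ = repdigit d₂ m
    eq : ∀ r₁ r₂ A X d₁ d₂ → 9 * ((r₁ * X + r₂) * A + r₁) + d₁ * (A * X) + d₂ * A + d₁ ≡ ((9 * r₁ + d₁) * X + (9 * r₂ + d₂)) * A + (9 * r₁ + d₁)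
    eq = solve-∀
    eq₂ : ∀ A X d₁ d₂ → (d₁ * A * X + d₂ * X) * A + d₁ * A ≡ d₁ * (A * (A * X)) + d₂ * (A * X) + d₁ * A
    eq₂ = solve-∀

  State : Set
  State = ℕ × ℕ × ℕ × ℕ × ℕ

  ∧-split : ∀ {a b} → a ∧ b ≡ true → a ≡ true × b ≡ true
  ∧-split {true} {true} refl = refl , refl

  ≡ᵇ-complete : ∀ {a b} → a ≡ b → (a ≡ᵇ b) ≡ true
  ≡ᵇ-complete {a} {b} e = true-T (≡⇒≡ᵇ a b e)
    where
    true-T : ∀ {b} → T b → b ≡ true
    true-T {true} _ = refl

  ≡ᵇ-sound : ∀ {a b} → (a ≡ᵇ b) ≡ true → a ≡ b
  ≡ᵇ-sound {a} {b} e = ≡ᵇ⇒≡ a b (subst T (sym e) tt)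

  -- With the flag false the length l is a fixed number, with the flag true it is known modulo L.
  label : Bool → (L : ℕ) → .{{NonZero L}} → ℕ → ℕ
  label true  L l = l % L
  label false L l = l

  -- p is a modulus for which S has period π and 10 ^_ has period t; the period of the states grows by the factors rN and rL.
  data Modulus : Set where
    modulus : (p π t rN rL : ℕ) → .{{NonZero p}} → .{{NonZero π}} → .{{NonZero t}} → .{{NonZero rN}} → .{{NonZero rL}} → Modulus

  module Sieve (fuel : ℕ) where

    residue-S residue-10 : (p π : ℕ) → .{{NonZero p}} → .{{NonZero π}} → ℕ → ℕ
    residue-S  p π n = comb (power-α p fuel (n % π)) 0 % p
    residue-10 p t k = power-10 p fuel (k % t)

    solves : (p : ℕ) → .{{NonZero p}} → (d₁ d₂ s A X : ℕ) → Bool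
    solves p d₁ d₂ s A X = (9 * s + d₁ * (A * X) + d₂ * A + d₁) % p ≡ᵇ (d₁ * (A * (A * X)) + d₂ * (A * X) + d₁ * A) % p

    lifts : (N r n : ℕ) → List ℕ
    lifts N r n = map (λ i → n + i * N) (upTo r)

    label-lifts : Bool → (L r l : ℕ) → List ℕ
    label-lifts true  L r l = lifts L r l
    label-lifts false L r l = l ∷ []

    tagged : (ℕ → ℕ) → List ℕ → List (ℕ × ℕ)
    tagged f = map (λ x → x , f x)

    survivors : (p : ℕ) → .{{NonZero p}} → (d₁ d₂ : ℕ) → List (ℕ × ℕ) → List (ℕ × ℕ) → List (ℕ × ℕ) → List State
    survivors p d₁ d₂ ns ls ms =
      concatMap (λ (n , s) → concatMap (λ (l , A) → concatMap (λ (m , X) → if solves p d₁ d₂ s A X then (n , l , m , d₁ , d₂) ∷ [] else []) ms) ls) ns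

    -- Residues are lifted before the test because the periods modulo p need not divide the current
    -- N and L.
    refine : Bool → Modulus → (N L : ℕ) → State → List State
    refine g (modulus p π t rN rL) N L (n , l , m , d₁ , d₂) = survivors p d₁ d₂
      (tagged (residue-S p π) (lifts N rN n)) (tagged (residue-10 p t) (label-lifts g L rL l)) (tagged (residue-10 p t) (lifts L rL m))

    -- The listed periods are verified by computation: S is periodic once three consecutive values
    -- return, and 10^_ once it returns to 1.
    valid : Modulus → (N L : ℕ) → Bool
    valid (modulus p π t rN rL) N L =
      (π <ᵇ 2 ^ fuel) ∧ (t <ᵇ 2 ^ fuel) ∧ ((N * rN) % π ≡ᵇ 0) ∧ ((L * rL) % t ≡ᵇ 0) ∧ (power-10 p fuel t % p ≡ᵇ 1 % p) ∧
      (comb (power-α p fuel π) 0 % p ≡ᵇ 3 % p) ∧ (comb (power-α p fuel π) 1 % p ≡ᵇ 1 % p) ∧ (comb (power-α p fuel π) 2 % p ≡ᵇ 3 % p)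

    scale-N scale-L : Modulus → ℕ
    scale-N (modulus _ _ _ rN _) = rN
    scale-L (modulus _ _ _ _ rL) = rL

    period-N period-L : List Modulus → ℕ → ℕ
    period-N []       N = N
    period-N (q ∷ qs) N = period-N qs (N * scale-N q)
    period-L []       L = L
    period-L (q ∷ qs) L = period-L qs (L * scale-L q)

    sieve : Bool → List Modulus → (N L : ℕ) → List State → List State
    sieve g []       N L ss = ss
    sieve g (q ∷ qs) N L ss = sieve g qs (N * scale-N q) (L * scale-L q) (concatMap (refine g q N L) ss)

    valids : List Modulus → (N L : ℕ) → Bool
    valids []       N L = true
    valids (q ∷ qs) N L = valid q N L ∧ valids qs (N * scale-N q) (L * scale-L q)

    scale-N-nonZero : ∀ q → NonZero (scale-N q)
    scale-N-nonZero (modulus _ _ _ (suc _) _) = _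

    scale-L-nonZero : ∀ q → NonZero (scale-L q)
    scale-L-nonZero (modulus _ _ _ _ (suc _)) = _

    period-N-nonZero : ∀ qs N → .{{NonZero N}} → NonZero (period-N qs N)
    period-N-nonZero []       N@(suc _) = _
    period-N-nonZero (q ∷ qs) N = period-N-nonZero qs (N * scale-N q) {{m*n≢0 N (scale-N q) {{it}} {{scale-N-nonZero q}}}}

    period-L-nonZero : ∀ qs N → .{{NonZero N}} → NonZero (period-L qs N)
    period-L-nonZero []       N@(suc _) = _
    period-L-nonZero (q ∷ qs) N = period-L-nonZero qs (N * scale-L q) {{m*n≢0 N (scale-L q) {{it}} {{scale-L-nonZero q}}}}

    lifts-complete : ∀ N r n .{{_ : NonZero N}} .{{_ : NonZero r}} .{{_ : NonZero (N * r)}} → n % (N * r) ∈ lifts N r (n % N)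
    lifts-complete N r n = subst (_∈ lifts N r (n % N)) (sym eq) (∈-map⁺ (λ i → n % N + i * N) (∈-upTo⁺ (m<n*o⇒m/o<n {x} {r} (subst (x <_) (*-comm N r) (m%n<n n (N * r))))))
      where
      x = n % (N * r)
      eq : x ≡ n % N + x / N * N
      eq = trans (m≡m%n+[m/n]*n x N) (cong (_+ x / N * N) (m∣n⇒o%n%m≡o%m N (N * r) n (divides r (*-comm N r))))

    label-lifts-complete : ∀ g L r l .{{_ : NonZero L}} .{{_ : NonZero r}} .{{_ : NonZero (L * r)}} → label g (L * r) l ∈ label-lifts g L r (label g L l)
    label-lifts-complete true  L r l = lifts-complete L r l
    label-lifts-complete false L r l = here refl

    tagged-complete : ∀ f {x xs} → x ∈ xs → (x , f x) ∈ tagged f xs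
    tagged-complete f = ∈-map⁺ (λ x → x , f x)

    survivors-complete : ∀ p .{{_ : NonZero p}} d₁ d₂ {n s l A m X ns ls ms} → (n , s) ∈ ns → (l , A) ∈ ls → (m , X) ∈ ms →
      solves p d₁ d₂ s A X ≡ true → (n , l , m , d₁ , d₂) ∈ survivors p d₁ d₂ ns ls ms
    survivors-complete p d₁ d₂ {n} {s} {l} {A} {m} {X} n∈ l∈ m∈ e = ∈-concatMap⁺ _ (lose n∈ (∈-concatMap⁺ _ (lose l∈ (∈-concatMap⁺ _ (lose m∈
      (subst (λ b → (n , l , m , d₁ , d₂) ∈ (if b then (n , l , m , d₁ , d₂) ∷ [] else [])) (sym e) (here refl)))))))

    S-mod-checked : ∀ p π .{{_ : NonZero p}} .{{_ : NonZero π}} → π < 2 ^ fuel → comb (power-α p fuel π) 0 ≈ 3 [ p ] → comb (power-α p fuel π) 1 ≈ 1 [ p ] → comb (power-α p fuel π) 2 ≈ 3 [ p ] →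
      ∀ n → S n ≈ S (n % π) [ p ]
    S-mod-checked p π π< h₀ h₁ h₂ = S-mod p π (trans (at 0) h₀) (trans (at 1) h₁) (trans (at 2) h₂) π (divides 1 (sym (*-identityˡ π)))
      where
      at : ∀ e → S (e + π) ≈ comb (power-α p fuel π) e [ p ]
      at e = trans (cong (λ k → S k % p) (+-comm e π)) (power-α-correct p fuel π π< e)

    module Soundness (n l m d₁ d₂ : ℕ) (solution : S n ≡ palRep d₁ d₂ l m) (g : Bool) where

      trace : (N L : ℕ) → .{{NonZero N}} → .{{NonZero L}} → State
      trace N L = n % N , label g L l , m % L , d₁ , d₂

      refine-sound : ∀ q N L .{{_ : NonZero N}} .{{_ : NonZero L}} → valid q N L ≡ true →
        trace (N * scale-N q) (L * scale-L q) {{m*n≢0 N (scale-N q) {{it}} {{scale-N-nonZero q}}}} {{m*n≢0 L (scale-L q) {{it}} {{scale-L-nonZero q}}}} ∈ refine g q N L (trace N L)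
      refine-sound (modulus p π t rN rL) N L v = survivors-complete p d₁ d₂
          (tagged-complete (residue-S p π) (lifts-complete N rN n))
          (tagged-complete (residue-10 p t) (label-lifts-complete g L rL l))
          (tagged-complete (residue-10 p t) (lifts-complete L rL m))
          check
        where
        instance
          N′≢0 : NonZero (N * rN)
          N′≢0 = m*n≢0 N rN
          L′≢0 : NonZero (L * rL)
          L′≢0 = m*n≢0 L rL
        v₁ = ∧-split v
        v₂ = ∧-split (proj₂ v₁)
        v₃ = ∧-split (proj₂ v₂)
        v₄ = ∧-split (proj₂ v₃)
        v₅ = ∧-split (proj₂ v₄)
        v₆ = ∧-split (proj₂ v₅)
        v₇ = ∧-split (proj₂ v₆)

        π< : π < 2 ^ fuel
        π< = <ᵇ⇒< π (2 ^ fuel) (subst T (sym (proj₁ v₁)) tt)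
        t< : t < 2 ^ fuel
        t< = <ᵇ⇒< t (2 ^ fuel) (subst T (sym (proj₁ v₂)) tt)
        π∣ : π ∣ N * rN
        π∣ = m%n≡0⇒n∣m (N * rN) π (≡ᵇ-sound (proj₁ v₃))
        t∣ : t ∣ L * rL
        t∣ = m%n≡0⇒n∣m (L * rL) t (≡ᵇ-sound (proj₁ v₄))
        10^t : 10 ^ t ≈ 1 [ p ]
        10^t = trans (sym (power-10-correct p fuel t t<)) (≡ᵇ-sound (proj₁ v₅))

        S≈ : residue-S p π (n % (N * rN)) ≈ S n [ p ]
        S≈ = trans (%-≈ (comb (power-α p fuel (n % (N * rN) % π)) 0)) (trans (cong (λ k → comb (power-α p fuel k) 0 % p) (m∣n⇒o%n%m≡o%m π (N * rN) n π∣))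
          (trans (sym (power-α-correct p fuel (n % π) (<-trans (m%n<n n π) π<) 0)) (trans (cong (λ k → S k % p) (+-identityʳ (n % π)))
            (sym (S-mod-checked p π π< (≡ᵇ-sound (proj₁ v₆)) (≡ᵇ-sound (proj₁ v₇)) (≡ᵇ-sound (proj₂ v₇)) n)))))

        10^≈ : ∀ k → residue-10 p t k ≈ 10 ^ k [ p ]
        10^≈ k = trans (power-10-correct p fuel (k % t) (<-trans (m%n<n k t) t<)) (sym (10^-mod p t 10^t t (divides 1 (sym (*-identityˡ t))) k))

        10^≈% : ∀ k → residue-10 p t (k % (L * rL)) ≈ 10 ^ k [ p ]
        10^≈% k = trans (cong (λ e → power-10 p fuel e % p) (m∣n⇒o%n%m≡o%m t (L * rL) k t∣)) (10^≈ k)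

        A≈ : ∀ b → residue-10 p t (label b (L * rL) l) ≈ 10 ^ l [ p ]
        A≈ true  = 10^≈% l
        A≈ false = 10^≈ l

        check : solves p d₁ d₂ (residue-S p π (n % (N * rN))) (residue-10 p t (label g (L * rL) l)) (residue-10 p t (m % (L * rL))) ≡ true
        check = trans (cong₂ _≡ᵇ_ left right) (≡ᵇ-complete palRep-equation′)
          where
          A≈g = A≈ g
          X≈ = 10^≈% m
          left = ≈-+ (≈-+ (≈-+ (≈-* {a = 9} refl (trans S≈ (cong (_% p) solution))) (≈-* {a = d₁} refl (≈-* A≈g X≈))) (≈-* {a = d₂} refl A≈g)) (refl {x = d₁ % p})
          right = ≈-+ (≈-+ (≈-* {a = d₁} refl (≈-* A≈g (≈-* A≈g X≈))) (≈-* {a = d₂} refl (≈-* A≈g X≈))) (≈-* {a = d₁} refl A≈g)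
          palRep-equation′ = cong (_% p) (palRep-equation d₁ d₂ l m)

      sieve-sound : ∀ qs N L ss .{{_ : NonZero N}} .{{_ : NonZero L}} → valids qs N L ≡ true → trace N L ∈ ss →
        trace (period-N qs N) (period-L qs L) {{period-N-nonZero qs N}} {{period-L-nonZero qs L}} ∈ sieve g qs N L ss
      sieve-sound []       N L ss v h = h
      sieve-sound (q ∷ qs) N L ss v h = sieve-sound qs (N * scale-N q) (L * scale-L q) (concatMap (refine g q N L) ss)
        {{m*n≢0 N (scale-N q) {{it}} {{scale-N-nonZero q}}}} {{m*n≢0 L (scale-L q) {{it}} {{scale-L-nonZero q}}}}
        (proj₂ (∧-split v)) (∈-concatMap⁺ (refine g q N L) (lose h (refine-sound q N L (proj₁ (∧-split v)))))

  residues : ℕ → ℕ → Triple → List (ℕ × ℕ)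
  residues zero    n v           = []
  residues (suc k) n (a , b , c) = (n , a) ∷ residues k (suc n) (b , c , (c + b + a) % 1000)

  S₁₀₀₀ : ℕ → Triple
  S₁₀₀₀ n = S n % 1000 , S (1 + n) % 1000 , S (2 + n) % 1000

  residues-complete : ∀ k n i → i < k → (n + i , S (n + i) % 1000) ∈ residues k n (S₁₀₀₀ n)
  residues-complete (suc k) n zero    h       = here (cong (λ e → e , S e % 1000) (+-identityʳ n))
  residues-complete (suc k) n (suc i) (s≤s h) = there (subst₂ (λ e v → (e , S e % 1000) ∈ residues k (suc n) v) (sym (+-suc n i))
    (cong (λ z → S (1 + n) % 1000 , S (2 + n) % 1000 , z) (next n))
    (residues-complete k (suc n) i h))
    where
    next : ∀ n → S (3 + n) % 1000 ≡ (S (2 + n) % 1000 + S (1 + n) % 1000 + S n % 1000) % 1000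
    next n = sym (≈-+ {1000} {S (2 + n) % 1000 + S (1 + n) % 1000} {S (2 + n) + S (1 + n)} {S n % 1000} {S n}
      (≈-+ {1000} {S (2 + n) % 1000} {S (2 + n)} {S (1 + n) % 1000} {S (1 + n)} (%-≈ (S (2 + n))) (%-≈ (S (1 + n)))) (%-≈ (S n)))

  only-if : {A : Set} → Bool → A → List A
  only-if b x = if b then x ∷ [] else []

  ∈-only-if : ∀ {A : Set} {b} {x : A} → b ≡ true → x ∈ only-if b x
  ∈-only-if refl = here refl

  unequal-digits : ℕ → ℕ → List (ℕ × ℕ)
  unequal-digits d₁ d₂ = only-if (not (d₁ ≡ᵇ d₂)) (d₁ , d₂)

  pairs-with : List ℕ → ℕ → List (ℕ × ℕ)
  pairs-with ds d₁ = concatMap (unequal-digits d₁) ds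

  digit-pairs : List (ℕ × ℕ)
  digit-pairs = concatMap (pairs-with (upTo 10)) (map suc (upTo 9))

  pairs-complete : ∀ {d₁ d₂ ds es} → d₁ ∈ es → d₂ ∈ ds → d₁ ≢ d₂ → (d₁ , d₂) ∈ concatMap (pairs-with ds) es
  pairs-complete {d₁} {d₂} {ds} d₁∈ d₂∈ ne = ∈-concatMap⁺ (pairs-with ds) (lose d₁∈ (∈-concatMap⁺ (unequal-digits d₁) (lose d₂∈ (∈-only-if differ))))
    where
    differ : not (d₁ ≡ᵇ d₂) ≡ true
    differ with d₁ ≡ᵇ d₂ in e
    ... | true  = contradiction (≡ᵇ-sound e) ne
    ... | false = refl

  ending : (ℕ → ℕ → ℕ) → ℕ × ℕ → ℕ × ℕ × ℕ
  ending tail (d₁ , d₂) = tail d₁ d₂ , d₁ , d₂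

  match : ℕ → ℕ × ℕ → ℕ × ℕ × ℕ → List State
  match l (n , s) (e , d₁ , d₂) = only-if (s ≡ᵇ e) (n , l , 0 , d₁ , d₂)

  matches : ℕ → List (ℕ × ℕ × ℕ) → ℕ × ℕ → List State
  matches l es x = concatMap (match l x) es

  -- The sieve starts from the last three digits, which depend only on d₁ and d₂ in each of the
  -- cases for l. The entry 0 for m is its residue modulo 1.
  initial : ℕ → (ℕ → ℕ → ℕ) → List (ℕ × ℕ) → ℕ → List State
  initial N tail ds l = concatMap (matches l (map (ending tail) ds)) (residues N 0 (3 , 1 , 3))

  initial-complete : ∀ N .{{_ : NonZero N}} → (∀ n → S n ≈ S (n % N) [ 1000 ]) → ∀ tail ds l n d₁ d₂ → (d₁ , d₂) ∈ ds → S n % 1000 ≡ tail d₁ d₂ → (n % N , l , 0 , d₁ , d₂) ∈ initial N tail ds l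
  initial-complete N period tail ds l n d₁ d₂ d∈ h = ∈-concatMap⁺ (matches l (map (ending tail) ds)) (lose (residues-complete N 0 (n % N) (m%n<n n N))
    (∈-concatMap⁺ (match l (n % N , S (n % N) % 1000)) (lose (∈-map⁺ (ending tail) d∈) (∈-only-if (≡ᵇ-complete (trans (sym (period n)) h))))))

  S-6200 : ∀ n → S n % 1000 ≡ S (n % 6200) % 1000
  S-6200 = Sieve.S-mod-checked 16 1000 6200 (<ᵇ⇒< 6200 (2 ^ 16) tt) refl refl refl

  all-sound : ∀ {A : Set} (p : A → Bool) {xs x} → all p xs ≡ true → x ∈ xs → p x ≡ true
  all-sound p h (here refl) = proj₁ (∧-split h)
  all-sound p {y ∷ ys} h (there i) = all-sound p (proj₂ (∧-split {p y} h)) i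

  -- A record, so that the type checker compares its parameters instead of evaluating the sieve again.
  record Run (fuel N : ℕ) (g : Bool) (qs : List Modulus) (tail : ℕ → ℕ → ℕ) (ds : List (ℕ × ℕ)) (l₀ : ℕ) (p : State → Bool) : Set where
    constructor run
    open Sieve fuel
    field
      valid-moduli : valids qs N 1 ≡ true
      outcome : all p (sieve g qs N 1 (initial N tail ds l₀)) ≡ true

  module Conclusion (fuel N : ℕ) .{{_ : NonZero N}} (period : ∀ n → S n ≈ S (n % N) [ 1000 ]) (n l m d₁ d₂ : ℕ) (solution : S n ≡ palRep d₁ d₂ l m)
    (g : Bool) (l₀ : ℕ) (l≡l₀ : label g 1 l ≡ l₀) where
    open Sieve fuel
    open Soundness n l m d₁ d₂ solution g

    conclusion : ∀ {qs tail ds p} → Run fuel N g qs tail ds l₀ p →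
      (d₁ , d₂) ∈ ds → S n % 1000 ≡ tail d₁ d₂ → p (trace (period-N qs N) (period-L qs 1) {{period-N-nonZero qs N}} {{period-L-nonZero qs 1}}) ≡ true
    conclusion {qs} {tail} {ds} {p} (run v h) d∈ e = all-sound p h (sieve-sound qs N 1 (initial N tail ds l₀) v
      (subst₂ (λ a b → (n % N , a , b , d₁ , d₂) ∈ initial N tail ds l₀) (sym l≡l₀) (sym (n%1≡0 m)) (initial-complete N period tail ds l₀ n d₁ d₂ d∈ e)))

-- The moduli and the three sieve computations

module SieveRuns where

  open Sieving
  open import Data.Nat
  open import Data.Bool using (Bool; true; false; _∧_)
  open import Data.List using (List; []; _∷_)
  open import Data.Product using (_,_)
  open import Relation.Binary.PropositionalEquality
  -- All periods in use are below 2^16, the range in which the fast powers are correct.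
  open Sieve 16

  -- 6200 is the period of S modulo 1000. The moduli are ordered so that few lifted states arise at each step.
  long-chain short-chain : List Modulus
  long-chain = modulus 11 10 2 1 2 ∷ modulus 101 680 4 17 2 ∷ modulus 239 4760 7 7 7 ∷ modulus 29 140 28 1 1 ∷ modulus 421 420 140 3 5 ∷ modulus 13 168 6 1 3 ∷ modulus 61 1860 60 1 1 ∷ modulus 41 560 5 2 1 ∷ modulus 9901 9900 12 33 1 ∷ modulus 1621 810 1620 9 27 ∷ modulus 4481 4480 2240 8 16 ∷ modulus 257 256 256 2 4 ∷ modulus 401 400 200 1 5 ∷ modulus 11251 5625 2250 25 5 ∷ modulus 33751 11250 5625 1 5 ∷ modulus 26731 8910 26730 1 33 ∷ modulus 35281 11760 17640 7 7 ∷ []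
  short-chain = modulus 11 10 2 1 2 ∷ modulus 7 48 6 6 3 ∷ modulus 61 1860 60 1 10 ∷ modulus 401 400 200 1 10 ∷ modulus 311 310 155 1 31 ∷ []

  -- The last three digits: d₂d₂d₁ for l = 1 and m ≥ 2, d₂d₁d₁ for l = 2, d₁d₁d₁ for l ≥ 3. The case
  -- l = m = 1 is settled by `three-digits`.
  tail₁ tail₂ tail₃ : ℕ → ℕ → ℕ
  tail₁ d₁ d₂ = d₂ * 110 + d₁
  tail₂ d₁ d₂ = d₂ * 100 + d₁ * 11
  tail₃ d₁ d₂ = d₁ * 111

  -- -1 = S₋₁ is the value of the pattern at (d₁, d₂, l, m) = (9, 8, -1, 1).
  residual : State → Bool
  residual (n , l , m , d₁ , d₂) = (l ≡ᵇ 20956319999) ∧ (d₁ ≡ᵇ 9) ∧ (d₂ ≡ᵇ 8)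

  none : State → Bool
  none _ = false

  run₁ : Run 16 6200 false short-chain tail₁ digit-pairs 1 none
  run₁ = run refl refl

  run₂ : Run 16 6200 false short-chain tail₂ digit-pairs 2 none
  run₂ = run refl refl

  run₃ : Run 16 6200 true long-chain tail₃ digit-pairs 0 residual
  run₃ = run refl refl

-- Assembly of the cases

module SolutionCases where

  open import Defs
  open import Data.Nat
  open import Data.Nat.Properties
  open import Data.Nat.DivMod
  open import Data.Nat.Tactic.RingSolver using (solve-∀)
  open import Data.Bool using (true; false; _∧_)
  open import Data.Empty using (⊥)
  open import Data.List.Membership.Propositional using (_∈_)
  open import Data.List.Membership.Propositional.Properties using (∈-map⁺; ∈-upTo⁺)
  open import Data.Product using (∃; _×_; _,_; proj₁; proj₂)
  open import Relation.Binary.PropositionalEquality hiding ([_])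
  open import Relation.Nullary using (¬_; yes; no; contradiction; _→-dec_; _×-dec_; ¬?)
  open import Relation.Nullary.Decidable using (toWitness)
  open VanishingPoints using (^-∙)
  open SizeBounds using (degree)
  open LinearForms
  open TwoAdic
  open Sieving
  open SieveRuns

  bracket : ∀ f n → 1 ≤ n → n < 64 ^ f → ∃ λ μ → 64 ^ μ ≤ n × n < 64 ^ suc μ
  bracket zero    n 1≤n n< = contradiction n< (≤⇒≯ 1≤n)
  bracket (suc f) n 1≤n n< with n <? 64 ^ f
  ... | yes n<′ = bracket f n 1≤n n<′
  ... | no  n≮  = f , ≮⇒≥ n≮ , n<

  n<64^n : ∀ n → n < 64 ^ n
  n<64^n n = <-≤-trans (n<2^n n) (^-monoˡ-≤ n (≤ᵇ⇒≤ 2 64 _))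

  64^≡2^ : ∀ μ → 64 ^ μ ≡ 2 ^ (6 * μ)
  64^≡2^ μ = ^-*-assoc 2 6 μ

  64^≡ : ∀ μ → 64 ^ μ ≡ 2 ^ μ * degree μ
  64^≡ μ = trans (64^≡2^ μ) (trans (cong (2 ^_) (*-comm 6 μ)) (trans (sym (^-*-assoc 2 μ 6)) (eq (2 ^ μ))))
    where
    eq : ∀ x → x * (x * (x * (x * (x * (x * 1))))) ≡ x * (x * ((x * x) * (x * x)))
    eq = solve-∀

  *≤2^ : ∀ c b .{{_ : NonZero b}} → c * b ≤ 2 ^ b → ∀ n → b ≤ n → c * n ≤ 2 ^ n
  *≤2^ c b h n b≤n with m≤n⇒∃[o]m+o≡n b≤n
  ... | j , refl = go j
    where
    go : ∀ j → c * (b + j) ≤ 2 ^ (b + j)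
    go zero    = subst (λ e → c * e ≤ 2 ^ e) (sym (+-identityʳ b)) h
    go (suc j) = ≤-trans (≤-reflexive (eq c b j)) (≤-trans (+-mono-≤ (go j) (≤-trans (m≤m*n c (b + j) {{b+j≢0}}) (≤-trans (go j) (m≤m+n (2 ^ (b + j)) 0))))
        (≤-reflexive (cong (2 ^_) (sym (+-suc b j)))))
      where
      b+j≢0 : NonZero (b + j)
      b+j≢0 = >-nonZero (<-≤-trans (>-nonZero⁻¹ b) (m≤m+n b j))
      eq : ∀ c b j → c * (b + suc j) ≡ c * (b + j) + c
      eq = solve-∀

  -- Adding 1 to the final l nines gives 10^l, so 2^l divides S n + 1 in the residual case.
  palRep-unit : ∀ l m → 1 + palRep 9 8 l m ≡ (repdigit 9 l * 10 ^ m + repdigit 8 m + 1) * 5 ^ l * 2 ^ l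
  palRep-unit l m = trans (trans (sym (+-suc (x * 10 ^ l) r)) (cong (x * 10 ^ l +_) r+1)) (trans (eq x (10 ^ l)) (trans (cong ((x + 1) *_) 10^≡) (sym (*-assoc (x + 1) (5 ^ l) (2 ^ l)))))
    where
    x = repdigit 9 l * 10 ^ m + repdigit 8 m
    r = repdigit 9 l
    r+1 : suc r ≡ 10 ^ l
    r+1 = *-cancelˡ-≡ (suc r) (10 ^ l) 9 (trans (eq′ r) (repdigit-closed 9 l))
      where
      eq′ : ∀ r → 9 * suc r ≡ 9 * r + 9
      eq′ = solve-∀
    10^≡ : 10 ^ l ≡ 5 ^ l * 2 ^ l
    10^≡ = ^-∙ 5 2 l
    eq : ∀ x a → x * a + a ≡ (x + 1) * a
    eq = solve-∀

  -- With A = 10^l and X = 10^m the digits 9 and 8 give 9 P = A X (9 A - 1) + A - 9. The remainder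
  -- is tiny against A X B, which is the source of the close approximation.
  linear-form : ∀ l m B → suc B ≡ 9 * 10 ^ l → 9 * palRep 9 8 l m + 9 ≡ 10 ^ (l + m) * B + 10 ^ l
  linear-form l m B h = +-cancelʳ-≡ (9 * (A * X) + 8 * A) _ _ (trans (eq (palRep 9 8 l m) A X) (trans (palRep-equation 9 8 l m) (trans (eq₂ A X)
      (trans (cong (λ c → A * X * c + (8 * (A * X) + 9 * A)) (sym h)) (trans (eq₃ (A * X) A B) (cong (λ c → c * B + A + (9 * (A * X) + 8 * A)) (sym (^-distribˡ-+-* 10 l m))))))))
    where
    A = 10 ^ l
    X = 10 ^ m
    eq : ∀ P A X → 9 * P + 9 + (9 * (A * X) + 8 * A) ≡ 9 * P + 9 * (A * X) + 8 * A + 9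
    eq = solve-∀
    eq₂ : ∀ A X → 9 * (A * (A * X)) + 8 * (A * X) + 9 * A ≡ A * X * (9 * A) + (8 * (A * X) + 9 * A)
    eq₂ = solve-∀
    eq₃ : ∀ Y A B → Y * suc B + (8 * Y + 9 * A) ≡ Y * B + A + (9 * Y + 8 * A)
    eq₃ = solve-∀

  -- The 2-adic bound makes n exponential in l. So l is logarithmic in n, and the huge lower bound
  -- for l makes the parameter μ large enough for the linear form.
  no-residual : ∀ n l m → 20956319999 ≤ l → S n ≡ palRep 9 8 l m → ⊥
  no-residual n l m l≥ e = go n e 2^l≤ 1≤n (bracket n n 1≤n (n<64^n n))
    where
    4≤l : 4 ≤ l
    4≤l = ≤-trans (≤ᵇ⇒≤ 4 20956319999 _) l≥
    2^l≤ : 2 ^ l ≤ 5 + n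
    2^l≤ = large-index n l ((repdigit 9 l * 10 ^ m + repdigit 8 m + 1) * 5 ^ l) 4≤l (trans (cong suc e) (palRep-unit l m))
    1≤n : 1 ≤ n
    1≤n = +-cancelˡ-≤ 5 1 n (≤-trans (≤-trans (≤ᵇ⇒≤ 6 16 _) (^-monoʳ-≤ 2 4≤l)) 2^l≤)
    go : ∀ n → S n ≡ palRep 9 8 l m → 2 ^ l ≤ 5 + n → 1 ≤ n → (∃ λ μ → 64 ^ μ ≤ n × n < 64 ^ suc μ) → ⊥
    go (suc n′) e 2^l≤ 1≤n (μ , lo , hi) = LinearForm.impossible μ 4072 n′ (l + m) l B ≤-refl (≤ᵇ⇒≤ 4072 4096 _) μ≥ 1000μ≤
        (subst (_≤ suc n′) (64^≡ μ) lo) (subst (λ x → suc n′ ≤ 64 * x) (64^≡ μ) (<⇒≤ hi))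
        (≤-trans (s≤s z≤n) 4≤l) l≤ (≤-trans (≤-trans (≤ᵇ⇒≤ 3 4 _) 4≤l) (m≤m+n l m)) (trans (cong (λ x → 9 * x + 9) e) (linear-form l m B B+1)) B+1
      where
      B = pred (9 * 10 ^ l)
      B+1 : suc B ≡ 9 * 10 ^ l
      B+1 = suc-pred (9 * 10 ^ l) {{m*n≢0 9 (10 ^ l) {{_}} {{m^n≢0 10 l}}}}
      -- Otherwise 2^(6μ+7) ≤ 2^l ≤ 5 + n < 2 · 64^(μ+1), whose two ends are equal.
      l≤ : l ≤ 6 * μ + 6
      l≤ = ≮⇒≥ λ lt → <⇒≱ (<-≤-trans (+-monoʳ-< 5 hi) (≤-trans (+-monoˡ-≤ (64 ^ suc μ) (≤-trans (≤ᵇ⇒≤ 5 64 _) (m≤m*n 64 (64 ^ μ) {{m^n≢0 64 μ}})))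
        (≤-trans (≤-reflexive (trans (eq (64 ^ suc μ)) (cong (2 *_) (trans (64^≡2^ (suc μ)) (cong (2 ^_) (trans (*-suc 6 μ) (+-comm 6 (6 * μ)))))))) (^-monoʳ-≤ 2 lt)))) 2^l≤
        where
        eq : ∀ x → x + x ≡ 2 * x
        eq = solve-∀
      -- 2819615680 = 4072 (170 · 4072 + 200) is what the linear form requires; the period
      -- 20956320000 of the long chain exceeds six times this number.
      μ≥ : 2819615680 ≤ μ
      μ≥ = *-cancelˡ-≤ 6 (≤-trans (≤ᵇ⇒≤ 16917694080 20956319993 _) (+-cancelʳ-≤ 6 20956319993 (6 * μ) (≤-trans l≥ l≤)))
      1000μ≤ : 1000 * μ ≤ 2 ^ μ
      1000μ≤ = *≤2^ 1000 14 (≤ᵇ⇒≤ 14000 16384 _) μ (≤-trans (≤ᵇ⇒≤ 14 2819615680 _) μ≥)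

  %1000 : ∀ c e → e < 1000 → (c * 1000 + e) % 1000 ≡ e
  %1000 c e h = trans (cong (_% 1000) (+-comm (c * 1000) e)) (trans ([m+kn]%n≡m%n e c 1000) (m<n⇒m%n≡m h))

  ending₁ : ∀ d₁ d₂ m → d₁ ≤ 9 → d₂ ≤ 9 → palRep d₁ d₂ 1 (2 + m) % 1000 ≡ tail₁ d₁ d₂
  ending₁ d₁ d₂ m h₁ h₂ = trans (cong (_% 1000) (eq d₁ d₂ (10 ^ m) (repdigit d₂ m))) (%1000 (d₁ * 10 ^ m + repdigit d₂ m) (tail₁ d₁ d₂)
      (≤-<-trans (+-mono-≤ (*-monoˡ-≤ 110 h₂) h₁) (<ᵇ⇒< 999 1000 _)))
    where
    eq : ∀ d₁ d₂ x r → ((0 * 10 + d₁) * (10 * (10 * x)) + ((r * 10 + d₂) * 10 + d₂)) * 10 + (0 * 10 + d₁) ≡ (d₁ * x + r) * 1000 + (d₂ * 110 + d₁)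
    eq = solve-∀

  ending₂ : ∀ d₁ d₂ m → d₁ ≤ 9 → d₂ ≤ 9 → palRep d₁ d₂ 2 (1 + m) % 1000 ≡ tail₂ d₁ d₂
  ending₂ d₁ d₂ m h₁ h₂ = trans (cong (_% 1000) (eq d₁ d₂ (10 ^ m) (repdigit d₂ m))) (%1000 (d₁ * 11 * 10 ^ m + repdigit d₂ m) (tail₂ d₁ d₂)
      (≤-<-trans (+-mono-≤ (*-monoˡ-≤ 100 h₂) (*-monoˡ-≤ 11 h₁)) (<ᵇ⇒< 999 1000 _)))
    where
    eq : ∀ d₁ d₂ x r → (((0 * 10 + d₁) * 10 + d₁) * (10 * x) + (r * 10 + d₂)) * 100 + ((0 * 10 + d₁) * 10 + d₁) ≡ (d₁ * 11 * x + r) * 1000 + (d₂ * 100 + d₁ * 11)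
    eq = solve-∀

  ending₃ : ∀ d₁ d₂ l m → d₁ ≤ 9 → palRep d₁ d₂ (3 + l) m % 1000 ≡ tail₃ d₁ d₂
  ending₃ d₁ d₂ l m h₁ = trans (cong (_% 1000) (eq d₁ (repdigit d₁ (3 + l) * 10 ^ m + repdigit d₂ m) (10 ^ l) (repdigit d₁ l)))
      (%1000 ((repdigit d₁ (3 + l) * 10 ^ m + repdigit d₂ m) * 10 ^ l + repdigit d₁ l) (tail₃ d₁ d₂) (≤-<-trans (*-monoˡ-≤ 111 h₁) (<ᵇ⇒< 999 1000 _)))
    where
    eq : ∀ d x a r → x * (10 * (10 * (10 * a))) + (((r * 10 + d) * 10 + d) * 10 + d) ≡ (x * a + r) * 1000 + d * 111
    eq = solve-∀

  1499≤S : ∀ n → 1499 ≤ S (12 + n)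
  1499≤S zero             = ≤-refl
  1499≤S (suc zero)       = ≤ᵇ⇒≤ 1499 2757 _
  1499≤S (suc (suc zero)) = ≤ᵇ⇒≤ 1499 5071 _
  1499≤S (suc (suc (suc n))) = ≤-trans (1499≤S n) (m≤n+m (S (12 + n)) (S (14 + n) + S (13 + n)))

  -- Already S 12 = 1499 has four digits and later values are no smaller, so n < 12 can be
  -- inspected.
  three-digits : ∀ n d₁ d₂ → d₁ ≤ 9 → d₂ ≤ 9 → d₁ ≢ d₂ → 0 < d₁ → S n ≡ palRep d₁ d₂ 1 1 → n ≡ 8 × d₁ ≡ 1 × d₂ ≡ 3
  three-digits n d₁ d₂ h₁ h₂ ne pos e = toWitness
      {a? = allUpTo? (λ n → allUpTo? (λ d₁ → allUpTo? (λ d₂ → ¬? (d₁ ≟ d₂) →-dec (0 <? d₁ →-dec (S n ≟ palRep d₁ d₂ 1 1 →-dec (n ≟ 8 ×-dec (d₁ ≟ 1 ×-dec d₂ ≟ 3))))) 10) 10) 12} _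
      n< (s≤s h₁) (s≤s h₂) ne pos e
    where
    small : palRep d₁ d₂ 1 1 ≤ 999
    small = +-mono-≤ (*-monoˡ-≤ 10 (+-mono-≤ (*-monoˡ-≤ 10 h₁) h₂)) h₁
    n< : n < 12
    n< = ≰⇒> λ 12≤n → <⇒≱ (<-≤-trans (<ᵇ⇒< 999 1499 _) (subst (λ k → 1499 ≤ S k) (m+[n∸m]≡n 12≤n) (1499≤S (n ∸ 12)))) (≤-trans (≤-reflexive e) small)

  false≢true : false ≢ true
  false≢true ()

  pair∈ : ∀ {d₁ d₂} → d₁ ≤ 9 → d₂ ≤ 9 → d₁ ≢ d₂ → 0 < d₁ → (d₁ , d₂) ∈ digit-pairs
  pair∈ {suc e} h₁ h₂ ne _ = pairs-complete (∈-map⁺ suc (∈-upTo⁺ h₁)) (∈-upTo⁺ (s≤s h₂)) ne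

  module _ (n d₁ d₂ : ℕ) (h₁ : d₁ ≤ 9) (h₂ : d₂ ≤ 9) (ne : d₁ ≢ d₂) (pos : 0 < d₁) where

    no-solution₁ : ∀ m → 2 ≤ m → ¬ (S n ≡ palRep d₁ d₂ 1 m)
    no-solution₁ m 2≤m e = false≢true (Conclusion.conclusion 16 6200 S-6200 n 1 m d₁ d₂ e false 1 refl run₁
      (pair∈ h₁ h₂ ne pos) (trans (cong (_% 1000) e) (last-digits (m≤n⇒∃[o]m+o≡n 2≤m))))
      where
      last-digits : (∃ λ m′ → 2 + m′ ≡ m) → palRep d₁ d₂ 1 m % 1000 ≡ tail₁ d₁ d₂
      last-digits (m′ , eq) = subst (λ m → palRep d₁ d₂ 1 m % 1000 ≡ tail₁ d₁ d₂) eq (ending₁ d₁ d₂ m′ h₁ h₂)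

    no-solution₂ : ∀ m → 1 ≤ m → ¬ (S n ≡ palRep d₁ d₂ 2 m)
    no-solution₂ m 1≤m e = false≢true (Conclusion.conclusion 16 6200 S-6200 n 2 m d₁ d₂ e false 2 refl run₂
      (pair∈ h₁ h₂ ne pos) (trans (cong (_% 1000) e) (last-digits (m≤n⇒∃[o]m+o≡n 1≤m))))
      where
      last-digits : (∃ λ m′ → 1 + m′ ≡ m) → palRep d₁ d₂ 2 m % 1000 ≡ tail₂ d₁ d₂
      last-digits (m′ , eq) = subst (λ m → palRep d₁ d₂ 2 m % 1000 ≡ tail₂ d₁ d₂) eq (ending₂ d₁ d₂ m′ h₁ h₂)

    no-solution₃ : ∀ l m → 3 ≤ l → ¬ (S n ≡ palRep d₁ d₂ l m)
    no-solution₃ l m 3≤l e = no-residual n l m l≥ (subst₂ (λ a b → S n ≡ palRep a b l m) (≡ᵇ-sound (proj₁ digits)) (≡ᵇ-sound (proj₂ digits)) e)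
      where
      last-digits : (∃ λ l′ → 3 + l′ ≡ l) → palRep d₁ d₂ l m % 1000 ≡ tail₃ d₁ d₂
      last-digits (l′ , eq) = subst (λ l → palRep d₁ d₂ l m % 1000 ≡ tail₃ d₁ d₂) eq (ending₃ d₁ d₂ l′ m h₁)
      state : residual (Sieve.Soundness.trace 16 n l m d₁ d₂ e true (Sieve.period-N 16 long-chain 6200) (Sieve.period-L 16 long-chain 1)) ≡ true
      state = Conclusion.conclusion 16 6200 S-6200 n l m d₁ d₂ e true 0 (n%1≡0 l) run₃
        (pair∈ h₁ h₂ ne pos) (trans (cong (_% 1000) e) (last-digits (m≤n⇒∃[o]m+o≡n 3≤l)))
      parts = ∧-split {l % 20956320000 ≡ᵇ 20956319999} {(d₁ ≡ᵇ 9) ∧ (d₂ ≡ᵇ 8)} state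
      l≥ : 20956319999 ≤ l
      l≥ = ≤-trans (≤-reflexive (sym (≡ᵇ-sound {l % 20956320000} (proj₁ parts)))) (m%n≤m l 20956320000)
      digits = ∧-split {d₁ ≡ᵇ 9} {d₂ ≡ᵇ 8} (proj₂ parts)

  solutions : (n d₁ d₂ l m : ℕ) → d₁ ≤ 9 → d₂ ≤ 9 → d₁ ≢ d₂ → 0 < d₁ → 1 ≤ l → 1 ≤ m → S n ≡ palRep d₁ d₂ l m → n ≡ 8 × d₁ ≡ 1 × d₂ ≡ 3 × l ≡ 1 × m ≡ 1
  solutions n d₁ d₂ l m h₁ h₂ ne pos 1≤l 1≤m e with l ≟ 1 | l ≟ 2 | m ≟ 1
  ... | yes refl | _ | yes refl = let (a , b , c) = three-digits n d₁ d₂ h₁ h₂ ne pos e in a , b , c , refl , refl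
  ... | yes refl | _ | no m≢1 = contradiction e (no-solution₁ n d₁ d₂ h₁ h₂ ne pos m (≤∧≢⇒< 1≤m (≢-sym m≢1)))
  ... | no _ | yes refl | _ = contradiction e (no-solution₂ n d₁ d₂ h₁ h₂ ne pos m 1≤m)
  ... | no l≢1 | no l≢2 | _ = contradiction e (no-solution₃ n d₁ d₂ h₁ h₂ ne pos l m (≤∧≢⇒< (≤∧≢⇒< 1≤l (≢-sym l≢1)) (≢-sym l≢2)))

open import Defs
open import Data.Nat using (ℕ; _≤_; _<_)
open import Data.Product using (_×_; _,_)
open import Relation.Binary.PropositionalEquality using (_≡_; _≢_; refl)
open SolutionCases

theorem1p1 : (S 8 ≡ palRep 1 3 1 1)
    × ((n d₁ d₂ l m : ℕ) → d₁ ≤ 9 → d₂ ≤ 9 → d₁ ≢ d₂ → 0 < d₁ → 1 ≤ l → 1 ≤ m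
        → S n ≡ palRep d₁ d₂ l m
        → n ≡ 8 × d₁ ≡ 1 × d₂ ≡ 3 × l ≡ 1 × m ≡ 1)
theorem1p1 = refl , solutions
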